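{- For each $L\in\{\mathsf{MN},\mathsf{MNF}\}$, there exists a $\Sigma_1$ provability predicate $\mathrm{Pr}_T(x)$ of $T$ satisfying condition $\mathbf{M}$ such that (1) for any modal formula $A$ and any arithmetical interpretation $f$ based on $\mathrm{Pr}_T(x)$, if $L\vdash A$ then $\mathsf{PA}\vdash f(A)$; and (2) there exists an arithmetical interpretation $f$ based on $\mathrm{Pr}_T(x)$ such that for any modal formula $A$, $L\vdash A$ if and only if $T\vdash f(A)$.
   Context: $T$ is a primitive recursively axiomatized consistent extension of Peano Arithmetic $\mathsf{PA}$ in the language of first-order arithmetic; $\ulcorner\varphi\urcorner$ denotes the numeral of the Gödel number of $\varphi$. A provability predicate of $T$ is an arithmetical formula $\mathrm{Pr}_T(x)$ such that for every natural number $n$, $\mathsf{PA}\vdash\mathrm{Pr}_T(\overline{n})$ iff $n$ is the Gödel number of a theorem of $T$. Condition $\mathbf{M}$: if $T\vdash\varphi\to\psi$ then $T\vdash\mathrm{Pr}_T(\ulcorner\varphi\urcorner)\to\mathrm{Pr}_T(\ulcorner\psi\urcorner)$. An arithmetical interpretation based on $\mathrm{Pr}_T$ is a map $f$ from modal formulas (built from propositional variables, $\bot$, $\to$, $\Box$) to arithmetical sentences with $f(\bot)$ being $0=1$, $f(A\to B)=f(A)\to f(B)$, $f(\Box A)=\mathrm{Pr}_T(\ulcorner f(A)\urcorner)$. The logic $\mathsf{MN}$ has as axioms all propositional tautologies in the modal language and rules Modus Ponens, Necessitation ($A/\Box A$) and RM ($A\to B/\Box A\to\Box B$); $\mathsf{MNF}$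 is $\mathsf{MN}$ plus the axiom scheme $\Box A\to\Box\Box A$. -}

module Defs where

open import Data.Nat using (ℕ; zero; suc; _+_; _*_; _<_)
open import Data.Fin using (Fin)
open import Data.Vec using (Vec; []; _∷_; tabulate; lookup)
open import Data.Unit using (⊤)
open import Data.Empty using (⊥)
open import Data.Bool using (Bool; true; false)
open import Data.Product using (Σ; _×_; _,_)
open import Relation.Nullary using (¬_)
open import Relation.Binary.PropositionalEquality using (_≡_; _≢_)
open import Function.Bundles using (_⇔_)

infixl 7 _⊗_
infixl 6 _⊕_
infix  5 _≐_
infixr 3 _⇒_

data Term : Set where
  var  : ℕ → Term
  zer  : Term
  suc' : Term → Term
  _⊕_  : Term → Term → Term
  _⊗_  : Term → Term → Term

data Formula : Set where
  ⊥'  : Formula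
  _≐_ : Term → Term → Formula
  _⇒_ : Formula → Formula → Formula
  ∀'  : Formula → Formula          -- binds de Bruijn variable 0

¬' : Formula → Formula
¬' φ = φ ⇒ ⊥'

∃' : Formula → Formula
∃' φ = ¬' (∀' (¬' φ))

renT : (ℕ → ℕ) → Term → Term
renT ρ (var n)  = var (ρ n)
renT ρ zer      = zer
renT ρ (suc' t) = suc' (renT ρ t)
renT ρ (t ⊕ s)  = renT ρ t ⊕ renT ρ s
renT ρ (t ⊗ s)  = renT ρ t ⊗ renT ρ s

shiftT : Term → Term
shiftT = renT suc

substT : (ℕ → Term) → Term → Term
substT σ (var n)  = σ n
substT σ zer      = zer
substT σ (suc' t) = suc' (substT σ t)
substT σ (t ⊕ s)  = substT σ t ⊕ substT σ s
substT σ (t ⊗ s)  = substT σ t ⊗ substT σ s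

liftS : (ℕ → Term) → ℕ → Term
liftS σ zero    = var zero
liftS σ (suc n) = shiftT (σ n)

substF : (ℕ → Term) → Formula → Formula
substF σ ⊥'      = ⊥'
substF σ (t ≐ s) = substT σ t ≐ substT σ s
substF σ (φ ⇒ ψ) = substF σ φ ⇒ substF σ ψ
substF σ (∀' φ)  = ∀' (substF (liftS σ) φ)

shiftF : Formula → Formula
shiftF = substF (λ n → var (suc n))

inst : Term → ℕ → Term
inst t zero    = t
inst t (suc n) = var n

_[_] : Formula → Term → Formula
φ [ t ] = substF (inst t) φ

ClosedT : ℕ → Term → Set
ClosedT k (var n)  = n < k
ClosedT k zer      = ⊤
ClosedT k (suc' t) = ClosedT k t
ClosedT k (t ⊕ s)  = ClosedT k t × ClosedT k s
ClosedT k (t ⊗ s)  = ClosedT k t × ClosedT k s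

Closed : ℕ → Formula → Set
Closed k ⊥'      = ⊤
Closed k (t ≐ s) = ClosedT k t × ClosedT k s
Closed k (φ ⇒ ψ) = Closed k φ × Closed k ψ
Closed k (∀' φ)  = Closed (suc k) φ

Sentence : Formula → Set
Sentence = Closed 0

numeral : ℕ → Term
numeral zero    = zer
numeral (suc n) = suc' (numeral n)

Theory : Set₁
Theory = Formula → Set

infix 2 _⊢_
data _⊢_ (T : Theory) : Formula → Set where
  ax    : ∀ {φ} → T φ → T ⊢ φ
  axK   : ∀ {φ ψ} → T ⊢ φ ⇒ ψ ⇒ φ
  axS   : ∀ {φ ψ χ} → T ⊢ (φ ⇒ ψ ⇒ χ) ⇒ (φ ⇒ ψ) ⇒ φ ⇒ χ
  axDN  : ∀ {φ} → T ⊢ ¬' (¬' φ) ⇒ φ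
  axIn  : ∀ {φ} t → T ⊢ ∀' φ ⇒ φ [ t ]
  axDi  : ∀ {φ ψ} → T ⊢ ∀' (φ ⇒ ψ) ⇒ ∀' φ ⇒ ∀' ψ
  axVac : ∀ {φ} → T ⊢ φ ⇒ ∀' (shiftF φ)
  axRef : ∀ t → T ⊢ t ≐ t
  axEq  : ∀ φ t s → T ⊢ (t ≐ s) ⇒ φ [ t ] ⇒ φ [ s ]
  mp    : ∀ {φ ψ} → T ⊢ φ ⇒ ψ → T ⊢ φ → T ⊢ ψ
  gen   : ∀ {φ} → T ⊢ φ → T ⊢ ∀' φ

stepS : ℕ → Term
stepS zero    = suc' (var zero)
stepS (suc n) = var (suc n)

data PAax : Formula → Set where
  pa1 : PAax (¬' (suc' (var 0) ≐ zer))
  pa2 : PAax (suc' (var 0) ≐ suc' (var 1) ⇒ var 0 ≐ var 1)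
  pa3 : PAax (var 0 ⊕ zer ≐ var 0)
  pa4 : PAax (var 0 ⊕ suc' (var 1) ≐ suc' (var 0 ⊕ var 1))
  pa5 : PAax (var 0 ⊗ zer ≐ zer)
  pa6 : PAax (var 0 ⊗ suc' (var 1) ≐ var 0 ⊗ var 1 ⊕ var 0)
  ind : ∀ φ → PAax (φ [ zer ] ⇒ ∀' (φ ⇒ substF stepS φ) ⇒ ∀' φ)

PA : Theory
PA = PAax

ExtendsPA : Theory → Set
ExtendsPA T = ∀ φ → PAax φ → T ⊢ φ

Consistent : Theory → Set
Consistent T = ¬ (T ⊢ ⊥')

-- Gödel numbering (Cantor pairing)

tri : ℕ → ℕ
tri zero    = zero
tri (suc n) = suc n + tri n

pair : ℕ → ℕ → ℕ
pair a b = tri (a + b) + b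

codeT : Term → ℕ
codeT (var n)  = pair 0 n
codeT zer      = pair 1 0
codeT (suc' t) = pair 2 (codeT t)
codeT (t ⊕ s)  = pair 3 (pair (codeT t) (codeT s))
codeT (t ⊗ s)  = pair 4 (pair (codeT t) (codeT s))

⌜_⌝ : Formula → ℕ
⌜ ⊥' ⌝    = pair 0 0
⌜ t ≐ s ⌝ = pair 1 (pair (codeT t) (codeT s))
⌜ φ ⇒ ψ ⌝ = pair 2 (pair ⌜ φ ⌝ ⌜ ψ ⌝)
⌜ ∀' φ ⌝  = pair 3 ⌜ φ ⌝

data PR : ℕ → Set where
  pZ    : PR 0
  pS    : PR 1
  pProj : ∀ {n} → Fin n → PR n
  pComp : ∀ {m n} → PR m → (Fin m → PR n) → PR n
  pRec  : ∀ {n} → PR n → PR (suc (suc n)) → PR (suc n)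

mutual
  evalPR : ∀ {n} → PR n → Vec ℕ n → ℕ
  evalPR pZ          xs       = 0
  evalPR pS          (x ∷ xs) = suc x
  evalPR (pProj i)   xs       = lookup xs i
  evalPR (pComp g h) xs       = evalPR g (tabulate (λ i → evalPR (h i) xs))
  evalPR (pRec g h)  (k ∷ xs) = evalRec g h xs k

  evalRec : ∀ {n} → PR n → PR (suc (suc n)) → Vec ℕ n → ℕ → ℕ
  evalRec g h xs zero    = evalPR g xs
  evalRec g h xs (suc k) = evalPR h (k ∷ evalRec g h xs k ∷ xs)

PRAxiomatized : Theory → Set
PRAxiomatized T = Σ (PR 1) λ χ → ∀ n →
  (evalPR χ (n ∷ []) ≢ 0) ⇔ Σ Formula (λ φ → (⌜ φ ⌝ ≡ n) × T φ)

_≤'_ : Term → Term → Formula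
t ≤' s = ∃' (var 0 ⊕ shiftT t ≐ shiftT s)

data Δ₀ : Formula → Set where
  d-eq  : ∀ t s → Δ₀ (t ≐ s)
  d-bot : Δ₀ ⊥'
  d-imp : ∀ {φ ψ} → Δ₀ φ → Δ₀ ψ → Δ₀ (φ ⇒ ψ)
  d-ball : ∀ {φ} t → Δ₀ φ → Δ₀ (∀' ((var 0 ≤' shiftT t) ⇒ φ))

data Σ₁ : Formula → Set where
  s-d0 : ∀ {φ} → Δ₀ φ → Σ₁ φ
  s-ex : ∀ {φ} → Σ₁ φ → Σ₁ (∃' φ)

IsProvPred : Theory → Formula → Set
IsProvPred T Pr = Closed 1 Pr × (∀ n →
  (PA ⊢ Pr [ numeral n ]) ⇔ Σ Formula (λ φ → (⌜ φ ⌝ ≡ n) × (T ⊢ φ)))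

Pr⟨_⟩ : Formula → Formula → Formula
Pr⟨ Pr ⟩ φ = Pr [ numeral ⌜ φ ⌝ ]

CondM : Theory → Formula → Set
CondM T Pr = ∀ φ ψ → T ⊢ φ ⇒ ψ → T ⊢ Pr⟨ Pr ⟩ φ ⇒ Pr⟨ Pr ⟩ ψ

infixr 3 _⇒m_
data MFm : Set where
  pv   : ℕ → MFm
  ⊥m   : MFm
  _⇒m_ : MFm → MFm → MFm
  □    : MFm → MFm

-- truth under a valuation of the "atoms" (propositional variables and
-- boxed formulas)
evalM : (MFm → Bool) → MFm → Bool
evalM v (pv n)   = v (pv n)
evalM v ⊥m       = false
evalM v (A ⇒m B) with evalM v A
... | true  = evalM v B
... | false = true
evalM v (□ A)    = v (□ A)

Tautology : MFm → Set
Tautology A = ∀ v → evalM v A ≡ true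

data Logic : Set where
  MN MNF : Logic

infix 2 _⊢m_
data _⊢m_ (L : Logic) : MFm → Set where
  taut : ∀ {A} → Tautology A → L ⊢m A
  mpm  : ∀ {A B} → L ⊢m A ⇒m B → L ⊢m A → L ⊢m B
  nec  : ∀ {A} → L ⊢m A → L ⊢m □ A
  rm   : ∀ {A B} → L ⊢m A ⇒m B → L ⊢m □ A ⇒m □ B
  ax4  : ∀ {A} → L ≡ MNF → L ⊢m □ A ⇒m □ (□ A)

Interpretation : Set
Interpretation = Σ (ℕ → Formula) λ g → ∀ n → Sentence (g n)

falsum : Formula
falsum = zer ≐ suc' zer

interp : Formula → (ℕ → Formula) → MFm → Formula
interp Pr g (pv n)   = g n
interp Pr g ⊥m       = falsum
interp Pr g (A ⇒m B) = interp Pr g A ⇒ interp Pr g B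
interp Pr g (□ A)    = Pr⟨ Pr ⟩ (interp Pr g A)

_⟦_⟧ : Interpretation → Formula → MFm → Formula
(f ⟦ Pr ⟧) A = interp Pr (Data.Product.proj₁ f) A

-- Every definition is staged so that PA only has to decide bounded sentences.  At stage m one knows the
-- finitely many implications T ⊢ x ⇒ w between codes up to m that have a certificate up to m.  A number c
-- codes a finite neighbourhood model.  A family z of finite sets of codes, one set for each world of c, is
-- good at stage m if z_k contains the sentence State c k, is closed under the known implications and under
-- the rule "x is boxed at k, hence Pr x", and does not contain ¬ State c k; here x is boxed at k when some
-- neighbourhood v of k has x ∈ z_j for all j ∈ v.  An event is a good family with a world l at which a root
-- (State c l, or Pr x for some x boxed at l) leads to ¬ State c l by the implications of stage m + 1.
-- State c l says that the first event is located at the world l of c; Pr x says that x is derived at some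
-- stage all of whose models admit good families, or that the first event occurs and x is boxed at its world.
--
-- In reality there is no event: the first one would make its own roots theorems of T and refute State c l.
-- Hence good families extend from stage to stage, all stages are fit for derivations, and Pr defines
-- provability; that PA ⊢ Pr x only for theorems x follows by Friedman's translation.  Within PA, no standard
-- stage has an event, by Δ₀-completeness, so at the first event the sets z_k are closed under every
-- implication T ⊢ φ ⇒ ψ.  This gives condition M, and □A ⇒ □□A when the models are transitive in the
-- sense of MNF; and by induction on A, T + State c l decides f(A) according to the truth of A at l.
-- Since T does not refute State c l, every modal formula with a finite countermodel is unprovable in T;
-- the countermodels come from eliminating unrealizable truth assignments.

module Submission where

open import Defs
open import Data.Bool using (Bool; true; false; _∨_; _∧_; if_then_else_)
import Data.Bool.Properties as Bool
open import Data.Empty using (⊥; ⊥-elim)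
open import Data.Fin using (Fin; zero; suc; toℕ; _↑ˡ_; _↑ʳ_)
open import Data.List using (List; []; _∷_; _++_; length; foldr)
open import Data.List.Membership.Propositional using (_∈_)
open import Data.List.Membership.Propositional.Properties using (∈-++⁺ˡ; ∈-++⁺ʳ; ∈-++⁻; ∈-map⁺; ∈-map⁻)
open import Data.List.Relation.Unary.All using (All; []; _∷_)
import Data.List.Relation.Unary.All as All
open import Data.List.Relation.Unary.Any using (here; there)
open import Data.Nat using (ℕ; zero; suc; pred; _+_; _*_; _∸_; _⊓_; _⊔_; _≤_; _<_; _≤′_; ≤′-refl; ≤′-step; z≤n; s≤s; s≤s⁻¹; _≤?_; _≟_; ≢-nonZero)
open import Data.Nat.Coprimality using (Coprime; coprime-divisor) renaming (sym to coprime-sym)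
open import Data.Nat.Divisibility
open import Data.Nat.Properties
open import Data.Nat.Tactic.RingSolver using (solve-∀)
open import Data.Product using (Σ; _×_; _,_; proj₁; proj₂)
open import Data.Product.Properties using (≡-dec)
open import Data.Sum using (_⊎_; inj₁; inj₂)
open import Data.Unit using (⊤; tt)
open import Data.Vec using (Vec; []; _∷_; lookup; map; tabulate) renaming (_++_ to _++ᵥ_)
open import Data.Vec.Properties using (map-∘; map-cong; map-id; lookup-map; tabulate∘lookup; tabulate-cong; lookup-++ˡ; lookup-++ʳ)
open import Function using (_∘_; id)
open import Function.Bundles using (_⇔_; Equivalence; mk⇔)
open import Relation.Binary using (tri<; tri≈; tri>)
open import Relation.Binary.PropositionalEquality hiding ([_])
open import Relation.Nullary using (Dec; yes; no; ¬_)
open import Relation.Nullary.Decidable using (_×-dec_; _⊎-dec_; _→-dec_; ⌊_⌋; False; toWitnessFalse)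

-- Substitution and derivability

-- The obstacle is that one `Σ₁` formula and one interpretation must refute all modal non-theorems
-- at once, although in reality nothing but ordinary derivations happens. Hence the model c is not
-- fixed in advance: the first event selects it, and an event is impossible in the standard model
-- yet not refuted by `T`. The sets of a family are closed under one-premise rules only, just as the
-- logics in question do not derive `□(A ∧ B)` from `□A` and `□B`. The closure of a set is therefore
-- the union of the closures of its elements, and every threat to coherence goes back to a single
-- root. Theorems fit into this scheme as consequences of the one sentence `⊥' ⇒ ⊥'`. A conflict is
-- sought with the implications of stage m + 1 in a family that is good at stage m. This offset
-- turns the absence of events into an induction step: implications that first become visible at m +
-- 1 cannot ruin a family that was good before.

substT-bounded : ∀ {k σ τ} → (∀ n → n < k → σ n ≡ τ n) → ∀ t → ClosedT k t → substT σ t ≡ substT τ t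
substT-bounded e (var n) c = e n c
substT-bounded e zer c = refl
substT-bounded e (suc' t) c = cong suc' (substT-bounded e t c)
substT-bounded e (t ⊕ s) (c , d) = cong₂ _⊕_ (substT-bounded e t c) (substT-bounded e s d)
substT-bounded e (t ⊗ s) (c , d) = cong₂ _⊗_ (substT-bounded e t c) (substT-bounded e s d)

liftS-bounded : ∀ {k σ τ} → (∀ n → n < k → σ n ≡ τ n) → ∀ n → n < suc k → liftS σ n ≡ liftS τ n
liftS-bounded e zero p = refl
liftS-bounded e (suc n) (s≤s p) = cong shiftT (e n p)

substF-bounded : ∀ {k σ τ} → (∀ n → n < k → σ n ≡ τ n) → ∀ φ → Closed k φ → substF σ φ ≡ substF τ φ
substF-bounded e ⊥' c = refl
substF-bounded e (t ≐ s) (c , d) = cong₂ _≐_ (substT-bounded e t c) (substT-bounded e s d)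
substF-bounded e (φ ⇒ ψ) (c , d) = cong₂ _⇒_ (substF-bounded e φ c) (substF-bounded e ψ d)
substF-bounded e (∀' φ) c = cong ∀' (substF-bounded (liftS-bounded e) φ c)

closedT-mono : ∀ {k l} → k ≤ l → ∀ t → ClosedT k t → ClosedT l t
closedT-mono p (var n) c = <-≤-trans c p
closedT-mono p zer c = tt
closedT-mono p (suc' t) c = closedT-mono p t c
closedT-mono p (t ⊕ s) (c , d) = closedT-mono p t c , closedT-mono p s d
closedT-mono p (t ⊗ s) (c , d) = closedT-mono p t c , closedT-mono p s d

closed-mono : ∀ {k l} → k ≤ l → ∀ φ → Closed k φ → Closed l φ
closed-mono p ⊥' c = tt
closed-mono p (t ≐ s) (c , d) = closedT-mono p t c , closedT-mono p s d
closed-mono p (φ ⇒ ψ) (c , d) = closed-mono p φ c , closed-mono p ψ d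
closed-mono p (∀' φ) c = closed-mono (s≤s p) φ c

boundT : Term → ℕ
boundT (var n) = suc n
boundT zer = 0
boundT (suc' t) = boundT t
boundT (t ⊕ s) = boundT t ⊔ boundT s
boundT (t ⊗ s) = boundT t ⊔ boundT s

bound : Formula → ℕ
bound ⊥' = 0
bound (t ≐ s) = boundT t ⊔ boundT s
bound (φ ⇒ ψ) = bound φ ⊔ bound ψ
bound (∀' φ) = bound φ

boundT-closed : ∀ t → ClosedT (boundT t) t
boundT-closed (var n) = ≤-refl
boundT-closed zer = tt
boundT-closed (suc' t) = boundT-closed t
boundT-closed (t ⊕ s) = closedT-mono (m≤m⊔n _ _) t (boundT-closed t) , closedT-mono (m≤n⊔m _ _) s (boundT-closed s)
boundT-closed (t ⊗ s) = closedT-mono (m≤m⊔n _ _) t (boundT-closed t) , closedT-mono (m≤n⊔m _ _) s (boundT-closed s)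

bound-closed : ∀ φ → Closed (bound φ) φ
bound-closed ⊥' = tt
bound-closed (t ≐ s) = closedT-mono (m≤m⊔n _ _) t (boundT-closed t) , closedT-mono (m≤n⊔m _ _) s (boundT-closed s)
bound-closed (φ ⇒ ψ) = closed-mono (m≤m⊔n _ _) φ (bound-closed φ) , closed-mono (m≤n⊔m _ _) ψ (bound-closed ψ)
bound-closed (∀' φ) = closed-mono (n≤1+n _) φ (bound-closed φ)

substF-ext : ∀ {σ τ} → (∀ n → σ n ≡ τ n) → ∀ φ → substF σ φ ≡ substF τ φ
substF-ext e φ = substF-bounded (λ n _ → e n) φ (bound-closed φ)

substT-subst : ∀ σ τ t → substT σ (substT τ t) ≡ substT (λ n → substT σ (τ n)) t
substT-subst σ τ (var n) = refl
substT-subst σ τ zer = refl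
substT-subst σ τ (suc' t) = cong suc' (substT-subst σ τ t)
substT-subst σ τ (t ⊕ s) = cong₂ _⊕_ (substT-subst σ τ t) (substT-subst σ τ s)
substT-subst σ τ (t ⊗ s) = cong₂ _⊗_ (substT-subst σ τ t) (substT-subst σ τ s)

substT-ren : ∀ σ ρ t → substT σ (renT ρ t) ≡ substT (σ ∘ ρ) t
substT-ren σ ρ (var n) = refl
substT-ren σ ρ zer = refl
substT-ren σ ρ (suc' t) = cong suc' (substT-ren σ ρ t)
substT-ren σ ρ (t ⊕ s) = cong₂ _⊕_ (substT-ren σ ρ t) (substT-ren σ ρ s)
substT-ren σ ρ (t ⊗ s) = cong₂ _⊗_ (substT-ren σ ρ t) (substT-ren σ ρ s)

renT-substT : ∀ ρ t → renT ρ t ≡ substT (var ∘ ρ) t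
renT-substT ρ (var n) = refl
renT-substT ρ zer = refl
renT-substT ρ (suc' t) = cong suc' (renT-substT ρ t)
renT-substT ρ (t ⊕ s) = cong₂ _⊕_ (renT-substT ρ t) (renT-substT ρ s)
renT-substT ρ (t ⊗ s) = cong₂ _⊗_ (renT-substT ρ t) (renT-substT ρ s)

substT-id : ∀ t → substT var t ≡ t
substT-id (var n) = refl
substT-id zer = refl
substT-id (suc' t) = cong suc' (substT-id t)
substT-id (t ⊕ s) = cong₂ _⊕_ (substT-id t) (substT-id s)
substT-id (t ⊗ s) = cong₂ _⊗_ (substT-id t) (substT-id s)

substT-liftS : ∀ σ t → substT (liftS σ) (shiftT t) ≡ shiftT (substT σ t)
substT-liftS σ t = trans (substT-ren (liftS σ) suc t)
  (sym (trans (renT-substT suc (substT σ t)) (trans (substT-subst (var ∘ suc) σ t)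
    (substT-bounded (λ n _ → sym (renT-substT suc (σ n))) t (boundT-closed t)))))

substF-subst : ∀ σ τ φ → substF σ (substF τ φ) ≡ substF (λ n → substT σ (τ n)) φ
substF-subst σ τ ⊥' = refl
substF-subst σ τ (t ≐ s) = cong₂ _≐_ (substT-subst σ τ t) (substT-subst σ τ s)
substF-subst σ τ (φ ⇒ ψ) = cong₂ _⇒_ (substF-subst σ τ φ) (substF-subst σ τ ψ)
substF-subst σ τ (∀' φ) = cong ∀' (trans (substF-subst (liftS σ) (liftS τ) φ) (substF-ext e φ))
  where
  e : ∀ n → substT (liftS σ) (liftS τ n) ≡ liftS (λ n → substT σ (τ n)) n
  e zero = refl
  e (suc n) = substT-liftS σ (τ n)

substF-id : ∀ {σ} → (∀ n → σ n ≡ var n) → ∀ φ → substF σ φ ≡ φ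
substF-id {σ} e φ = trans (substF-ext e φ) (go φ)
  where
  l : ∀ n → liftS var n ≡ var n
  l zero = refl
  l (suc n) = refl
  go : ∀ φ → substF var φ ≡ φ
  go ⊥' = refl
  go (t ≐ s) = cong₂ _≐_ (substT-id t) (substT-id s)
  go (φ ⇒ ψ) = cong₂ _⇒_ (go φ) (go ψ)
  go (∀' φ) = cong ∀' (trans (substF-ext l φ) (go φ))

inst-shiftT : ∀ t u → substT (inst u) (shiftT t) ≡ t
inst-shiftT t u = trans (substT-ren (inst u) suc t) (substT-id t)

substF-inst : ∀ σ φ t → substF σ (φ [ t ]) ≡ (substF (liftS σ) φ) [ substT σ t ]
substF-inst σ φ t = trans (substF-subst σ (inst t) φ) (sym (trans (substF-subst (inst (substT σ t)) (liftS σ) φ) (substF-ext e φ)))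
  where
  e : ∀ n → substT (inst (substT σ t)) (liftS σ n) ≡ substT σ (inst t n)
  e zero = refl
  e (suc n) = inst-shiftT (σ n) _

substF-shift : ∀ σ φ → substF (liftS σ) (shiftF φ) ≡ shiftF (substF σ φ)
substF-shift σ φ = trans (substF-subst (liftS σ) (λ n → var (suc n)) φ)
  (sym (trans (substF-subst (λ n → var (suc n)) σ φ) (substF-ext (λ n → sym (renT-substT suc (σ n))) φ)))

numeral-subst : ∀ σ n → substT σ (numeral n) ≡ numeral n
numeral-subst σ zero = refl
numeral-subst σ (suc n) = cong suc' (numeral-subst σ n)

numeral-closed : ∀ k n → ClosedT k (numeral n)
numeral-closed k zero = tt
numeral-closed k (suc n) = numeral-closed k n

module _ {T : Theory} where

  ⊢id : ∀ {φ} → T ⊢ φ ⇒ φ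
  ⊢id {φ} = mp (mp axS axK) (axK {ψ = φ})

  _⨾_ : ∀ {φ ψ χ} → T ⊢ φ ⇒ ψ → T ⊢ ψ ⇒ χ → T ⊢ φ ⇒ χ
  p ⨾ q = mp (mp axS (mp axK q)) p

  instT : ∀ {φ} t → T ⊢ ∀' φ → T ⊢ φ [ t ]
  instT t p = mp (axIn t) p

⊢-lift : ∀ {T U : Theory} → (∀ φ → T φ → U ⊢ φ) → ∀ {φ} → T ⊢ φ → U ⊢ φ
⊢-lift h (ax a) = h _ a
⊢-lift h axK = axK
⊢-lift h axS = axS
⊢-lift h axDN = axDN
⊢-lift h (axIn t) = axIn t
⊢-lift h axDi = axDi
⊢-lift h axVac = axVac
⊢-lift h (axRef t) = axRef t
⊢-lift h (axEq φ t s) = axEq φ t s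
⊢-lift h (mp p q) = mp (⊢-lift h p) (⊢-lift h q)
⊢-lift h (gen p) = gen (⊢-lift h p)

-- The axioms `pa1` to `pa6` are open formulas in the variables 0 and 1, so two generalizations
-- followed by two instantiations realize any substitution. The value for variable 1 is shifted
-- under the inner binder, and the second instantiation undoes the shift.
inst2 : ∀ {T φ} σ → Closed 2 φ → T ⊢ φ → T ⊢ substF σ φ
inst2 {T} {φ} σ c p = subst (T ⊢_) e (instT (σ 0) (subst (T ⊢_) refl (instT (σ 1) (gen (gen p)))))
  where
  f : ∀ n → n < 2 → substT (inst (σ 0)) (liftS (inst (σ 1)) n) ≡ σ n
  f zero _ = refl
  f (suc zero) _ = inst-shiftT (σ 1) _
  f (suc (suc n)) (s≤s (s≤s ()))
  e : (substF (liftS (inst (σ 1))) φ) [ σ 0 ] ≡ substF σ φ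
  e = trans (substF-subst (inst (σ 0)) (liftS (inst (σ 1))) φ) (substF-bounded f φ c)

PAax-subst : ∀ {φ} σ → PAax φ → PA ⊢ substF σ φ
PAax-subst σ pa1 = inst2 σ ((s≤s z≤n , tt) , tt) (ax pa1)
PAax-subst σ pa2 = inst2 σ ((s≤s z≤n , s≤s (s≤s z≤n)) , (s≤s z≤n , s≤s (s≤s z≤n))) (ax pa2)
PAax-subst σ pa3 = inst2 σ ((s≤s z≤n , tt) , s≤s z≤n) (ax pa3)
PAax-subst σ pa4 = inst2 σ ((s≤s z≤n , s≤s (s≤s z≤n)) , (s≤s z≤n , s≤s (s≤s z≤n))) (ax pa4)
PAax-subst σ pa5 = inst2 σ ((s≤s z≤n , tt) , tt) (ax pa5)
PAax-subst σ pa6 = inst2 σ ((s≤s z≤n , s≤s (s≤s z≤n)) , ((s≤s z≤n , s≤s (s≤s z≤n)) , s≤s z≤n)) (ax pa6)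
PAax-subst σ (ind φ) = subst (PA ⊢_) (cong₂ _⇒_ (sym (substF-inst σ φ zer)) (cong₂ _⇒_ (cong ∀' (cong₂ _⇒_ refl e)) refl)) (ax (ind (substF (liftS σ) φ)))
  where
  f : ∀ n → substT stepS (liftS σ n) ≡ substT (liftS σ) (stepS n)
  f zero = refl
  f (suc n) = trans (substT-ren stepS suc (σ n)) (sym (renT-substT suc (σ n)))
  e : substF stepS (substF (liftS σ) φ) ≡ substF (liftS σ) (substF stepS φ)
  e = trans (substF-subst stepS (liftS σ) φ) (trans (substF-ext f φ) (sym (substF-subst (liftS σ) stepS φ)))

-- The eigenvariable rule `∀I` rests on this renaming of free variables. Induction axioms survive it
-- because `stepS` commutes with lifted substitutions.
⊢-subst : ∀ {φ} σ → PA ⊢ φ → PA ⊢ substF σ φ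
⊢-subst σ (ax a) = PAax-subst σ a
⊢-subst σ axK = axK
⊢-subst σ axS = axS
⊢-subst σ axDN = axDN
⊢-subst σ (axIn {φ} t) = subst (PA ⊢_) (cong (_ ⇒_) (sym (substF-inst σ φ t))) (axIn (substT σ t))
⊢-subst σ axDi = axDi
⊢-subst σ (axVac {φ}) = subst (PA ⊢_) (cong (λ z → substF σ φ ⇒ ∀' z) (sym (substF-shift σ φ))) axVac
⊢-subst σ (axRef t) = axRef _
⊢-subst σ (axEq φ t s) = subst (PA ⊢_) (cong ((substT σ t ≐ substT σ s) ⇒_) (cong₂ _⇒_ (sym (substF-inst σ φ t)) (sym (substF-inst σ φ s)))) (axEq (substF (liftS σ) φ) _ _)
⊢-subst σ (mp p q) = mp (⊢-subst σ p) (⊢-subst σ q)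
⊢-subst σ (gen p) = gen (⊢-subst (liftS σ) p)

-- Natural deduction in PA

Ctx : Set
Ctx = List Formula

-- The head of the context is the innermost antecedent, so `ƛ` and `unƛ` leave the derivation itself
-- unchanged.
_⇒*_ : Ctx → Formula → Formula
[] ⇒* φ = φ
(ψ ∷ Γ) ⇒* φ = Γ ⇒* (ψ ⇒ φ)

infix 2 _⊩_
-- A record because `_⇒*_` is not injective: contexts and conclusions become inferable by
-- unification.
record _⊩_ (Γ : Ctx) (φ : Formula) : Set where
  constructor nd
  field unnd : PA ⊢ Γ ⇒* φ
open _⊩_ public

lift* : ∀ Γ {φ} → PA ⊢ φ → PA ⊢ Γ ⇒* φ
lift* [] p = p
lift* (ψ ∷ Γ) p = lift* Γ (mp axK p)

mp* : ∀ Γ {φ ψ} → PA ⊢ Γ ⇒* (φ ⇒ ψ) → PA ⊢ Γ ⇒* φ → PA ⊢ Γ ⇒* ψ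
mp* [] p q = mp p q
mp* (χ ∷ Γ) p q = mp* Γ (mp* Γ (lift* Γ axS) p) q

infixl 5 _·_
_·_ : ∀ {Γ φ ψ} → Γ ⊩ φ ⇒ ψ → Γ ⊩ φ → Γ ⊩ ψ
_·_ {Γ} (nd p) (nd q) = nd (mp* Γ p q)

thm : ∀ {Γ φ} → PA ⊢ φ → Γ ⊩ φ
thm {Γ} p = nd (lift* Γ p)

ƛ : ∀ {Γ φ ψ} → φ ∷ Γ ⊩ ψ → Γ ⊩ φ ⇒ ψ
ƛ (nd p) = nd p

unƛ : ∀ {Γ φ ψ} → Γ ⊩ φ ⇒ ψ → φ ∷ Γ ⊩ ψ
unƛ (nd p) = nd p

wk : ∀ {Γ φ ψ} → Γ ⊩ φ → ψ ∷ Γ ⊩ φ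
wk p = unƛ (thm axK · p)

h0 : ∀ {Γ φ} → φ ∷ Γ ⊩ φ
h0 {Γ} = nd (lift* Γ ⊢id)

h1 : ∀ {Γ φ ψ} → ψ ∷ φ ∷ Γ ⊩ φ
h1 = wk h0

h2 : ∀ {Γ φ ψ χ} → χ ∷ ψ ∷ φ ∷ Γ ⊩ φ
h2 = wk h1

h3 : ∀ {Γ φ ψ χ θ} → θ ∷ χ ∷ ψ ∷ φ ∷ Γ ⊩ φ
h3 = wk h2

dn : ∀ {Γ φ} → Γ ⊩ ¬' (¬' φ) → Γ ⊩ φ
dn p = thm axDN · p

efq : ∀ {Γ φ} → Γ ⊩ ⊥' → Γ ⊩ φ
efq p = dn (ƛ (wk p))

lem : ∀ {Γ} φ {χ} → φ ∷ Γ ⊩ χ → ¬' φ ∷ Γ ⊩ χ → Γ ⊩ χ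
lem φ p q = dn (ƛ (h0 · (wk (ƛ q) · ƛ (h1 · (wk (wk (ƛ p)) · h0)))))

infixr 4.6 _∧'_
infixr 4.5 _∨'_
_∧'_ _∨'_ : Formula → Formula → Formula
φ ∧' ψ = ¬' (φ ⇒ ¬' ψ)
φ ∨' ψ = ¬' φ ⇒ ψ

∧I : ∀ {Γ φ ψ} → Γ ⊩ φ → Γ ⊩ ψ → Γ ⊩ φ ∧' ψ
∧I p q = ƛ (h0 · wk p · wk q)

∧₁ : ∀ {Γ φ ψ} → Γ ⊩ φ ∧' ψ → Γ ⊩ φ
∧₁ p = dn (ƛ (wk p · ƛ (efq (h1 · h0))))

∧₂ : ∀ {Γ φ ψ} → Γ ⊩ φ ∧' ψ → Γ ⊩ ψ
∧₂ p = dn (ƛ (wk p · ƛ h1))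

∨₁ : ∀ {Γ φ ψ} → Γ ⊩ φ → Γ ⊩ φ ∨' ψ
∨₁ p = ƛ (efq (h0 · wk p))

∨₂ : ∀ {Γ φ ψ} → Γ ⊩ ψ → Γ ⊩ φ ∨' ψ
∨₂ p = ƛ (wk p)

∨E : ∀ {Γ φ ψ χ} → Γ ⊩ φ ∨' ψ → φ ∷ Γ ⊩ χ → ψ ∷ Γ ⊩ χ → Γ ⊩ χ
∨E {φ = φ} p q r = lem φ q (wk (ƛ r) · (wk p · h0))

boundC : Ctx → ℕ
boundC [] = 0
boundC (φ ∷ Γ) = bound φ ⊔ boundC Γ

shiftC : Ctx → Ctx
shiftC [] = []
shiftC (φ ∷ Γ) = shiftF φ ∷ shiftC Γ

∀* : ∀ Γ {φ} → PA ⊢ ∀' (shiftC Γ ⇒* φ) → PA ⊢ Γ ⇒* ∀' φ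
∀* [] p = p
∀* (ψ ∷ Γ) {φ} p = mp* Γ (lift* Γ (axDi ⨾ mp axS' axVac)) (∀* Γ p)
  where
  axS' : ∀ {χ} → PA ⊢ (ψ ⇒ ∀' (shiftF ψ)) ⇒ (∀' (shiftF ψ) ⇒ χ) ⇒ ψ ⇒ χ
  axS' = unnd {[]} (ƛ (ƛ (ƛ (h1 · (h2 · h0)))))

-- The eigenvariable rule in higher-order form: the premise is used for one fresh variable.
∀I : ∀ {Γ φ} → (∀ t → Γ ⊩ φ [ t ]) → Γ ⊩ ∀' φ
∀I {Γ} {φ} h = nd (∀* Γ (gen (subst (PA ⊢_) (e Γ (m≤n⊔m _ _) φ (var N) e0) (⊢-subst σ (unnd (h (var N)))))))
  where
  N : ℕ
  N = bound φ ⊔ boundC Γ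
  σ : ℕ → Term
  σ n with n ≟ N
  ... | yes _ = var 0
  ... | no _ = var (suc n)
  σN : σ N ≡ var 0
  σN with N ≟ N
  ... | yes _ = refl
  ... | no q = ⊥-elim (q refl)
  σ< : ∀ n → n < N → σ n ≡ var (suc n)
  σ< n p with n ≟ N
  ... | yes q = ⊥-elim (<-irrefl q p)
  ... | no _ = refl
  fresh : ∀ ψ → bound ψ ≤ N → substF σ ψ ≡ shiftF ψ
  fresh ψ p = substF-bounded (λ n q → σ< n (<-≤-trans q p)) ψ (bound-closed ψ)
  e0 : substF σ (φ [ var N ]) ≡ φ
  e0 = trans (substF-subst σ (inst (var N)) φ) (trans (substF-bounded {bound φ} f φ (bound-closed φ)) (substF-id (λ _ → refl) φ))
    where
    f : ∀ n → n < bound φ → substT σ (inst (var N) n) ≡ var n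
    f zero _ = σN
    f (suc n) p = σ< n (<-≤-trans (<-trans ≤-refl p) (m≤m⊔n _ _))
  e : ∀ Δ → boundC Δ ≤ N → ∀ ψ t {χ} → substF σ (ψ [ t ]) ≡ χ → substF σ (Δ ⇒* (ψ [ t ])) ≡ shiftC Δ ⇒* χ
  e Δ p ψ t q = go Δ p q
    where
    go : ∀ Δ → boundC Δ ≤ N → ∀ {ψ χ} → substF σ ψ ≡ χ → substF σ (Δ ⇒* ψ) ≡ shiftC Δ ⇒* χ
    go [] p q = q
    go (θ ∷ Δ) p q = go Δ (≤-trans (m≤n⊔m _ _) p) (cong₂ _⇒_ (fresh θ (≤-trans (m≤m⊔n _ _) p)) q)

∀E : ∀ {Γ φ} t → Γ ⊩ ∀' φ → Γ ⊩ φ [ t ]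
∀E t p = thm (axIn t) · p

∃I : ∀ {Γ} φ t → Γ ⊩ φ [ t ] → Γ ⊩ ∃' φ
∃I φ t p = ƛ (∀E t h0 · wk p)

∃E : ∀ {Γ φ χ} → Γ ⊩ ∃' φ → (∀ t → φ [ t ] ∷ Γ ⊩ χ) → Γ ⊩ χ
∃E {φ = φ} p h = dn (ƛ (wk p · ∀I (λ t → ƛ (h1 · (wk (wk (ƛ (h t))) · h0)))))

-- Bounded formulas with explicit environments.  The node `call` keeps substitution
-- instances unevaluated, so that both readings of a formula commute with it definitionally.

infixl 7 _*ᵗ_
infixl 6 _+ᵗ_
infix  5 _≈_
infixr 4 _∧d_
infixr 3 _∨d_
infixr 2 _⊃_

data Tm (n : ℕ) : Set where
  vr   : Fin n → Tm n
  #_   : ℕ → Tm n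
  S    : Tm n → Tm n
  _+ᵗ_ : Tm n → Tm n → Tm n
  _*ᵗ_ : Tm n → Tm n → Tm n

data D : ℕ → Set where
  _≈_  : ∀ {n} → Tm n → Tm n → D n
  ⊥d   : ∀ {n} → D n
  _⊃_  : ∀ {n} → D n → D n → D n
  _∧d_ : ∀ {n} → D n → D n → D n
  _∨d_ : ∀ {n} → D n → D n → D n
  ∀≤   : ∀ {n} → Tm n → D (suc n) → D n
  ∃≤   : ∀ {n} → Tm n → D (suc n) → D n
  call : ∀ {m n} → D m → Vec (Tm n) m → D n

¬d : ∀ {n} → D n → D n
¬d d = d ⊃ ⊥d

mutual
  evT : ∀ {n} → Tm n → Vec ℕ n → ℕ
  evT (vr i) ρ = lookup ρ i
  evT (# k) ρ = k
  evT (S t) ρ = suc (evT t ρ)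
  evT (t +ᵗ s) ρ = evT t ρ + evT s ρ
  evT (t *ᵗ s) ρ = evT t ρ * evT s ρ

  evTs : ∀ {n m} → Vec (Tm n) m → Vec ℕ n → Vec ℕ m
  evTs [] ρ = []
  evTs (t ∷ ts) ρ = evT t ρ ∷ evTs ts ρ

⟪_⟫ : ∀ {n} → D n → Vec ℕ n → Set
⟪ t ≈ s ⟫ ρ = evT t ρ ≡ evT s ρ
⟪ ⊥d ⟫ ρ = ⊥
⟪ d ⊃ e ⟫ ρ = ⟪ d ⟫ ρ → ⟪ e ⟫ ρ
⟪ d ∧d e ⟫ ρ = ⟪ d ⟫ ρ × ⟪ e ⟫ ρ
⟪ d ∨d e ⟫ ρ = ⟪ d ⟫ ρ ⊎ ⟪ e ⟫ ρ
⟪ ∀≤ t d ⟫ ρ = ∀ x → x ≤ evT t ρ → ⟪ d ⟫ (x ∷ ρ)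
⟪ ∃≤ t d ⟫ ρ = Σ ℕ λ x → x ≤ evT t ρ × ⟪ d ⟫ (x ∷ ρ)
⟪ call d ts ⟫ ρ = ⟪ d ⟫ (evTs ts ρ)

all≤? : ∀ {P : ℕ → Set} b → (∀ x → Dec (P x)) → Dec (∀ x → x ≤ b → P x)
all≤? {P} zero p with p 0
... | yes q = yes λ { .0 z≤n → q }
... | no ¬q = no λ f → ¬q (f 0 z≤n)
all≤? {P} (suc b) p with all≤? b p | p (suc b)
... | no ¬q | _ = no λ f → ¬q λ x x≤b → f x (≤-trans x≤b (n≤1+n b))
... | yes _ | no ¬q = no λ f → ¬q (f (suc b) ≤-refl)
... | yes f | yes q = yes g
  where
  g : ∀ x → x ≤ suc b → P x
  g x x≤ with m≤n⇒m<n∨m≡n x≤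
  ... | inj₁ (s≤s x≤b) = f x x≤b
  ... | inj₂ refl = q

any≤? : ∀ {P : ℕ → Set} b → (∀ x → Dec (P x)) → Dec (Σ ℕ λ x → x ≤ b × P x)
any≤? {P} zero p with p 0
... | yes q = yes (0 , z≤n , q)
... | no ¬q = no λ { (.0 , z≤n , q) → ¬q q }
any≤? {P} (suc b) p with any≤? b p | p (suc b)
... | yes (x , x≤b , q) | _ = yes (x , ≤-trans x≤b (n≤1+n b) , q)
... | no _ | yes q = yes (suc b , ≤-refl , q)
... | no ¬f | no ¬q = no g
  where
  g : ¬ (Σ ℕ λ x → x ≤ suc b × P x)
  g (x , x≤ , q) with m≤n⇒m<n∨m≡n x≤
  ... | inj₁ (s≤s x≤b) = ¬f (x , x≤b , q)
  ... | inj₂ refl = ¬q q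

decD : ∀ {n} (d : D n) ρ → Dec (⟪ d ⟫ ρ)
decD (t ≈ s) ρ = evT t ρ ≟ evT s ρ
decD ⊥d ρ = no λ ()
decD (d ⊃ e) ρ = decD d ρ →-dec decD e ρ
decD (d ∧d e) ρ = decD d ρ ×-dec decD e ρ
decD (d ∨d e) ρ = decD d ρ ⊎-dec decD e ρ
decD (∀≤ t d) ρ = all≤? (evT t ρ) λ x → decD d (x ∷ ρ)
decD (∃≤ t d) ρ = any≤? (evT t ρ) λ x → decD d (x ∷ ρ)
decD (call d ts) ρ = decD d (evTs ts ρ)

tm : ∀ {n} → Tm n → Vec Term n → Term
tm (vr i) τ = lookup τ i
tm (# k) τ = numeral k
tm (S t) τ = suc' (tm t τ)
tm (t +ᵗ s) τ = tm t τ ⊕ tm s τ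
tm (t *ᵗ s) τ = tm t τ ⊗ tm s τ

tms : ∀ {n m} → Vec (Tm n) m → Vec Term n → Vec Term m
tms [] τ = []
tms (t ∷ ts) τ = tm t τ ∷ tms ts τ

ball : Term → Formula → Formula
ball b φ = ∀' ((var 0 ≤' shiftT b) ⇒ φ)

bex : Term → Formula → Formula
bex b φ = ¬' (ball b (¬' φ))

F : ∀ {n} → D n → Vec Term n → Formula
F (t ≈ s) τ = tm t τ ≐ tm s τ
F ⊥d τ = ⊥'
F (d ⊃ e) τ = F d τ ⇒ F e τ
F (d ∧d e) τ = F d τ ∧' F e τ
F (d ∨d e) τ = F d τ ∨' F e τ
F (∀≤ t d) τ = ball (tm t τ) (F d (var 0 ∷ map shiftT τ))
F (∃≤ t d) τ = bex (tm t τ) (F d (var 0 ∷ map shiftT τ))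
F (call d ts) τ = F d (tms ts τ)

F-Δ₀ : ∀ {n} (d : D n) τ → Δ₀ (F d τ)
F-Δ₀ (t ≈ s) τ = d-eq _ _
F-Δ₀ ⊥d τ = d-bot
F-Δ₀ (d ⊃ e) τ = d-imp (F-Δ₀ d τ) (F-Δ₀ e τ)
F-Δ₀ (d ∧d e) τ = d-imp (d-imp (F-Δ₀ d τ) (d-imp (F-Δ₀ e τ) d-bot)) d-bot
F-Δ₀ (d ∨d e) τ = d-imp (d-imp (F-Δ₀ d τ) d-bot) (F-Δ₀ e τ)
F-Δ₀ (∀≤ t d) τ = d-ball _ (F-Δ₀ d _)
F-Δ₀ (∃≤ t d) τ = d-imp (d-ball _ (d-imp (F-Δ₀ d _) d-bot)) d-bot
F-Δ₀ (call d ts) τ = F-Δ₀ d _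

le-subst : ∀ σ t s → substF σ (t ≤' s) ≡ (substT σ t ≤' substT σ s)
le-subst σ t s = cong ∃' (cong₂ _≐_ (cong (var 0 ⊕_) (substT-liftS σ t)) (substT-liftS σ s))

tm-subst : ∀ {n} σ (t : Tm n) τ → substT σ (tm t τ) ≡ tm t (map (substT σ) τ)
tm-subst σ (vr i) τ = sym (lookup-map i (substT σ) τ)
tm-subst σ (# k) τ = numeral-subst σ k
tm-subst σ (S t) τ = cong suc' (tm-subst σ t τ)
tm-subst σ (t +ᵗ s) τ = cong₂ _⊕_ (tm-subst σ t τ) (tm-subst σ s τ)
tm-subst σ (t *ᵗ s) τ = cong₂ _⊗_ (tm-subst σ t τ) (tm-subst σ s τ)

tms-subst : ∀ {n m} σ (ts : Vec (Tm n) m) τ → map (substT σ) (tms ts τ) ≡ tms ts (map (substT σ) τ)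
tms-subst σ [] τ = refl
tms-subst σ (t ∷ ts) τ = cong₂ _∷_ (tm-subst σ t τ) (tms-subst σ ts τ)

lift-env : ∀ {n} σ (τ : Vec Term n) → map (substT (liftS σ)) (map shiftT τ) ≡ map shiftT (map (substT σ) τ)
lift-env σ τ = trans (sym (map-∘ _ _ τ)) (trans (map-cong (substT-liftS σ) τ) (map-∘ _ _ τ))

ball-subst : ∀ σ b φ → substF σ (ball b φ) ≡ ball (substT σ b) (substF (liftS σ) φ)
ball-subst σ b φ = cong ∀' (cong (_⇒ substF (liftS σ) φ) (trans (le-subst (liftS σ) (var 0) (shiftT b)) (cong (var 0 ≤'_) (substT-liftS σ b))))

F-subst : ∀ {n} σ (d : D n) τ → substF σ (F d τ) ≡ F d (map (substT σ) τ)
F-subst σ (t ≈ s) τ = cong₂ _≐_ (tm-subst σ t τ) (tm-subst σ s τ)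
F-subst σ ⊥d τ = refl
F-subst σ (d ⊃ e) τ = cong₂ _⇒_ (F-subst σ d τ) (F-subst σ e τ)
F-subst σ (d ∧d e) τ = cong₂ _∧'_ (F-subst σ d τ) (F-subst σ e τ)
F-subst σ (d ∨d e) τ = cong₂ _∨'_ (F-subst σ d τ) (F-subst σ e τ)
F-subst σ (∀≤ t d) τ = trans (ball-subst σ (tm t τ) _)
  (cong₂ ball (tm-subst σ t τ) (trans (F-subst (liftS σ) d _) (cong (λ z → F d (var 0 ∷ z)) (lift-env σ τ))))
F-subst σ (∃≤ t d) τ = cong ¬' (trans (ball-subst σ (tm t τ) _)
  (cong₂ (λ b φ → ball b (¬' φ)) (tm-subst σ t τ) (trans (F-subst (liftS σ) d _) (cong (λ z → F d (var 0 ∷ z)) (lift-env σ τ)))))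
F-subst σ (call d ts) τ = trans (F-subst σ d _) (cong (F d) (tms-subst σ ts τ))

F-inst : ∀ {n} (d : D (suc n)) t τ → (F d (var 0 ∷ map shiftT τ)) [ t ] ≡ F d (t ∷ τ)
F-inst d t τ = trans (F-subst (inst t) d _)
  (cong (λ z → F d (t ∷ z)) (trans (sym (map-∘ _ _ τ)) (trans (map-cong (λ u → inst-shiftT u t) τ) (map-id τ))))

le-inst : ∀ t b → (var 0 ≤' shiftT b) [ t ] ≡ (t ≤' b)
le-inst t b = trans (le-subst (inst t) (var 0) (shiftT b)) (cong (t ≤'_) (inst-shiftT b t))

∀≤I : ∀ {Γ n} {b : Tm n} {d τ} → (∀ t → (t ≤' tm b τ) ∷ Γ ⊩ F d (t ∷ τ)) → Γ ⊩ F (∀≤ b d) τ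
∀≤I {Γ} {b = b} {d} {τ} h = ∀I λ t → subst (Γ ⊩_) (cong₂ _⇒_ (sym (le-inst t (tm b τ))) (sym (F-inst d t τ))) (ƛ (h t))

∀≤E : ∀ {Γ n} {b : Tm n} {d τ} → Γ ⊩ F (∀≤ b d) τ → ∀ t → Γ ⊩ t ≤' tm b τ → Γ ⊩ F d (t ∷ τ)
∀≤E {Γ} {b = b} {d} {τ} p t q = subst (Γ ⊩_) (cong₂ _⇒_ (le-inst t (tm b τ)) (F-inst d t τ)) (∀E t p) · q

∃≤I : ∀ {Γ n} {b : Tm n} {d τ} t → Γ ⊩ t ≤' tm b τ → Γ ⊩ F d (t ∷ τ) → Γ ⊩ F (∃≤ b d) τ
∃≤I {b = b} {d} {τ} t q p = ƛ (∀≤E {b = b} {d = ¬d d} {τ} h0 t (wk q) · wk p)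

∃≤E : ∀ {Γ n} {b : Tm n} {d τ χ} → Γ ⊩ F (∃≤ b d) τ → (∀ t → F d (t ∷ τ) ∷ (t ≤' tm b τ) ∷ Γ ⊩ χ) → Γ ⊩ χ
∃≤E {b = b} {d} {τ} p h = dn (ƛ (wk p · ∀≤I {b = b} {d = ¬d d} {τ} (λ t → ƛ (h2 · (wk (wk (wk (ƛ (ƛ (h t))))) · h1 · h0)))))

closedTs : ∀ {k n} → Vec Term n → Set
closedTs {k} τ = ∀ i → ClosedT k (lookup τ i)

shiftT-closed : ∀ {k} t → ClosedT k t → ClosedT (suc k) (shiftT t)
shiftT-closed (var n) c = s≤s c
shiftT-closed zer c = tt
shiftT-closed (suc' t) c = shiftT-closed t c
shiftT-closed (t ⊕ s) (c , d) = shiftT-closed t c , shiftT-closed s d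
shiftT-closed (t ⊗ s) (c , d) = shiftT-closed t c , shiftT-closed s d

tm-closed : ∀ {k n} (t : Tm n) {τ} → closedTs {k} τ → ClosedT k (tm t τ)
tm-closed (vr i) c = c i
tm-closed (# n) c = numeral-closed _ n
tm-closed (S t) c = tm-closed t c
tm-closed (t +ᵗ s) c = tm-closed t c , tm-closed s c
tm-closed (t *ᵗ s) c = tm-closed t c , tm-closed s c

tms-closed : ∀ {k n m} (ts : Vec (Tm n) m) {τ} → closedTs {k} τ → closedTs {k} (tms ts τ)
tms-closed (t ∷ ts) c zero = tm-closed t c
tms-closed (t ∷ ts) c (suc i) = tms-closed ts c i

env-closed : ∀ {k n} {τ : Vec Term n} → closedTs {k} τ → closedTs {suc k} (var 0 ∷ map shiftT τ)
env-closed c zero = s≤s z≤n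
env-closed {k} {τ = τ} c (suc i) = subst (ClosedT (suc k)) (sym (lookup-map i shiftT τ)) (shiftT-closed (lookup τ i) (c i))

F-closed : ∀ {k n} (d : D n) {τ} → closedTs {k} τ → Closed k (F d τ)
F-closed (t ≈ s) c = tm-closed t c , tm-closed s c
F-closed ⊥d c = tt
F-closed (d ⊃ e) c = F-closed d c , F-closed e c
F-closed (d ∧d e) c = (F-closed d c , F-closed e c , tt) , tt
F-closed (d ∨d e) c = (F-closed d c , tt) , F-closed e c
F-closed (∀≤ t d) {τ} c = (((((s≤s z≤n , s≤s (s≤s z≤n)) , shiftT-closed (shiftT (tm t τ)) (shiftT-closed (tm t τ) (tm-closed t {τ} c))) , tt) , tt) , F-closed d (env-closed c))
F-closed (∃≤ t d) {τ} c = ((((((s≤s z≤n , s≤s (s≤s z≤n)) , shiftT-closed (shiftT (tm t τ)) (shiftT-closed (tm t τ) (tm-closed t {τ} c))) , tt) , tt) , F-closed d (env-closed c) , tt)) , tt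
F-closed (call d ts) c = F-closed d (tms-closed ts c)

-- Peano arithmetic

≐refl : ∀ {Γ} t → Γ ⊩ t ≐ t
≐refl t = thm (axRef t)

leib : ∀ {Γ} φ {s t} → Γ ⊩ s ≐ t → Γ ⊩ φ [ s ] → Γ ⊩ φ [ t ]
leib φ {s} {t} e p = thm (axEq φ s t) · e · p

leib₁ : ∀ {Γ n} (d : D (suc n)) {s t} τ → Γ ⊩ s ≐ t → Γ ⊩ F d (s ∷ τ) → Γ ⊩ F d (t ∷ τ)
leib₁ {Γ} d {s} {t} τ e p = subst (Γ ⊩_) (F-inst d t τ) (leib _ e (subst (Γ ⊩_) (sym (F-inst d s τ)) p))

x0 : ∀ {n} → Tm (1 + n)
x0 = vr zero
x1 : ∀ {n} → Tm (2 + n)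
x1 = vr (suc zero)
x2 : ∀ {n} → Tm (3 + n)
x2 = vr (suc (suc zero))
x3 : ∀ {n} → Tm (4 + n)
x3 = vr (suc (suc (suc zero)))
x4 : ∀ {n} → Tm (5 + n)
x4 = vr (suc (suc (suc (suc zero))))
x5 : ∀ {n} → Tm (6 + n)
x5 = vr (suc (suc (suc (suc (suc zero)))))
x6 : ∀ {n} → Tm (7 + n)
x6 = vr (suc (suc (suc (suc (suc (suc zero))))))
x7 : ∀ {n} → Tm (8 + n)
x7 = vr (suc (suc (suc (suc (suc (suc (suc zero)))))))
x9 : ∀ {n} → Tm (10 + n)
x9 = vr (suc (suc (suc (suc (suc (suc (suc (suc (suc zero)))))))))
x10 : ∀ {n} → Tm (11 + n)
x10 = vr (suc (suc (suc (suc (suc (suc (suc (suc (suc (suc zero))))))))))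
x11 : ∀ {n} → Tm (12 + n)
x11 = vr (suc (suc (suc (suc (suc (suc (suc (suc (suc (suc (suc zero)))))))))))

≐sym : ∀ {Γ s t} → Γ ⊩ s ≐ t → Γ ⊩ t ≐ s
≐sym {s = s} e = leib₁ (x0 ≈ x1) (s ∷ []) e (≐refl s)

≐trans : ∀ {Γ s t u} → Γ ⊩ s ≐ t → Γ ⊩ t ≐ u → Γ ⊩ s ≐ u
≐trans {s = s} e f = leib₁ (x1 ≈ x0) (s ∷ []) f e

≐S : ∀ {Γ s t} → Γ ⊩ s ≐ t → Γ ⊩ suc' s ≐ suc' t
≐S {s = s} e = leib₁ (S x1 ≈ S x0) (s ∷ []) e (≐refl _)

≐⊕ : ∀ {Γ s t s' t'} → Γ ⊩ s ≐ t → Γ ⊩ s' ≐ t' → Γ ⊩ s ⊕ s' ≐ t ⊕ t'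
≐⊕ {s = s} {t} {s'} e f = leib₁ (x1 +ᵗ x2 ≈ vr (suc (suc (suc zero))) +ᵗ x0) (s ∷ s' ∷ t ∷ []) f
  (leib₁ (x1 +ᵗ x2 ≈ x0 +ᵗ x2) (s ∷ s' ∷ []) e (≐refl _))

≐⊗ : ∀ {Γ s t s' t'} → Γ ⊩ s ≐ t → Γ ⊩ s' ≐ t' → Γ ⊩ s ⊗ s' ≐ t ⊗ t'
≐⊗ {s = s} {t} {s'} e f = leib₁ (x1 *ᵗ x2 ≈ vr (suc (suc (suc zero))) *ᵗ x0) (s ∷ s' ∷ t ∷ []) f
  (leib₁ (x1 *ᵗ x2 ≈ x0 *ᵗ x2) (s ∷ s' ∷ []) e (≐refl _))

private
  σ₂ : Term → Term → ℕ → Term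
  σ₂ t s zero = t
  σ₂ t s (suc _) = s

PA1 : ∀ {Γ} t → Γ ⊩ ¬' (suc' t ≐ zer)
PA1 t = thm (PAax-subst (σ₂ t t) pa1)

PA2 : ∀ {Γ t s} → Γ ⊩ suc' t ≐ suc' s → Γ ⊩ t ≐ s
PA2 {t = t} {s} p = thm (PAax-subst (σ₂ t s) pa2) · p

PA3 : ∀ {Γ} t → Γ ⊩ t ⊕ zer ≐ t
PA3 t = thm (PAax-subst (σ₂ t t) pa3)

PA4 : ∀ {Γ} t s → Γ ⊩ t ⊕ suc' s ≐ suc' (t ⊕ s)
PA4 t s = thm (PAax-subst (σ₂ t s) pa4)

PA5 : ∀ {Γ} t → Γ ⊩ t ⊗ zer ≐ zer
PA5 t = thm (PAax-subst (σ₂ t t) pa5)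

PA6 : ∀ {Γ} t s → Γ ⊩ t ⊗ suc' s ≐ t ⊗ s ⊕ t
PA6 t s = thm (PAax-subst (σ₂ t s) pa6)

indR : ∀ {Γ} φ → Γ ⊩ φ [ zer ] → (∀ t → Γ ⊩ φ [ t ] ⇒ φ [ suc' t ]) → ∀ t → Γ ⊩ φ [ t ]
indR {Γ} φ z s t = ∀E t (thm (ax (ind φ)) · z · ∀I λ u → subst (Γ ⊩_) (cong (φ [ u ] ⇒_) (sym (e u))) (s u))
  where
  e : ∀ u → (substF stepS φ) [ u ] ≡ φ [ suc' u ]
  e u = trans (substF-subst (inst u) stepS φ) (substF-ext (λ { zero → refl ; (suc n) → refl }) φ)

indD : ∀ {Γ n} (d : D (suc n)) τ → Γ ⊩ F d (zer ∷ τ) → (∀ t → Γ ⊩ F d (t ∷ τ) ⇒ F d (suc' t ∷ τ)) → ∀ t → Γ ⊩ F d (t ∷ τ)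
indD {Γ} d τ z s t = subst (Γ ⊩_) (F-inst d t τ) (indR (F d (var 0 ∷ map shiftT τ))
  (subst (Γ ⊩_) (sym (F-inst d zer τ)) z)
  (λ u → subst (Γ ⊩_) (sym (cong₂ _⇒_ (F-inst d u τ) (F-inst d (suc' u) τ))) (s u)) t)

0⊕ : ∀ {Γ} t → Γ ⊩ zer ⊕ t ≐ t
0⊕ = indD (# 0 +ᵗ x0 ≈ x0) [] (PA3 _) λ t → ƛ (≐trans (PA4 _ _) (≐S h0))

S⊕ : ∀ {Γ} s t → Γ ⊩ suc' s ⊕ t ≐ suc' (s ⊕ t)
S⊕ s = indD (S x1 +ᵗ x0 ≈ S (x1 +ᵗ x0)) (s ∷ [])
  (≐trans (PA3 _) (≐S (≐sym (PA3 _)))) λ t → ƛ (≐trans (PA4 _ _) (≐S (≐trans h0 (≐sym (PA4 _ _)))))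

leI : ∀ {Γ t s} u → Γ ⊩ u ⊕ t ≐ s → Γ ⊩ t ≤' s
leI {Γ} {t} {s} u p = ∃I _ u (subst (Γ ⊩_) (sym (cong₂ _≐_ (cong (u ⊕_) (inst-shiftT t u)) (inst-shiftT s u))) p)

leE : ∀ {Γ t s χ} → Γ ⊩ t ≤' s → (∀ u → (u ⊕ t ≐ s) ∷ Γ ⊩ χ) → Γ ⊩ χ
leE {Γ} {t} {s} {χ} p h = ∃E p λ u → subst (λ φ → φ ∷ Γ ⊩ χ) (sym (cong₂ _≐_ (cong (u ⊕_) (inst-shiftT t u)) (inst-shiftT s u))) (h u)

le-refl : ∀ {Γ} t → Γ ⊩ t ≤' t
le-refl t = leI zer (0⊕ t)

le-zero : ∀ {Γ} t → Γ ⊩ zer ≤' t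
le-zero t = leI t (PA3 t)

le-resp : ∀ {Γ t t' s s'} → Γ ⊩ t ≐ t' → Γ ⊩ s ≐ s' → Γ ⊩ t ≤' s → Γ ⊩ t' ≤' s'
le-resp e f p = leE p λ u → leI u (≐trans (≐⊕ (≐refl u) (wk (≐sym e))) (≐trans h0 (wk f)))

le-S : ∀ {Γ t s} → Γ ⊩ t ≤' s → Γ ⊩ t ≤' suc' s
le-S p = leE p λ u → leI (suc' u) (≐trans (S⊕ _ _) (≐S h0))

S-le-S : ∀ {Γ t s} → Γ ⊩ t ≤' s → Γ ⊩ suc' t ≤' suc' s
S-le-S p = leE p λ u → leI u (≐trans (PA4 _ _) (≐S h0))

caseN : ∀ {Γ χ} t → (t ≐ zer) ∷ Γ ⊩ χ → (∀ w → (t ≐ suc' w) ∷ Γ ⊩ χ) → Γ ⊩ χ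
caseN {Γ} {χ} t p q = ∨E (indD ((x0 ≈ # 0) ∨d ∃≤ x0 (x1 ≈ S x0)) [] (∨₁ (≐refl _))
    (λ t → ƛ (∨₂ (∃≤I {b = x0} {d = x1 ≈ S x0} {suc' t ∷ []} t (le-S (le-refl t)) (≐refl _)))) t)
  p (∃≤E {b = x0} {d = x1 ≈ S x0} {t ∷ []} h0 λ w → wk (wk (wk (ƛ (q w)))) · h0)

le-total : ∀ {Γ χ} t s → (t ≤' s) ∷ Γ ⊩ χ → (s ≤' t) ∷ Γ ⊩ χ → Γ ⊩ χ
le-total {Γ} {χ} t s p q = ∨E (subst (Γ ⊩_) (e t) (indR φ (subst (Γ ⊩_) (sym (e zer)) (∨₁ (le-zero s))) step t)) p q
  where
  φ : Formula
  φ = (var 0 ≤' shiftT s) ∨' (shiftT s ≤' var 0)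
  e : ∀ u → φ [ u ] ≡ (u ≤' s) ∨' (s ≤' u)
  e u = cong₂ _∨'_ (le-inst u s) (trans (le-subst (inst u) (shiftT s) (var 0)) (cong (_≤' u) (inst-shiftT s u)))
  step : ∀ u → Γ ⊩ φ [ u ] ⇒ φ [ suc' u ]
  step u = subst (Γ ⊩_) (sym (cong₂ _⇒_ (e u) (e (suc' u)))) (ƛ (∨E h0
    (leE h0 λ w → caseN w
      (∨₂ (le-resp (≐trans (≐sym (0⊕ u)) (≐trans (≐⊕ (≐sym h0) (≐refl u)) h1)) (≐refl _) (le-S (le-refl u))))
      (λ w' → ∨₁ (leI w' (≐trans (PA4 _ _) (≐trans (≐sym (S⊕ _ _)) (≐trans (≐⊕ (≐sym h0) (≐refl u)) h1))))))
    (∨₂ (le-S h0))))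

num+ : ∀ {Γ} m n → Γ ⊩ numeral m ⊕ numeral n ≐ numeral (m + n)
num+ m zero rewrite +-identityʳ m = PA3 _
num+ m (suc n) rewrite +-suc m n = ≐trans (PA4 _ _) (≐S (num+ m n))

num* : ∀ {Γ} m n → Γ ⊩ numeral m ⊗ numeral n ≐ numeral (m * n)
num* m zero rewrite *-zeroʳ m = PA5 _
num* {Γ} m (suc n) rewrite *-suc m n | +-comm m (m * n) = ≐trans (PA6 _ _) (≐trans (≐⊕ (num* m n) (≐refl _)) (num+ (m * n) m))

num≢ : ∀ {Γ} m n → m ≢ n → Γ ⊩ ¬' (numeral m ≐ numeral n)
num≢ zero zero q = ⊥-elim (q refl)
num≢ zero (suc n) q = ƛ (PA1 _ · ≐sym h0)
num≢ (suc m) zero q = PA1 _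
num≢ (suc m) (suc n) q = ƛ (wk (num≢ m n (q ∘ cong suc)) · PA2 h0)

num≤ : ∀ {Γ m n} → m ≤ n → Γ ⊩ numeral m ≤' numeral n
num≤ {n = n} z≤n = le-zero _
num≤ (s≤s p) = S-le-S (num≤ p)

le-cases : ∀ {Γ χ} n t → Γ ⊩ t ≤' numeral n → (∀ k → k ≤ n → (t ≐ numeral k) ∷ Γ ⊩ χ) → Γ ⊩ χ
le-cases zero t p h = caseN t (h 0 z≤n) λ w → leE (wk p) λ u → efq (PA1 _ · ≐trans (≐sym (PA4 _ _)) (≐trans (≐⊕ (≐refl u) (≐sym h1)) h0))
le-cases (suc n) t p h = caseN t (h 0 z≤n) λ w →
  le-cases n w (leE (wk p) λ u → leI u (PA2 (≐trans (≐sym (PA4 _ _)) (≐trans (≐⊕ (≐refl u) (≐sym h1)) h0))))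
    λ k k≤ → wk (wk (ƛ (h (suc k) (s≤s k≤)))) · ≐trans h1 (≐S h0)

-- The substitute for speaking of nonstandard elements: below `N` the term is a numeral and bounded
-- facts about it are decided outside PA; otherwise it exceeds any bound that the argument needs.
split : ∀ {Γ χ} N t → (∀ k → k < N → (t ≐ numeral k) ∷ Γ ⊩ χ) → (numeral N ≤' t) ∷ Γ ⊩ χ → Γ ⊩ χ
split zero t h p = ƛ p · le-zero t
split (suc N) t h p = caseN t (h 0 (s≤s z≤n)) λ w → split N w
  (λ k k< → wk (wk (ƛ (h (suc k) (s≤s k<)))) · ≐trans h1 (≐S h0))
  (wk (wk (ƛ p)) · le-resp (≐refl _) (≐sym h1) (S-le-S h0))

infixr 5 _∷_
data PW (Γ : Ctx) : ∀ {n} → Vec Term n → Vec Term n → Set where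
  []  : PW Γ [] []
  _∷_ : ∀ {n s t} {σ τ : Vec Term n} → Γ ⊩ s ≐ t → PW Γ σ τ → PW Γ (s ∷ σ) (t ∷ τ)

PWsym : ∀ {n Γ} {σ τ : Vec Term n} → PW Γ σ τ → PW Γ τ σ
PWsym [] = []
PWsym (p ∷ e) = ≐sym p ∷ PWsym e

PWwk : ∀ {n Γ φ} {σ τ : Vec Term n} → PW Γ σ τ → PW (φ ∷ Γ) σ τ
PWwk [] = []
PWwk (p ∷ e) = wk p ∷ PWwk e

PWrefl : ∀ {n Γ} {τ : Vec Term n} → PW Γ τ τ
PWrefl {τ = []} = []
PWrefl {τ = t ∷ τ} = ≐refl t ∷ PWrefl

PWlookup : ∀ {n Γ} {σ τ : Vec Term n} i → PW Γ σ τ → Γ ⊩ lookup σ i ≐ lookup τ i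
PWlookup zero (p ∷ e) = p
PWlookup (suc i) (p ∷ e) = PWlookup i e

tm-cong : ∀ {n Γ} (t : Tm n) {σ τ} → PW Γ σ τ → Γ ⊩ tm t σ ≐ tm t τ
tm-cong (vr i) e = PWlookup i e
tm-cong (# k) e = ≐refl _
tm-cong (S t) e = ≐S (tm-cong t e)
tm-cong (t +ᵗ s) e = ≐⊕ (tm-cong t e) (tm-cong s e)
tm-cong (t *ᵗ s) e = ≐⊗ (tm-cong t e) (tm-cong s e)

tms-cong : ∀ {n m Γ} (ts : Vec (Tm n) m) {σ τ} → PW Γ σ τ → PW Γ (tms ts σ) (tms ts τ)
tms-cong [] e = []
tms-cong (t ∷ ts) e = tm-cong t e ∷ tms-cong ts e

F-cong : ∀ {n Γ} (d : D n) {σ τ} → PW Γ σ τ → Γ ⊩ F d σ → Γ ⊩ F d τ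
F-cong (t ≈ s) e p = ≐trans (≐sym (tm-cong t e)) (≐trans p (tm-cong s e))
F-cong ⊥d e p = p
F-cong (d ⊃ d') e p = ƛ (F-cong d' (PWwk e) (wk p · F-cong d (PWsym (PWwk e)) h0))
F-cong (d ∧d d') e p = ∧I (F-cong d e (∧₁ p)) (F-cong d' e (∧₂ p))
F-cong (d ∨d d') e p = ∨E p (∨₁ (F-cong d (PWwk e) h0)) (∨₂ (F-cong d' (PWwk e) h0))
F-cong (∀≤ b d) {σ} {τ} e p = ∀≤I {b = b} {d} {τ} λ t → F-cong d (≐refl t ∷ PWwk e)
  (∀≤E {b = b} {d} {σ} (wk p) t (le-resp (≐refl t) (wk (≐sym (tm-cong b e))) h0))
F-cong (∃≤ b d) {σ} {τ} e p = ∃≤E {b = b} {d} {σ} p λ t → ∃≤I {b = b} {d} {τ} t (le-resp (≐refl t) (wk (wk (tm-cong b e))) h1)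
  (F-cong d (≐refl t ∷ PWwk (PWwk e)) h0)
F-cong (call d ts) e p = F-cong d (tms-cong ts e) p

nums : ∀ {n} → Vec ℕ n → Vec Term n
nums [] = []
nums (x ∷ ρ) = numeral x ∷ nums ρ

tm-num : ∀ {n Γ} (t : Tm n) ρ → Γ ⊩ tm t (nums ρ) ≐ numeral (evT t ρ)
tm-num (vr zero) (x ∷ ρ) = ≐refl _
tm-num (vr (suc i)) (x ∷ ρ) = tm-num (vr i) ρ
tm-num (# k) ρ = ≐refl _
tm-num (S t) ρ = ≐S (tm-num t ρ)
tm-num (t +ᵗ s) ρ = ≐trans (≐⊕ (tm-num t ρ) (tm-num s ρ)) (num+ (evT t ρ) (evT s ρ))
tm-num (t *ᵗ s) ρ = ≐trans (≐⊗ (tm-num t ρ) (tm-num s ρ)) (num* (evT t ρ) (evT s ρ))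

tms-num : ∀ {n m Γ} (ts : Vec (Tm n) m) ρ → PW Γ (tms ts (nums ρ)) (nums (evTs ts ρ))
tms-num [] ρ = []
tms-num (t ∷ ts) ρ = tm-num t ρ ∷ tms-num ts ρ

mutual
  -- Δ₀-completeness. Truth and falsity are handled together because implication exchanges them;
  -- `decD` takes the place of excluded middle.
  true⇒ : ∀ {n Γ} (d : D n) ρ → ⟪ d ⟫ ρ → Γ ⊩ F d (nums ρ)
  true⇒ (t ≈ s) ρ p = ≐trans (tm-num t ρ) (≐sym (subst (λ k → _ ⊩ tm s (nums ρ) ≐ numeral k) (sym p) (tm-num s ρ)))
  true⇒ (d ⊃ e) ρ p with decD d ρ
  ... | yes q = ƛ (true⇒ e ρ (p q))
  ... | no q = ƛ (efq (false⇒ d ρ q · h0))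
  true⇒ (d ∧d e) ρ (p , q) = ∧I (true⇒ d ρ p) (true⇒ e ρ q)
  true⇒ (d ∨d e) ρ (inj₁ p) = ∨₁ (true⇒ d ρ p)
  true⇒ (d ∨d e) ρ (inj₂ p) = ∨₂ (true⇒ e ρ p)
  true⇒ (∀≤ b d) ρ p = ∀≤I {b = b} {d} {nums ρ} λ t →
    le-cases (evT b ρ) t (le-resp (≐refl t) (tm-num b ρ) h0) λ k k≤ →
      F-cong d (≐sym h0 ∷ PWrefl) (true⇒ d (k ∷ ρ) (p k k≤))
  true⇒ (∃≤ b d) ρ (k , k≤ , p) = ∃≤I {b = b} {d} {nums ρ} (numeral k)
    (le-resp (≐refl _) (≐sym (tm-num b ρ)) (num≤ k≤)) (true⇒ d (k ∷ ρ) p)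
  true⇒ (call d ts) ρ p = F-cong d (PWsym (tms-num ts ρ)) (true⇒ d (evTs ts ρ) p)

  false⇒ : ∀ {n Γ} (d : D n) ρ → ¬ ⟪ d ⟫ ρ → Γ ⊩ ¬' (F d (nums ρ))
  false⇒ (t ≈ s) ρ p = ƛ (num≢ _ _ p · ≐trans (≐sym (tm-num t ρ)) (≐trans h0 (tm-num s ρ)))
  false⇒ ⊥d ρ p = ƛ h0
  false⇒ (d ⊃ e) ρ p with decD d ρ
  ... | yes q = ƛ (false⇒ e ρ (λ r → p (λ _ → r)) · (h0 · true⇒ d ρ q))
  ... | no q = ⊥-elim (p λ r → ⊥-elim (q r))
  false⇒ (d ∧d e) ρ p with decD d ρ
  ... | yes q = ƛ (false⇒ e ρ (λ r → p (q , r)) · ∧₂ h0)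
  ... | no q = ƛ (false⇒ d ρ q · ∧₁ h0)
  false⇒ (d ∨d e) ρ p = ƛ (∨E h0 (false⇒ d ρ (p ∘ inj₁) · h0) (false⇒ e ρ (p ∘ inj₂) · h0))
  false⇒ (∀≤ b d) ρ p with any≤? (evT b ρ) (λ k → decNot k)
    where
    decNot : ∀ k → Dec (¬ ⟪ d ⟫ (k ∷ ρ))
    decNot k with decD d (k ∷ ρ)
    ... | yes q = no λ f → f q
    ... | no q = yes q
  ... | yes (k , k≤ , q) = ƛ (false⇒ d (k ∷ ρ) q ·
        ∀≤E {b = b} {d} {nums ρ} h0 (numeral k) (le-resp (≐refl _) (≐sym (tm-num b ρ)) (num≤ k≤)))
  ... | no q = ⊥-elim (p λ k k≤ → stable k k≤)
    where
    stable : ∀ k → k ≤ evT b ρ → ⟪ d ⟫ (k ∷ ρ)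
    stable k k≤ with decD d (k ∷ ρ)
    ... | yes r = r
    ... | no r = ⊥-elim (q (k , k≤ , r))
  false⇒ (∃≤ b d) ρ p = ƛ (∃≤E {b = b} {d} {nums ρ} h0 λ t →
    le-cases (evT b ρ) t (le-resp (≐refl t) (tm-num b ρ) h1) λ k k≤ →
      false⇒ d (k ∷ ρ) (λ r → p (k , k≤ , r)) · F-cong d (h0 ∷ PWrefl) h1)
  false⇒ (call d ts) ρ p = ƛ (false⇒ d (evTs ts ρ) p · F-cong d (tms-num ts ρ) h0)

-- The standard model with falsity read as an arbitrary set A (Friedman's translation):
-- it turns provability of a Σ₁ sentence into an actual witness.

module Translation (A : Set) where

  valT : (ℕ → ℕ) → Term → ℕ
  valT ρ (var n) = ρ n
  valT ρ zer = 0
  valT ρ (suc' t) = suc (valT ρ t)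
  valT ρ (t ⊕ s) = valT ρ t + valT ρ s
  valT ρ (t ⊗ s) = valT ρ t * valT ρ s

  _◂_ : ℕ → (ℕ → ℕ) → ℕ → ℕ
  (x ◂ ρ) zero = x
  (x ◂ ρ) (suc n) = ρ n

  -- The atomic clause is already closed under double negation relative to `A`. This makes every
  -- formula `stable` and so validates `axDN` constructively.
  Sat : (ℕ → ℕ) → Formula → Set
  Sat ρ ⊥' = A
  Sat ρ (t ≐ s) = (valT ρ t ≡ valT ρ s → A) → A
  Sat ρ (φ ⇒ ψ) = Sat ρ φ → Sat ρ ψ
  Sat ρ (∀' φ) = ∀ x → Sat (x ◂ ρ) φ

  stable : ∀ ρ φ → ((Sat ρ φ → A) → A) → Sat ρ φ
  stable ρ ⊥' p = p (λ a → a)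
  stable ρ (t ≐ s) p = λ k → p λ q → q k
  stable ρ (φ ⇒ ψ) p = λ x → stable ρ ψ λ k → p λ f → k (f x)
  stable ρ (∀' φ) p = λ x → stable _ φ λ k → p λ f → k (f x)

  val-subst : ∀ ρ σ t → valT ρ (substT σ t) ≡ valT (valT ρ ∘ σ) t
  val-subst ρ σ (var n) = refl
  val-subst ρ σ zer = refl
  val-subst ρ σ (suc' t) = cong suc (val-subst ρ σ t)
  val-subst ρ σ (t ⊕ s) = cong₂ _+_ (val-subst ρ σ t) (val-subst ρ σ s)
  val-subst ρ σ (t ⊗ s) = cong₂ _*_ (val-subst ρ σ t) (val-subst ρ σ s)

  val-ren : ∀ ρ f t → valT ρ (renT f t) ≡ valT (ρ ∘ f) t
  val-ren ρ f t = trans (cong (valT ρ) (renT-substT f t)) (val-subst ρ (var ∘ f) t)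

  mutual
    to : ∀ {ρ ρ' σ} φ → (∀ n → valT ρ (σ n) ≡ ρ' n) → Sat ρ (substF σ φ) → Sat ρ' φ
    to ⊥' e p = p
    to {ρ} {ρ'} {σ} (t ≐ s) e p = λ k → p λ q → k (trans (sym (val t)) (trans q (val s)))
      where
      val : ∀ t → valT ρ (substT σ t) ≡ valT ρ' t
      val t = val-ext e t
    to (φ ⇒ ψ) e p = λ x → to ψ e (p (from φ e x))
    to (∀' φ) e p = λ x → to φ (lifted x e) (p x)

    from : ∀ {ρ ρ' σ} φ → (∀ n → valT ρ (σ n) ≡ ρ' n) → Sat ρ' φ → Sat ρ (substF σ φ)
    from ⊥' e p = p
    from (t ≐ s) e p = λ k → p λ q → k (trans (val-ext e t) (trans q (sym (val-ext e s))))
    from (φ ⇒ ψ) e p = λ x → from ψ e (p (to φ e x))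
    from (∀' φ) e p = λ x → from φ (lifted x e) (p x)

    val-ext : ∀ {ρ ρ' σ} → (∀ n → valT ρ (σ n) ≡ ρ' n) → ∀ t → valT ρ (substT σ t) ≡ valT ρ' t
    val-ext e (var n) = e n
    val-ext e zer = refl
    val-ext e (suc' t) = cong suc (val-ext e t)
    val-ext e (t ⊕ s) = cong₂ _+_ (val-ext e t) (val-ext e s)
    val-ext e (t ⊗ s) = cong₂ _*_ (val-ext e t) (val-ext e s)

    lifted : ∀ {ρ ρ' σ} x → (∀ n → valT ρ (σ n) ≡ ρ' n) → ∀ n → valT (x ◂ ρ) (liftS σ n) ≡ (x ◂ ρ') n
    lifted x e zero = refl
    lifted {ρ} {σ = σ} x e (suc n) = trans (val-ren (x ◂ ρ) suc (σ n)) (e n)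

  inst-env : ∀ ρ t n → valT ρ (inst t n) ≡ (valT ρ t ◂ ρ) n
  inst-env ρ t zero = refl
  inst-env ρ t (suc n) = refl

  sound : ∀ {φ} → PA ⊢ φ → ∀ ρ → Sat ρ φ
  sound (ax pa1) ρ = λ p → p λ ()
  sound (ax pa2) ρ = λ p k → p λ q → k (suc-injective q)
  sound (ax pa3) ρ = λ k → k (+-identityʳ _)
  sound (ax pa4) ρ = λ k → k (+-suc (ρ 0) (ρ 1))
  sound (ax pa5) ρ = λ k → k (*-zeroʳ (ρ 0))
  sound (ax pa6) ρ = λ k → k (trans (*-suc (ρ 0) (ρ 1)) (+-comm (ρ 0) _))
  sound (ax (ind φ)) ρ = λ z s → go z s
    where
    go : Sat ρ (φ [ zer ]) → (∀ x → Sat (x ◂ ρ) φ → Sat (x ◂ ρ) (substF stepS φ)) → ∀ x → Sat (x ◂ ρ) φ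
    go z s zero = to φ (inst-env ρ zer) z
    go z s (suc x) = to φ (λ { zero → refl ; (suc n) → refl }) (s x (go z s x))
  sound axK ρ = λ x _ → x
  sound axS ρ = λ f g x → f x (g x)
  sound (axDN {φ}) ρ = stable ρ φ
  sound (axIn {φ} t) ρ = λ f → from φ (inst-env ρ t) (f (valT ρ t))
  sound axDi ρ = λ f g x → f x (g x)
  sound (axVac {φ}) ρ = λ p x → from φ (λ n → refl) p
  sound (axRef t) ρ = λ k → k refl
  sound (axEq φ t s) ρ = λ p q → stable ρ (φ [ s ]) λ k → p λ e →
    k (from φ (inst-env ρ s) (subst (λ z → Sat (z ◂ ρ) φ) e (to φ (inst-env ρ t) q)))
  sound (mp p q) ρ = sound p ρ (sound q ρ)
  sound (gen p) ρ = λ x → sound p (x ◂ ρ)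

  val-numeral : ∀ ρ n → valT ρ (numeral n) ≡ n
  val-numeral ρ zero = refl
  val-numeral ρ (suc n) = cong suc (val-numeral ρ n)

  -- With `A` chosen as the information sought, each numeral instance either supplies it or is
  -- refutable in PA. The translated existential statement then yields `A` itself, and `Sat` of the
  -- matrix never has to be analysed.
  witness : ∀ φ → PA ⊢ ∃' φ → (∀ n → A ⊎ (PA ⊢ ¬' (φ [ numeral n ]))) → A
  witness φ p h = sound p (λ _ → 0) λ n q → f n q (h n)
    where
    f : ∀ n → Sat (n ◂ (λ _ → 0)) φ → A ⊎ (PA ⊢ ¬' (φ [ numeral n ])) → A
    f n q (inj₁ a) = a
    f n q (inj₂ r) = sound r (λ _ → 0) (from φ (λ k → trans (inst-env (λ _ → 0) (numeral n) k)
      (cong (λ z → (z ◂ (λ _ → 0)) k) (val-numeral (λ _ → 0) n))) q)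

close2 : Formula → ℕ → ℕ → Formula
close2 φ x e = (φ [ numeral x ]) [ numeral e ]

close3 : Formula → ℕ → ℕ → ℕ → Formula
close3 φ x y e = ((φ [ numeral x ]) [ numeral y ]) [ numeral e ]

-- Unlike the Cantor pairing this is a polynomial, hence a term of arithmetic; it is injective since
-- b ≤ a + b keeps the value below the next square.
pairing : ℕ → ℕ → ℕ
pairing a b = (a + b) * (a + b) + b

-- What the construction needs from the arithmetization of T and from the coding of finite sets.
-- A certificate u witnesses: cert, that T proves the implication between the formulas coded by x and w;
-- pcert, scert and ncert, that w codes P̂, Ŝ and ¬ Ŝ at the given numerals, where e = pair ⌜ P̂ ⌝ ⌜ Ŝ ⌝.
-- mem z k x: x lies in the k-th component of the family of sets coded by z; Cap m Y: all families
-- of sets up to m have codes up to Y.  The tables of c describe a finite neighbourhood model: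
-- nbh a v: v is a neighbourhood of the world a; elt v j: the world j lies in v; val a q: the variable q is true at a.
record Kit (T : Theory) : Set where
  field
    cert : D 3
    cert-sound : ∀ {u x w} → ⟪ cert ⟫ (u ∷ x ∷ w ∷ []) → Σ Formula λ φ → Σ Formula λ ψ → x ≡ ⌜ φ ⌝ × w ≡ ⌜ ψ ⌝ × (T ⊢ φ ⇒ ψ)
    cert-complete : ∀ {φ ψ} → T ⊢ φ ⇒ ψ → Σ ℕ λ u → ⟪ cert ⟫ (u ∷ ⌜ φ ⌝ ∷ ⌜ ψ ⌝ ∷ [])
    pcert : D 4
    pcert-sound : ∀ φ ψ {u x w} → ⟪ pcert ⟫ (u ∷ pair ⌜ φ ⌝ ⌜ ψ ⌝ ∷ x ∷ w ∷ []) → w ≡ ⌜ close2 φ x (pair ⌜ φ ⌝ ⌜ ψ ⌝) ⌝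
    pcert-complete : ∀ φ ψ x → Σ ℕ λ u → ⟪ pcert ⟫ (u ∷ pair ⌜ φ ⌝ ⌜ ψ ⌝ ∷ x ∷ ⌜ close2 φ x (pair ⌜ φ ⌝ ⌜ ψ ⌝) ⌝ ∷ [])
    scert : D 5
    scert-sound : ∀ φ ψ {u c l w} → ⟪ scert ⟫ (u ∷ pair ⌜ φ ⌝ ⌜ ψ ⌝ ∷ c ∷ l ∷ w ∷ []) → w ≡ ⌜ close3 ψ c l (pair ⌜ φ ⌝ ⌜ ψ ⌝) ⌝
    scert-complete : ∀ φ ψ c l → Σ ℕ λ u → ⟪ scert ⟫ (u ∷ pair ⌜ φ ⌝ ⌜ ψ ⌝ ∷ c ∷ l ∷ ⌜ close3 ψ c l (pair ⌜ φ ⌝ ⌜ ψ ⌝) ⌝ ∷ [])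
    ncert : D 5
    ncert-sound : ∀ φ ψ {u c l w} → ⟪ ncert ⟫ (u ∷ pair ⌜ φ ⌝ ⌜ ψ ⌝ ∷ c ∷ l ∷ w ∷ []) → w ≡ ⌜ ¬' (close3 ψ c l (pair ⌜ φ ⌝ ⌜ ψ ⌝)) ⌝
    ncert-complete : ∀ φ ψ c l → Σ ℕ λ u → ⟪ ncert ⟫ (u ∷ pair ⌜ φ ⌝ ⌜ ψ ⌝ ∷ c ∷ l ∷ ⌜ ¬' (close3 ψ c l (pair ⌜ φ ⌝ ⌜ ψ ⌝)) ⌝ ∷ [])
    mem : D 3
    Cap : D 2
    cap-exists : ∀ m → Σ ℕ λ Y → ⟪ Cap ⟫ (m ∷ Y ∷ [])
    cap-codes : ∀ {m Y} → ⟪ Cap ⟫ (m ∷ Y ∷ []) → (f : ℕ → ℕ → Bool) →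
      Σ ℕ λ z → z ≤ Y × (∀ k x → k ≤ m → x ≤ m → ⟪ mem ⟫ (z ∷ k ∷ x ∷ []) ⇔ (f k x ≡ true))
    nbh elt val : D 3
    -- tables are extended constantly beyond their size N
    tables : ∀ N (f g h : ℕ → ℕ → Bool) → Σ ℕ λ c → N ≤ c × (∀ a b →
      (⟪ nbh ⟫ (c ∷ a ∷ b ∷ []) ⇔ (f (a ⊓ N) (b ⊓ N) ≡ true)) ×
      (⟪ elt ⟫ (c ∷ a ∷ b ∷ []) ⇔ (g (a ⊓ N) (b ⊓ N) ≡ true)) ×
      (⟪ val ⟫ (c ∷ a ∷ b ∷ []) ⇔ (h (a ⊓ N) (b ⊓ N) ≡ true)))

-- The bounded formulas of the construction

module Formulas (L : Logic) {T : Theory} (K : Kit T) where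
  open Kit K

  -- The arguments of each formula, in order, are listed after its name: m is a stage, Y the bound on codes
  -- of families given by Cap, e the code of P̂ and Ŝ, c a model, k and l worlds of it, z a family of sets of codes.
  -- The formulas refer to their own codes through the parameter e, so that no diagonal lemma is needed.
  -- They are opaque, as unfolding their Gödel numbers is infeasible.
  -- The number 3 is ⌜ ⊥' ⇒ ⊥' ⌝, and ∃≤ t (x0 ≈ s) says that s ≤ t.

  opaque
    imp : D 3                 -- m x w
    imp = ∃≤ x0 (call cert (x0 ∷ x2 ∷ x3 ∷ []))

  opaque
    prc : D 4                 -- m e x w
    -- The first conjunct says x + 1 ≤ m. So `Pr x` becomes visible only after x, and a box rule
    -- newly applied at stage m + 1 concerns an x that stage m already knows.
    prc = ∃≤ x0 (x0 ≈ S x3) ∧d ∃≤ x0 (call pcert (x0 ∷ x2 ∷ x3 ∷ x4 ∷ []))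

  opaque
    sc : D 5                  -- m e c k w
    sc = ∃≤ x0 (call scert (x0 ∷ x2 ∷ x3 ∷ x4 ∷ x5 ∷ []))

  opaque
    nc : D 5                  -- m e c k w
    -- The first conjunct says c + 1 ≤ m. At stage c coherence for the model c is therefore vacuous,
    -- which starts the induction on stages.
    nc = ∃≤ x0 (x0 ≈ S x3) ∧d ∃≤ x0 (call ncert (x0 ∷ x2 ∷ x3 ∷ x4 ∷ x5 ∷ []))

  opaque
    box : D 4                 -- z c k x
    box = ∃≤ x1 (call nbh (x2 ∷ x3 ∷ x0 ∷ []) ∧d
      ∀≤ x2 (call elt (x3 ∷ x1 ∷ x0 ∷ []) ⊃ call mem (x2 ∷ x0 ∷ x5 ∷ [])))

  opaque
    trans4 : Logic → D 1      -- c
    trans4 MN = # 0 ≈ # 0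
    -- The condition for `□A ⇒ □□A` in monotone neighbourhood semantics: if v is a neighbourhood of
    -- a, then some neighbourhood of a consists of worlds that have a neighbourhood inside v.
    trans4 MNF = ∀≤ x0 (∀≤ x1 (call nbh (x2 ∷ x1 ∷ x0 ∷ []) ⊃
      ∃≤ x2 (call nbh (x3 ∷ x2 ∷ x0 ∷ []) ∧d
        ∀≤ x3 (call elt (x4 ∷ x1 ∷ x0 ∷ []) ⊃
          ∃≤ x4 (call nbh (x5 ∷ x1 ∷ x0 ∷ []) ∧d
            ∀≤ x5 (call elt (x6 ∷ x1 ∷ x0 ∷ []) ⊃ call elt (x6 ∷ x4 ∷ x0 ∷ [])))))))

  opaque
    frame : D 1               -- c
    -- The first conjunct is the counterpart of necessitation: what belongs to the sets of all
    -- worlds is boxed at every world only because each world has some neighbourhood.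
    frame = ∀≤ x0 (∃≤ x1 (call nbh (x2 ∷ x1 ∷ x0 ∷ []))) ∧d trans4 L

  opaque
    seeded : D 5              -- m e c k z
    seeded = ∀≤ x0 ((x0 ≈ # 3) ∨d call sc (x1 ∷ x2 ∷ x3 ∷ x4 ∷ x0 ∷ []) ⊃ call mem (x5 ∷ x4 ∷ x0 ∷ []))

  opaque
    impClosed : D 3           -- m k z
    impClosed = ∀≤ x0 (∀≤ x1 (call imp (x2 ∷ x1 ∷ x0 ∷ []) ⊃ call mem (x4 ∷ x3 ∷ x1 ∷ []) ⊃ call mem (x4 ∷ x3 ∷ x0 ∷ [])))

  opaque
    boxClosed : D 5           -- m e c k z
    boxClosed = ∀≤ x0 (∀≤ x1 (call prc (x2 ∷ x3 ∷ x1 ∷ x0 ∷ []) ⊃ call box (x6 ∷ x4 ∷ x5 ∷ x1 ∷ []) ⊃ call mem (x6 ∷ x5 ∷ x0 ∷ [])))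

  opaque
    coherent : D 5            -- m e c k z
    coherent = ∀≤ x0 (call nc (x1 ∷ x2 ∷ x3 ∷ x4 ∷ x0 ∷ []) ⊃ ¬d (call mem (x5 ∷ x4 ∷ x0 ∷ [])))

  opaque
    good : D 4                -- m e c z
    good = ∀≤ x2 (call seeded (x1 ∷ x2 ∷ x3 ∷ x0 ∷ x4 ∷ []) ∧d call impClosed (x1 ∷ x0 ∷ x4 ∷ []) ∧d
      call boxClosed (x1 ∷ x2 ∷ x3 ∷ x0 ∷ x4 ∷ []) ∧d call coherent (x1 ∷ x2 ∷ x3 ∷ x0 ∷ x4 ∷ []))

  opaque
    necClosed : D 3           -- m e z
    necClosed = ∀≤ x0 (∀≤ x1 (call prc (x2 ∷ x3 ∷ x1 ∷ x0 ∷ []) ⊃ call mem (x4 ∷ # 0 ∷ x1 ∷ []) ⊃ call mem (x4 ∷ # 0 ∷ x0 ∷ [])))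

  opaque
    base : D 3                -- m e z
    base = ∀≤ x0 (x0 ≈ # 3 ⊃ call mem (x3 ∷ # 0 ∷ x0 ∷ [])) ∧d call impClosed (x0 ∷ # 0 ∷ x2 ∷ []) ∧d call necClosed (x0 ∷ x1 ∷ x2 ∷ [])

  opaque
    cl : D 4                  -- m Y e x
    -- The closure of `⊥' ⇒ ⊥'` under implications and necessitation, as the intersection of all
    -- closed sets. Component 0 of a family serves as a single set, and the bound Y keeps the
    -- quantifier over sets bounded.
    cl = ∀≤ x1 (call base (x1 ∷ x3 ∷ x0 ∷ []) ⊃ call mem (x0 ∷ # 0 ∷ x4 ∷ []))

  opaque
    capL : D 2                -- m Y
    -- Sets up to m + 1 are needed because `conflict` works with the implications of stage m + 1.
    -- Taking the least Y makes it a function of m, which PA can evaluate at standard m.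
    capL = call Cap (S x0 ∷ x1 ∷ []) ∧d ∀≤ x1 (¬d (x0 ≈ x2) ⊃ ¬d (call Cap (S x1 ∷ x0 ∷ [])))

  opaque
    safe : D 3                -- m Y e
    -- The good family must moreover contain, at every world, whatever is derived at the stage. At a
    -- nonstandard stage this is what keeps a derivation of x from clashing with a world where x
    -- fails.
    safe = ∀≤ x0 (call frame (x0 ∷ []) ⊃ ∃≤ x2 (call good (x2 ∷ x4 ∷ x1 ∷ x0 ∷ []) ∧d
      ∀≤ x2 (call cl (x3 ∷ x4 ∷ x5 ∷ x0 ∷ []) ⊃ ∀≤ x2 (call mem (x2 ∷ x0 ∷ x1 ∷ [])))))

  opaque
    proved : D 4              -- m Y e x
    proved = call capL (x0 ∷ x1 ∷ []) ∧d call safe (x0 ∷ x1 ∷ x2 ∷ []) ∧d ∃≤ x0 (x0 ≈ x4) ∧d call cl (x0 ∷ x1 ∷ x2 ∷ x3 ∷ [])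

  opaque
    root : D 6                -- m e c l z r
    -- These are sentences that PA proves if the event in question is the first one; a `State` and a
    -- boxed x then have a numerical witness.
    root = (x5 ≈ # 3) ∨d call sc (S x0 ∷ x1 ∷ x2 ∷ x3 ∷ x5 ∷ []) ∨d
      ∃≤ x0 (call prc (S x1 ∷ x2 ∷ x0 ∷ x6 ∷ []) ∧d call box (x5 ∷ x3 ∷ x4 ∷ x0 ∷ []))

  opaque
    conflict : D 6            -- m Y e c l z
    -- Reachability of n from r along implications is expressed by membership of n in every closed
    -- set that contains r.
    conflict = ∃≤ (S x0) (call root (x1 ∷ x3 ∷ x4 ∷ x5 ∷ x6 ∷ x0 ∷ []) ∧d
      ∃≤ (S x1) (call nc (S x2 ∷ x4 ∷ x5 ∷ x6 ∷ x0 ∷ []) ∧d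
        ∀≤ x3 (call mem (x0 ∷ # 0 ∷ x2 ∷ []) ⊃ call impClosed (S x3 ∷ # 0 ∷ x0 ∷ []) ⊃ call mem (x0 ∷ # 0 ∷ x1 ∷ []))))

  opaque
    event : D 6               -- m Y e c l z
    event = call capL (x0 ∷ x1 ∷ []) ∧d ∃≤ x0 (x0 ≈ x4) ∧d ∃≤ x3 (x0 ≈ x5) ∧d ∃≤ x1 (x0 ≈ x6) ∧d
      call frame (x3 ∷ []) ∧d call good (x0 ∷ x2 ∷ x3 ∷ x5 ∷ []) ∧d call conflict (x0 ∷ x1 ∷ x2 ∷ x3 ∷ x4 ∷ x5 ∷ [])

  opaque
    tup : D 6                 -- n m Y c l z
    tup = x0 ≈ pr x1 (pr x2 (pr x3 (pr x4 x5)))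
      where
      pr : ∀ {n} → Tm n → Tm n → Tm n
      pr a b = (a +ᵗ b) *ᵗ (a +ᵗ b) +ᵗ b

  opaque
    eventAt : D 2             -- n e
    eventAt = ∃≤ x0 (∃≤ x1 (∃≤ x2 (∃≤ x3 (∃≤ x4 (
      call tup (x5 ∷ x4 ∷ x3 ∷ x2 ∷ x1 ∷ x0 ∷ []) ∧d call event (x4 ∷ x3 ∷ x6 ∷ x2 ∷ x1 ∷ x0 ∷ []))))))

  opaque
    -- the last conjunct spares PA the injectivity of the tupling function
    first : D 7               -- n e m Y c l z
    first = call tup (x0 ∷ x2 ∷ x3 ∷ x4 ∷ x5 ∷ x6 ∷ []) ∧d call event (x2 ∷ x3 ∷ x1 ∷ x4 ∷ x5 ∷ x6 ∷ []) ∧d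
      ∀≤ x0 (¬d (x0 ≈ x1) ⊃ ¬d (call eventAt (x0 ∷ x2 ∷ []))) ∧d
      ∀≤ x0 (∀≤ x1 (∀≤ x2 (∀≤ x3 (∀≤ x4 (call tup (x5 ∷ x4 ∷ x3 ∷ x2 ∷ x1 ∷ x0 ∷ []) ⊃
        x2 ≈ x9 ∧d x1 ≈ x10 ∧d x0 ≈ x11)))))

  opaque
    declared : D 4            -- n e c l
    declared = ∃≤ x0 (x0 ≈ x3) ∧d ∃≤ x0 (x0 ≈ x4) ∧d ∃≤ x0 (∃≤ x1 (∃≤ x2 (call first (x3 ∷ x4 ∷ x2 ∷ x1 ∷ x5 ∷ x6 ∷ x0 ∷ []))))

  opaque
    later : D 3               -- n x e
    later = ∃≤ x0 (∃≤ x1 (∃≤ x2 (∃≤ x3 (∃≤ x4 (call first (x5 ∷ x7 ∷ x4 ∷ x3 ∷ x2 ∷ x1 ∷ x0 ∷ []) ∧d call box (x0 ∷ x2 ∷ x1 ∷ x6 ∷ []))))))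

  opaque
    provable : D 3            -- n x e
    provable = ∃≤ x0 (∃≤ x1 (call proved (x1 ∷ x0 ∷ x4 ∷ x3 ∷ []))) ∨d call later (x0 ∷ x1 ∷ x2 ∷ [])

  opaque
    valued : D 3              -- n q e
    valued = ∃≤ x0 (∃≤ x1 (∃≤ x2 (∃≤ x3 (∃≤ x4 (call first (x5 ∷ x7 ∷ x4 ∷ x3 ∷ x2 ∷ x1 ∷ x0 ∷ []) ∧d call val (x2 ∷ x1 ∷ x6 ∷ []))))))

  opaque
    P̂ Ŝ : Formula
    P̂ = ∃' (F provable (var 0 ∷ var 1 ∷ var 2 ∷ []))
    Ŝ = ∃' (F declared (var 0 ∷ var 3 ∷ var 1 ∷ var 2 ∷ []))

  opaque
    e* : ℕ
    e* = pair ⌜ P̂ ⌝ ⌜ Ŝ ⌝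

    e*-def : e* ≡ pair ⌜ P̂ ⌝ ⌜ Ŝ ⌝
    e*-def = refl

  opaque
    E : Term
    E = numeral e*

    E-def : E ≡ numeral e*
    E-def = refl

  opaque
    Pr : Formula
    Pr = ∃' (F provable (var 0 ∷ var 1 ∷ E ∷ []))

  opaque
    State : ℕ → ℕ → Formula
    State c l = ∃' (F declared (var 0 ∷ E ∷ numeral c ∷ numeral l ∷ []))

  opaque
    NState : ℕ → ℕ → Formula
    NState c l = ¬' (State c l)

  opaque
    atom : ℕ → Formula
    atom q = ∃' (F valued (var 0 ∷ numeral q ∷ E ∷ []))

-- Using the formulas inside PA; the fixed point

isAll isEx : ∀ {n} → D n → Set
isAll (∀≤ _ _) = ⊤
isAll _ = ⊥
isEx (∃≤ _ _) = ⊤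
isEx _ = ⊥

bnd : ∀ {n} → D n → Tm n
bnd (∀≤ b _) = b
bnd (∃≤ b _) = b
bnd _ = # 0

bdy : ∀ {n} → D n → D (suc n)
bdy (∀≤ _ d) = d
bdy (∃≤ _ d) = d
bdy _ = ⊥d

-- Since `bnd` and `bdy` take a quantifier apart by computation, a formula can be opened by its name
-- without restating its body.
allE : ∀ {Γ n} (d : D n) {_ : isAll d} τ → Γ ⊩ F d τ → ∀ t → Γ ⊩ t ≤' tm (bnd d) τ → Γ ⊩ F (bdy d) (t ∷ τ)
allE (∀≤ b d) τ = ∀≤E {b = b} {d} {τ}

allI : ∀ {Γ n} (d : D n) {_ : isAll d} τ → (∀ t → (t ≤' tm (bnd d) τ) ∷ Γ ⊩ F (bdy d) (t ∷ τ)) → Γ ⊩ F d τ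
allI (∀≤ b d) τ = ∀≤I {b = b} {d} {τ}

exI : ∀ {Γ n} (d : D n) {_ : isEx d} τ t → Γ ⊩ t ≤' tm (bnd d) τ → Γ ⊩ F (bdy d) (t ∷ τ) → Γ ⊩ F d τ
exI (∃≤ b d) τ = ∃≤I {b = b} {d} {τ}

-- Context extension is represented by its effect on derivations, so that weakenings compose as
-- functions.
_⊑_ : Ctx → Ctx → Set
Γ ⊑ Δ = ∀ {φ} → Γ ⊩ φ → Δ ⊩ φ

exE : ∀ {Γ n χ} (d : D n) {_ : isEx d} τ → Γ ⊩ F d τ →
  (∀ {Δ} → Γ ⊑ Δ → ∀ t → Δ ⊩ t ≤' tm (bnd d) τ → Δ ⊩ F (bdy d) (t ∷ τ) → Δ ⊩ χ) → Γ ⊩ χ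
exE (∃≤ b d) τ p h = ∃≤E {b = b} {d} {τ} p λ t → h (wk ∘ wk) t h1 h0

le-down : ∀ {Γ k N t} → k ≤ N → Γ ⊩ numeral N ≤' t → Γ ⊩ numeral k ≤' t
le-down {N = zero} z≤n p = p
le-down {N = suc N} p q with m≤n⇒m<n∨m≡n p
... | inj₂ refl = q
... | inj₁ (s≤s r) = le-down r (leE q λ u → leI (suc' u) (≐trans (S⊕ _ _) (≐trans (≐sym (PA4 _ _)) h0)))

exLe : ∀ {Γ b t} {d : D 2} → d ≡ ∃≤ (vr zero) (vr zero ≈ vr (suc (suc zero))) → Γ ⊩ F d (b ∷ t ∷ []) → Γ ⊩ t ≤' b
exLe {b = b} {t} refl p = exE (∃≤ (vr zero) (vr zero ≈ vr (suc (suc zero)))) (b ∷ t ∷ []) p λ w u q r → le-resp r (≐refl _) q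

least : ∀ {P : ℕ → Set} → (∀ n → Dec (P n)) → ∀ n → P n → Σ ℕ λ m → P m × (∀ k → k < m → ¬ P k)
least {P} P? n p = go n 0 (λ k ()) (subst P (sym (+-identityʳ n)) p)
  where
  go : ∀ d k → (∀ j → j < k → ¬ P j) → P (d + k) → Σ ℕ λ m → P m × (∀ k → k < m → ¬ P k)
  go zero k h p = k , p , h
  go (suc d) k h p with P? k
  ... | yes q = k , q , h
  ... | no q = go d (suc k) (λ j j< → h' j (m≤n⇒m<n∨m≡n j<)) (subst P (sym (+-suc d k)) p)
    where
    h' : ∀ j → suc j < suc k ⊎ suc j ≡ suc k → ¬ P j
    h' j (inj₁ (s≤s r)) = h j r
    h' j (inj₂ refl) = q

module Internal (L : Logic) {T : Theory} (K : Kit T) where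
  open Kit K
  open Formulas L K public

  E-subst : ∀ σ → substT σ E ≡ E
  E-subst σ rewrite E-def = numeral-subst σ e*

  shift-numeral : ∀ n → shiftT (numeral n) ≡ numeral n
  shift-numeral n = trans (renT-substT suc (numeral n)) (numeral-subst _ n)

  shift-E : shiftT E ≡ E
  shift-E = trans (renT-substT suc E) (E-subst _)

  opaque
    unfolding Pr
    Pr-inst : ∀ n → Pr [ numeral n ] ≡ ∃' (F provable (var 0 ∷ numeral n ∷ E ∷ []))
    Pr-inst n = cong ∃' (trans (F-subst (liftS (inst (numeral n))) provable _)
      (cong₂ (λ a b → F provable (var 0 ∷ a ∷ b ∷ [])) (shift-numeral n) (E-subst _)))

  opaque
    unfolding P̂
    -- The fixed point: inserting the number `e*` for the parameter turns the open formula `P̂` into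
    -- `Pr`. As `e*` codes both `P̂` and `Ŝ`, provability and states refer to each other through it.
    close-P̂ : ∀ n → close2 P̂ n e* ≡ Pr [ numeral n ]
    close-P̂ n = trans (cong₂ _[_] s1 (sym E-def)) (trans s2 (sym (Pr-inst n)))
      where
      s1 : P̂ [ numeral n ] ≡ ∃' (F provable (var 0 ∷ numeral n ∷ var 1 ∷ []))
      s1 = cong ∃' (trans (F-subst (liftS (inst (numeral n))) provable _)
        (cong (λ a → F provable (var 0 ∷ a ∷ var 1 ∷ [])) (shift-numeral n)))
      s2 : (∃' (F provable (var 0 ∷ numeral n ∷ var 1 ∷ []))) [ E ] ≡ ∃' (F provable (var 0 ∷ numeral n ∷ E ∷ []))
      s2 = cong ∃' (trans (F-subst (liftS (inst E)) provable _)
        (cong₂ (λ a b → F provable (var 0 ∷ a ∷ b ∷ [])) (numeral-subst _ n) shift-E))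

  opaque
    unfolding P̂ State
    close-Ŝ : ∀ c l → close3 Ŝ c l e* ≡ State c l
    close-Ŝ c l = trans (cong₂ (λ φ t → (φ [ numeral l ]) [ t ]) s1 (sym E-def)) (trans (cong (_[ E ]) s2) s3)
      where
      s1 : Ŝ [ numeral c ] ≡ ∃' (F declared (var 0 ∷ var 2 ∷ numeral c ∷ var 1 ∷ []))
      s1 = cong ∃' (trans (F-subst (liftS (inst (numeral c))) declared _)
        (cong (λ a → F declared (var 0 ∷ var 2 ∷ a ∷ var 1 ∷ [])) (shift-numeral c)))
      s2 : (∃' (F declared (var 0 ∷ var 2 ∷ numeral c ∷ var 1 ∷ []))) [ numeral l ] ≡ ∃' (F declared (var 0 ∷ var 1 ∷ numeral c ∷ numeral l ∷ []))
      s2 = cong ∃' (trans (F-subst (liftS (inst (numeral l))) declared _)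
        (cong₂ (λ a b → F declared (var 0 ∷ var 1 ∷ a ∷ b ∷ [])) (numeral-subst _ c) (shift-numeral l)))
      s3 : (∃' (F declared (var 0 ∷ var 1 ∷ numeral c ∷ numeral l ∷ []))) [ E ] ≡ State c l
      s3 = cong ∃' (trans (F-subst (liftS (inst E)) declared _)
        (trans (cong (λ a → F declared (var 0 ∷ a ∷ substT σ (numeral c) ∷ substT σ (numeral l) ∷ [])) shift-E)
          (cong₂ (λ a b → F declared (var 0 ∷ E ∷ a ∷ b ∷ [])) (numeral-subst σ c) (numeral-subst σ l))))
        where
        σ : ℕ → Term
        σ = liftS (inst E)

  opaque
    unfolding NState
    NState-def : ∀ c l → NState c l ≡ ¬' (State c l)
    NState-def c l = refl

  E≐ : ∀ {Γ} → Γ ⊩ numeral e* ≐ E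
  E≐ rewrite E-def = ≐refl _

  opaque
    unfolding imp
    -- The stage only bounds the certificate, so one standard certificate serves at all larger
    -- stages, nonstandard ones included.
    imp-std : ∀ {φ ψ} → T ⊢ φ ⇒ ψ → Σ ℕ λ N → ∀ {Γ m} → Γ ⊩ numeral N ≤' m →
      Γ ⊩ F imp (m ∷ numeral ⌜ φ ⌝ ∷ numeral ⌜ ψ ⌝ ∷ [])
    imp-std {φ} {ψ} p with cert-complete p
    ... | u , q = u , λ {_} {m} h → exI imp (m ∷ numeral ⌜ φ ⌝ ∷ numeral ⌜ ψ ⌝ ∷ []) (numeral u) h (true⇒ cert (u ∷ ⌜ φ ⌝ ∷ ⌜ ψ ⌝ ∷ []) q)

  opaque
    unfolding prc
    prc-std : ∀ x → Σ ℕ λ N → ∀ {Γ m} → Γ ⊩ numeral N ≤' m →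
      Γ ⊩ F prc (m ∷ E ∷ numeral x ∷ numeral ⌜ Pr [ numeral x ] ⌝ ∷ [])
    prc-std x with pcert-complete P̂ Ŝ x
    ... | u , q rewrite sym e*-def | close-P̂ x = suc x ⊔ u , λ {_} {m} h →
      ∧I (exI (∃≤ (vr zero) (vr zero ≈ S (vr (suc (suc (suc zero)))))) (m ∷ E ∷ numeral x ∷ numeral ⌜ Pr [ numeral x ] ⌝ ∷ [])
          (numeral (suc x)) (le-down (m≤m⊔n (suc x) u) h) (≐refl _))
        (exI (∃≤ (vr zero) (call pcert (x0 ∷ x2 ∷ x3 ∷ x4 ∷ []))) (m ∷ E ∷ numeral x ∷ numeral ⌜ Pr [ numeral x ] ⌝ ∷ []) (numeral u) (le-down (m≤n⊔m (suc x) u) h)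
          (F-cong pcert (≐refl _ ∷ E≐ ∷ PWrefl) (true⇒ pcert (u ∷ e* ∷ x ∷ ⌜ Pr [ numeral x ] ⌝ ∷ []) q)))

  opaque
    unfolding sc
    sc-std : ∀ c l → Σ ℕ λ N → ∀ {Γ m} → Γ ⊩ numeral N ≤' m →
      Γ ⊩ F sc (m ∷ E ∷ numeral c ∷ numeral l ∷ numeral ⌜ State c l ⌝ ∷ [])
    sc-std c l with scert-complete P̂ Ŝ c l
    ... | u , q rewrite sym e*-def | close-Ŝ c l = u , λ {_} {m} h →
      exI sc (m ∷ E ∷ numeral c ∷ numeral l ∷ numeral ⌜ State c l ⌝ ∷ []) (numeral u) h
      (F-cong scert (≐refl _ ∷ E≐ ∷ PWrefl) (true⇒ scert (u ∷ e* ∷ c ∷ l ∷ ⌜ State c l ⌝ ∷ []) q))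

  opaque
    unfolding nc
    nc-std : ∀ c l → Σ ℕ λ N → ∀ {Γ m} → Γ ⊩ numeral N ≤' m →
      Γ ⊩ F nc (m ∷ E ∷ numeral c ∷ numeral l ∷ numeral ⌜ NState c l ⌝ ∷ [])
    nc-std c l with ncert-complete P̂ Ŝ c l
    ... | u , q = suc c ⊔ u , λ {_} {m} h →
      ∧I (exI (∃≤ (vr zero) (vr zero ≈ S (vr (suc (suc (suc zero)))))) (m ∷ E ∷ numeral c ∷ numeral l ∷ numeral ⌜ NState c l ⌝ ∷ [])
          (numeral (suc c)) (le-down (m≤m⊔n (suc c) u) h) (≐refl _))
        (exI (∃≤ (vr zero) (call ncert (x0 ∷ x2 ∷ x3 ∷ x4 ∷ x5 ∷ []))) (m ∷ E ∷ numeral c ∷ numeral l ∷ numeral ⌜ NState c l ⌝ ∷ []) (numeral u) (le-down (m≤n⊔m (suc c) u) h)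
          (F-cong ncert (≐refl _ ∷ E≐ ∷ PWrefl) (true⇒ ncert (u ∷ e* ∷ c ∷ l ∷ ⌜ NState c l ⌝ ∷ []) q')))
      where
      q' : ⟪ ncert ⟫ (u ∷ e* ∷ c ∷ l ∷ ⌜ NState c l ⌝ ∷ [])
      q' = subst₂ (λ e φ → ⟪ ncert ⟫ (u ∷ e ∷ c ∷ l ∷ ⌜ φ ⌝ ∷ [])) (sym e*-def)
        (trans (cong ¬' (trans (cong (close3 Ŝ c l) (sym e*-def)) (close-Ŝ c l))) (sym (NState-def c l))) q

  module _ {Γ : Ctx} where
    opaque
      unfolding impClosed
      impClosedE : ∀ {m k z x w} → Γ ⊩ F impClosed (m ∷ k ∷ z ∷ []) → Γ ⊩ x ≤' m → Γ ⊩ w ≤' m →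
        Γ ⊩ F imp (m ∷ x ∷ w ∷ []) → Γ ⊩ F mem (z ∷ k ∷ x ∷ []) → Γ ⊩ F mem (z ∷ k ∷ w ∷ [])
      impClosedE {m} {k} {z} {x} {w} p a b q r =
        allE (bdy impClosed) (x ∷ m ∷ k ∷ z ∷ []) (allE impClosed (m ∷ k ∷ z ∷ []) p x a) w b · q · r

    opaque
      unfolding seeded
      seededE : ∀ {m e c k z w} → Γ ⊩ F seeded (m ∷ e ∷ c ∷ k ∷ z ∷ []) → Γ ⊩ w ≤' m →
        Γ ⊩ F sc (m ∷ e ∷ c ∷ k ∷ w ∷ []) → Γ ⊩ F mem (z ∷ k ∷ w ∷ [])
      seededE {m} {e} {c} {k} {z} {w} p a q = allE seeded (m ∷ e ∷ c ∷ k ∷ z ∷ []) p w a · ∨₂ q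

    opaque
      unfolding boxClosed
      boxClosedE : ∀ {m e c k z x w} → Γ ⊩ F boxClosed (m ∷ e ∷ c ∷ k ∷ z ∷ []) → Γ ⊩ x ≤' m → Γ ⊩ w ≤' m →
        Γ ⊩ F prc (m ∷ e ∷ x ∷ w ∷ []) → Γ ⊩ F box (z ∷ c ∷ k ∷ x ∷ []) → Γ ⊩ F mem (z ∷ k ∷ w ∷ [])
      boxClosedE {m} {e} {c} {k} {z} {x} {w} p a b q r = allE (bdy boxClosed) (x ∷ m ∷ e ∷ c ∷ k ∷ z ∷ []) (allE boxClosed (m ∷ e ∷ c ∷ k ∷ z ∷ []) p x a) w b · q · r

    opaque
      unfolding coherent
      coherentE : ∀ {m e c k z w} → Γ ⊩ F coherent (m ∷ e ∷ c ∷ k ∷ z ∷ []) → Γ ⊩ w ≤' m →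
        Γ ⊩ F nc (m ∷ e ∷ c ∷ k ∷ w ∷ []) → Γ ⊩ F mem (z ∷ k ∷ w ∷ []) → Γ ⊩ ⊥'
      coherentE {m} {e} {c} {k} {z} {w} p a q r = allE coherent (m ∷ e ∷ c ∷ k ∷ z ∷ []) p w a · q · r

    opaque
      unfolding good
      goodE : ∀ {m e c z k} → Γ ⊩ F good (m ∷ e ∷ c ∷ z ∷ []) → Γ ⊩ k ≤' c →
        Γ ⊩ (F seeded (m ∷ e ∷ c ∷ k ∷ z ∷ []) ∧' F impClosed (m ∷ k ∷ z ∷ []) ∧' F boxClosed (m ∷ e ∷ c ∷ k ∷ z ∷ []) ∧' F coherent (m ∷ e ∷ c ∷ k ∷ z ∷ []))
      goodE {m} {e} {c} {z} {k} p a = allE good (m ∷ e ∷ c ∷ z ∷ []) p k a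

    opaque
      unfolding necClosed
      necClosedE : ∀ {m e z x w} → Γ ⊩ F necClosed (m ∷ e ∷ z ∷ []) → Γ ⊩ x ≤' m → Γ ⊩ w ≤' m →
        Γ ⊩ F prc (m ∷ e ∷ x ∷ w ∷ []) → Γ ⊩ F mem (z ∷ zer ∷ x ∷ []) → Γ ⊩ F mem (z ∷ zer ∷ w ∷ [])
      necClosedE {m} {e} {z} {x} {w} p a b q r = allE (bdy necClosed) (x ∷ m ∷ e ∷ z ∷ []) (allE necClosed (m ∷ e ∷ z ∷ []) p x a) w b · q · r

    opaque
      unfolding box
      boxI : ∀ {z c k x} t → Γ ⊩ t ≤' c → Γ ⊩ F nbh (c ∷ k ∷ t ∷ []) →
        (∀ {Δ} → Γ ⊑ Δ → ∀ j → Δ ⊩ j ≤' c → Δ ⊩ F elt (c ∷ t ∷ j ∷ []) → Δ ⊩ F mem (z ∷ j ∷ x ∷ [])) →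
        Γ ⊩ F box (z ∷ c ∷ k ∷ x ∷ [])
      boxI {z} {c} {k} {x} t a p h = exI box (z ∷ c ∷ k ∷ x ∷ []) t a (∧I p (allI (body (bdy box)) (t ∷ z ∷ c ∷ k ∷ x ∷ [])
        λ j → ƛ (h (wk ∘ wk) j h1 h0)))
        where
        body : ∀ {n} → D n → D n
        body (d ∧d e) = e
        body d = d

    opaque
      unfolding box
      boxE : ∀ {z c k x χ} → Γ ⊩ F box (z ∷ c ∷ k ∷ x ∷ []) →
        (∀ {Δ} → Γ ⊑ Δ → ∀ t → Δ ⊩ t ≤' c → Δ ⊩ F nbh (c ∷ k ∷ t ∷ []) →
          (∀ {Θ} → Δ ⊑ Θ → ∀ j → Θ ⊩ j ≤' c → Θ ⊩ F elt (c ∷ t ∷ j ∷ []) → Θ ⊩ F mem (z ∷ j ∷ x ∷ [])) → Δ ⊩ χ) → Γ ⊩ χ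
      boxE {z} {c} {k} {x} p h = exE box (z ∷ c ∷ k ∷ x ∷ []) p λ w t a q → h w t a (∧₁ q)
        λ w' j b r → allE (body (bdy box)) (t ∷ z ∷ c ∷ k ∷ x ∷ []) (w' (∧₂ q)) j b · r
        where
        body : ∀ {n} → D n → D n
        body (d ∧d e) = e
        body d = d

    opaque
      unfolding cl
      clE : ∀ {m Y e x z} → Γ ⊩ F cl (m ∷ Y ∷ e ∷ x ∷ []) → Γ ⊩ z ≤' Y → Γ ⊩ F base (m ∷ e ∷ z ∷ []) → Γ ⊩ F mem (z ∷ zer ∷ x ∷ [])
      clE {m} {Y} {e} {x} {z} p a q = allE cl (m ∷ Y ∷ e ∷ x ∷ []) p z a · q

    opaque
      unfolding cl base
      clI : ∀ {m Y e x} → (∀ {Δ} → Γ ⊑ Δ → ∀ z → Δ ⊩ z ≤' Y → Δ ⊩ F impClosed (m ∷ zer ∷ z ∷ []) → Δ ⊩ F necClosed (m ∷ e ∷ z ∷ []) →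
        Δ ⊩ F base (m ∷ e ∷ z ∷ []) → Δ ⊩ F mem (z ∷ zer ∷ x ∷ [])) → Γ ⊩ F cl (m ∷ Y ∷ e ∷ x ∷ [])
      clI {m} {Y} {e} {x} h = allI cl (m ∷ Y ∷ e ∷ x ∷ []) λ z → ƛ (h (wk ∘ wk) z h1 (∧₁ (∧₂ h0)) (∧₂ (∧₂ h0)) h0)

    opaque
      unfolding safe
      safeE : ∀ {m Y e c χ} → Γ ⊩ F safe (m ∷ Y ∷ e ∷ []) → Γ ⊩ c ≤' m → Γ ⊩ F frame (c ∷ []) →
        (∀ {Δ} → Γ ⊑ Δ → ∀ z → Δ ⊩ F good (m ∷ e ∷ c ∷ z ∷ []) →
          (∀ {x k} → Δ ⊩ x ≤' m → Δ ⊩ F cl (m ∷ Y ∷ e ∷ x ∷ []) → Δ ⊩ k ≤' c → Δ ⊩ F mem (z ∷ k ∷ x ∷ [])) → Δ ⊩ χ) → Γ ⊩ χ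
      safeE {m} {Y} {e} {c} p a q h = exE (conc (bdy safe)) (c ∷ m ∷ Y ∷ e ∷ []) (allE safe (m ∷ Y ∷ e ∷ []) p c a · q) λ w z b r →
        h w z (∧₁ r) λ {x} {k} b' r' b'' → allE (conc (bdy (snd (bdy (conc (bdy safe)))))) (x ∷ z ∷ c ∷ m ∷ Y ∷ e ∷ [])
          (allE (snd (bdy (conc (bdy safe)))) (z ∷ c ∷ m ∷ Y ∷ e ∷ []) (∧₂ r) x b' · r') k b''
        where
        conc snd : ∀ {n} → D n → D n
        conc (d ⊃ e) = e
        conc d = d
        snd (d ∧d e) = e
        snd d = d

    opaque
      unfolding proved
      provedE : ∀ {m Y e x} → Γ ⊩ F proved (m ∷ Y ∷ e ∷ x ∷ []) →
        (Γ ⊩ F capL (m ∷ Y ∷ [])) × (Γ ⊩ F safe (m ∷ Y ∷ e ∷ [])) × (Γ ⊩ x ≤' m) × (Γ ⊩ F cl (m ∷ Y ∷ e ∷ x ∷ []))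
      provedE {m} {Y} {e} {x} p = ∧₁ p , ∧₁ (∧₂ p) , exLe refl (∧₁ (∧₂ (∧₂ p))) , ∧₂ (∧₂ (∧₂ p))

    opaque
      unfolding proved
      provedI : ∀ {m Y e x} → Γ ⊩ F capL (m ∷ Y ∷ []) → Γ ⊩ F safe (m ∷ Y ∷ e ∷ []) → Γ ⊩ x ≤' m → Γ ⊩ F cl (m ∷ Y ∷ e ∷ x ∷ []) →
        Γ ⊩ F proved (m ∷ Y ∷ e ∷ x ∷ [])
      provedI {m} {Y} {e} {x} p q r s = ∧I p (∧I q (∧I (exI (∃≤ (vr zero) (vr zero ≈ vr (suc (suc zero)))) (m ∷ x ∷ []) x r (≐refl x)) s))

    opaque
      unfolding event
      eventE : ∀ {m Y e c l z} → Γ ⊩ F event (m ∷ Y ∷ e ∷ c ∷ l ∷ z ∷ []) →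
        (Γ ⊩ F capL (m ∷ Y ∷ [])) × (Γ ⊩ c ≤' m) × (Γ ⊩ l ≤' c) × (Γ ⊩ z ≤' Y) × (Γ ⊩ F frame (c ∷ [])) × (Γ ⊩ F good (m ∷ e ∷ c ∷ z ∷ []))
      eventE {m} {Y} {e} {c} {l} {z} p = ∧₁ p , exLe refl (∧₁ (∧₂ p)) , exLe refl (∧₁ (∧₂ (∧₂ p))) , exLe refl (∧₁ (∧₂ (∧₂ (∧₂ p)))) ,
        ∧₁ (∧₂ (∧₂ (∧₂ (∧₂ p)))) , ∧₁ (∧₂ (∧₂ (∧₂ (∧₂ (∧₂ p)))))

exUE : ∀ {Γ n χ} (d : D (suc n)) {τ} → map shiftT τ ≡ τ → Γ ⊩ ∃' (F d (var 0 ∷ τ)) →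
  (∀ {Δ} → Γ ⊑ Δ → ∀ t → Δ ⊩ F d (t ∷ τ) → Δ ⊩ χ) → Γ ⊩ χ
exUE {Γ} {χ = χ} d {τ} e p h = ∃E p λ t → subst (λ φ → φ ∷ Γ ⊩ χ) (sym (eq t)) (h wk t h0)
  where
  eq : ∀ t → (F d (var 0 ∷ τ)) [ t ] ≡ F d (t ∷ τ)
  eq t = trans (cong (λ τ → (F d (var 0 ∷ τ)) [ t ]) (sym e)) (F-inst d t τ)

exUI : ∀ {Γ n} (d : D (suc n)) {τ} → map shiftT τ ≡ τ → ∀ t → Γ ⊩ F d (t ∷ τ) → Γ ⊩ ∃' (F d (var 0 ∷ τ))
exUI {Γ} d {τ} e t p = ∃I _ t (subst (Γ ⊩_) (sym (trans (cong (λ τ → (F d (var 0 ∷ τ)) [ t ]) (sym e)) (F-inst d t τ))) p)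

-- Bounds of stages and uniqueness of the first event, inside PA

module Stages (L : Logic) {T : Theory} (K : Kit T) where
  open Kit K
  open Internal L K public

  opaque
    unfolding capL
    capNum : ∀ k → Σ ℕ λ Y → ⟪ capL ⟫ (k ∷ Y ∷ [])
    capNum k with least (λ Y → decD Cap (suc k ∷ Y ∷ [])) _ (proj₂ (cap-exists (suc k)))
    ... | Y , p , h = Y , p , λ y y≤ ne q → h y (≤∧≢⇒< y≤ ne) q

    cap-unique : ∀ {k Y Y'} → ⟪ capL ⟫ (k ∷ Y ∷ []) → ⟪ capL ⟫ (k ∷ Y' ∷ []) → Y ≡ Y'
    cap-unique {Y = Y} {Y'} (p , h) (q , g) with Y ≟ Y'
    ... | yes e = e
    ... | no ne with ≤-total Y Y'
    ...   | inj₁ le = ⊥-elim (g Y le ne p)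
    ...   | inj₂ le = ⊥-elim (h Y' le (ne ∘ sym) q)

    capL-Cap : ∀ {k Y} → ⟪ capL ⟫ (k ∷ Y ∷ []) → ⟪ Cap ⟫ (suc k ∷ Y ∷ [])
    capL-Cap = proj₁

    -- Below the true value `Y₀`, the term `Y` is a numeral and `capL` is decided; strictly above
    -- it, the minimality clause of `capL` would exclude `Y₀`.
    capPA : ∀ k {Γ Y} → Γ ⊩ F capL (numeral k ∷ Y ∷ []) → Γ ⊩ Y ≐ numeral (proj₁ (capNum k))
    capPA k {Γ} {Y} p = le-total Y Y₀
      (le-cases _ Y h0 λ j _ → case j)
      (lem (Y₀ ≐ Y) (≐sym h0) (efq (allE (snd capL) (numeral k ∷ Y ∷ []) (wk (wk (∧₂ p))) Y₀ h1 · h0 · true⇒ Cap (suc k ∷ proj₁ (capNum k) ∷ []) (capL-Cap (proj₂ (capNum k))))))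
      where
      Y₀ : Term
      Y₀ = numeral (proj₁ (capNum k))
      snd : ∀ {n} → D n → D n
      snd (d ∧d e) = e
      snd d = d
      case : ∀ j → (Y ≐ numeral j) ∷ (Y ≤' Y₀) ∷ Γ ⊩ Y ≐ Y₀
      case j with decD capL (k ∷ j ∷ [])
      ... | yes q = subst (λ i → (Y ≐ numeral j) ∷ (Y ≤' Y₀) ∷ Γ ⊩ Y ≐ numeral i) (cap-unique q (proj₂ (capNum k))) h0
      ... | no q = efq (false⇒ capL (k ∷ j ∷ []) q · F-cong capL {σ = numeral k ∷ Y ∷ []} (≐refl _ ∷ h0 ∷ []) (wk (wk p)))

  record Ev (Γ : Ctx) (n m Y c l z : Term) : Set where
    field
      is-first : Γ ⊩ F first (n ∷ E ∷ m ∷ Y ∷ c ∷ l ∷ z ∷ [])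
      m≤ : Γ ⊩ m ≤' n
      Y≤ : Γ ⊩ Y ≤' n
      c≤ : Γ ⊩ c ≤' n
      l≤ : Γ ⊩ l ≤' n
      z≤ : Γ ⊩ z ≤' n
  open Ev public

  evWk : ∀ {Γ Δ n m Y c l z} → Γ ⊑ Δ → Ev Γ n m Y c l z → Ev Δ n m Y c l z
  evWk w e = record { is-first = w (is-first e) ; m≤ = w (m≤ e) ; Y≤ = w (Y≤ e) ; c≤ = w (c≤ e) ; l≤ = w (l≤ e) ; z≤ = w (z≤ e) }

  body : ∀ {n} → D n → D n
  body (d ∧d e) = e
  body d = d

  module _ {Γ : Ctx} {n : Term} where
    opaque
      unfolding declared
      declaredE : ∀ {c l χ} → Γ ⊩ F declared (n ∷ E ∷ c ∷ l ∷ []) →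
        (∀ {Δ} → Γ ⊑ Δ → ∀ m Y z → Ev Δ n m Y c l z → Δ ⊩ χ) → Γ ⊩ χ
      declaredE {c} {l} p h =
        exE d₁ (n ∷ E ∷ c ∷ l ∷ []) (∧₂ (∧₂ p)) λ w₁ m m≤ q₁ →
        exE d₂ (m ∷ n ∷ E ∷ c ∷ l ∷ []) q₁ λ w₂ Y Y≤ q₂ →
        exE d₃ (Y ∷ m ∷ n ∷ E ∷ c ∷ l ∷ []) q₂ λ w₃ z z≤ q₃ →
        h (w₃ ∘ w₂ ∘ w₁) m Y z (record { is-first = q₃ ; m≤ = w₃ (w₂ m≤) ; Y≤ = w₃ Y≤
          ; c≤ = w₃ (w₂ (w₁ (le (∧₁ p)))) ; l≤ = w₃ (w₂ (w₁ (le (∧₁ (∧₂ p))))) ; z≤ = z≤ })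
        where
        d₁ : D 4
        d₁ = body (body declared)
        d₂ : D 5
        d₂ = bdy d₁
        d₃ : D 6
        d₃ = bdy d₂
        le : ∀ {t} → Γ ⊩ bex n (var 0 ≐ shiftT t) → Γ ⊩ t ≤' n
        le {t} p = exLe refl p

    opaque
      unfolding later
      laterE : ∀ {x χ} → Γ ⊩ F later (n ∷ x ∷ E ∷ []) →
        (∀ {Δ} → Γ ⊑ Δ → ∀ m Y c l z → Ev Δ n m Y c l z → Δ ⊩ F box (z ∷ c ∷ l ∷ x ∷ []) → Δ ⊩ χ) → Γ ⊩ χ
      laterE {x} p h =
        exE later (n ∷ x ∷ E ∷ []) p λ w₁ m m≤ q₁ →
        exE (bdy later) (m ∷ n ∷ x ∷ E ∷ []) q₁ λ w₂ Y Y≤ q₂ →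
        exE (bdy (bdy later)) (Y ∷ m ∷ n ∷ x ∷ E ∷ []) q₂ λ w₃ c c≤ q₃ →
        exE (bdy (bdy (bdy later))) (c ∷ Y ∷ m ∷ n ∷ x ∷ E ∷ []) q₃ λ w₄ l l≤ q₄ →
        exE (bdy (bdy (bdy (bdy later)))) (l ∷ c ∷ Y ∷ m ∷ n ∷ x ∷ E ∷ []) q₄ λ w₅ z z≤ q₅ →
        h (w₅ ∘ w₄ ∘ w₃ ∘ w₂ ∘ w₁) m Y c l z (record { is-first = ∧₁ q₅ ; m≤ = w₅ (w₄ (w₃ (w₂ m≤))) ; Y≤ = w₅ (w₄ (w₃ Y≤))
          ; c≤ = w₅ (w₄ c≤) ; l≤ = w₅ l≤ ; z≤ = z≤ }) (∧₂ q₅)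

      laterI : ∀ {x m Y c l z} → Ev Γ n m Y c l z → Γ ⊩ F box (z ∷ c ∷ l ∷ x ∷ []) → Γ ⊩ F later (n ∷ x ∷ E ∷ [])
      laterI {x} {m} {Y} {c} {l} {z} e p =
        exI later (n ∷ x ∷ E ∷ []) m (m≤ e)
        (exI (bdy later) (m ∷ n ∷ x ∷ E ∷ []) Y (Y≤ e)
        (exI (bdy (bdy later)) (Y ∷ m ∷ n ∷ x ∷ E ∷ []) c (c≤ e)
        (exI (bdy (bdy (bdy later))) (c ∷ Y ∷ m ∷ n ∷ x ∷ E ∷ []) l (l≤ e)
        (exI (bdy (bdy (bdy (bdy later)))) (l ∷ c ∷ Y ∷ m ∷ n ∷ x ∷ E ∷ []) z (z≤ e) (∧I (is-first e) p)))))

    opaque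
      unfolding valued
      valuedE : ∀ {x χ} → Γ ⊩ F valued (n ∷ x ∷ E ∷ []) →
        (∀ {Δ} → Γ ⊑ Δ → ∀ m Y c l z → Ev Δ n m Y c l z → Δ ⊩ F val (c ∷ l ∷ x ∷ []) → Δ ⊩ χ) → Γ ⊩ χ
      valuedE {x} p h =
        exE valued (n ∷ x ∷ E ∷ []) p λ w₁ m m≤ q₁ →
        exE (bdy valued) (m ∷ n ∷ x ∷ E ∷ []) q₁ λ w₂ Y Y≤ q₂ →
        exE (bdy (bdy valued)) (Y ∷ m ∷ n ∷ x ∷ E ∷ []) q₂ λ w₃ c c≤ q₃ →
        exE (bdy (bdy (bdy valued))) (c ∷ Y ∷ m ∷ n ∷ x ∷ E ∷ []) q₃ λ w₄ l l≤ q₄ →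
        exE (bdy (bdy (bdy (bdy valued)))) (l ∷ c ∷ Y ∷ m ∷ n ∷ x ∷ E ∷ []) q₄ λ w₅ z z≤ q₅ →
        h (w₅ ∘ w₄ ∘ w₃ ∘ w₂ ∘ w₁) m Y c l z (record { is-first = ∧₁ q₅ ; m≤ = w₅ (w₄ (w₃ (w₂ m≤))) ; Y≤ = w₅ (w₄ (w₃ Y≤))
          ; c≤ = w₅ (w₄ c≤) ; l≤ = w₅ l≤ ; z≤ = z≤ }) (∧₂ q₅)

      valuedI : ∀ {x m Y c l z} → Ev Γ n m Y c l z → Γ ⊩ F val (c ∷ l ∷ x ∷ []) → Γ ⊩ F valued (n ∷ x ∷ E ∷ [])
      valuedI {x} {m} {Y} {c} {l} {z} e p =
        exI valued (n ∷ x ∷ E ∷ []) m (m≤ e)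
        (exI (bdy valued) (m ∷ n ∷ x ∷ E ∷ []) Y (Y≤ e)
        (exI (bdy (bdy valued)) (Y ∷ m ∷ n ∷ x ∷ E ∷ []) c (c≤ e)
        (exI (bdy (bdy (bdy valued))) (c ∷ Y ∷ m ∷ n ∷ x ∷ E ∷ []) l (l≤ e)
        (exI (bdy (bdy (bdy (bdy valued)))) (l ∷ c ∷ Y ∷ m ∷ n ∷ x ∷ E ∷ []) z (z≤ e) (∧I (is-first e) p)))))

    opaque
      unfolding provable
      provableE : ∀ {x χ} → Γ ⊩ F provable (n ∷ x ∷ E ∷ []) →
        (∀ {Δ} → Γ ⊑ Δ → ∀ m Y → Δ ⊩ m ≤' n → Δ ⊩ Y ≤' n → Δ ⊩ F proved (m ∷ Y ∷ E ∷ x ∷ []) → Δ ⊩ χ) →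
        (∀ {Δ} → Γ ⊑ Δ → Δ ⊩ F later (n ∷ x ∷ E ∷ []) → Δ ⊩ χ) → Γ ⊩ χ
      provableE {x} p h g = ∨E p
        (exE (bdy' provable) (n ∷ x ∷ E ∷ []) h0 λ w₁ m m≤ q₁ → exE (bdy (bdy' provable)) (m ∷ n ∷ x ∷ E ∷ []) q₁ λ w₂ Y Y≤ q₂ →
          h (w₂ ∘ w₁ ∘ wk) m Y (w₂ m≤) Y≤ q₂)
        (g wk h0)
        where
        bdy' : ∀ {n} → D n → D n
        bdy' (d ∨d e) = d
        bdy' d = d

      provableI₁ : ∀ {x} m Y → Γ ⊩ m ≤' n → Γ ⊩ Y ≤' n → Γ ⊩ F proved (m ∷ Y ∷ E ∷ x ∷ []) → Γ ⊩ F provable (n ∷ x ∷ E ∷ [])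
      provableI₁ {x} m Y a b p = ∨₁ (exI (bdy' provable) (n ∷ x ∷ E ∷ []) m a (exI (bdy (bdy' provable)) (m ∷ n ∷ x ∷ E ∷ []) Y b p))
        where
        bdy' : ∀ {n} → D n → D n
        bdy' (d ∨d e) = d
        bdy' d = d

      provableI₂ : ∀ {x} → Γ ⊩ F later (n ∷ x ∷ E ∷ []) → Γ ⊩ F provable (n ∷ x ∷ E ∷ [])
      provableI₂ p = ∨₂ p

    opaque
      unfolding first
      firstEvent : ∀ {m Y c l z} → Ev Γ n m Y c l z → Γ ⊩ F event (m ∷ Y ∷ E ∷ c ∷ l ∷ z ∷ [])
      firstEvent e = ∧₁ (∧₂ (is-first e))

    opaque
      unfolding first
      firstTup : ∀ {m Y c l z} → Ev Γ n m Y c l z → Γ ⊩ F tup (n ∷ m ∷ Y ∷ c ∷ l ∷ z ∷ [])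
      firstTup e = ∧₁ (is-first e)

    opaque
      unfolding first
      firstMin : ∀ {m Y c l z n'} → Ev Γ n m Y c l z → Γ ⊩ n' ≤' n → Γ ⊩ ¬' (n' ≐ n) ⇒ ¬' (F eventAt (n' ∷ E ∷ []))
      firstMin {m} {Y} {c} {l} {z} {n'} e a = allE d (n ∷ E ∷ m ∷ Y ∷ c ∷ l ∷ z ∷ []) (∧₁ (∧₂ (∧₂ (is-first e)))) n' a
        where
        fst : D 7 → D 7
        fst (d ∧d e) = d
        fst d = d
        d : D 7
        d = fst (body (body first))

    opaque
      unfolding first
      firstDec : ∀ {m Y c l z m' Y' c' l' z'} → Ev Γ n m Y c l z → Γ ⊩ m' ≤' n → Γ ⊩ Y' ≤' n → Γ ⊩ c' ≤' n → Γ ⊩ l' ≤' n → Γ ⊩ z' ≤' n →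
        Γ ⊩ F tup (n ∷ m' ∷ Y' ∷ c' ∷ l' ∷ z' ∷ []) → (Γ ⊩ c' ≐ c) × (Γ ⊩ l' ≐ l) × (Γ ⊩ z' ≐ z)
      firstDec {m} {Y} {c} {l} {z} {m'} {Y'} {c'} {l'} {z'} e a b a' b' a'' p = ∧₁ q , ∧₁ (∧₂ q) , ∧₂ (∧₂ q)
        where
        d : D 7
        d = body (body (body first))
        q : Γ ⊩ (c' ≐ c) ∧' (l' ≐ l) ∧' (z' ≐ z)
        q = allE (bdy (bdy (bdy (bdy d)))) (l' ∷ c' ∷ Y' ∷ m' ∷ n ∷ E ∷ m ∷ Y ∷ c ∷ l ∷ z ∷ [])
          (allE (bdy (bdy (bdy d))) (c' ∷ Y' ∷ m' ∷ n ∷ E ∷ m ∷ Y ∷ c ∷ l ∷ z ∷ [])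
          (allE (bdy (bdy d)) (Y' ∷ m' ∷ n ∷ E ∷ m ∷ Y ∷ c ∷ l ∷ z ∷ [])
          (allE (bdy d) (m' ∷ n ∷ E ∷ m ∷ Y ∷ c ∷ l ∷ z ∷ [])
          (allE d (n ∷ E ∷ m ∷ Y ∷ c ∷ l ∷ z ∷ []) (∧₂ (∧₂ (∧₂ (is-first e)))) m' a) Y' b) c' a') l' b') z' a'' · p

    opaque
      unfolding eventAt
      eventAtI : ∀ {m Y c l z} → Ev Γ n m Y c l z → Γ ⊩ F eventAt (n ∷ E ∷ [])
      eventAtI {m} {Y} {c} {l} {z} e =
        exI eventAt (n ∷ E ∷ []) m (m≤ e)
        (exI (bdy eventAt) (m ∷ n ∷ E ∷ []) Y (Y≤ e)
        (exI (bdy (bdy eventAt)) (Y ∷ m ∷ n ∷ E ∷ []) c (c≤ e)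
        (exI (bdy (bdy (bdy eventAt))) (c ∷ Y ∷ m ∷ n ∷ E ∷ []) l (l≤ e)
        (exI (bdy (bdy (bdy (bdy eventAt)))) (l ∷ c ∷ Y ∷ m ∷ n ∷ E ∷ []) z (z≤ e) (∧I (firstTup e) (firstEvent e))))))

  ev-same : ∀ {Γ n m Y c l z n' m' Y' c' l' z'} → Ev Γ n m Y c l z → Ev Γ n' m' Y' c' l' z' → Γ ⊩ n ≐ n'
  ev-same {n = n} {n' = n'} e e' = le-total n n'
    (dn (ƛ (firstMin (evWk (wk ∘ wk) e') h1 · h0 · eventAtI (evWk (wk ∘ wk) e))))
    (≐sym (dn (ƛ (firstMin (evWk (wk ∘ wk) e) h1 · h0 · eventAtI (evWk (wk ∘ wk) e')))))

  -- Minimality on both sides forces the same event number, and the last conjunct of `first` says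
  -- that this number decodes in only one way.
  ev-unique : ∀ {Γ n m Y c l z n' m' Y' c' l' z'} → Ev Γ n m Y c l z → Ev Γ n' m' Y' c' l' z' →
    (Γ ⊩ c ≐ c') × (Γ ⊩ l ≐ l') × (Γ ⊩ z ≐ z')
  ev-unique {n = n} {m} {Y} {c} {l} {z} {n'} e e' = firstDec e' (r (m≤ e)) (r (Y≤ e)) (r (c≤ e)) (r (l≤ e)) (r (z≤ e))
      (F-cong tup {σ = n ∷ m ∷ Y ∷ c ∷ l ∷ z ∷ []} (ev-same e e' ∷ PWrefl) (firstTup e))
    where
    r : ∀ {t} → _ ⊩ t ≤' n → _ ⊩ t ≤' n'
    r p = le-resp (≐refl _) (ev-same e e') p

maxUpTo : (ℕ → ℕ) → ℕ → ℕ
maxUpTo f zero = f 0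
maxUpTo f (suc n) = f (suc n) ⊔ maxUpTo f n

≤maxUpTo : ∀ f {k n} → k ≤ n → f k ≤ maxUpTo f n
≤maxUpTo f {n = zero} z≤n = ≤-refl
≤maxUpTo f {n = suc n} p with m≤n⇒m<n∨m≡n p
... | inj₁ (s≤s q) = ≤-trans (≤maxUpTo f q) (m≤n⊔m _ _)
... | inj₂ refl = m≤m⊔n _ _

-- Truth in the coded models

module Frames (L : Logic) {T : Theory} (K : Kit T) where
  open Kit K
  open Stages L K public

  Force : ℕ → ℕ → MFm → Set
  Force c k (pv q) = ⟪ val ⟫ (c ∷ k ∷ q ∷ [])
  Force c k ⊥m = ⊥
  Force c k (A ⇒m B) = Force c k A → Force c k B
  Force c k (□ A) = Σ ℕ λ v → v ≤ c × (⟪ nbh ⟫ (c ∷ k ∷ v ∷ []) × (∀ j → j ≤ c → ⟪ elt ⟫ (c ∷ v ∷ j ∷ []) → Force c j A))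

  force? : ∀ c k A → Dec (Force c k A)
  force? c k (pv q) = decD val _
  force? c k ⊥m = no λ ()
  force? c k (A ⇒m B) = force? c k A →-dec force? c k B
  force? c k (□ A) = any≤? c λ v → decD nbh _ ×-dec all≤? c λ j → decD elt _ →-dec force? c j A

  opaque
    unfolding frame
    frame-serial : ∀ {c k} → ⟪ frame ⟫ (c ∷ []) → k ≤ c → Σ ℕ λ v → v ≤ c × ⟪ nbh ⟫ (c ∷ k ∷ v ∷ [])
    frame-serial (h , _) p = h _ p

-- What PA proves about provability and states

module Theorems (L : Logic) {T : Theory} (K : Kit T) (hPA : ExtendsPA T) where
  open Kit K
  open Frames L K public

  pr⊢ : ∀ x → PA ⊢ Pr [ numeral x ] → PA ⊢ ∃' (F provable (var 0 ∷ numeral x ∷ E ∷ []))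
  pr⊢ x = subst (PA ⊢_) (Pr-inst x)

  nE : ∀ n → map shiftT (numeral n ∷ E ∷ []) ≡ numeral n ∷ E ∷ []
  nE n = cong₂ (λ a b → a ∷ b ∷ []) (shift-numeral n) shift-E

  -- Facts established outside PA, in `Reality` and `Stability`. The arguments inside PA draw on
  -- them only after a stage has been reduced to a standard one, where bounded formulas are decided.
  module WithTruths
    (noEvent : ∀ m Y c l z → ¬ ⟪ event ⟫ (m ∷ Y ∷ e* ∷ c ∷ l ∷ z ∷ []))
    (proved-sound : ∀ {m Y} φ → ⟪ proved ⟫ (m ∷ Y ∷ e* ∷ ⌜ φ ⌝ ∷ []) → T ⊢ φ)
    (pr-complete : ∀ φ → T ⊢ φ → PA ⊢ Pr⟨ Pr ⟩ φ)
    (state-con : ∀ c k → k ≤ c → ⟪ frame ⟫ (c ∷ []) → ¬ (T ⊢ NState c k)) where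

    -- At a standard stage k all data of an event are bounded by standard numbers: c by k, l by c,
    -- and z by the Y that `capPA` computes. Finitely many cases remain, and `noEvent` refutes each.
    bigStage : ∀ N {Γ m Y c l z} → Γ ⊩ F event (m ∷ Y ∷ E ∷ c ∷ l ∷ z ∷ []) → Γ ⊩ numeral N ≤' m
    bigStage N {Γ} {m} {Y} {c} {l} {z} p = split N m (λ k _ → small k) h0
      where
      small : ∀ k → (m ≐ numeral k) ∷ Γ ⊩ numeral N ≤' m
      small k = efq
        (le-cases k c (le-resp (≐refl c) h0 (wk (proj₁ (proj₂ q)))) λ c₀ _ →
         le-cases c₀ l (le-resp (≐refl l) h0 (wk (wk (proj₁ (proj₂ (proj₂ q)))))) λ l₀ _ →
         le-cases (proj₁ (capNum k)) z (le-resp (≐refl z) (wk (wk Yeq)) (wk (wk (wk (proj₁ (proj₂ (proj₂ (proj₂ q)))))))) λ z₀ _ →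
           false⇒ event (k ∷ proj₁ (capNum k) ∷ e* ∷ c₀ ∷ l₀ ∷ z₀ ∷ []) (noEvent k _ c₀ l₀ z₀) ·
           F-cong event {σ = m ∷ Y ∷ E ∷ c ∷ l ∷ z ∷ []} (h3 ∷ wk (wk (wk Yeq)) ∷ ≐sym E≐ ∷ h2 ∷ h1 ∷ h0 ∷ []) (wk (wk (wk (wk p)))))
        where
        q = eventE p
        Yeq : (m ≐ numeral k) ∷ Γ ⊩ Y ≐ numeral (proj₁ (capNum k))
        Yeq = capPA k (F-cong capL {σ = m ∷ Y ∷ []} (h0 ∷ ≐refl _ ∷ []) (wk (proj₁ q)))

    -- At a standard stage `proved` is decided, and where it is true φ really is a theorem of `T`.
    -- What is left is a stage beyond any prescribed standard bound.
    provedSplit : ∀ φ N {Γ m Y χ} → Γ ⊩ F proved (m ∷ Y ∷ E ∷ numeral ⌜ φ ⌝ ∷ []) → (T ⊢ φ → Γ ⊩ χ) →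
      (numeral N ≤' m) ∷ Γ ⊩ χ → Γ ⊩ χ
    provedSplit φ N {Γ} {m} {Y} {χ} p h g = split N m (λ k _ → small k) g
      where
      small : ∀ k → (m ≐ numeral k) ∷ Γ ⊩ χ
      small k with decD proved (k ∷ proj₁ (capNum k) ∷ e* ∷ ⌜ φ ⌝ ∷ [])
      ... | yes q = wk (h (proved-sound φ q))
      ... | no q = efq (false⇒ proved (k ∷ proj₁ (capNum k) ∷ e* ∷ ⌜ φ ⌝ ∷ []) q ·
              F-cong proved {σ = m ∷ Y ∷ E ∷ numeral ⌜ φ ⌝ ∷ []} (h0 ∷ Yeq ∷ ≐sym E≐ ∷ PWrefl) (wk p))
        where
        Yeq : (m ≐ numeral k) ∷ Γ ⊩ Y ≐ numeral (proj₁ (capNum k))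
        Yeq = capPA k (F-cong capL {σ = m ∷ Y ∷ []} (h0 ∷ ≐refl _ ∷ []) (wk (proj₁ (provedE p))))

    -- Pr is closed under a passage from φ to ψ performed uniformly at all large stages.
    prStep : ∀ φ ψ N → (T ⊢ φ → PA ⊢ Pr⟨ Pr ⟩ ψ) →
      (∀ {Γ m Y} → Γ ⊩ numeral N ≤' m → Γ ⊩ F proved (m ∷ Y ∷ E ∷ numeral ⌜ φ ⌝ ∷ []) → Γ ⊩ F proved (m ∷ Y ∷ E ∷ numeral ⌜ ψ ⌝ ∷ [])) →
      (∀ {Γ m c l z} → Γ ⊩ numeral N ≤' m → Γ ⊩ F frame (c ∷ []) → Γ ⊩ l ≤' c → Γ ⊩ F good (m ∷ E ∷ c ∷ z ∷ []) →
        Γ ⊩ F box (z ∷ c ∷ l ∷ numeral ⌜ φ ⌝ ∷ []) → Γ ⊩ F box (z ∷ c ∷ l ∷ numeral ⌜ ψ ⌝ ∷ [])) →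
      PA ⊢ Pr⟨ Pr ⟩ φ ⇒ Pr⟨ Pr ⟩ ψ
    prStep φ ψ N a b c = subst (PA ⊢_) (cong₂ _⇒_ (sym (Pr-inst ⌜ φ ⌝)) (sym (Pr-inst ⌜ ψ ⌝))) (unnd {[]} (ƛ
      (exUE provable (nE ⌜ φ ⌝) h0 λ _ n p → provableE p
        (λ _ m Y m≤ Y≤ q → provedSplit φ N q (λ t → thm (pr⊢ ⌜ ψ ⌝ (a t)))
          (exUI provable (nE ⌜ ψ ⌝) n (provableI₁ m Y (wk m≤) (wk Y≤) (b h0 (wk q)))))
        (λ _ q → laterE q λ _ m Y c' l z ev r → exUI provable (nE ⌜ ψ ⌝) n (provableI₂ (laterI ev
          (let e = eventE (firstEvent ev) in
           c (bigStage N (firstEvent ev)) (proj₁ (proj₂ (proj₂ (proj₂ (proj₂ e))))) (proj₁ (proj₂ (proj₂ e))) (proj₂ (proj₂ (proj₂ (proj₂ (proj₂ e))))) r)))))))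

    impStep : ∀ {φ ψ} → T ⊢ φ ⇒ ψ → Σ ℕ λ N → ∀ {Γ m k z} → Γ ⊩ numeral N ≤' m → Γ ⊩ F impClosed (m ∷ k ∷ z ∷ []) →
      Γ ⊩ F mem (z ∷ k ∷ numeral ⌜ φ ⌝ ∷ []) → Γ ⊩ F mem (z ∷ k ∷ numeral ⌜ ψ ⌝ ∷ [])
    impStep {φ} {ψ} p with imp-std p
    ... | u , h = u ⊔ (⌜ φ ⌝ ⊔ ⌜ ψ ⌝) , λ le q r → impClosedE q
      (le-down (≤-trans (m≤m⊔n ⌜ φ ⌝ ⌜ ψ ⌝) (m≤n⊔m u _)) le) (le-down (≤-trans (m≤n⊔m ⌜ φ ⌝ ⌜ ψ ⌝) (m≤n⊔m u _)) le)
      (h (le-down (m≤m⊔n u _) le)) r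

    -- Once the certificate of the implication lies below the stage, both the derived set and all
    -- components of a good family absorb it; boxes follow because neighbourhood semantics is
    -- monotone.
    prM : ∀ φ ψ → T ⊢ φ ⇒ ψ → PA ⊢ Pr⟨ Pr ⟩ φ ⇒ Pr⟨ Pr ⟩ ψ
    prM φ ψ p with impStep p
    ... | u , h = prStep φ ψ (u ⊔ ⌜ ψ ⌝) (λ t → pr-complete ψ (mp p t))
      (λ le q → let (a , b , c , d) = provedE q in provedI a b (le-down (m≤n⊔m u _) le)
        (clI λ w z z≤ i _ bs → h (le-down (m≤m⊔n u _) (w le)) i (clE (w d) z≤ bs)))
      (λ le _ _ g q → boxE q λ w t t≤ a f → boxI t t≤ a λ w' j j≤ b →
        h (le-down (m≤m⊔n u _) (w' (w le))) (∧₁ (∧₂ (goodE (w' (w g)) j≤))) (f w' j j≤ b))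

    prcStep : ∀ φ → Σ ℕ λ N → ∀ {Γ m} → Γ ⊩ numeral N ≤' m →
      (Γ ⊩ numeral ⌜ φ ⌝ ≤' m) × (Γ ⊩ numeral ⌜ Pr⟨ Pr ⟩ φ ⌝ ≤' m) × (Γ ⊩ F prc (m ∷ E ∷ numeral ⌜ φ ⌝ ∷ numeral ⌜ Pr⟨ Pr ⟩ φ ⌝ ∷ []))
    prcStep φ with prc-std ⌜ φ ⌝
    ... | u , h = u ⊔ (⌜ φ ⌝ ⊔ ⌜ Pr⟨ Pr ⟩ φ ⌝) , λ le →
      le-down (≤-trans (m≤m⊔n ⌜ φ ⌝ _) (m≤n⊔m u _)) le , le-down (≤-trans (m≤n⊔m ⌜ φ ⌝ _) (m≤n⊔m u _)) le , h (le-down (m≤m⊔n u _) le)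

    opaque
      unfolding frame trans4
      transE : L ≡ MNF → ∀ {Γ c a v χ} → Γ ⊩ F frame (c ∷ []) → Γ ⊩ a ≤' c → Γ ⊩ v ≤' c → Γ ⊩ F nbh (c ∷ a ∷ v ∷ []) →
        (∀ {Δ} → Γ ⊑ Δ → ∀ v' → Δ ⊩ v' ≤' c → Δ ⊩ F nbh (c ∷ a ∷ v' ∷ []) →
          (∀ {Θ χ} → Δ ⊑ Θ → ∀ k → Θ ⊩ k ≤' c → Θ ⊩ F elt (c ∷ v' ∷ k ∷ []) →
            (∀ {Λ} → Θ ⊑ Λ → ∀ v'' → Λ ⊩ v'' ≤' c → Λ ⊩ F nbh (c ∷ k ∷ v'' ∷ []) →
              (∀ {Ξ} → Λ ⊑ Ξ → ∀ j → Ξ ⊩ j ≤' c → Ξ ⊩ F elt (c ∷ v'' ∷ j ∷ []) → Ξ ⊩ F elt (c ∷ v ∷ j ∷ [])) → Λ ⊩ χ) → Θ ⊩ χ) →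
          Δ ⊩ χ) → Γ ⊩ χ
      transE eq {Γ} {c} {a} {v} p a≤ v≤ q h =
        exE d₃ (v ∷ a ∷ c ∷ []) (allE d₂ (a ∷ c ∷ []) (allE d₁ (c ∷ []) p' a a≤) v v≤ · q) λ w v' v'≤ r →
        h w v' v'≤ (∧₁ r) λ w₁ k k≤ s g →
        exE d₅ (k ∷ v' ∷ v ∷ a ∷ c ∷ []) (allE d₄ (v' ∷ v ∷ a ∷ c ∷ []) (w₁ (∧₂ r)) k k≤ · s) λ w₂ v'' v''≤ t →
        g w₂ v'' v''≤ (∧₁ t) λ w₃ j j≤ u → allE d₆ (v'' ∷ k ∷ v' ∷ v ∷ a ∷ c ∷ []) (w₃ (∧₂ t)) j j≤ · u
        where
        p' : Γ ⊩ F (trans4 MNF) (c ∷ [])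
        p' = subst (λ L → Γ ⊩ F (trans4 L) (c ∷ [])) eq (∧₂ p)
        conc : ∀ {n} → D n → D n
        conc (d ⊃ e) = e
        conc d = d
        d₁ : D 1
        d₁ = trans4 MNF
        d₂ : D 2
        d₂ = bdy d₁
        d₃ : D 3
        d₃ = conc (bdy d₂)
        d₄ : D 4
        d₄ = body (bdy d₃)
        d₅ : D 5
        d₅ = conc (bdy d₄)
        d₆ : D 6
        d₆ = body (bdy d₅)

    -- For derivations, closure under necessitation suffices. For a box, transitivity gives a
    -- neighbourhood of the same world at all of whose worlds φ is again boxed; `boxClosed` then
    -- puts `Pr φ` into their sets.
    pr4 : L ≡ MNF → ∀ φ → PA ⊢ Pr⟨ Pr ⟩ φ ⇒ Pr⟨ Pr ⟩ (Pr⟨ Pr ⟩ φ)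
    pr4 eq φ with prcStep φ
    ... | N , h = prStep φ (Pr⟨ Pr ⟩ φ) N (λ t → pr-complete _ (⊢-lift hPA (pr-complete φ t)))
      (λ le q → let (a , b , c , d) = provedE q ; (i , j , k) = h le in provedI a b j
        (clI λ w z z≤ _ n bs → necClosedE n (w i) (w j) (w k) (clE (w d) z≤ bs)))
      (λ le f l≤ g q → boxE q λ w t t≤ a m → transE eq (w f) (w l≤) t≤ a λ w₁ v' v'≤ b r → boxI v' v'≤ b λ w₂ k k≤ s →
        let (i , j , p) = h (w₂ (w₁ (w le))) in
        boxClosedE (∧₁ (∧₂ (∧₂ (goodE (w₂ (w₁ (w g))) k≤)))) i j p
          (r w₂ k k≤ s λ w₃ v'' v''≤ b' r' → boxI v'' v''≤ b' λ w₄ y y≤ s' → m (w₄ ∘ w₃ ∘ w₂ ∘ w₁) y y≤ (r' w₄ y y≤ s')))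

    module Truth (c : ℕ) (fr : ⟪ frame ⟫ (c ∷ [])) where

      f : MFm → Formula
      f = interp Pr atom

      Large : (Ctx → Term → Term → Set) → ℕ → Set
      Large P N = ∀ {Γ m z} → Γ ⊩ numeral N ≤' m → Γ ⊩ F good (m ∷ E ∷ numeral c ∷ z ∷ []) → P Γ m z

      seed : ∀ k → k ≤ c → ∀ {φ} → PA ⊢ State c k ⇒ φ → Σ ℕ (Large λ Γ m z → Γ ⊩ F mem (z ∷ numeral k ∷ numeral ⌜ φ ⌝ ∷ []))
      seed k k≤ p with sc-std c k | impStep (⊢-lift hPA p)
      ... | u , g | u' , h = (u ⊔ u') ⊔ ⌜ State c k ⌝ , λ le q → let e = goodE q (num≤ k≤) in
        h (le-down (≤-trans (m≤n⊔m u u') (m≤m⊔n (u ⊔ u') _)) le) (∧₁ (∧₂ e))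
          (seededE (∧₁ e) (le-down (m≤n⊔m (u ⊔ u') _) le) (g (le-down (≤-trans (m≤m⊔n u u') (m≤m⊔n (u ⊔ u') _)) le)))

      -- The implication is contraposed because coherence forbids only one sentence, the negated
      -- state: φ in the set of k would lead to it.
      contra : ∀ k → k ≤ c → ∀ {φ} → PA ⊢ State c k ⇒ ¬' φ → Σ ℕ (Large λ Γ m z → Γ ⊩ F mem (z ∷ numeral k ∷ numeral ⌜ φ ⌝ ∷ []) → Γ ⊩ ⊥')
      contra k k≤ {φ} p with nc-std c k | impStep (⊢-lift hPA p')
        where
        p' : PA ⊢ φ ⇒ NState c k
        p' = subst (λ ψ → PA ⊢ φ ⇒ ψ) (sym (NState-def c k)) (unnd {[]} (ƛ (ƛ (thm p · h0 · h1))))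
      ... | u , g | u' , h = (u ⊔ u') ⊔ ⌜ NState c k ⌝ , λ le q r → let e = goodE q (num≤ k≤) in
        coherentE (∧₂ (∧₂ (∧₂ e))) (le-down (m≤n⊔m (u ⊔ u') _) le) (g (le-down (≤-trans (m≤m⊔n u u') (m≤m⊔n (u ⊔ u') _)) le))
          (h (le-down (≤-trans (m≤n⊔m u u') (m≤m⊔n (u ⊔ u') _)) le) (∧₁ (∧₂ e)) r)

      Decided : ℕ → Formula → Set → Set
      Decided k φ P = (P → PA ⊢ State c k ⇒ φ) × (¬ P → PA ⊢ State c k ⇒ ¬' φ)

      opaque
        unfolding State
        stateE : ∀ {Γ k χ} → Γ ⊩ State c k → (∀ {Δ} → Γ ⊑ Δ → ∀ n m Y z → Ev Δ n m Y (numeral c) (numeral k) z → Δ ⊩ χ) → Γ ⊩ χ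
        stateE {k = k} p h = exUE declared (cong₂ _∷_ shift-E (cong₂ (λ a b → a ∷ b ∷ []) (shift-numeral c) (shift-numeral k))) p
          λ w n q → declaredE q λ w' m Y z e → h (w' ∘ w) n m Y z e

      opaque
        unfolding atom
        atom⇒ : ∀ {k} q → ⟪ val ⟫ (c ∷ k ∷ q ∷ []) → PA ⊢ State c k ⇒ atom q
        atom⇒ {k} q p = unnd {[]} (ƛ (stateE h0 λ w n m Y z e → exUI valued (nE q) n (valuedI e (true⇒ val (c ∷ k ∷ q ∷ []) p))))

        atom⇐ : ∀ {k} q → ¬ ⟪ val ⟫ (c ∷ k ∷ q ∷ []) → PA ⊢ State c k ⇒ ¬' (atom q)
        atom⇐ {k} q p = unnd {[]} (ƛ (ƛ (stateE h1 λ w n m Y z e → exUE valued (nE q) (w h0) λ w₁ n' r → valuedE r λ w₂ m' Y' c' l' z' e' s →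
          let (a , b , _) = ev-unique e' (evWk (w₂ ∘ w₁) e) in
          false⇒ val (c ∷ k ∷ q ∷ []) p · F-cong val {σ = c' ∷ l' ∷ numeral q ∷ []} (a ∷ b ∷ PWrefl) s)))

      -- In the case of `□`, the values already decided at the finitely many worlds are carried by
      -- `seed` and `contra` into every good family for c beyond a common threshold; the stage of
      -- the first event lies beyond it by `bigStage`.
      truth : ∀ A k → k ≤ c → Decided k (f A) (Force c k A)
      truth (pv q) k _ = atom⇒ q , atom⇐ q
      truth ⊥m k _ = (λ ()) , λ _ → unnd {[]} (ƛ (num≢ 0 1 λ ()))
      truth (A ⇒m B) k k≤ = pos , neg
        where
        pos : (Force c k A → Force c k B) → PA ⊢ State c k ⇒ f A ⇒ f B
        pos h with force? c k A | force? c k B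
        ... | _ | yes b = unnd {[]} (ƛ (ƛ (thm (proj₁ (truth B k k≤) b) · h1)))
        ... | yes a | no b = ⊥-elim (b (h a))
        ... | no a | no _ = unnd {[]} (ƛ (ƛ (efq (thm (proj₂ (truth A k k≤) a) · h1 · h0))))
        neg : ¬ (Force c k A → Force c k B) → PA ⊢ State c k ⇒ ¬' (f A ⇒ f B)
        neg h with force? c k A | force? c k B
        ... | _ | yes b = ⊥-elim (h λ _ → b)
        ... | no a | _ = ⊥-elim (h λ a' → ⊥-elim (a a'))
        ... | yes a | no b = unnd {[]} (ƛ (ƛ (thm (proj₂ (truth B k k≤) b) · h1 · (h0 · (thm (proj₁ (truth A k k≤) a) · h1)))))
      truth (□ A) k k≤ = pos , neg
        where
        x : Term
        x = numeral ⌜ f A ⌝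
        threshold : ∀ j → Dec (j ≤ c) → ℕ
        threshold j (no _) = 0
        threshold j (yes j≤) with force? c j A
        ... | yes a = proj₁ (seed j j≤ (proj₁ (truth A j j≤) a))
        ... | no a = proj₁ (contra j j≤ (proj₂ (truth A j j≤) a))
        N : ℕ
        -- Joining c makes c one of the models that `safe` speaks about at such a stage.
        N = maxUpTo (λ j → threshold j (j ≤? c)) c ⊔ c
        N≥ : ∀ j → j ≤ c → threshold j (j ≤? c) ≤ N
        N≥ j j≤ = ≤-trans (≤maxUpTo (λ j → threshold j (j ≤? c)) j≤) (m≤m⊔n _ _)
        yesMem : ∀ j → j ≤ c → Force c j A → Large (λ Γ m z → Γ ⊩ F mem (z ∷ numeral j ∷ x ∷ [])) N
        yesMem j j≤ a le g with j ≤? c | N≥ j j≤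
        ... | no n | _ = ⊥-elim (n j≤)
        ... | yes j≤' | N≥' with force? c j A
        ...   | yes a' = proj₂ (seed j j≤' (proj₁ (truth A j j≤') a')) (le-down N≥' le) g
        ...   | no n = ⊥-elim (n a)
        noMem : ∀ j → j ≤ c → ¬ Force c j A → Large (λ Γ m z → Γ ⊩ F mem (z ∷ numeral j ∷ x ∷ []) → Γ ⊩ ⊥') N
        noMem j j≤ a le g p with j ≤? c | N≥ j j≤
        ... | no n | _ = ⊥-elim (n j≤)
        ... | yes j≤' | N≥' with force? c j A
        ...   | yes a' = ⊥-elim (a a')
        ...   | no a' = proj₂ (contra j j≤' (proj₂ (truth A j j≤') a')) (le-down N≥' le) g p
        goodOf : ∀ {Γ n m Y c l z} → Ev Γ n m Y c l z → Γ ⊩ F good (m ∷ E ∷ c ∷ z ∷ [])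
        goodOf e = proj₂ (proj₂ (proj₂ (proj₂ (proj₂ (eventE (firstEvent e))))))
        pos : Force c k (□ A) → PA ⊢ State c k ⇒ Pr⟨ Pr ⟩ (f A)
        pos (v , v≤ , a , h) = subst (λ φ → PA ⊢ State c k ⇒ φ) (sym (Pr-inst ⌜ f A ⌝)) (unnd {[]} (ƛ (stateE h0 λ w n m Y z e →
          exUI provable (nE ⌜ f A ⌝) n (provableI₂ (laterI e (boxI (numeral v) (num≤ v≤) (true⇒ nbh (c ∷ k ∷ v ∷ []) a)
            λ w' j j≤ b → le-cases c j j≤ λ j₀ j₀≤ → inside j j₀ j₀≤ (evWk (wk ∘ w') e) (wk b)))))))
          where
          inside : ∀ {Γ n m Y z} j j₀ → j₀ ≤ c → Ev ((j ≐ numeral j₀) ∷ Γ) n m Y (numeral c) (numeral k) z →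
            (j ≐ numeral j₀) ∷ Γ ⊩ F elt (numeral c ∷ numeral v ∷ j ∷ []) → (j ≐ numeral j₀) ∷ Γ ⊩ F mem (z ∷ j ∷ x ∷ [])
          inside {z = z} j j₀ j₀≤ e b with decD elt (c ∷ v ∷ j₀ ∷ [])
          ... | no q = efq (false⇒ elt (c ∷ v ∷ j₀ ∷ []) q · F-cong elt {σ = numeral c ∷ numeral v ∷ j ∷ []} (≐refl _ ∷ ≐refl _ ∷ h0 ∷ []) b)
          ... | yes q = F-cong mem {σ = z ∷ numeral j₀ ∷ x ∷ []} (≐refl _ ∷ ≐sym h0 ∷ PWrefl)
                  (yesMem j₀ j₀≤ (h j₀ j₀≤ q) (bigStage N (firstEvent e)) (goodOf e))
        neg : ¬ Force c k (□ A) → PA ⊢ State c k ⇒ ¬' (Pr⟨ Pr ⟩ (f A))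
        neg h = subst (λ φ → PA ⊢ State c k ⇒ ¬' φ) (sym (Pr-inst ⌜ f A ⌝)) (unnd {[]} (ƛ (ƛ (stateE h1 λ w n m Y z e →
          exUE provable (nE ⌜ f A ⌝) (w h0) λ w₁ n' p → provableE p
            -- A derivation at a standard stage would make `f A` a theorem of `T` and so refute the
            -- state at `j₀`. At a large stage, `safe` supplies a good family for c with `f A` in
            -- the set of `j₀`, where it cannot be.
            (λ w₂ m' Y' _ _ q → provedSplit (f A) N q
              (λ t → ⊥-elim (state-con c j₀ j₀≤ fr (subst (T ⊢_) (sym (NState-def c j₀))
                (contrapose t (⊢-lift hPA (proj₂ (truth A j₀ j₀≤) j₀∉))))))
              (let (_ , s , y , d) = provedE (wk q) in safeE s (le-down (m≤n⊔m _ c) h0) (true⇒ frame (c ∷ []) fr) λ w₃ z' g u →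
                noMem j₀ j₀≤ j₀∉ (w₃ h0) g (u (w₃ y) (w₃ d) (num≤ j₀≤))))
            -- By uniqueness this is the event that declares the state, so the box is evaluated at
            -- the world k of c, and each neighbourhood of k contains a world where A fails.
            (λ w₂ q → laterE q λ w₃ m' Y' c' l' z' e' b →
              let (a₁ , a₂ , _) = ev-unique e' (evWk (w₃ ∘ w₂ ∘ w₁) e) in
              boxE (F-cong box {σ = z' ∷ c' ∷ l' ∷ x ∷ []} (≐refl _ ∷ a₁ ∷ a₂ ∷ PWrefl) b) λ w₄ v v≤ nb inc →
                le-cases c v v≤ λ v₀ v₀≤ → outside v₀ v₀≤
                  (F-cong nbh {σ = numeral c ∷ numeral k ∷ v ∷ []} (≐refl _ ∷ ≐refl _ ∷ h0 ∷ []) (wk nb))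
                  (bigStage N (firstEvent (evWk (wk ∘ w₄) e')))
                  (F-cong good {σ = m' ∷ E ∷ c' ∷ z' ∷ []} (≐refl _ ∷ ≐refl _ ∷ wk (w₄ a₁) ∷ PWrefl) (goodOf (evWk (wk ∘ w₄) e')))
                  λ j j≤ r → inc wk (numeral j) (num≤ j≤) (F-cong elt {σ = numeral c ∷ numeral v₀ ∷ numeral j ∷ []} (≐refl _ ∷ ≐sym h0 ∷ PWrefl) r))))))
          where
          contrapose : ∀ {φ} {ψ} → T ⊢ φ → T ⊢ ψ ⇒ ¬' φ → T ⊢ ¬' ψ
          contrapose p q = mp (mp axS q) (mp axK p)
          out : ∀ v → v ≤ c → ⟪ nbh ⟫ (c ∷ k ∷ v ∷ []) → Σ ℕ λ j → j ≤ c × (⟪ elt ⟫ (c ∷ v ∷ j ∷ []) × ¬ Force c j A)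
          out v v≤ q with any≤? c (λ j → decD elt (c ∷ v ∷ j ∷ []) ×-dec (force? c j A →-dec no id))
          ... | yes r = r
          ... | no r = ⊥-elim (h (v , v≤ , q , λ j j≤ i → st j j≤ i (force? c j A)))
            where
            st : ∀ j → j ≤ c → ⟪ elt ⟫ (c ∷ v ∷ j ∷ []) → Dec (Force c j A) → Force c j A
            st j j≤ i (yes a) = a
            st j j≤ i (no a) = ⊥-elim (r (j , j≤ , i , a))
          some : Σ ℕ λ j → j ≤ c × (¬ Force c j A)
          some with frame-serial fr k≤
          ... | v , v≤ , q with out v v≤ q
          ...   | j , j≤ , _ , a = j , j≤ , a
          j₀ : ℕ
          j₀ = proj₁ some
          j₀≤ : j₀ ≤ c
          j₀≤ = proj₁ (proj₂ some)
          j₀∉ : ¬ Force c j₀ A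
          j₀∉ = proj₂ (proj₂ some)
          outside : ∀ {Γ m z} v₀ → v₀ ≤ c → Γ ⊩ F nbh (numeral c ∷ numeral k ∷ numeral v₀ ∷ []) → Γ ⊩ numeral N ≤' m →
            Γ ⊩ F good (m ∷ E ∷ numeral c ∷ z ∷ []) →
            (∀ j → j ≤ c → Γ ⊩ F elt (numeral c ∷ numeral v₀ ∷ numeral j ∷ []) → Γ ⊩ F mem (z ∷ numeral j ∷ x ∷ [])) → Γ ⊩ ⊥'
          outside v₀ v₀≤ nb le g inc with decD nbh (c ∷ k ∷ v₀ ∷ [])
          ... | no q = false⇒ nbh (c ∷ k ∷ v₀ ∷ []) q · nb
          ... | yes q with out v₀ v₀≤ q
          ...   | j , j≤ , i , a = noMem j j≤ a le g (inc j j≤ (true⇒ elt (c ∷ v₀ ∷ j ∷ []) i))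

-- Injectivity of the Gödel numbering

tri-mono : ∀ {m n} → m ≤ n → tri m ≤ tri n
tri-mono z≤n = z≤n
tri-mono (s≤s p) = s≤s (+-mono-≤ p (tri-mono p))

pair-sum : ∀ a b a' b' → pair a b ≡ pair a' b' → ¬ (a + b < a' + b')
pair-sum a b a' b' e p = <-irrefl e (<-≤-trans
  (subst (pair a b <_) (+-comm (tri (a + b)) (suc (a + b))) (+-monoʳ-< (tri (a + b)) (s≤s (m≤n+m b a))))
  (≤-trans (tri-mono p) (m≤m+n _ b')))

pair-inj : ∀ a b a' b' → pair a b ≡ pair a' b' → a ≡ a' × b ≡ b'
pair-inj a b a' b' e with <-cmp (a + b) (a' + b')
... | tri< p _ _ = ⊥-elim (pair-sum a b a' b' e p)
... | tri> _ _ p = ⊥-elim (pair-sum a' b' a b (sym e) p)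
... | tri≈ _ q _ = +-cancelʳ-≡ b a a' (trans q (cong (a' +_) (sym bb))) , bb
  where
  bb : b ≡ b'
  bb = +-cancelˡ-≡ (tri (a' + b')) b b' (trans (cong (λ s → tri s + b) (sym q)) e)

-- An opaque copy of the pairing function: unification then never unfolds Gödel numbers.
opaque
  pr : ℕ → ℕ → ℕ
  pr = pair

  pr≡pair : ∀ a b → pr a b ≡ pair a b
  pr≡pair a b = refl

  pr-inj : ∀ {a b a' b'} → pr a b ≡ pr a' b' → a ≡ a' × b ≡ b'
  pr-inj {a} {b} {a'} {b'} = pair-inj a b a' b'

pr-inj₂ : ∀ {a b a' b'} → pr a b ≡ pr a' b' → b ≡ b'
pr-inj₂ e = proj₂ (pr-inj e)

clash : ∀ {A : Set} {i a j b} {i≢j : False (i ≟ j)} → pr i a ≡ pr j b → A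
clash {i≢j = i≢j} e = ⊥-elim (toWitnessFalse i≢j (proj₁ (pr-inj e)))

termCode : Term → ℕ
termCode (var n) = pr 0 n
termCode zer = pr 1 0
termCode (suc' t) = pr 2 (termCode t)
termCode (t ⊕ s) = pr 3 (pr (termCode t) (termCode s))
termCode (t ⊗ s) = pr 4 (pr (termCode t) (termCode s))

code : Formula → ℕ
code ⊥' = pr 0 0
code (t ≐ s) = pr 1 (pr (termCode t) (termCode s))
code (φ ⇒ ψ) = pr 2 (pr (code φ) (code ψ))
code (∀' φ) = pr 3 (code φ)

pr-cong : ∀ a {b b'} → b ≡ b' → pr a b ≡ pair a b'
pr-cong a refl = pr≡pair a _

pr-cong₂ : ∀ {a a' b b'} → a ≡ a' → b ≡ b' → pr a b ≡ pair a' b'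
pr-cong₂ refl refl = pr≡pair _ _

termCode≡ : ∀ t → termCode t ≡ codeT t
termCode≡ (var n) = pr≡pair 0 n
termCode≡ zer = pr≡pair 1 0
termCode≡ (suc' t) = pr-cong 2 (termCode≡ t)
termCode≡ (t ⊕ s) = pr-cong 3 (pr-cong₂ (termCode≡ t) (termCode≡ s))
termCode≡ (t ⊗ s) = pr-cong 4 (pr-cong₂ (termCode≡ t) (termCode≡ s))

code≡ : ∀ φ → code φ ≡ ⌜ φ ⌝
code≡ ⊥' = pr≡pair 0 0
code≡ (t ≐ s) = pr-cong 1 (pr-cong₂ (termCode≡ t) (termCode≡ s))
code≡ (φ ⇒ ψ) = pr-cong 2 (pr-cong₂ (code≡ φ) (code≡ ψ))
code≡ (∀' φ) = pr-cong 3 (code≡ φ)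

termCode-inj : ∀ t t' → termCode t ≡ termCode t' → t ≡ t'
termCode-inj (var n) (var n') e = cong var (pr-inj₂ e)
termCode-inj (var n) zer e = clash e
termCode-inj (var n) (suc' t') e = clash e
termCode-inj (var n) (t' ⊕ s') e = clash e
termCode-inj (var n) (t' ⊗ s') e = clash e
termCode-inj zer (var n') e = clash e
termCode-inj zer zer e = refl
termCode-inj zer (suc' t') e = clash e
termCode-inj zer (t' ⊕ s') e = clash e
termCode-inj zer (t' ⊗ s') e = clash e
termCode-inj (suc' t) (var n') e = clash e
termCode-inj (suc' t) zer e = clash e
termCode-inj (suc' t) (suc' t') e = cong suc' (termCode-inj t t' (pr-inj₂ e))
termCode-inj (suc' t) (t' ⊕ s') e = clash e
termCode-inj (suc' t) (t' ⊗ s') e = clash e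
termCode-inj (t ⊕ s) (var n') e = clash e
termCode-inj (t ⊕ s) zer e = clash e
termCode-inj (t ⊕ s) (suc' t') e = clash e
termCode-inj (t ⊕ s) (t' ⊕ s') e = let (a , b) = pr-inj (pr-inj₂ e) in cong₂ _⊕_ (termCode-inj t t' a) (termCode-inj s s' b)
termCode-inj (t ⊕ s) (t' ⊗ s') e = clash e
termCode-inj (t ⊗ s) (var n') e = clash e
termCode-inj (t ⊗ s) zer e = clash e
termCode-inj (t ⊗ s) (suc' t') e = clash e
termCode-inj (t ⊗ s) (t' ⊕ s') e = clash e
termCode-inj (t ⊗ s) (t' ⊗ s') e = let (a , b) = pr-inj (pr-inj₂ e) in cong₂ _⊗_ (termCode-inj t t' a) (termCode-inj s s' b)

code-inj : ∀ φ φ' → code φ ≡ code φ' → φ ≡ φ'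
code-inj ⊥' ⊥' e = refl
code-inj ⊥' (t' ≐ s') e = clash e
code-inj ⊥' (φ' ⇒ ψ') e = clash e
code-inj ⊥' (∀' φ') e = clash e
code-inj (t ≐ s) ⊥' e = clash e
code-inj (t ≐ s) (t' ≐ s') e = let (a , b) = pr-inj (pr-inj₂ e) in cong₂ _≐_ (termCode-inj t t' a) (termCode-inj s s' b)
code-inj (t ≐ s) (φ' ⇒ ψ') e = clash e
code-inj (t ≐ s) (∀' φ') e = clash e
code-inj (φ ⇒ ψ) ⊥' e = clash e
code-inj (φ ⇒ ψ) (t' ≐ s') e = clash e
code-inj (φ ⇒ ψ) (φ' ⇒ ψ') e = let (a , b) = pr-inj (pr-inj₂ e) in cong₂ _⇒_ (code-inj φ φ' a) (code-inj ψ ψ' b)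
code-inj (φ ⇒ ψ) (∀' φ') e = clash e
code-inj (∀' φ) ⊥' e = clash e
code-inj (∀' φ) (t' ≐ s') e = clash e
code-inj (∀' φ) (φ' ⇒ ψ') e = clash e
code-inj (∀' φ) (∀' φ') e = cong ∀' (code-inj φ φ' (pr-inj₂ e))

⌜⌝-inj : ∀ φ φ' → ⌜ φ ⌝ ≡ ⌜ φ' ⌝ → φ ≡ φ'
⌜⌝-inj φ φ' e = code-inj φ φ' (trans (code≡ φ) (trans e (sym (code≡ φ'))))

-- Saturation of finite sets

Fam : Set
Fam = ℕ → ℕ → Bool

_⊆_ : Fam → Fam → Set
X ⊆ X' = ∀ k x → X k x ≡ true → X' k x ≡ true

sumTo : (ℕ → ℕ) → ℕ → ℕ
sumTo f zero = f 0
sumTo f (suc n) = f (suc n) + sumTo f n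

sumTo-mono : ∀ {f g} → (∀ k → f k ≤ g k) → ∀ n → sumTo f n ≤ sumTo g n
sumTo-mono h zero = h 0
sumTo-mono h (suc n) = +-mono-≤ (h (suc n)) (sumTo-mono h n)

sumTo-strict : ∀ {f g} → (∀ k → f k ≤ g k) → ∀ {k n} → k ≤ n → f k < g k → sumTo f n < sumTo g n
sumTo-strict h {n = zero} z≤n p = p
sumTo-strict h {k} {suc n} q p with m≤n⇒m<n∨m≡n q
... | inj₁ (s≤s r) = +-mono-≤-< (h (suc n)) (sumTo-strict h r p)
... | inj₂ refl = +-mono-<-≤ p (sumTo-mono h n)

absent : Bool → ℕ
absent true = 0
absent false = 1

missing : ℕ → ℕ → Fam → ℕ
missing c b X = sumTo (λ k → sumTo (λ x → absent (X k x)) b) c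

absent-mono : ∀ {p q} → (p ≡ true → q ≡ true) → absent q ≤ absent p
absent-mono {true} h rewrite h refl = z≤n
absent-mono {false} {true} h = z≤n
absent-mono {false} {false} h = ≤-refl

missing-< : ∀ {c b X X'} → X ⊆ X' → ∀ {k x} → k ≤ c → x ≤ b → X k x ≡ false → X' k x ≡ true → missing c b X' < missing c b X
missing-< {b = b} {X} {X'} s {k} {x} k≤ x≤ p q = sumTo-strict (λ k → sumTo-mono (λ x → absent-mono (s k x)) b) k≤
  (sumTo-strict (λ x → absent-mono (s k x)) x≤ (subst₂ (λ u v → absent u < absent v) (sym q) (sym p) ≤-refl))

module _ (Inv : Fam → Set) (Rule : Fam → ℕ → ℕ → Set) (Rule? : ∀ X k x → Dec (Rule X k x)) (c b : ℕ)
  (step : ∀ X → Inv X → ∀ k x → k ≤ c → x ≤ b → Rule X k x → Σ Fam λ X' → X ⊆ X' × X' k x ≡ true × Inv X') where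

  -- Each step strictly lowers `missing`, the number of absent pairs in the finite rectangle. The
  -- step is supplied by the caller because it may have to add further elements to restore the
  -- invariant.
  saturate : ∀ X → Inv X → Σ Fam λ X' → X ⊆ X' × Inv X' × (∀ k x → k ≤ c → x ≤ b → Rule X' k x → X' k x ≡ true)
  saturate X i = go (missing c b X) X i ≤-refl
    where
    go : ∀ n X → Inv X → missing c b X ≤ n → Σ Fam λ X' → X ⊆ X' × Inv X' × (∀ k x → k ≤ c → x ≤ b → Rule X' k x → X' k x ≡ true)
    go n X i le with any≤? c (λ k → any≤? b λ x → Rule? X k x ×-dec (X k x Bool.≟ false))
    ... | no h = X , (λ _ _ p → p) , i , λ k x k≤ x≤ r → Bool.¬-not λ q → h (k , k≤ , x , x≤ , r , q)
    ... | yes (k , k≤ , x , x≤ , r , q) with step X i k x k≤ x≤ r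
    go zero X i le | yes (k , k≤ , x , x≤ , r , q) | X' , s , p , i' = ⊥-elim (n≮0 (<-≤-trans (missing-< {c} {b} s k≤ x≤ q p) le))
    go (suc n) X i le | yes (k , k≤ , x , x≤ , r , q) | X' , s , p , i' with go n X' i' (s≤s⁻¹ (≤-trans (missing-< {c} {b} s k≤ x≤ q p) le))
    ... | X'' , s' , rest = X'' , (λ k x → s' k x ∘ s k x) , rest

data Reach (b : ℕ) (S : ℕ → Set) (R : ℕ → ℕ → Set) : ℕ → Set where
  start : ∀ {x} → x ≤ b → S x → Reach b S R x
  next  : ∀ {x y} → Reach b S R x → R x y → y ≤ b → Reach b S R y

reach≤ : ∀ {b S R x} → Reach b S R x → x ≤ b
reach≤ (start p _) = p
reach≤ (next _ _ p) = p

module _ (b : ℕ) {S : ℕ → Set} {R : ℕ → ℕ → Set} (S? : ∀ x → Dec (S x)) (R? : ∀ x y → Dec (R x y)) where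

  private
    Rule : Fam → ℕ → ℕ → Set
    Rule X k y = S y ⊎ Σ ℕ λ x → x ≤ b × (X 0 x ≡ true × R x y)

    Sound : Fam → Set
    Sound X = ∀ k x → X k x ≡ true → Reach b S R x

    add : Fam → ℕ → Fam
    add X y k x = X k x ∨ ⌊ x ≟ y ⌋

    full : Σ Fam λ X' → (λ _ _ → false) ⊆ X' × Sound X' × (∀ k x → k ≤ 0 → x ≤ b → Rule X' k x → X' k x ≡ true)
    full = saturate Sound Rule (λ X k y → S? y ⊎-dec any≤? b λ x → (X 0 x Bool.≟ true) ×-dec R? x y) 0 b
      (λ X i k y k≤ y≤ r → add X y , (λ k x p → cong (_∨ ⌊ x ≟ y ⌋) p) , trans (cong (X k y ∨_) (yes-refl y)) (Bool.∨-zeroʳ _) , new X i y y≤ r)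
      (λ _ _ → false) (λ _ _ ())
      where
      yes-refl : ∀ y → ⌊ y ≟ y ⌋ ≡ true
      yes-refl y with y ≟ y
      ... | yes _ = refl
      ... | no n = ⊥-elim (n refl)
      new : ∀ X → Sound X → ∀ y → y ≤ b → S y ⊎ (Σ ℕ λ x → x ≤ b × (X 0 x ≡ true × R x y)) → Sound (add X y)
      new X i y y≤ r k x p with X k x in eq | x ≟ y
      new X i y y≤ r k x p | true | _ = i k x eq
      new X i y y≤ (inj₁ s) k .y p | false | yes refl = start y≤ s
      new X i y y≤ (inj₂ (x' , _ , q , t)) k .y p | false | yes refl = next (i 0 x' q) t y≤

  reachSet : ℕ → Bool
  reachSet = proj₁ full 0

  reachSet-sound : ∀ {x} → reachSet x ≡ true → Reach b S R x
  reachSet-sound = proj₁ (proj₂ (proj₂ full)) 0 _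

  reachSet-complete : ∀ {x} → Reach b S R x → reachSet x ≡ true
  reachSet-complete (start p s) = proj₂ (proj₂ (proj₂ full)) 0 _ z≤n p (inj₁ s)
  reachSet-complete (next r t p) = proj₂ (proj₂ (proj₂ full)) 0 _ z≤n p (inj₂ (_ , reach≤ r , reachSet-complete r , t))

pairing-≤₁ : ∀ a b → a ≤ pairing a b
pairing-≤₁ a b = ≤-trans (sq (a + b) (m≤m+n a b)) (m≤m+n _ b)
  where
  sq : ∀ s → a ≤ s → a ≤ s * s
  sq zero p = p
  sq (suc s) p = ≤-trans p (m≤m+n (suc s) (s * suc s))

pairing-≤₂ : ∀ a b → b ≤ pairing a b
pairing-≤₂ a b = m≤n+m b _

pairing-inj : ∀ a b a' b' → pairing a b ≡ pairing a' b' → a ≡ a' × b ≡ b'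
pairing-inj a b a' b' e = +-cancelʳ-≡ b a a' (trans ss (cong (a' +_) (sym bb))) , bb
  where
  lt : ∀ s t x y → x ≤ s → s < t → s * s + x < t * t + y
  lt s t x y x≤ s<t = <-≤-trans (s≤s (+-monoʳ-≤ (s * s) x≤)) (≤-trans
    (≤-trans (s≤s (≤-trans (≤-reflexive (trans (+-comm (s * s) s) (sym (*-suc s s)))) (m≤n+m (s * suc s) s))) ≤-refl)
    (≤-trans (*-mono-≤ s<t s<t) (m≤m+n (t * t) y)))
  ss : a + b ≡ a' + b'
  ss with ≤-<-connex (a + b) (a' + b') | ≤-<-connex (a' + b') (a + b)
  ... | inj₁ p | inj₁ q = ≤-antisym p q
  ... | inj₂ p | _ = ⊥-elim (<-irrefl (sym e) (lt (a' + b') (a + b) b' b (m≤n+m b' a') p))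
  ... | inj₁ _ | inj₂ q = ⊥-elim (<-irrefl e (lt (a + b) (a' + b') b b' (m≤n+m b a) q))
  bb : b ≡ b'
  bb = +-cancelˡ-≡ ((a' + b') * (a' + b')) b b' (trans (cong (λ s → s * s + b) (sym ss)) e)

-- The formulas in the standard model; absence of events

module Reality (L : Logic) {T : Theory} (K : Kit T) (hPA : ExtendsPA T) (con : Consistent T) where
  open Kit K
  open Theorems L K hPA public

  Th : ℕ → Set
  Th x = Σ Formula λ φ → x ≡ ⌜ φ ⌝ × (T ⊢ φ)

  Th⇒ : ∀ φ → Th ⌜ φ ⌝ → T ⊢ φ
  Th⇒ φ (ψ , e , p) = subst (T ⊢_) (sym (⌜⌝-inj φ ψ e)) p

  opaque
    unfolding imp
    imp-mono : ∀ {m m' x w} → m ≤ m' → ⟪ imp ⟫ (m ∷ x ∷ w ∷ []) → ⟪ imp ⟫ (m' ∷ x ∷ w ∷ [])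
    imp-mono p (u , u≤ , q) = u , ≤-trans u≤ p , q

    imp-Th : ∀ {m x w} → ⟪ imp ⟫ (m ∷ x ∷ w ∷ []) → Th x → Th w
    imp-Th (u , _ , q) (χ , e , t) with cert-sound q
    ... | φ , ψ , refl , ex , p = ψ , ex , mp p (subst (T ⊢_) (sym (⌜⌝-inj φ χ e)) t)

    imp-true : ∀ {φ ψ} → T ⊢ φ ⇒ ψ → Σ ℕ λ N → ∀ m → N ≤ m → ⟪ imp ⟫ (m ∷ ⌜ φ ⌝ ∷ ⌜ ψ ⌝ ∷ [])
    imp-true p with cert-complete p
    ... | u , q = u , λ m le → u , le , q

  opaque
    unfolding prc

    prc-< : ∀ {m x w} → ⟪ prc ⟫ (m ∷ e* ∷ x ∷ w ∷ []) → suc x ≤ m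
    prc-< ((t , t≤ , r) , _) = subst (_≤ _) r t≤

    prc-code : ∀ {m x w} → ⟪ prc ⟫ (m ∷ e* ∷ x ∷ w ∷ []) → w ≡ ⌜ Pr [ numeral x ] ⌝
    prc-code {x = x} {w} (_ , (u , u≤ , q)) = trans (pcert-sound P̂ Ŝ (subst (λ e → ⟪ pcert ⟫ (u ∷ e ∷ x ∷ w ∷ [])) e*-def q))
      (cong ⌜_⌝ (trans (cong (close2 P̂ x) (sym e*-def)) (close-P̂ x)))

  opaque
    unfolding sc
    sc-mono : ∀ {m m' c k w} → m ≤ m' → ⟪ sc ⟫ (m ∷ e* ∷ c ∷ k ∷ w ∷ []) → ⟪ sc ⟫ (m' ∷ e* ∷ c ∷ k ∷ w ∷ [])
    sc-mono p (u , u≤ , q) = u , ≤-trans u≤ p , q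

    sc-code : ∀ {m c k w} → ⟪ sc ⟫ (m ∷ e* ∷ c ∷ k ∷ w ∷ []) → w ≡ ⌜ State c k ⌝
    sc-code {c = c} {k} {w} (u , u≤ , q) = trans (scert-sound P̂ Ŝ (subst (λ e → ⟪ scert ⟫ (u ∷ e ∷ c ∷ k ∷ w ∷ [])) e*-def q))
      (cong ⌜_⌝ (trans (cong (close3 Ŝ c k) (sym e*-def)) (close-Ŝ c k)))

  opaque
    unfolding nc
    nc-mono : ∀ {m m' c k w} → m ≤ m' → ⟪ nc ⟫ (m ∷ e* ∷ c ∷ k ∷ w ∷ []) → ⟪ nc ⟫ (m' ∷ e* ∷ c ∷ k ∷ w ∷ [])
    nc-mono p ((t , t≤ , r) , (u , u≤ , q)) = (t , ≤-trans t≤ p , r) , (u , ≤-trans u≤ p , q)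

    nc-< : ∀ {m c k w} → ⟪ nc ⟫ (m ∷ e* ∷ c ∷ k ∷ w ∷ []) → suc c ≤ m
    nc-< ((t , t≤ , r) , _) = subst (_≤ _) r t≤

    nc-code : ∀ {m c k w} → ⟪ nc ⟫ (m ∷ e* ∷ c ∷ k ∷ w ∷ []) → w ≡ ⌜ NState c k ⌝
    nc-code {c = c} {k} {w} (_ , (u , u≤ , q)) = trans (ncert-sound P̂ Ŝ (subst (λ e → ⟪ ncert ⟫ (u ∷ e ∷ c ∷ k ∷ w ∷ [])) e*-def q))
      (cong ⌜_⌝ (trans (cong ¬' (trans (cong (close3 Ŝ c k) (sym e*-def)) (close-Ŝ c k))) (sym (NState-def c k))))

    nc-true : ∀ c k → Σ ℕ λ N → ∀ m → N ≤ m → ⟪ nc ⟫ (m ∷ e* ∷ c ∷ k ∷ ⌜ NState c k ⌝ ∷ [])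
    nc-true c k with ncert-complete P̂ Ŝ c k
    ... | u , q = suc c ⊔ u , λ m le → (suc c , ≤-trans (m≤m⊔n (suc c) u) le , refl) , (u , ≤-trans (m≤n⊔m (suc c) u) le ,
      subst₂ (λ e φ → ⟪ ncert ⟫ (u ∷ e ∷ c ∷ k ∷ ⌜ φ ⌝ ∷ [])) (sym e*-def)
        (trans (cong ¬' (trans (cong (close3 Ŝ c k) (sym e*-def)) (close-Ŝ c k))) (sym (NState-def c k))) q)

  Box : Fam → ℕ → ℕ → ℕ → Set
  Box X c k x = Σ ℕ λ v → v ≤ c × (⟪ nbh ⟫ (c ∷ k ∷ v ∷ []) × (∀ j → j ≤ c → ⟪ elt ⟫ (c ∷ v ∷ j ∷ []) → X j x ≡ true))

  -- Goodness without the closure under boxes. That closure is the only condition linking different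
  -- worlds, and it is reached afterwards by saturation.
  record Pre (m c : ℕ) (X : Fam) : Set where
    field
      seeds : ∀ k → k ≤ c → ∀ w → w ≤ m → (w ≡ 3 ⊎ ⟪ sc ⟫ (m ∷ e* ∷ c ∷ k ∷ w ∷ [])) → X k w ≡ true
      imps  : ∀ k → k ≤ c → ∀ x → x ≤ m → ∀ w → w ≤ m → ⟪ imp ⟫ (m ∷ x ∷ w ∷ []) → X k x ≡ true → X k w ≡ true
      coh   : ∀ k → k ≤ c → ∀ w → w ≤ m → ⟪ nc ⟫ (m ∷ e* ∷ c ∷ k ∷ w ∷ []) → ¬ (X k w ≡ true)
  open Pre

  BoxClosed : ℕ → ℕ → Fam → Set
  BoxClosed m c X = ∀ k → k ≤ c → ∀ w → w ≤ m → (Σ ℕ λ x → x ≤ m × (⟪ prc ⟫ (m ∷ e* ∷ x ∷ w ∷ []) × Box X c k x)) → X k w ≡ true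

  Codes : ℕ → ℕ → Fam → Set
  Codes b z X = ∀ k x → k ≤ b → x ≤ b → ⟪ mem ⟫ (z ∷ k ∷ x ∷ []) ⇔ (X k x ≡ true)

  codeOf : ∀ {m Y} → ⟪ capL ⟫ (m ∷ Y ∷ []) → ∀ X → Σ ℕ λ z → z ≤ Y × Codes (suc m) z X
  codeOf p X = cap-codes (capL-Cap p) X

  private
    to' : ∀ {m z X} → Codes (suc m) z X → ∀ {k x} → k ≤ m → x ≤ suc m → ⟪ mem ⟫ (z ∷ k ∷ x ∷ []) → X k x ≡ true
    to' e k≤ x≤ = Equivalence.to (e _ _ (≤-trans k≤ (n≤1+n _)) x≤)
    from' : ∀ {m z X} → Codes (suc m) z X → ∀ {k x} → k ≤ m → x ≤ suc m → X k x ≡ true → ⟪ mem ⟫ (z ∷ k ∷ x ∷ [])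
    from' e k≤ x≤ = Equivalence.from (e _ _ (≤-trans k≤ (n≤1+n _)) x≤)

  opaque
    unfolding box
    box⇒ : ∀ {m c z X k x} → c ≤ m → Codes (suc m) z X → x ≤ suc m → ⟪ box ⟫ (z ∷ c ∷ k ∷ x ∷ []) → Box X c k x
    box⇒ c≤ e x≤ (v , v≤ , a , h) = v , v≤ , a , λ j j≤ i → to' e (≤-trans j≤ c≤) x≤ (h j j≤ i)

    box⇐ : ∀ {m c z X k x} → c ≤ m → Codes (suc m) z X → x ≤ suc m → Box X c k x → ⟪ box ⟫ (z ∷ c ∷ k ∷ x ∷ [])
    box⇐ c≤ e x≤ (v , v≤ , a , h) = v , v≤ , a , λ j j≤ i → from' e (≤-trans j≤ c≤) x≤ (h j j≤ i)

  opaque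
    unfolding good seeded impClosed boxClosed coherent
    good⇐ : ∀ {m c z X} → c ≤ m → Codes (suc m) z X → Pre m c X → BoxClosed m c X → ⟪ good ⟫ (m ∷ e* ∷ c ∷ z ∷ [])
    good⇐ {m} {c} c≤ e p b k k≤ =
      (λ w w≤ s → from' e k≤m (up w≤) (seeds p k k≤ w w≤ s)) ,
      (λ x x≤ w w≤ i q → from' e k≤m (up w≤) (imps p k k≤ x x≤ w w≤ i (to' e k≤m (up x≤) q))) ,
      (λ x x≤ w w≤ r q → from' e k≤m (up w≤) (b k k≤ w w≤ (x , x≤ , r , box⇒ c≤ e (up x≤) q))) ,
      (λ w w≤ n q → coh p k k≤ w w≤ n (to' e k≤m (up w≤) q))
      where
      k≤m : k ≤ m
      k≤m = ≤-trans k≤ c≤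
      up : ∀ {x} → x ≤ m → x ≤ suc m
      up p = ≤-trans p (n≤1+n m)

  Root : ℕ → ℕ → ℕ → (ℕ → Set) → ℕ → Set
  Root m c l η r = (r ≡ 3 ⊎ ⟪ sc ⟫ (suc m ∷ e* ∷ c ∷ l ∷ r ∷ [])) ⊎ Σ ℕ λ x → x ≤ m × (⟪ prc ⟫ (suc m ∷ e* ∷ x ∷ r ∷ []) × η x)

  Imp : ℕ → ℕ → ℕ → Set
  Imp m x w = ⟪ imp ⟫ (m ∷ x ∷ w ∷ [])

  imp? : ∀ m x w → Dec (Imp m x w)
  imp? m x w = decD imp _

  opaque
    unfolding conflict root impClosed
    conflict⇐ : ∀ {m Y c l z r n} → Root m c l (λ x → ⟪ box ⟫ (z ∷ c ∷ l ∷ x ∷ [])) r → ⟪ nc ⟫ (suc m ∷ e* ∷ c ∷ l ∷ n ∷ []) →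
      Reach (suc m) (_≡ r) (Imp (suc m)) n → ⟪ conflict ⟫ (m ∷ Y ∷ e* ∷ c ∷ l ∷ z ∷ [])
    conflict⇐ {m} {Y} {c} {l} {z} {r} {n} rt q p = r , first≤ p , rt' rt , n , reach≤ p , q , λ Z _ a h → along Z a h p
      where
      rt' : Root m c l (λ x → ⟪ box ⟫ (z ∷ c ∷ l ∷ x ∷ [])) r → ⟪ root ⟫ (m ∷ e* ∷ c ∷ l ∷ z ∷ r ∷ [])
      rt' (inj₁ (inj₁ a)) = inj₁ a
      rt' (inj₁ (inj₂ a)) = inj₂ (inj₁ a)
      rt' (inj₂ a) = inj₂ (inj₂ a)
      first≤ : ∀ {n} → Reach (suc m) (_≡ r) (Imp (suc m)) n → r ≤ suc m
      first≤ (start p refl) = p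
      first≤ (next p _ _) = first≤ p
      along : ∀ Z → ⟪ mem ⟫ (Z ∷ 0 ∷ r ∷ []) → ⟪ impClosed ⟫ (suc m ∷ 0 ∷ Z ∷ []) → ∀ {n} → Reach (suc m) (_≡ r) (Imp (suc m)) n → ⟪ mem ⟫ (Z ∷ 0 ∷ n ∷ [])
      along Z a h (start _ refl) = a
      along Z a h (next p i n≤) = h _ (reach≤ p) _ n≤ i (along Z a h p)

    conflict⇒ : ∀ {m Y c l z} → ⟪ capL ⟫ (m ∷ Y ∷ []) → ⟪ conflict ⟫ (m ∷ Y ∷ e* ∷ c ∷ l ∷ z ∷ []) →
      Σ ℕ λ r → Σ ℕ λ n → Root m c l (λ x → ⟪ box ⟫ (z ∷ c ∷ l ∷ x ∷ [])) r × (⟪ nc ⟫ (suc m ∷ e* ∷ c ∷ l ∷ n ∷ []) × Reach (suc m) (_≡ r) (Imp (suc m)) n)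
    -- The set of elements reachable from r is itself closed and has a code up to Y, so testing
    -- `conflict` on it yields an actual path.
    conflict⇒ {m} {Y} {c} {l} {z} cp (r , r≤ , rt , n , n≤ , q , h) = r , n , rt' rt , q , reachSet-sound (suc m) (_≟ r) (imp? (suc m))
        (to' e z≤n n≤ (h (proj₁ cd) (proj₁ (proj₂ cd)) (from' e z≤n r≤ (reachSet-complete (suc m) (_≟ r) (imp? (suc m)) (start r≤ refl)))
          λ x x≤ w w≤ i a → from' e z≤n w≤ (reachSet-complete (suc m) (_≟ r) (imp? (suc m))
            (next (reachSet-sound (suc m) (_≟ r) (imp? (suc m)) (to' e z≤n x≤ a)) i w≤))))
      where
      X : Fam
      X _ = reachSet (suc m) (_≟ r) (imp? (suc m))
      cd : Σ ℕ λ z → z ≤ Y × Codes (suc m) z X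
      cd = codeOf cp X
      e : Codes (suc m) (proj₁ cd) X
      e = proj₂ (proj₂ cd)
      rt' : ⟪ root ⟫ (m ∷ e* ∷ c ∷ l ∷ z ∷ r ∷ []) → Root m c l (λ x → ⟪ box ⟫ (z ∷ c ∷ l ∷ x ∷ [])) r
      rt' (inj₁ a) = inj₁ (inj₁ a)
      rt' (inj₂ (inj₁ a)) = inj₁ (inj₂ a)
      rt' (inj₂ (inj₂ a)) = inj₂ a

  opaque
    unfolding event
    event⇐ : ∀ {m Y c l z} → ⟪ capL ⟫ (m ∷ Y ∷ []) → c ≤ m → l ≤ c → z ≤ Y → ⟪ frame ⟫ (c ∷ []) → ⟪ good ⟫ (m ∷ e* ∷ c ∷ z ∷ []) →
      ⟪ conflict ⟫ (m ∷ Y ∷ e* ∷ c ∷ l ∷ z ∷ []) → ⟪ event ⟫ (m ∷ Y ∷ e* ∷ c ∷ l ∷ z ∷ [])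
    event⇐ {m} {Y} {c} {l} {z} a b d f g h i = a , (c , b , refl) , (l , d , refl) , (z , f , refl) , g , h , i

    event-capL : ∀ {m Y c l z} → ⟪ event ⟫ (m ∷ Y ∷ e* ∷ c ∷ l ∷ z ∷ []) → ⟪ capL ⟫ (m ∷ Y ∷ [])
    event-capL (a , _) = a

    event-conflict : ∀ {m Y c l z} → ⟪ event ⟫ (m ∷ Y ∷ e* ∷ c ∷ l ∷ z ∷ []) → ⟪ conflict ⟫ (m ∷ Y ∷ e* ∷ c ∷ l ∷ z ∷ [])
    event-conflict (_ , _ , _ , _ , _ , _ , i) = i

  tuple : ℕ → ℕ → ℕ → ℕ → ℕ → ℕ
  tuple m Y c l z = pairing m (pairing Y (pairing c (pairing l z)))

  opaque
    unfolding eventAt tup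
    eventAt⇐ : ∀ {m Y c l z} → ⟪ event ⟫ (m ∷ Y ∷ e* ∷ c ∷ l ∷ z ∷ []) → ⟪ eventAt ⟫ (tuple m Y c l z ∷ e* ∷ [])
    eventAt⇐ {m} {Y} {c} {l} {z} p = m , a , Y , b , c , d , l , f , z , g , refl , p
      where
      a : m ≤ tuple m Y c l z
      a = pairing-≤₁ m _
      a' : pairing Y (pairing c (pairing l z)) ≤ tuple m Y c l z
      a' = pairing-≤₂ m _
      b : Y ≤ tuple m Y c l z
      b = ≤-trans (pairing-≤₁ Y _) a'
      b' : pairing c (pairing l z) ≤ tuple m Y c l z
      b' = ≤-trans (pairing-≤₂ Y _) a'
      d : c ≤ tuple m Y c l z
      d = ≤-trans (pairing-≤₁ c _) b'
      d' : pairing l z ≤ tuple m Y c l z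
      d' = ≤-trans (pairing-≤₂ c _) b'
      f : l ≤ tuple m Y c l z
      f = ≤-trans (pairing-≤₁ l _) d'
      g : z ≤ tuple m Y c l z
      g = ≤-trans (pairing-≤₂ l _) d'

    eventAt⇒ : ∀ {n} → ⟪ eventAt ⟫ (n ∷ e* ∷ []) → Σ ℕ λ m → Σ ℕ λ Y → Σ ℕ λ c → Σ ℕ λ l → Σ ℕ λ z →
      (m ≤ n × Y ≤ n × c ≤ n × l ≤ n × z ≤ n) × (n ≡ tuple m Y c l z × ⟪ event ⟫ (m ∷ Y ∷ e* ∷ c ∷ l ∷ z ∷ []))
    eventAt⇒ (m , a , Y , b , c , d , l , f , z , g , e , p) = m , Y , c , l , z , (a , b , d , f , g) , e , p

  opaque
    unfolding first tup
    first⇐ : ∀ {n m Y c l z} → n ≡ tuple m Y c l z → ⟪ event ⟫ (m ∷ Y ∷ e* ∷ c ∷ l ∷ z ∷ []) →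
      (∀ k → k < n → ¬ ⟪ eventAt ⟫ (k ∷ e* ∷ [])) → ⟪ first ⟫ (n ∷ e* ∷ m ∷ Y ∷ c ∷ l ∷ z ∷ [])
    first⇐ {n} {m} {Y} {c} {l} {z} e p h = e , p , (λ k k≤ ne → h k (≤∧≢⇒< k≤ ne)) ,
      λ m' _ Y' _ c' _ l' _ z' _ e' → u m' Y' c' l' z' (trans (sym e') e)
      where
      u : ∀ m' Y' c' l' z' → tuple m' Y' c' l' z' ≡ tuple m Y c l z → c' ≡ c × (l' ≡ l × z' ≡ z)
      u m' Y' c' l' z' q =
        let (_ , q₁) = pairing-inj m' _ m _ q ; (_ , q₂) = pairing-inj Y' _ Y _ q₁ ; (a , q₃) = pairing-inj c' _ c _ q₂
            (b , d) = pairing-inj l' z' l z q₃ in a , b , d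

  opaque
    unfolding declared
    declared⇐ : ∀ {n m Y c l z} → m ≤ n × Y ≤ n × c ≤ n × l ≤ n × z ≤ n → ⟪ first ⟫ (n ∷ e* ∷ m ∷ Y ∷ c ∷ l ∷ z ∷ []) →
      ⟪ declared ⟫ (n ∷ e* ∷ c ∷ l ∷ [])
    declared⇐ (a , b , d , f , g) p = (_ , d , refl) , (_ , f , refl) , (_ , a , _ , b , _ , g , p)

  opaque
    unfolding provable later
    later⇐ : ∀ {n m Y c l z x} → m ≤ n × Y ≤ n × c ≤ n × l ≤ n × z ≤ n → ⟪ first ⟫ (n ∷ e* ∷ m ∷ Y ∷ c ∷ l ∷ z ∷ []) →
      ⟪ box ⟫ (z ∷ c ∷ l ∷ x ∷ []) → ⟪ provable ⟫ (n ∷ x ∷ e* ∷ [])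
    later⇐ (a , b , d , f , g) p q = inj₂ (_ , a , _ , b , _ , d , _ , f , _ , g , p , q)

    proved⇐ : ∀ {m Y x} → ⟪ proved ⟫ (m ∷ Y ∷ e* ∷ x ∷ []) → ⟪ provable ⟫ (m ⊔ Y ∷ x ∷ e* ∷ [])
    proved⇐ {m} {Y} p = inj₁ (m , m≤m⊔n m Y , Y , m≤n⊔m m Y , p)

    provable⇒ : ∀ {n x} → ⟪ provable ⟫ (n ∷ x ∷ e* ∷ []) → (Σ ℕ λ m → Σ ℕ λ Y → ⟪ proved ⟫ (m ∷ Y ∷ e* ∷ x ∷ [])) ⊎
      (Σ ℕ λ m → Σ ℕ λ Y → Σ ℕ λ c → Σ ℕ λ l → Σ ℕ λ z → ⟪ first ⟫ (n ∷ e* ∷ m ∷ Y ∷ c ∷ l ∷ z ∷ []))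
    provable⇒ (inj₁ (m , _ , Y , _ , p)) = inj₁ (m , Y , p)
    provable⇒ (inj₂ (m , _ , Y , _ , c , _ , l , _ , z , _ , p , _)) = inj₂ (m , Y , c , l , z , p)

  opaque
    unfolding first
    first-event : ∀ {n m Y c l z} → ⟪ first ⟫ (n ∷ e* ∷ m ∷ Y ∷ c ∷ l ∷ z ∷ []) → ⟪ event ⟫ (m ∷ Y ∷ e* ∷ c ∷ l ∷ z ∷ [])
    first-event (_ , p , _) = p

  pr-true : ∀ {n x} → ⟪ provable ⟫ (n ∷ x ∷ e* ∷ []) → PA ⊢ Pr [ numeral x ]
  pr-true {n} {x} p = subst (PA ⊢_) (sym (Pr-inst x)) (unnd {[]} (exUI provable (nE x) (numeral n)
    (F-cong provable (≐refl _ ∷ ≐refl _ ∷ E≐ ∷ []) (true⇒ provable (n ∷ x ∷ e* ∷ []) p))))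

  opaque
    unfolding State
    state-true : ∀ {n c l} → ⟪ declared ⟫ (n ∷ e* ∷ c ∷ l ∷ []) → PA ⊢ State c l
    state-true {n} {c} {l} p = unnd {[]} (exUI declared (cong₂ _∷_ shift-E (cong₂ (λ a b → a ∷ b ∷ []) (shift-numeral c) (shift-numeral l))) (numeral n)
      (F-cong declared (≐refl _ ∷ E≐ ∷ PWrefl) (true⇒ declared (n ∷ e* ∷ c ∷ l ∷ []) p)))

  private
    3-Th : Th 3
    3-Th = (⊥' ⇒ ⊥') , refl , ⊢id

    module _ {n m Y c l z} (bs : m ≤ n × Y ≤ n × c ≤ n × l ≤ n × z ≤ n) (fs : ⟪ first ⟫ (n ∷ e* ∷ m ∷ Y ∷ c ∷ l ∷ z ∷ [])) where

      stateT : T ⊢ State c l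
      stateT = ⊢-lift hPA (state-true (declared⇐ bs fs))

      rootTh : ∀ {r} → Root m c l (λ x → ⟪ box ⟫ (z ∷ c ∷ l ∷ x ∷ [])) r → Th r
      rootTh (inj₁ (inj₁ e)) = subst Th (sym e) 3-Th
      rootTh (inj₁ (inj₂ a)) = State c l , sc-code a , stateT
      rootTh (inj₂ (x , _ , a , b)) = Pr [ numeral x ] , prc-code a , ⊢-lift hPA (pr-true (later⇐ bs fs b))

      reachTh : ∀ {b r x} → Th r → Reach b (_≡ r) (Imp b) x → Th x
      reachTh h (start _ e) = subst Th (sym e) h
      reachTh h (next p i _) = imp-Th i (reachTh h p)

      refute : ∀ {r x} → Root m c l (λ x → ⟪ box ⟫ (z ∷ c ∷ l ∷ x ∷ [])) r → ⟪ nc ⟫ (suc m ∷ e* ∷ c ∷ l ∷ x ∷ []) →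
        Reach (suc m) (_≡ r) (Imp (suc m)) x → ⊥
      refute rt q p = con (mp (subst (T ⊢_) (NState-def c l) (Th⇒ (NState c l) (subst Th (nc-code q) (reachTh (rootTh rt) p)))) stateT)

  noEvent : ∀ m Y c l z → ¬ ⟪ event ⟫ (m ∷ Y ∷ e* ∷ c ∷ l ∷ z ∷ [])
  noEvent m Y c l z ev =
    let (n , at , min) = least (λ n → decD eventAt (n ∷ e* ∷ [])) (tuple m Y c l z) (eventAt⇐ ev)
        (m₀ , Y₀ , c₀ , l₀ , z₀ , bs , e , ev₀) = eventAt⇒ at
        (r , x , rt , q , p) = conflict⇒ (event-capL ev₀) (event-conflict ev₀)
    in refute bs (first⇐ e ev₀ min) rt q p

-- Good families at every stage, and the correctness of `Pr`

dec⇒ : {P : Set} (d : Dec P) → ⌊ d ⌋ ≡ true → P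
dec⇒ (yes p) _ = p

dec⇐ : {P : Set} (d : Dec P) → P → ⌊ d ⌋ ≡ true
dec⇐ (yes _) _ = refl
dec⇐ (no n) p = ⊥-elim (n p)

module Stability (L : Logic) {T : Theory} (K : Kit T) (hPA : ExtendsPA T) (con : Consistent T) where
  open Kit K
  open Reality L K hPA con public
  open Pre

  box? : ∀ X c k x → Dec (Box X c k x)
  box? X c k x = any≤? c λ v → decD nbh _ ×-dec all≤? c λ j → decD elt _ →-dec (X j x Bool.≟ true)

  box-mono : ∀ {X X' c k x} → (∀ j → j ≤ c → X j x ≡ true → X' j x ≡ true) → Box X c k x → Box X' c k x
  box-mono h (v , v≤ , a , f) = v , v≤ , a , λ j j≤ i → h j j≤ (f j j≤ i)

  pre-down : ∀ {m c X} → Pre (suc m) c X → Pre m c X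
  pre-down {m} p .seeds k k≤ w w≤ (inj₁ e) = seeds p k k≤ w (≤-trans w≤ (n≤1+n m)) (inj₁ e)
  pre-down {m} p .seeds k k≤ w w≤ (inj₂ s) = seeds p k k≤ w (≤-trans w≤ (n≤1+n m)) (inj₂ (sc-mono (n≤1+n m) s))
  pre-down {m} p .imps k k≤ x x≤ w w≤ i = imps p k k≤ x (≤-trans x≤ (n≤1+n m)) w (≤-trans w≤ (n≤1+n m)) (imp-mono (n≤1+n m) i)
  pre-down {m} p .coh k k≤ w w≤ n = coh p k k≤ w (≤-trans w≤ (n≤1+n m)) (nc-mono (n≤1+n m) n)

  -- The given family must be kept, and below this is assumed for every family at stage m: each
  -- single addition at stage m + 1 is tested in a box-closed extension of the family built so far.
  Extends : ℕ → ℕ → Fam → Set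
  Extends m c X = Σ Fam λ X' → (∀ k x → k ≤ c → x ≤ m → X k x ≡ true → X' k x ≡ true) × (Pre m c X' × BoxClosed m c X')

  -- No root of a stable family leads to a conflict at the next stage, for this would be an event.
  noConflict : ∀ {m c X} → c ≤ m → ⟪ frame ⟫ (c ∷ []) → Pre m c X → BoxClosed m c X → ∀ k → k ≤ c → ∀ {r n} →
    Root m c k (Box X c k) r → ⟪ nc ⟫ (suc m ∷ e* ∷ c ∷ k ∷ n ∷ []) → ¬ Reach (suc m) (_≡ r) (Imp (suc m)) n
  noConflict {m} {c} {X} c≤ fr p b k k≤ {r} rt q rc =
    let (Y , cp) = capNum m
        (z , z≤ , e) = codeOf cp X
    in noEvent m Y c k z (event⇐ cp c≤ k≤ z≤ fr (good⇐ {X = X} c≤ e p b) (conflict⇐ (rt' e rt) q rc))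
    where
    rt' : ∀ {z} → Codes (suc m) z X → Root m c k (Box X c k) r → Root m c k (λ x → ⟪ box ⟫ (z ∷ c ∷ k ∷ x ∷ [])) r
    rt' e (inj₁ a) = inj₁ a
    rt' e (inj₂ (x , x≤ , a , d)) = inj₂ (x , x≤ , a , box⇐ {X = X} c≤ e (≤-trans x≤ (n≤1+n m)) d)

  module _ {m c : ℕ} (c≤ : c ≤ m) (fr : ⟪ frame ⟫ (c ∷ [])) (ext : ∀ X → Pre m c X → Extends m c X) where

    private
      Rule : Fam → ℕ → ℕ → Set
      Rule X k w = Σ ℕ λ x → x ≤ suc m × (⟪ prc ⟫ (suc m ∷ e* ∷ x ∷ w ∷ []) × Box X c k x)

      Rule? : ∀ X k w → Dec (Rule X k w)
      Rule? X k w = any≤? (suc m) λ x → decD prc _ ×-dec box? X c k x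

      up : ℕ → ℕ → Bool
      up w = reachSet (suc m) (_≟ w) (imp? (suc m))

      add : Fam → ℕ → ℕ → Fam
      add X k w k' x = X k' x ∨ (⌊ k' ≟ k ⌋ ∧ up w x)

      add-⊆ : ∀ X k w → X ⊆ add X k w
      add-⊆ X k w k' x p = cong (_∨ (⌊ k' ≟ k ⌋ ∧ up w x)) p

      add-new : ∀ X k w {x} → Reach (suc m) (_≡ w) (Imp (suc m)) x → add X k w k x ≡ true
      add-new X k w {x} r = trans (cong (X k x ∨_) (cong₂ _∧_ (dec⇐ (k ≟ k) refl) (reachSet-complete (suc m) (_≟ w) (imp? (suc m)) r))) (Bool.∨-zeroʳ (X k x))

      add-inv : ∀ X k w k' x → add X k w k' x ≡ true → X k' x ≡ true ⊎ (k' ≡ k × Reach (suc m) (_≡ w) (Imp (suc m)) x)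
      add-inv X k w k' x p with X k' x
      ... | true = inj₁ refl
      ... | false with k' ≟ k
      ...   | yes e = inj₂ (e , reachSet-sound (suc m) (_≟ w) (imp? (suc m)) p)

      pre-add : ∀ X → Pre (suc m) c X → ∀ k w → k ≤ c → Rule X k w → Pre (suc m) c (add X k w)
      pre-add X p k w k≤ rule .seeds k' k'≤ y y≤ s = add-⊆ X k w k' y (seeds p k' k'≤ y y≤ s)
      pre-add X p k w k≤ rule .imps k' k'≤ x x≤ y y≤ i q with add-inv X k w k' x q
      ... | inj₁ r = add-⊆ X k w k' y (imps p k' k'≤ x x≤ y y≤ i r)
      ... | inj₂ (refl , r) = add-new X k w (next r i y≤)
      pre-add X p k w k≤ (x , x≤ , a , d) .coh k' k'≤ y y≤ n q with add-inv X k w k' y q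
      ... | inj₁ r = coh p k' k'≤ y y≤ n r
      -- The current family, seen at stage m, extends to a box-closed `X'`. The delay in `prc` gives
      -- x ≤ m, so x is still boxed in `X'` and the added `Pr x` is a root there; a path from it to
      -- a negated state would be an event at stage m.
      ... | inj₂ (refl , r) = let (X' , s , p' , b') = ext X (pre-down p) in
            noConflict c≤ fr p' b' k k≤ (inj₂ (x , s≤s⁻¹ (prc-< a) , a , box-mono {X} {X'} (λ j j≤ → s j x j≤ (s≤s⁻¹ (prc-< a))) d)) n r

    extend-suc : ∀ X → Pre (suc m) c X → Extends (suc m) c X
    extend-suc X p = let (X' , s , p' , h) = saturate (Pre (suc m) c) Rule Rule? c (suc m)
                           (λ X p k w k≤ w≤ r → add X k w , add-⊆ X k w , add-new X k w (start w≤ refl) , pre-add X p k w k≤ r) X p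
                     in X' , (λ k x _ _ → s k x) , p' , λ k k≤ w w≤ r → h k w k≤ w≤ r

    module _ (X : Fam) (p : Pre m c X) where

      next-coherent : ∀ k → k ≤ c → ∀ {r n} → (r ≡ 3 ⊎ ⟪ sc ⟫ (suc m ∷ e* ∷ c ∷ k ∷ r ∷ [])) →
        ⟪ nc ⟫ (suc m ∷ e* ∷ c ∷ k ∷ n ∷ []) → ¬ Reach (suc m) (_≡ r) (Imp (suc m)) n
      next-coherent k k≤ s q r = let (X' , _ , p' , b') = ext X p in noConflict c≤ fr p' b' k k≤ (inj₁ s) q r

  -- at stage c nothing about the frame c is visible yet
  extend-base : ∀ c X → Pre c c X → Extends c c X
  extend-base c X p = (λ _ _ → true) , (λ _ _ _ _ _ → refl) ,
    record { seeds = λ _ _ _ _ _ → refl ; imps = λ _ _ _ _ _ _ _ _ → refl ; coh = λ k k≤ w w≤ n _ → <-irrefl refl (nc-< n) } , λ _ _ _ _ _ → refl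

  Seed : ℕ → ℕ → ℕ → ℕ → Set
  Seed m c k x = x ≡ 3 ⊎ ⟪ sc ⟫ (m ∷ e* ∷ c ∷ k ∷ x ∷ [])

  seed? : ∀ m c k x → Dec (Seed m c k x)
  seed? m c k x = (x ≟ 3) ⊎-dec decD sc _

  initial : ℕ → ℕ → Fam
  initial m c k = reachSet m (seed? m c k) (imp? m)

  reach-root : ∀ {b R S x} → Reach b S R x → Σ ℕ λ r → S r × Reach b (_≡ r) R x
  reach-root (start p s) = _ , s , start p refl
  reach-root (next r i p) = let (r' , s , q) = reach-root r in r' , s , next q i p

  initial-pre : ∀ m c → (∀ k → k ≤ c → ∀ {r n} → Seed m c k r → ⟪ nc ⟫ (m ∷ e* ∷ c ∷ k ∷ n ∷ []) → ¬ Reach m (_≡ r) (Imp m) n) → Pre m c (initial m c)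
  initial-pre m c h .seeds k k≤ w w≤ s = reachSet-complete m (seed? m c k) (imp? m) (start w≤ s)
  initial-pre m c h .imps k k≤ x x≤ w w≤ i q = reachSet-complete m (seed? m c k) (imp? m) (next (reachSet-sound m (seed? m c k) (imp? m) q) i w≤)
  initial-pre m c h .coh k k≤ w w≤ n q = let (r , s , p) = reach-root (reachSet-sound m (seed? m c k) (imp? m) q) in h k k≤ s n p

  -- The two claims climb together: extending the initial family of one stage gives a good family
  -- there, and `noConflict` for it says that the seeds of the next stage are coherent.
  stable' : ∀ d c → ⟪ frame ⟫ (c ∷ []) → (∀ X → Pre (d + c) c X → Extends (d + c) c X) × Pre (d + c) c (initial (d + c) c)
  stable' zero c fr = extend-base c , initial-pre c c λ k k≤ s n _ → <-irrefl refl (nc-< n)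
  stable' (suc d) c fr = let (ext , p) = stable' d c fr in
    extend-suc (m≤n+m c d) fr ext , initial-pre (suc d + c) c (next-coherent (m≤n+m c d) fr ext _ p)

  stable-family : ∀ m c → c ≤ m → ⟪ frame ⟫ (c ∷ []) → Extends m c (initial m c)
  stable-family m c le fr = subst (λ m → Extends m c (initial m c)) (m∸n+n≡m le) (let (ext , p) = stable' (m ∸ c) c fr in ext _ p)

  opaque
    unfolding base impClosed necClosed
    base⇐ : ∀ {m Z X} → Codes (suc m) Z X → (3 ≤ m → X 0 3 ≡ true) → (∀ x → x ≤ m → ∀ w → w ≤ m → Imp m x w → X 0 x ≡ true → X 0 w ≡ true) →
      (∀ x → x ≤ m → ∀ w → w ≤ m → ⟪ prc ⟫ (m ∷ e* ∷ x ∷ w ∷ []) → X 0 x ≡ true → X 0 w ≡ true) → ⟪ base ⟫ (m ∷ e* ∷ Z ∷ [])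
    base⇐ {m} {Z} {X} e a b c = (λ w w≤ eq → from (up w≤) (subst (λ w → X 0 w ≡ true) (sym eq) (a (subst (_≤ m) eq w≤)))) ,
      (λ x x≤ w w≤ i q → from (up w≤) (b x x≤ w w≤ i (to (up x≤) q))) ,
      (λ x x≤ w w≤ i q → from (up w≤) (c x x≤ w w≤ i (to (up x≤) q)))
      where
      up : ∀ {x} → x ≤ m → x ≤ suc m
      up p = ≤-trans p (n≤1+n m)
      to : ∀ {x} → x ≤ suc m → ⟪ mem ⟫ (Z ∷ 0 ∷ x ∷ []) → X 0 x ≡ true
      to x≤ = Equivalence.to (e 0 _ z≤n x≤)
      from : ∀ {x} → x ≤ suc m → X 0 x ≡ true → ⟪ mem ⟫ (Z ∷ 0 ∷ x ∷ [])
      from x≤ = Equivalence.from (e 0 _ z≤n x≤)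

    base-step : ∀ {m Z x} → ⟪ base ⟫ (m ∷ e* ∷ Z ∷ []) → 3 ≤ m → x ≤ m → Imp m 3 x → ⟪ mem ⟫ (Z ∷ 0 ∷ x ∷ [])
    base-step (a , b , _) 3≤ x≤ i = b 3 3≤ _ x≤ i (a 3 3≤ refl)

  opaque
    unfolding cl
    cl⇒ : ∀ {m Y x} → ⟪ capL ⟫ (m ∷ Y ∷ []) → ⟪ cl ⟫ (m ∷ Y ∷ e* ∷ x ∷ []) → x ≤ m → (X : Fam) → (∀ Z → Codes (suc m) Z X → ⟪ base ⟫ (m ∷ e* ∷ Z ∷ [])) → X 0 x ≡ true
    cl⇒ cp h x≤ X b = let (Z , Z≤ , e) = codeOf cp X in Equivalence.to (e 0 _ z≤n (≤-trans x≤ (n≤1+n _))) (h Z Z≤ (b Z e))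

    cl⇐ : ∀ {m Y x} → 3 ≤ m → x ≤ m → Imp m 3 x → ⟪ cl ⟫ (m ∷ Y ∷ e* ∷ x ∷ [])
    cl⇐ a b c = λ Z _ h → base-step h a b c

  inAll : ℕ → Fam → Fam
  inAll c X _ x = ⌊ all≤? c (λ k → X k x Bool.≟ true) ⌋

  opaque
    unfolding safe
    -- The elements common to all components of a box-closed family form a set as in `base`: by
    -- seriality such an element is boxed at every world, so its necessitation is common as well.
    -- Hence the intersection `cl` lies inside.
    safe-true : ∀ m Y → ⟪ capL ⟫ (m ∷ Y ∷ []) → ⟪ safe ⟫ (m ∷ Y ∷ e* ∷ [])
    safe-true m Y cp c c≤ fr = witness (stable-family m c c≤ fr)
      where
      witness : Extends m c (initial m c) → Σ ℕ λ z → z ≤ Y × (⟪ good ⟫ (m ∷ e* ∷ c ∷ z ∷ []) ×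
        (∀ x → x ≤ m → ⟪ cl ⟫ (m ∷ Y ∷ e* ∷ x ∷ []) → ∀ k → k ≤ c → ⟪ mem ⟫ (z ∷ k ∷ x ∷ [])))
      witness (X , _ , p , b) = let (z , z≤ , e) = codeOf cp X in z , z≤ , good⇐ {X = X} c≤ e p b ,
          λ x x≤ q k k≤ → Equivalence.from (e k x (≤-trans k≤ (≤-trans c≤ (n≤1+n m))) (≤-trans x≤ (n≤1+n m))) (out x (inside x x≤ q) k k≤)
        where
        out : ∀ x → inAll c X 0 x ≡ true → ∀ k → k ≤ c → X k x ≡ true
        out x = dec⇒ (all≤? c (λ k → X k x Bool.≟ true))
        into : ∀ x → (∀ k → k ≤ c → X k x ≡ true) → inAll c X 0 x ≡ true
        into x = dec⇐ (all≤? c (λ k → X k x Bool.≟ true))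
        inside : ∀ x → x ≤ m → ⟪ cl ⟫ (m ∷ Y ∷ e* ∷ x ∷ []) → inAll c X 0 x ≡ true
        inside x x≤ q = cl⇒ cp q x≤ (inAll c X) λ Z e' → base⇐ {X = inAll c X} e'
          (λ 3≤ → into 3 λ k k≤ → seeds p k k≤ 3 3≤ (inj₁ refl))
          (λ x x≤ w w≤ i a → into w λ k k≤ → imps p k k≤ x x≤ w w≤ i (out x a k k≤))
          (λ x x≤ w w≤ i a → into w λ k k≤ → b k k≤ w w≤ (x , x≤ , i ,
            (let (v , v≤ , n) = frame-serial fr k≤ in v , v≤ , n , λ j j≤ _ → out x a j j≤)))

  opaque
    unfolding proved
    proved-true : ∀ {m Y x} → ⟪ capL ⟫ (m ∷ Y ∷ []) → 3 ≤ m → x ≤ m → Imp m 3 x → ⟪ proved ⟫ (m ∷ Y ∷ e* ∷ x ∷ [])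
    proved-true {m} {Y} {x} cp a b c = cp , safe-true m Y cp , (x , b , refl) , cl⇐ a b c

    proved-parts : ∀ {m Y x} → ⟪ proved ⟫ (m ∷ Y ∷ e* ∷ x ∷ []) → ⟪ capL ⟫ (m ∷ Y ∷ []) × x ≤ m × ⟪ cl ⟫ (m ∷ Y ∷ e* ∷ x ∷ [])
    proved-parts {m} (a , _ , (y , y≤ , e) , d) = a , subst (_≤ m) e y≤ , d

  -- A theorem is one implication away from `⊥' ⇒ ⊥'`, so it is derived at any stage that exceeds
  -- its code, the number 3 and the certificate, and every stage is safe.
  pr-complete : ∀ φ → T ⊢ φ → PA ⊢ Pr⟨ Pr ⟩ φ
  pr-complete φ p = let (N , h) = imp-true {⊥' ⇒ ⊥'} (mp axK p)
                        m = N ⊔ (3 ⊔ ⌜ φ ⌝)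
                        (Y , cp) = capNum m
                    in pr-true (proved⇐ {m} {Y} (proved-true cp (≤-trans (m≤m⊔n 3 ⌜ φ ⌝) (m≤n⊔m N _)) (≤-trans (m≤n⊔m 3 ⌜ φ ⌝) (m≤n⊔m N _)) (h m (m≤m⊔n N _))))

  private
    Any : ℕ → ℕ → ℕ → Set
    Any m x w = Imp m x w ⊎ ⟪ prc ⟫ (m ∷ e* ∷ x ∷ w ∷ [])

    any? : ∀ m x w → Dec (Any m x w)
    any? m x w = imp? m x w ⊎-dec decD prc _

    -- Necessitation steps are sound because `pr-complete` is already available at this point.
    any-Th : ∀ {m x} → Reach m (_≡ 3) (Any m) x → Th x
    any-Th (start _ e) = subst Th (sym e) ((⊥' ⇒ ⊥') , refl , ⊢id)
    any-Th (next r (inj₁ i) _) = imp-Th i (any-Th r)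
    any-Th (next {x} r (inj₂ i) _) = let (φ , e , p) = any-Th r in
      Pr [ numeral x ] , prc-code i , subst (λ x → T ⊢ Pr [ numeral x ]) (sym e) (⊢-lift hPA (pr-complete φ p))

  proved-Th : ∀ {m Y x} → ⟪ proved ⟫ (m ∷ Y ∷ e* ∷ x ∷ []) → Th x
  proved-Th {m} {Y} h = let (cp , x≤ , d) = proved-parts h in
    any-Th (reachSet-sound m (_≟ 3) (any? m) (cl⇒ cp d x≤ X λ Z e → base⇐ {X = X} e
      (λ 3≤ → complete (start 3≤ refl)) (λ x x≤ w w≤ i a → complete (next (sound a) (inj₁ i) w≤)) (λ x x≤ w w≤ i a → complete (next (sound a) (inj₂ i) w≤))))
    where
    X : Fam
    X _ = reachSet m (_≟ 3) (any? m)
    sound : ∀ {x} → X 0 x ≡ true → Reach m (_≡ 3) (Any m) x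
    sound = reachSet-sound m (_≟ 3) (any? m)
    complete : ∀ {x} → Reach m (_≡ 3) (Any m) x → X 0 x ≡ true
    complete = reachSet-complete m (_≟ 3) (any? m)

  proved-sound : ∀ {m Y} φ → ⟪ proved ⟫ (m ∷ Y ∷ e* ∷ ⌜ φ ⌝ ∷ []) → T ⊢ φ
  proved-sound φ h = Th⇒ φ (proved-Th h)

  -- A proof of the negated state would carry it from `⊥' ⇒ ⊥'` into the set of k of a good family
  -- at a large stage, against coherence.
  state-con : ∀ c k → k ≤ c → ⟪ frame ⟫ (c ∷ []) → ¬ (T ⊢ NState c k)
  state-con c k k≤ fr p =
    let (N₁ , h₁) = imp-true {⊥' ⇒ ⊥'} (mp axK p)
        (N₂ , h₂) = nc-true c k
        m = (N₁ ⊔ N₂) ⊔ ((3 ⊔ ⌜ NState c k ⌝) ⊔ c)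
        b₁ = ≤-trans (m≤m⊔n N₁ N₂) (m≤m⊔n (N₁ ⊔ N₂) _)
        b₂ = ≤-trans (m≤n⊔m N₁ N₂) (m≤m⊔n (N₁ ⊔ N₂) _)
        b₃ = ≤-trans (≤-trans (m≤m⊔n 3 ⌜ NState c k ⌝) (m≤m⊔n (3 ⊔ ⌜ NState c k ⌝) c)) (m≤n⊔m (N₁ ⊔ N₂) _)
        b₄ = ≤-trans (≤-trans (m≤n⊔m 3 ⌜ NState c k ⌝) (m≤m⊔n (3 ⊔ ⌜ NState c k ⌝) c)) (m≤n⊔m (N₁ ⊔ N₂) _)
        b₅ = ≤-trans (m≤n⊔m (3 ⊔ ⌜ NState c k ⌝) c) (m≤n⊔m (N₁ ⊔ N₂) _)
        (X , _ , q , _) = stable-family m c b₅ fr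
    in coh q k k≤ ⌜ NState c k ⌝ b₄ (h₂ m b₂) (imps q k k≤ 3 b₃ ⌜ NState c k ⌝ b₄ (h₁ m b₁) (seeds q k k≤ 3 b₃ (inj₁ refl)))

  open WithTruths noEvent proved-sound pr-complete state-con public

-- Elimination of truth assignments

_≟m_ : (A B : MFm) → Dec (A ≡ B)
pv m ≟m pv n with m ≟ n
... | yes refl = yes refl
... | no ne = no λ { refl → ne refl }
pv _ ≟m ⊥m = no λ ()
pv _ ≟m (_ ⇒m _) = no λ ()
pv _ ≟m □ _ = no λ ()
⊥m ≟m pv _ = no λ ()
⊥m ≟m ⊥m = yes refl
⊥m ≟m (_ ⇒m _) = no λ ()
⊥m ≟m □ _ = no λ ()
(_ ⇒m _) ≟m pv _ = no λ ()
(_ ⇒m _) ≟m ⊥m = no λ ()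
(A ⇒m B) ≟m (C ⇒m D) with A ≟m C | B ≟m D
... | yes refl | yes refl = yes refl
... | no ne | _ = no λ { refl → ne refl }
... | _ | no ne = no λ { refl → ne refl }
(_ ⇒m _) ≟m □ _ = no λ ()
□ _ ≟m pv _ = no λ ()
□ _ ≟m ⊥m = no λ ()
□ _ ≟m (_ ⇒m _) = no λ ()
□ A ≟m □ B with A ≟m B
... | yes refl = yes refl
... | no ne = no λ { refl → ne refl }

Val : Set
Val = MFm → Bool

imp-intro : ∀ v A B → (evalM v A ≡ true → evalM v B ≡ true) → evalM v (A ⇒m B) ≡ true
imp-intro v A B h with evalM v A
... | true = h refl
... | false = refl

imp-elim : ∀ v A B → evalM v (A ⇒m B) ≡ true → evalM v A ≡ true → evalM v B ≡ true
imp-elim v A B p q with evalM v A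
... | true = p

imp-false : ∀ v A B → evalM v A ≡ true → evalM v B ≡ false → evalM v (A ⇒m B) ≡ false
imp-false v A B p q with evalM v A
... | true = q

split-imp : ∀ v A B → (evalM v A ≡ true × evalM v B ≡ false) ⊎ evalM v (A ⇒m B) ≡ true
split-imp v A B with evalM v A
... | false = inj₂ refl
... | true with evalM v B
...   | true = inj₂ refl
...   | false = inj₁ (refl , refl)

not-true : ∀ {b} → b ≢ true → b ≡ false
not-true {true} h = ⊥-elim (h refl)
not-true {false} h = refl

atoms : MFm → List MFm
atoms (pv q) = pv q ∷ []
atoms ⊥m = []
atoms (A ⇒m B) = atoms A ++ atoms B
atoms (□ A) = □ A ∷ atoms A

bodies : MFm → List MFm
bodies (pv q) = []
bodies ⊥m = []
bodies (A ⇒m B) = bodies A ++ bodies B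
bodies (□ A) = A ∷ bodies A

box-atom : ∀ A {B} → B ∈ bodies A → □ B ∈ atoms A
box-atom (A ⇒m B) p with ∈-++⁻ (bodies A) p
... | inj₁ q = ∈-++⁺ˡ (box-atom A q)
... | inj₂ q = ∈-++⁺ʳ (atoms A) (box-atom B q)
box-atom (□ A) (here refl) = here refl
box-atom (□ A) (there p) = there (box-atom A p)

body-atoms : ∀ A {B} → B ∈ bodies A → ∀ {a} → a ∈ atoms B → a ∈ atoms A
body-atoms (A ⇒m B) p q with ∈-++⁻ (bodies A) p
... | inj₁ r = ∈-++⁺ˡ (body-atoms A r q)
... | inj₂ r = ∈-++⁺ʳ (atoms A) (body-atoms B r q)
body-atoms (□ A) (here refl) q = there q
body-atoms (□ A) (there p) q = there (body-atoms A p q)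

eval-agree : ∀ {v v'} A → (∀ {a} → a ∈ atoms A → v a ≡ v' a) → evalM v A ≡ evalM v' A
eval-agree (pv q) h = h (here refl)
eval-agree ⊥m h = refl
eval-agree {v} {v'} (A ⇒m B) h with evalM v A | evalM v' A | eval-agree {v} {v'} A (λ p → h (∈-++⁺ˡ p))
... | true | .true | refl = eval-agree B (λ p → h (∈-++⁺ʳ (atoms A) p))
... | false | .false | refl = refl
eval-agree (□ A) h = h (here refl)

override : MFm → Bool → Val → Val
override a b v x with x ≟m a
... | yes _ = b
... | no _ = v x

branch : MFm → List Val → List Val
branch a [] = []
branch a (v ∷ vs) = override a true v ∷ override a false v ∷ branch a vs

vals : List MFm → List Val
vals [] = (λ _ → false) ∷ []
vals (a ∷ as) = branch a (vals as)

Agree : List MFm → Val → Val → Set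
Agree as v V = ∀ {a} → a ∈ as → v a ≡ V a

vals-complete : ∀ as V → Σ Val λ v → v ∈ vals as × Agree as v V
vals-complete [] V = _ , here refl , λ ()
vals-complete (a ∷ as) V = let (v , p , h) = vals-complete as V in go (vals as) v p h
  where
  ok : ∀ v → Agree as v V → Agree (a ∷ as) (override a (V a) v) V
  ok v h {x} p with x ≟m a
  ... | yes refl = refl
  ok v h (here e) | no ne = ⊥-elim (ne e)
  ok v h (there p) | no ne = h p
  go : ∀ vs v → v ∈ vs → Agree as v V → Σ Val λ v' → v' ∈ branch a vs × Agree (a ∷ as) v' V
  go (v ∷ vs) .v (here refl) h with V a in eq
  ... | true = override a true v , here refl , subst (λ b → Agree (a ∷ as) (override a b v) V) eq (ok v h)
  ... | false = override a false v , there (here refl) , subst (λ b → Agree (a ∷ as) (override a b v) V) eq (ok v h)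
  go (v ∷ vs) w (there p) h = let (v' , q , r) = go vs w p h in v' , there (there q) , r

lit : Val → MFm → MFm
lit v a = if v a then a else (a ⇒m ⊥m)

refutation : List MFm → Val → MFm
refutation [] v = ⊥m
refutation (a ∷ as) v = lit v a ⇒m refutation as v

isAtom : MFm → Set
isAtom a = ∀ V → evalM V a ≡ V a

atoms-atomic : ∀ A {a} → a ∈ atoms A → isAtom a
atoms-atomic (pv q) (here refl) V = refl
atoms-atomic (A ⇒m B) p with ∈-++⁻ (atoms A) p
... | inj₁ q = atoms-atomic A q
... | inj₂ q = atoms-atomic B q
atoms-atomic (□ A) (here refl) V = refl
atoms-atomic (□ A) (there p) = atoms-atomic A p

lit-true : ∀ {a} → isAtom a → ∀ v V → v a ≡ V a → evalM V (lit v a) ≡ true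
lit-true {a} at v V e with v a
... | true = trans (at V) (sym e)
... | false = imp-intro V a ⊥m λ p → trans e (trans (sym (at V)) p)

lit-agree : ∀ {a} → isAtom a → ∀ v V → evalM V (lit v a) ≡ true → v a ≡ V a
lit-agree {a} at v V p with v a
... | true = trans (sym p) (at V)
... | false = sym (not-true λ q → f (imp-elim V a ⊥m p (trans (at V) q)))
  where
  f : false ≢ true
  f ()

refutation-false : ∀ as → (∀ {a} → a ∈ as → isAtom a) → ∀ v V → Agree as v V → evalM V (refutation as v) ≡ false
refutation-false [] at v V h = refl
refutation-false (a ∷ as) at v V h = imp-false V (lit v a) _ (lit-true (at (here refl)) v V (h (here refl))) (refutation-false as (at ∘ there) v V (h ∘ there))

refutation-true : ∀ as → (∀ {a} → a ∈ as → isAtom a) → ∀ v V → evalM V (refutation as v) ≡ true ⊎ Agree as v V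
refutation-true [] at v V = inj₂ λ ()
refutation-true (a ∷ as) at v V with split-imp V (lit v a) (refutation as v)
... | inj₂ p = inj₁ p
... | inj₁ (p , q) with refutation-true as (at ∘ there) v V
...   | inj₁ r = ⊥-elim (t≢f (trans (sym r) q))
  where
  t≢f : true ≢ false
  t≢f ()
...   | inj₂ h = inj₂ λ { (here refl) → lit-agree (at (here refl)) v V p ; (there r) → h r }

collect : ∀ {ℓ} {X : Set} {P : X → Set} {Q : Set ℓ} (xs : List X) → (∀ x → x ∈ xs → P x ⊎ Q) → (∀ x → x ∈ xs → P x) ⊎ Q
collect [] h = inj₁ λ _ ()
collect (x ∷ xs) h with h x (here refl)
... | inj₂ q = inj₂ q
... | inj₁ p with collect xs (λ y r → h y (there r))
...   | inj₂ q = inj₂ q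
...   | inj₁ ps = inj₁ λ { _ (here refl) → p ; y (there r) → ps y r }

remove : ∀ {X : Set} {x : X} (xs : List X) → x ∈ xs → List X
remove (x ∷ xs) (here _) = xs
remove (x ∷ xs) (there p) = x ∷ remove xs p

remove-length : ∀ {X : Set} {x : X} xs (p : x ∈ xs) → suc (length (remove xs p)) ≡ length xs
remove-length (x ∷ xs) (here _) = refl
remove-length (x ∷ xs) (there p) = cong suc (remove-length xs p)

remove-∈ : ∀ {X : Set} {x y : X} xs (p : x ∈ xs) → y ∈ xs → y ≡ x ⊎ y ∈ remove xs p
remove-∈ (x ∷ xs) (here refl) (here refl) = inj₁ refl
remove-∈ (x ∷ xs) (here _) (there q) = inj₂ q
remove-∈ (x ∷ xs) (there p) (here refl) = inj₂ (here refl)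
remove-∈ (x ∷ xs) (there p) (there q) with remove-∈ xs p q
... | inj₁ e = inj₁ e
... | inj₂ r = inj₂ (there r)

module Elimination (L : Logic) (A : MFm) where

  Wit : List Val → MFm → MFm → Set
  Wit W B C = Σ Val λ u → u ∈ W × (evalM u B ≡ true × evalM u C ≡ false)

  -- The demands of a false `□C` at w, one for each sort of neighbourhood in the future
  -- countermodel: the full set, the B-worlds for a true `□B`, and under `MNF` also the `□B`-worlds
  -- must all contain a world refuting C.
  Good : List Val → Val → Set
  Good W w = ∀ C → C ∈ bodies A → w (□ C) ≡ true ⊎ (Wit W (⊥m ⇒m ⊥m) C × (∀ B → B ∈ bodies A →
    w (□ B) ≡ false ⊎ (Wit W B C × (L ≡ MN ⊎ Wit W (□ B) C))))

  Inv : List Val → Set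
  Inv W = ∀ v → v ∈ vals (atoms A) → v ∈ W ⊎ (L ⊢m refutation (atoms A) v)

  private
    at : ∀ {a} → a ∈ atoms A → isAtom a
    at = atoms-atomic A

    -- Refuted assignments are moved one by one into antecedents of Y. What remains is true under
    -- every assignment and hence an axiom.
    derive : ∀ vs Y → (∀ v → v ∈ vs → L ⊢m refutation (atoms A) v ⊎ (∀ V → Agree (atoms A) v V → evalM V Y ≡ true)) →
      (∀ V → evalM V Y ≡ true ⊎ Σ Val λ v → v ∈ vs × Agree (atoms A) v V) → L ⊢m Y
    derive [] Y d h = taut λ V → case (h V)
      where
      case : ∀ {V} → (evalM V Y ≡ true ⊎ Σ Val λ v → v ∈ [] × Agree (atoms A) v V) → evalM V Y ≡ true
      case (inj₁ p) = p
    derive (v ∷ vs) Y d h with d v (here refl)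
    ... | inj₂ g = derive vs Y (λ u p → d u (there p)) λ V → case (h V)
      where
      case : ∀ {V} → (evalM V Y ≡ true ⊎ Σ Val λ u → u ∈ v ∷ vs × Agree (atoms A) u V) → evalM V Y ≡ true ⊎ Σ Val λ u → u ∈ vs × Agree (atoms A) u V
      case (inj₁ p) = inj₁ p
      case (inj₂ (u , here refl , a)) = inj₁ (g _ a)
      case (inj₂ (u , there p , a)) = inj₂ (u , p , a)
    ... | inj₁ p = mpm (derive vs (refutation (atoms A) v ⇒m Y) (λ u q → weak (d u (there q))) λ V → case (h V)) p
      where
      weak : ∀ {u} → (L ⊢m refutation (atoms A) u ⊎ (∀ V → Agree (atoms A) u V → evalM V Y ≡ true)) →
        L ⊢m refutation (atoms A) u ⊎ (∀ V → Agree (atoms A) u V → evalM V (refutation (atoms A) v ⇒m Y) ≡ true)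
      weak (inj₁ q) = inj₁ q
      weak (inj₂ g) = inj₂ λ V a → imp-intro V (refutation (atoms A) v) Y λ _ → g V a
      t≢f : true ≢ false
      t≢f ()
      case : ∀ {V} → (evalM V Y ≡ true ⊎ Σ Val λ u → u ∈ v ∷ vs × Agree (atoms A) u V) →
        evalM V (refutation (atoms A) v ⇒m Y) ≡ true ⊎ Σ Val λ u → u ∈ vs × Agree (atoms A) u V
      case {V} (inj₁ p) = inj₁ (imp-intro V (refutation (atoms A) v) Y λ _ → p)
      case {V} (inj₂ (u , here refl , a)) = inj₁ (imp-intro V (refutation (atoms A) v) Y λ q →
        ⊥-elim (t≢f (trans (sym q) (refutation-false (atoms A) at v V a))))
      case (inj₂ (u , there p , a)) = inj₂ (u , p , a)

  provable-if : ∀ {W} → Inv W → ∀ Y → (∀ {a} → a ∈ atoms Y → a ∈ atoms A) → (∀ u → u ∈ W → evalM u Y ≡ true) → L ⊢m Y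
  provable-if {W} inv Y sub h = derive (vals (atoms A)) Y (λ v p → case v (inv v p)) λ V → inj₂ (vals-complete (atoms A) V)
    where
    case : ∀ v → (v ∈ W ⊎ (L ⊢m refutation (atoms A) v)) → L ⊢m refutation (atoms A) v ⊎ (∀ V → Agree (atoms A) v V → evalM V Y ≡ true)
    case v (inj₂ r) = inj₁ r
    case v (inj₁ p) = inj₂ λ V a → trans (sym (eval-agree Y (λ q → a (sub q)))) (h v p)

  private
    search : ∀ W B C → Wit W B C ⊎ (∀ u → u ∈ W → evalM u (B ⇒m C) ≡ true)
    search [] B C = inj₂ λ _ ()
    search (u ∷ W) B C with split-imp u B C
    ... | inj₁ p = inj₁ (u , here refl , p)
    ... | inj₂ p with search W B C
    ...   | inj₁ (u' , q , r) = inj₁ (u' , there q , r)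
    ...   | inj₂ h = inj₂ λ { _ (here refl) → p ; u (there q) → h u q }

    sub-imp : ∀ {B C} → (∀ {a} → a ∈ atoms B → a ∈ atoms A) → (∀ {a} → a ∈ atoms C → a ∈ atoms A) → ∀ {a} → a ∈ atoms (B ⇒m C) → a ∈ atoms A
    sub-imp {B} f g p with ∈-++⁻ (atoms B) p
    ... | inj₁ q = f q
    ... | inj₂ q = g q

    consequence : ∀ w X → (∀ V → Agree (atoms A) w V → evalM V X ≡ false) → L ⊢m X → L ⊢m refutation (atoms A) w
    consequence w X h p = mpm (taut λ V → imp-intro V X (refutation (atoms A) w) λ q → case (refutation-true (atoms A) at w V) q) p
      where
      t≢f : true ≢ false
      t≢f ()
      case : ∀ {V} → evalM V (refutation (atoms A) w) ≡ true ⊎ Agree (atoms A) w V → evalM V X ≡ true → evalM V (refutation (atoms A) w) ≡ true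
      case (inj₁ r) q = r
      case {V} (inj₂ a) q = ⊥-elim (t≢f (trans (sym q) (h V a)))

    trans-imp : ∀ {B C D} → L ⊢m B ⇒m C → L ⊢m C ⇒m D → L ⊢m B ⇒m D
    trans-imp {B} {C} {D} p q = mpm (mpm (taut λ V → imp-intro V (B ⇒m C) _ λ a → imp-intro V (C ⇒m D) _ λ b →
      imp-intro V B D λ c → imp-elim V C D b (imp-elim V B C a c)) p) q

    logic? : (L ≡ MN) ⊎ (L ≡ MNF)
    logic? = f L
      where
      f : ∀ L → (L ≡ MN) ⊎ (L ≡ MNF)
      f MN = inj₁ refl
      f MNF = inj₂ refl

  -- A missing witness makes C, `B ⇒m C` or `□ B ⇒m C` true throughout W, hence provable by
  -- `provable-if`. Then `nec`, `rm`, or `ax4` together with `rm` contradicts the values of w on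
  -- boxes.
  test : ∀ W → Inv W → ∀ w → Good W w ⊎ (L ⊢m refutation (atoms A) w)
  test W inv w = collect (bodies A) λ C c → body C c
    where
    module _ (C : MFm) (c : C ∈ bodies A) where
      module _ (nC : w (□ C) ≡ false) where
        pos : ∀ B → B ∈ bodies A → (w (□ B) ≡ false ⊎ (Wit W B C × (L ≡ MN ⊎ Wit W (□ B) C))) ⊎ (L ⊢m refutation (atoms A) w)
        pos B b with w (□ B) in eq
        ... | false = inj₁ (inj₁ refl)
        ... | true with search W B C
        ...   | inj₂ h = inj₂ (consequence w (□ B ⇒m □ C) false' (rm (provable-if inv (B ⇒m C) (sub-imp {B} {C} (body-atoms A b) (body-atoms A c)) h)))
          where
          false' : ∀ V → Agree (atoms A) w V → evalM V (□ B ⇒m □ C) ≡ false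
          false' V a = imp-false V (□ B) (□ C) (trans (sym (a (box-atom A b))) eq) (trans (sym (a (box-atom A c))) nC)
        ...   | inj₁ u with logic?
        ...     | inj₁ e = inj₁ (inj₂ (u , inj₁ e))
        ...     | inj₂ e with search W (□ B) C
        ...       | inj₁ u' = inj₁ (inj₂ (u , inj₂ u'))
        ...       | inj₂ h = inj₂ (consequence w (□ B ⇒m □ C) false' (trans-imp (ax4 e) (rm (provable-if inv (□ B ⇒m C)
                    (sub-imp {□ B} {C} (λ { (here refl) → box-atom A b ; (there q) → body-atoms A b q }) (body-atoms A c)) h))))
          where
          false' : ∀ V → Agree (atoms A) w V → evalM V (□ B ⇒m □ C) ≡ false
          false' V a = imp-false V (□ B) (□ C) (trans (sym (a (box-atom A b))) eq) (trans (sym (a (box-atom A c))) nC)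

        neg : (Wit W (⊥m ⇒m ⊥m) C × (∀ B → B ∈ bodies A → w (□ B) ≡ false ⊎ (Wit W B C × (L ≡ MN ⊎ Wit W (□ B) C)))) ⊎ (L ⊢m refutation (atoms A) w)
        neg with search W (⊥m ⇒m ⊥m) C
        ... | inj₂ h = inj₂ (consequence w (□ C) (λ V a → trans (sym (a (box-atom A c))) nC)
                (nec (provable-if inv C (body-atoms A c) λ u p → imp-elim u (⊥m ⇒m ⊥m) C (h u p) refl)))
        ... | inj₁ u with collect (bodies A) pos
        ...   | inj₁ f = inj₁ (u , f)
        ...   | inj₂ r = inj₂ r

      body : (w (□ C) ≡ true ⊎ (Wit W (⊥m ⇒m ⊥m) C × (∀ B → B ∈ bodies A → w (□ B) ≡ false ⊎ (Wit W B C × (L ≡ MN ⊎ Wit W (□ B) C))))) ⊎ (L ⊢m refutation (atoms A) w)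
      body with w (□ C) in eq
      ... | true = inj₁ (inj₁ refl)
      ... | false with neg eq
      ...   | inj₁ p = inj₁ (inj₂ p)
      ...   | inj₂ r = inj₂ r

  Stable : List Val → Set
  Stable W = ∀ w → w ∈ W → Good W w

  eliminate : ∀ n W → length W ≤ n → Inv W → Σ (List Val) λ W' → Inv W' × Stable W'
  eliminate n W le inv with collect {Q = Σ Val λ w → w ∈ W × (L ⊢m refutation (atoms A) w)} W (λ w p → case p (test W inv w))
    where
    case : ∀ {w} → w ∈ W → Good W w ⊎ (L ⊢m refutation (atoms A) w) → Good W w ⊎ Σ Val λ w → w ∈ W × (L ⊢m refutation (atoms A) w)
    case p (inj₁ g) = inj₁ g
    case p (inj₂ r) = inj₂ (_ , p , r)
  ... | inj₁ g = W , inv , g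
  eliminate zero (_ ∷ _) () inv | inj₂ _
  eliminate zero [] le inv | inj₂ (w , () , r)
  eliminate (suc n) W le inv | inj₂ (w , p , r) = eliminate n (remove W p)
      (s≤s⁻¹ (subst (_≤ suc n) (sym (remove-length W p)) le)) λ v q → case (inv v q)
    where
    case : ∀ {v} → (v ∈ W ⊎ (L ⊢m refutation (atoms A) v)) → v ∈ remove W p ⊎ (L ⊢m refutation (atoms A) v)
    case (inj₂ s) = inj₂ s
    case (inj₁ q) with remove-∈ W p q
    ... | inj₁ refl = inj₂ r
    ... | inj₂ s = inj₁ s

  decide : (L ⊢m A) ⊎ Σ (List Val) λ W → Stable W × Σ Val λ w → w ∈ W × evalM w A ≡ false
  decide = let (W , inv , st) = eliminate _ (vals (atoms A)) ≤-refl (λ v p → inj₁ p) in case W inv st (search W (⊥m ⇒m ⊥m) A)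
    where
    case : ∀ W → Inv W → Stable W → Wit W (⊥m ⇒m ⊥m) A ⊎ (∀ u → u ∈ W → evalM u ((⊥m ⇒m ⊥m) ⇒m A) ≡ true) →
      (L ⊢m A) ⊎ Σ (List Val) λ W → Stable W × Σ Val λ w → w ∈ W × evalM w A ≡ false
    case W inv st (inj₁ (w , p , _ , q)) = inj₂ (W , st , w , p , q)
    case W inv st (inj₂ h) = inj₁ (provable-if inv A id λ u p → imp-elim u (⊥m ⇒m ⊥m) A (h u p) refl)

-- Modal tautologies inside PA

module Kalmar (f : MFm → Formula) (f⊥ : f ⊥m ≡ falsum) (f⇒ : ∀ A B → f (A ⇒m B) ≡ (f A ⇒ f B)) where

  Lit : Ctx → Val → MFm → Set
  Lit Γ v A = (evalM v A ≡ true → Γ ⊩ f A) × (evalM v A ≡ false → Γ ⊩ ¬' (f A))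

  lits : ∀ {Γ} v A → (∀ {a} → a ∈ atoms A → Lit Γ v a) → Lit Γ v A
  lits v (pv q) h = h (here refl)
  lits v ⊥m h = (λ ()) , λ _ → subst (λ φ → _ ⊩ ¬' φ) (sym f⊥) (num≢ 0 1 λ ())
  lits {Γ} v (A ⇒m B) h = subst (λ φ → (evalM v (A ⇒m B) ≡ true → Γ ⊩ φ) × (evalM v (A ⇒m B) ≡ false → Γ ⊩ ¬' φ)) (sym (f⇒ A B))
      (go (lits v A (λ p → h (∈-++⁺ˡ p))) (lits v B (λ p → h (∈-++⁺ʳ (atoms A) p))))
    where
    go : Lit Γ v A → Lit Γ v B → (evalM v (A ⇒m B) ≡ true → Γ ⊩ f A ⇒ f B) × (evalM v (A ⇒m B) ≡ false → Γ ⊩ ¬' (f A ⇒ f B))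
    go (a , b) (c , d) with evalM v A
    ... | true = (λ p → ƛ (wk (c p))) , λ p → ƛ (wk (d p) · (h0 · wk (a refl)))
    ... | false = (λ _ → ƛ (efq (wk (b refl) · h0))) , λ ()
  lits v (□ A) h = h (here refl)

  -- Kalmár's argument: excluded middle for the image of each atom leads to contexts that prove all
  -- literals of some valuation, and there the value of A is proved by induction.
  tautology : ∀ {A} → Tautology A → PA ⊢ f A
  tautology {A} t = unnd {[]} (go (atoms A) (λ _ → false) λ p → inj₁ p)
    where
    go : ∀ {Γ} as v → (∀ {a} → a ∈ atoms A → a ∈ as ⊎ Lit Γ v a) → Γ ⊩ f A
    go [] v h = proj₁ (lits v A λ p → out (h p)) (t v)
      where
      out : ∀ {a Γ} → a ∈ [] ⊎ Lit Γ v a → Lit Γ v a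
      out (inj₂ l) = l
    go {Γ} (b ∷ as) v h = lem (f b) (go as (override b true v) (λ p → advance true (atoms-atomic A p) (h0' true) (h p)))
                                     (go as (override b false v) (λ p → advance false (atoms-atomic A p) (h0' false) (h p)))
      where
      ctx : Bool → Formula
      ctx c = if c then f b else ¬' (f b)
      h0' : ∀ c → ctx c ∷ Γ ⊩ ctx c
      h0' c = h0
      advance : ∀ c {a} → isAtom a → ctx c ∷ Γ ⊩ ctx c → a ∈ b ∷ as ⊎ Lit Γ v a → a ∈ as ⊎ Lit (ctx c ∷ Γ) (override b c v) a
      advance c {a} at k h rewrite at (override b c v) | at v with a ≟m b
      advance true at k h | yes refl = inj₂ ((λ _ → k) , λ ())
      advance false at k h | yes refl = inj₂ ((λ ()) , λ _ → k)
      advance c at k (inj₁ (here e)) | no ne = ⊥-elim (ne e)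
      advance c at k (inj₁ (there p)) | no ne = inj₁ p
      advance c at k (inj₂ (l , l')) | no ne = inj₂ ((λ p → wk (l p)) , λ p → wk (l' p))

-- From a stable list of assignments to a coded countermodel; the theorem for a given kit

nth : {X : Set} → X → List X → ℕ → X
nth d [] n = d
nth d (x ∷ xs) zero = x
nth d (x ∷ xs) (suc n) = nth d xs n

nth-⊓ : {X : Set} (d : X) → ∀ xs n N → length xs ≤ N → nth d xs (n ⊓ N) ≡ nth d xs n
nth-⊓ d [] n N le = refl
nth-⊓ d (x ∷ xs) zero N le = refl
nth-⊓ d (x ∷ xs) (suc n) (suc N) (s≤s le) = nth-⊓ d xs n N le

index : {X : Set} (d : X) {x : X} → ∀ xs → x ∈ xs → Σ ℕ λ n → n ≤ length xs × nth d xs n ≡ x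
index d (x ∷ xs) (here refl) = 0 , z≤n , refl
index d (x ∷ xs) (there p) = let (n , le , e) = index d xs p in suc n , s≤s le , e

nth-cases : {X : Set} (d : X) → ∀ xs n → nth d xs n ≡ d ⊎ nth d xs n ∈ xs
nth-cases d [] n = inj₁ refl
nth-cases d (x ∷ xs) zero = inj₂ (here refl)
nth-cases d (x ∷ xs) (suc n) with nth-cases d xs n
... | inj₁ e = inj₁ e
... | inj₂ p = inj₂ (there p)

atom-body : ∀ A {C} → □ C ∈ atoms A → C ∈ bodies A
atom-body (pv q) (here ())
atom-body (pv q) (there ())
atom-body (A ⇒m B) p with ∈-++⁻ (atoms A) p
... | inj₁ q = ∈-++⁺ˡ (atom-body A q)
... | inj₂ q = ∈-++⁺ʳ (bodies A) (atom-body B q)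
atom-body (□ A) (here refl) = here refl
atom-body (□ A) (there p) = there (atom-body A p)

varBound : MFm → ℕ
varBound (pv q) = q
varBound ⊥m = 0
varBound (A ⇒m B) = varBound A ⊔ varBound B
varBound (□ A) = varBound A

var-≤ : ∀ A {q} → pv q ∈ atoms A → q ≤ varBound A
var-≤ (pv q) (here refl) = ≤-refl
var-≤ (A ⇒m B) p with ∈-++⁻ (atoms A) p
... | inj₁ r = ≤-trans (var-≤ A r) (m≤m⊔n _ _)
... | inj₂ r = ≤-trans (var-≤ B r) (m≤n⊔m (varBound A) _)
var-≤ (□ A) (there p) = var-≤ A p

module Completeness (L : Logic) {T : Theory} (K : Kit T) (hPA : ExtendsPA T) (con : Consistent T) where
  open Kit K
  open Stability L K hPA con public

  opaque
    unfolding frame trans4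
    -- A stronger form of transitivity suffices: the worlds of the new neighbourhood have v itself
    -- as a neighbourhood.
    frame⇐ : ∀ {c} → (∀ a → a ≤ c → Σ ℕ λ v → v ≤ c × ⟪ nbh ⟫ (c ∷ a ∷ v ∷ [])) →
      (L ≡ MNF → ∀ a → a ≤ c → ∀ v → v ≤ c → ⟪ nbh ⟫ (c ∷ a ∷ v ∷ []) → Σ ℕ λ v' → v' ≤ c × (⟪ nbh ⟫ (c ∷ a ∷ v' ∷ []) ×
        (∀ k → k ≤ c → ⟪ elt ⟫ (c ∷ v' ∷ k ∷ []) → ⟪ nbh ⟫ (c ∷ k ∷ v ∷ [])))) → ⟪ frame ⟫ (c ∷ [])
    frame⇐ {c} s t = s , by L t
      where
      by : ∀ L → (L ≡ MNF → ∀ a → a ≤ c → ∀ v → v ≤ c → ⟪ nbh ⟫ (c ∷ a ∷ v ∷ []) → Σ ℕ λ v' → v' ≤ c × (⟪ nbh ⟫ (c ∷ a ∷ v' ∷ []) ×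
        (∀ k → k ≤ c → ⟪ elt ⟫ (c ∷ v' ∷ k ∷ []) → ⟪ nbh ⟫ (c ∷ k ∷ v ∷ [])))) → ⟪ trans4 L ⟫ (c ∷ [])
      by MN t = refl
      by MNF t a a≤ v v≤ p = let (v' , v'≤ , q , h) = t refl a a≤ v v≤ p in
        v' , v'≤ , q , λ k k≤ i → v , v≤ , h k k≤ i , λ j j≤ e → e

  module CounterModel (A : MFm) (W : List Val) (w₀ : Val) (w₀∈ : w₀ ∈ W) (st : Elimination.Stable L A W) where

    ⊤m : MFm
    ⊤m = ⊥m ⇒m ⊥m

    -- a neighbourhood with description (X , Y) consists of the worlds satisfying Y and belongs to the worlds satisfying X
    extra : Logic → List (MFm × MFm)
    extra MN = []
    extra MNF = Data.List.map (λ B → □ B , □ B) (bodies A)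

    nbhds : List (MFm × MFm)
    nbhds = (⊤m , ⊤m) ∷ (Data.List.map (λ B → □ B , B) (bodies A) ++ extra L)

    wld : ℕ → Val
    -- Numbers beyond the list denote `w₀` again, so every number up to c is a world taken from W.
    wld = nth w₀ W

    desc : ℕ → MFm × MFm
    -- Numbers beyond the list receive the description `⊥m` and thus are neighbourhoods of no world.
    desc = nth (⊥m , ⊥m) nbhds

    N : ℕ
    N = length W ⊔ (length nbhds ⊔ varBound A)

    W≤ : length W ≤ N
    W≤ = m≤m⊔n (length W) _

    ds≤ : length nbhds ≤ N
    ds≤ = ≤-trans (m≤m⊔n (length nbhds) (varBound A)) (m≤n⊔m (length W) _)

    vb≤ : varBound A ≤ N
    vb≤ = ≤-trans (m≤n⊔m (length nbhds) _) (m≤n⊔m (length W) _)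

    wld-∈ : ∀ k → wld k ∈ W
    wld-∈ k with nth-cases w₀ W k
    ... | inj₁ e = subst (_∈ W) (sym e) w₀∈
    ... | inj₂ p = p

    table = tables N (λ a v → evalM (wld a) (proj₁ (desc v))) (λ v j → evalM (wld j) (proj₂ (desc v))) (λ a q → wld a (pv q))

    c : ℕ
    c = proj₁ table

    N≤c : N ≤ c
    N≤c = proj₁ (proj₂ table)

    private
      spec = proj₂ (proj₂ table)
      ew : ∀ k → wld (k ⊓ N) ≡ wld k
      ew k = nth-⊓ w₀ W k N W≤
      ed : ∀ v → desc (v ⊓ N) ≡ desc v
      ed v = nth-⊓ (⊥m , ⊥m) nbhds v N ds≤

    nbh⇒ : ∀ k v → ⟪ nbh ⟫ (c ∷ k ∷ v ∷ []) → evalM (wld k) (proj₁ (desc v)) ≡ true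
    nbh⇒ k v p = subst₂ (λ u d → evalM u (proj₁ d) ≡ true) (ew k) (ed v) (Equivalence.to (proj₁ (spec k v)) p)

    nbh⇐ : ∀ k v → evalM (wld k) (proj₁ (desc v)) ≡ true → ⟪ nbh ⟫ (c ∷ k ∷ v ∷ [])
    nbh⇐ k v p = Equivalence.from (proj₁ (spec k v)) (subst₂ (λ u d → evalM u (proj₁ d) ≡ true) (sym (ew k)) (sym (ed v)) p)

    elt⇒ : ∀ v j → ⟪ elt ⟫ (c ∷ v ∷ j ∷ []) → evalM (wld j) (proj₂ (desc v)) ≡ true
    elt⇒ v j p = subst₂ (λ u d → evalM u (proj₂ d) ≡ true) (ew j) (ed v) (Equivalence.to (proj₁ (proj₂ (spec v j))) p)

    elt⇐ : ∀ v j → evalM (wld j) (proj₂ (desc v)) ≡ true → ⟪ elt ⟫ (c ∷ v ∷ j ∷ [])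
    elt⇐ v j p = Equivalence.from (proj₁ (proj₂ (spec v j))) (subst₂ (λ u d → evalM u (proj₂ d) ≡ true) (sym (ew j)) (sym (ed v)) p)

    val⇔ : ∀ k q → q ≤ N → ⟪ val ⟫ (c ∷ k ∷ q ∷ []) ⇔ (wld k (pv q) ≡ true)
    val⇔ k q le = subst₂ (λ u r → ⟪ val ⟫ (c ∷ k ∷ q ∷ []) ⇔ (u (pv r) ≡ true)) (ew k) (m≤n⇒m⊓n≡m le) (proj₂ (proj₂ (spec k q)))

    find : ∀ {d} → d ∈ nbhds → Σ ℕ λ v → v ≤ c × desc v ≡ d
    find p = let (v , le , e) = index (⊥m , ⊥m) nbhds p in v , ≤-trans le (≤-trans ds≤ N≤c) , e

    data Kind (X Y : MFm) : Set where
      all  : X ≡ ⊤m → Y ≡ ⊤m → Kind X Y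
      ext  : ∀ B → B ∈ bodies A → X ≡ □ B → Y ≡ B → Kind X Y
      boxed : ∀ B → B ∈ bodies A → L ≡ MNF → X ≡ □ B → Y ≡ □ B → Kind X Y
      none : X ≡ ⊥m → Kind X Y

    kind : ∀ v → Kind (proj₁ (desc v)) (proj₂ (desc v))
    kind v with nth-cases (⊥m , ⊥m) nbhds v
    ... | inj₁ e = none (cong proj₁ e)
    ... | inj₂ (here e) = all (cong proj₁ e) (cong proj₂ e)
    ... | inj₂ (there p) with ∈-++⁻ (Data.List.map (λ B → □ B , B) (bodies A)) p
    ...   | inj₁ q = let (B , b , e) = ∈-map⁻ _ q in ext B b (cong proj₁ e) (cong proj₂ e)
    ...   | inj₂ q = by L refl q
      where
      by : ∀ L' → L ≡ L' → desc v ∈ extra L' → Kind (proj₁ (desc v)) (proj₂ (desc v))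
      by MNF eq q = let (B , b , e) = ∈-map⁻ _ q in boxed B b eq (cong proj₁ e) (cong proj₂ e)

    boxed-∈ : L ≡ MNF → ∀ {B} → B ∈ bodies A → (□ B , □ B) ∈ nbhds
    boxed-∈ eq {B} b = there (∈-++⁺ʳ (Data.List.map (λ B → □ B , B) (bodies A)) (subst (λ L → (□ B , □ B) ∈ extra L) (sym eq) (∈-map⁺ (λ B → □ B , □ B) b)))

    private
      move : ∀ {u X Y} → X ≡ Y → evalM u X ≡ true → evalM u Y ≡ true
      move refl p = p

    fr : ⟪ frame ⟫ (c ∷ [])
    fr = frame⇐ (λ a _ → 0 , z≤n , nbh⇐ a 0 refl) λ eq a a≤ v v≤ p → tr eq a v v≤ (nbh⇒ a v p) (kind v)
      where
      Goal : ℕ → ℕ → Set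
      Goal a v = Σ ℕ λ v' → v' ≤ c × (⟪ nbh ⟫ (c ∷ a ∷ v' ∷ []) × (∀ k → k ≤ c → ⟪ elt ⟫ (c ∷ v' ∷ k ∷ []) → ⟪ nbh ⟫ (c ∷ k ∷ v ∷ [])))
      -- The `□ B`-worlds all have v as a neighbourhood, and under `MNF` they form by `extra` a
      -- neighbourhood of each of themselves.
      via : L ≡ MNF → ∀ a v B → B ∈ bodies A → proj₁ (desc v) ≡ □ B → evalM (wld a) (□ B) ≡ true → Goal a v
      via eq a v B b e p = let (v' , le , d) = find (boxed-∈ eq b) in
        v' , le , nbh⇐ a v' (move {wld a} (sym (cong proj₁ d)) p) , λ k _ q → nbh⇐ k v (move {wld k} (trans (cong proj₂ d) (sym e)) (elt⇒ v' k q))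
      tr : L ≡ MNF → ∀ a v → v ≤ c → evalM (wld a) (proj₁ (desc v)) ≡ true → Kind (proj₁ (desc v)) (proj₂ (desc v)) → Goal a v
      tr eq a v v≤ p (all e _) = v , v≤ , nbh⇐ a v p , λ k _ _ → nbh⇐ k v (move {wld k} (sym e) refl)
      tr eq a v v≤ p (ext B b e _) = via eq a v B b e (move {wld a} e p)
      tr eq a v v≤ p (boxed B b _ e _) = via eq a v B b e (move {wld a} e p)
      tr eq a v v≤ p (none e) with move {wld a} e p
      ... | ()

    private
      t≢f : true ≢ false
      t≢f ()

    -- If `□ C` is false at a world, `Good` places inside each of its neighbourhoods, whatever its
    -- kind, a world of W that refutes C.
    truthM : ∀ B → (∀ {a} → a ∈ atoms B → a ∈ atoms A) → ∀ k → (Force c k B → evalM (wld k) B ≡ true) × (evalM (wld k) B ≡ true → Force c k B)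
    truthM (pv q) s k = let e = val⇔ k q (≤-trans (var-≤ A (s (here refl))) vb≤) in Equivalence.to e , Equivalence.from e
    truthM ⊥m s k = (λ ()) , λ ()
    truthM (B ⇒m C) s k = (λ h → imp-intro (wld k) B C λ p → proj₁ c' (h (proj₂ b' p))) , λ p h → proj₂ c' (imp-elim (wld k) B C p (proj₁ b' h))
      where
      b' = truthM B (λ p → s (∈-++⁺ˡ p)) k
      c' = truthM C (λ p → s (∈-++⁺ʳ (atoms B) p)) k
    truthM (□ C) s k = to , from
      where
      C∈ : C ∈ bodies A
      C∈ = atom-body A (s (here refl))
      ih : ∀ j → (Force c j C → evalM (wld j) C ≡ true) × (evalM (wld j) C ≡ true → Force c j C)
      ih = truthM C (λ p → s (there p))
      from : wld k (□ C) ≡ true → Force c k (□ C)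
      from p = let (v , v≤ , e) = find (there (∈-++⁺ˡ (∈-map⁺ (λ B → □ B , B) C∈))) in
        v , v≤ , nbh⇐ k v (move {wld k} (sym (cong proj₁ e)) p) , λ j _ q → proj₂ (ih j) (move {wld j} (cong proj₂ e) (elt⇒ v j q))
      module _ (v : ℕ) (h : ∀ j → j ≤ c → ⟪ elt ⟫ (c ∷ v ∷ j ∷ []) → Force c j C) where
        absurd : ∀ Y → proj₂ (desc v) ≡ Y → ¬ Elimination.Wit L A W Y C
        absurd Y e (u , p , q , r) = let (j , le , d) = index w₀ W p in
          t≢f (trans (sym (proj₁ (ih j) (h j (≤-trans le (≤-trans W≤ N≤c)) (elt⇐ v j (move {wld j} (sym e) (trans (cong (λ u → evalM u Y) d) q))))))
            (trans (cong (λ u → evalM u C) d) r))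
      to : Force c k (□ C) → wld k (□ C) ≡ true
      to (v , v≤ , p , h) with wld k (□ C) in eq
      ... | true = refl
      ... | false = ⊥-elim (case (st (wld k) (wld-∈ k) C C∈) (kind v))
        where
        no-box : ∀ {B} → proj₁ (desc v) ≡ □ B → wld k (□ B) ≢ false
        no-box e q = t≢f (trans (sym (move {wld k} e (nbh⇒ k v p))) q)
        case : wld k (□ C) ≡ true ⊎ (Elimination.Wit L A W ⊤m C × (∀ B → B ∈ bodies A → wld k (□ B) ≡ false ⊎ (Elimination.Wit L A W B C × (L ≡ MN ⊎ Elimination.Wit L A W (□ B) C)))) →
          Kind (proj₁ (desc v)) (proj₂ (desc v)) → ⊥
        case (inj₁ q) _ = t≢f (trans (sym q) eq)
        case (inj₂ (u , g)) (all _ e) = absurd v h ⊤m e u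
        case (inj₂ (u , g)) (ext B b d e) with g B b
        ... | inj₁ q = no-box d q
        ... | inj₂ (u' , _) = absurd v h B e u'
        case (inj₂ (u , g)) (boxed B b f d e) with g B b
        ... | inj₁ q = no-box d q
        ... | inj₂ (_ , inj₁ f') = MN≢MNF (trans (sym f') f)
          where
          MN≢MNF : MN ≢ MNF
          MN≢MNF ()
        ... | inj₂ (_ , inj₂ u') = absurd v h (□ B) e u'
        case (inj₂ (u , g)) (none d) with move {wld k} d (nbh⇒ k v p)
        ... | ()

  incomplete : ∀ A → T ⊢ interp Pr atom A → L ⊢m A
  incomplete A p with Elimination.decide L A
  ... | inj₁ q = q
  ... | inj₂ (W , st , w , w∈ , e) = ⊥-elim (refute (index w W w∈))
    where
    open CounterModel A W w w∈ st
    refute : ¬ Σ ℕ λ n → n ≤ length W × nth w W n ≡ w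
    refute (k , le , d) = state-con c k k≤ fr (subst (T ⊢_) (sym (NState-def c k)) (contra' p
        (⊢-lift hPA (proj₂ (Truth.truth c fr A k k≤) λ fc → f≢t (trans (trans (sym e) (sym (cong (λ u → evalM u A) d))) (proj₁ (truthM A id k) fc))))))
      where
      k≤ : k ≤ c
      k≤ = ≤-trans le (≤-trans W≤ N≤c)
      f≢t : false ≢ true
      f≢t ()
      contra' : ∀ {φ ψ} → T ⊢ φ → T ⊢ ψ ⇒ ¬' φ → T ⊢ ¬' ψ
      contra' p q = mp (mp axS q) (mp axK p)

  sound-L : ∀ (g : ℕ → Formula) A → L ⊢m A → PA ⊢ interp Pr g A
  sound-L g A (taut t) = Kalmar.tautology (interp Pr g) refl (λ _ _ → refl) {A} t
  sound-L g A (mpm p q) = mp (sound-L g _ p) (sound-L g _ q)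
  sound-L g _ (nec {A} p) = pr-complete (interp Pr g A) (⊢-lift hPA (sound-L g A p))
  sound-L g _ (rm {A} {B} p) = prM (interp Pr g A) (interp Pr g B) (⊢-lift hPA (sound-L g (A ⇒m B) p))
  sound-L g _ (ax4 {A} e) = pr4 e (interp Pr g A)

  E-closed : ∀ k → ClosedT k E
  E-closed k = subst (ClosedT k) (sym E-def) (numeral-closed k e*)

  opaque
    unfolding Pr
    Pr-Σ₁ : Σ₁ Pr
    Pr-Σ₁ = s-ex (s-d0 (F-Δ₀ provable _))

    Pr-closed : Closed 1 Pr
    Pr-closed = (F-closed provable cs , _) , _
      where
      cs : closedTs {2} (var 0 ∷ var 1 ∷ E ∷ [])
      cs zero = s≤s z≤n
      cs (suc zero) = s≤s (s≤s z≤n)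
      cs (suc (suc zero)) = E-closed 2

  opaque
    unfolding atom
    atom-closed : ∀ q → Sentence (atom q)
    atom-closed q = (F-closed valued cs , _) , _
      where
      cs : closedTs {1} (var 0 ∷ numeral q ∷ E ∷ [])
      cs zero = s≤s z≤n
      cs (suc zero) = numeral-closed 1 q
      cs (suc (suc zero)) = E-closed 1

  -- Every numeral instance of the matrix is refuted in PA or true. In the latter case it describes
  -- a derivation, from which a theorem is read off, since it cannot describe an event.
  pr-sound : ∀ n → PA ⊢ Pr [ numeral n ] → Σ Formula λ φ → ⌜ φ ⌝ ≡ n × (T ⊢ φ)
  pr-sound n p = Translation.witness _ (F provable (var 0 ∷ numeral n ∷ E ∷ [])) (pr⊢ n p) λ k → case k (decD provable (k ∷ n ∷ e* ∷ []))
    where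
    inst-eq : ∀ k → (F provable (var 0 ∷ numeral n ∷ E ∷ [])) [ numeral k ] ≡ F provable (numeral k ∷ numeral n ∷ E ∷ [])
    inst-eq k = trans (cong (λ τ → (F provable (var 0 ∷ τ)) [ numeral k ]) (sym (nE n))) (F-inst provable (numeral k) (numeral n ∷ E ∷ []))
    case : ∀ k → Dec (⟪ provable ⟫ (k ∷ n ∷ e* ∷ [])) → (Σ Formula λ φ → ⌜ φ ⌝ ≡ n × (T ⊢ φ)) ⊎ (PA ⊢ ¬' ((F provable (var 0 ∷ numeral n ∷ E ∷ [])) [ numeral k ]))
    case k (no q) = inj₂ (subst (λ φ → PA ⊢ ¬' φ) (sym (inst-eq k)) (unnd {[]} (ƛ (false⇒ provable (k ∷ n ∷ e* ∷ []) q ·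
      F-cong provable (≐refl _ ∷ ≐refl _ ∷ ≐sym E≐ ∷ []) h0))))
    case k (yes q) = inj₁ (from (provable⇒ q))
      where
      from : (Σ ℕ λ m → Σ ℕ λ Y → ⟪ proved ⟫ (m ∷ Y ∷ e* ∷ n ∷ [])) ⊎
        (Σ ℕ λ m → Σ ℕ λ Y → Σ ℕ λ c → Σ ℕ λ l → Σ ℕ λ z → ⟪ first ⟫ (k ∷ e* ∷ m ∷ Y ∷ c ∷ l ∷ z ∷ [])) → Σ Formula λ φ → ⌜ φ ⌝ ≡ n × (T ⊢ φ)
      from (inj₁ (m , Y , h)) = let (φ , e , t) = proved-Th h in φ , sym e , t
      from (inj₂ (m , Y , c , l , z , h)) = ⊥-elim (noEvent m Y c l z (first-event h))

  main : Σ Formula (λ Pr → Σ₁ Pr × IsProvPred T Pr × CondM T Pr ×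
    (∀ (f : Interpretation) (A : MFm) → L ⊢m A → PA ⊢ (f ⟦ Pr ⟧) A) ×
    Σ Interpretation (λ f → ∀ (A : MFm) → (L ⊢m A) ⇔ (T ⊢ (f ⟦ Pr ⟧) A)))
  main = Pr , Pr-Σ₁ , (Pr-closed , λ n → mk⇔ (pr-sound n) (λ { (φ , refl , t) → pr-complete φ t })) ,
    (λ φ ψ p → ⊢-lift hPA (prM φ ψ p)) , (λ f A p → sound-L (proj₁ f) A p) ,
    (atom , atom-closed) , λ A → mk⇔ (λ p → ⊢-lift hPA (sound-L atom A p)) (incomplete A)

-- Coding finite sets by divisibility: q belongs to the set coded by (d , w) when 1 + (q + 1) d divides w.

modulus : ℕ → ℕ → ℕ
modulus d q = suc (suc q * d)

CommonMultiple : ℕ → ℕ → Set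
CommonMultiple d b = ∀ i → i ≤ b → suc i ∣ d

-- A common divisor divides the combination j - i of the two moduli, hence d, hence the 1 by which
-- each modulus exceeds a multiple of d.
moduli-coprime : ∀ {d b} → CommonMultiple d b → ∀ {i j} → i < j → j ≤ b → Coprime (modulus d i) (modulus d j)
moduli-coprime {d} {b} cm {i} {j} i<j j≤b {e} (p , q) = ∣1⇒≡1 (∣m+n∣m⇒∣n (subst (e ∣_) (+-comm 1 (suc i * d)) p) (∣n⇒∣m*n (suc i) (∣-trans e∣δ δ∣d)))
  where
  δ : ℕ
  δ = j ∸ i
  -- (j + 1) (1 + (i + 1) d) = (i + 1) (1 + (j + 1) d) + (j − i)
  key : suc j * modulus d i ≡ suc i * modulus d j + δ
  key = subst (λ j → suc j * modulus d i ≡ suc i * modulus d j + δ) (m+[n∸m]≡n (<⇒≤ i<j)) (ring i δ d)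
    where
    ring : ∀ i δ d → suc (i + δ) * suc (suc i * d) ≡ suc i * suc (suc (i + δ) * d) + δ
    ring = solve-∀
  e∣δ : e ∣ δ
  e∣δ = ∣m+n∣m⇒∣n (subst (e ∣_) key (∣n⇒∣m*n (suc j) p)) (∣n⇒∣m*n (suc i) q)
  δ∣d : δ ∣ d
  δ∣d with δ in eq
  ... | zero = ⊥-elim (<-irrefl (sym (m∸n≡0⇒m≤n' eq)) i<j)
    where
    m∸n≡0⇒m≤n' : j ∸ i ≡ 0 → j ≡ i
    m∸n≡0⇒m≤n' z = ≤-antisym (m∸n≡0⇒m≤n z) (<⇒≤ i<j)
  ... | suc k = cm k (≤-trans (≤-trans (n≤1+n k) (subst (_≤ j) eq (m∸n≤m j i))) j≤b)

prod : ℕ → (ℕ → Bool) → ℕ → ℕ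
prod d f zero = if f 0 then modulus d 0 else 1
prod d f (suc n) = (if f (suc n) then modulus d (suc n) else 1) * prod d f n

prod-∣ : ∀ d f {q n} → q ≤ n → f q ≡ true → modulus d q ∣ prod d f n
prod-∣ d f {n = zero} z≤n p rewrite p = ∣-refl
prod-∣ d f {n = suc n} q≤ p with m≤n⇒m<n∨m≡n q≤
... | inj₁ (s≤s r) = ∣n⇒∣m*n (if f (suc n) then modulus d (suc n) else 1) (prod-∣ d f r p)
... | inj₂ refl rewrite p = m∣m*n (prod d f n)

coprime-1 : ∀ {m} → Coprime m 1
coprime-1 (_ , q) = ∣1⇒≡1 q

module _ {d b : ℕ} (cm : CommonMultiple d b) where

  coprime-≢ : ∀ {i j} → i ≢ j → i ≤ b → j ≤ b → Coprime (modulus d i) (modulus d j)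
  coprime-≢ {i} {j} ne i≤ j≤ with <-cmp i j
  ... | tri< p _ _ = moduli-coprime cm p j≤
  ... | tri≈ _ e _ = ⊥-elim (ne e)
  ... | tri> _ _ p = coprime-sym (moduli-coprime cm p i≤)

  factor-coprime : ∀ (f : ℕ → Bool) {q i} → q ≤ b → i ≤ b → (f i ≡ true → q ≢ i) → Coprime (modulus d q) (if f i then modulus d i else 1)
  factor-coprime f {q} {i} q≤ i≤ ne with f i
  ... | true = coprime-≢ (ne refl) q≤ i≤
  ... | false = coprime-1

  -- The modulus is coprime to every factor of the product, so dividing it would force it to be 1; a
  -- nonzero d excludes that.
  prod-∣⁻ : ∀ (f : ℕ → Bool) {q n} → n ≤ b → q ≤ b → f q ≢ true → ¬ (d ≡ 0) → ¬ (modulus d q ∣ prod d f n)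
  prod-∣⁻ f {q} n≤ q≤ nf d≢0 h = d≢0 (m*n≡0⇒m≡0-suc q (suc-injective (go n≤ h)))
    where
    ne : ∀ {i} → f i ≡ true → q ≢ i
    ne p refl = nf p
    m*n≡0⇒m≡0-suc : ∀ q → suc q * d ≡ 0 → d ≡ 0
    m*n≡0⇒m≡0-suc q e = m+n≡0⇒m≡0 d e
    go : ∀ {n} → n ≤ b → modulus d q ∣ prod d f n → modulus d q ≡ 1
    go {zero} n≤ h = factor-coprime f q≤ n≤ ne (∣-refl , h)
    go {suc n} n≤ h = go (≤-trans (n≤1+n n) n≤) (coprime-divisor (factor-coprime f q≤ n≤ ne) h)

  -- The source of the common bound on codes: all sets are coded by divisors of a single w, because
  -- pairwise coprime divisors can be multiplied.
  prod-divides : ∀ (f : ℕ → Bool) {w} → (∀ i → i ≤ b → modulus d i ∣ w) → ∀ n → n ≤ b → prod d f n ∣ w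
  prod-divides f h zero n≤ with f 0
  ... | true = h 0 n≤
  ... | false = 1∣ _
  prod-divides f {w} h (suc n) n≤ with f (suc n)
  ... | false = subst (_∣ w) (sym (*-identityˡ (prod d f n))) (prod-divides f h n (≤-trans (n≤1+n n) n≤))
  ... | true = join (prod-divides f h n (≤-trans (n≤1+n n) n≤)) (h (suc n) n≤)
    where
    cop : ∀ {k} → k ≤ n → Coprime (modulus d (suc n)) (prod d f k)
    cop {zero} k≤ = factor-coprime f n≤ z≤n λ _ ()
    cop {suc k} k≤ (p , q) = cop (≤-trans (n≤1+n k) k≤) (p , coprime-divisor c' q)
      where
      c' : Coprime _ (if f (suc k) then modulus d (suc k) else 1)
      c' (r , s) = factor-coprime f n≤ (≤-trans k≤ (≤-trans (n≤1+n n) n≤)) (λ _ e → <-irrefl (sym (suc-injective e)) k≤) (∣-trans r p , s)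
    join : prod d f n ∣ w → modulus d (suc n) ∣ w → modulus d (suc n) * prod d f n ∣ w
    join (divides k e) q = let (divides l g) = coprime-divisor (cop ≤-refl) (subst (modulus d (suc n) ∣_) (trans e (*-comm k (prod d f n))) q) in
      divides l (trans e (trans (cong (_* prod d f n) g) (*-assoc l (modulus d (suc n)) (prod d f n))))

fac : ℕ → ℕ
fac zero = 1
fac (suc n) = suc n * fac n

fac-multiple : ∀ b → CommonMultiple (fac (suc b)) b
fac-multiple zero .0 z≤n = m∣m*n 1
fac-multiple (suc b) i p with m≤n⇒m<n∨m≡n p
... | inj₁ (s≤s q) = ∣n⇒∣m*n (suc (suc b)) (fac-multiple b i q)
... | inj₂ refl = m∣m*n (fac (suc b))

fac-pos : ∀ n → 0 < fac n
fac-pos zero = s≤s z≤n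
fac-pos (suc n) = ≤-trans (fac-pos n) (m≤m+n (fac n) (n * fac n))

prod-pos : ∀ d f n → 0 < prod d f n
prod-pos d f zero with f 0
... | true = s≤s z≤n
... | false = s≤s z≤n
prod-pos d f (suc n) with f (suc n)
... | true = ≤-trans (prod-pos d f n) (m≤m+n (prod d f n) _)
... | false = ≤-trans (prod-pos d f n) (m≤m+n (prod d f n) _)

pairing-mono : ∀ {a b a' b'} → a ≤ a' → b ≤ b' → pairing a b ≤ pairing a' b'
pairing-mono p q = +-mono-≤ (*-mono-≤ (+-mono-≤ p q) (+-mono-≤ p q)) q

prᵗ : ∀ {n} → Tm n → Tm n → Tm n
prᵗ a b = (a +ᵗ b) *ᵗ (a +ᵗ b) +ᵗ b

opaque
  memD : D 3      -- z k x
  memD = ∃≤ x0 (∃≤ x1 (x2 ≈ prᵗ x1 x0 ∧d ∃≤ x0 (x0 *ᵗ S (S (prᵗ x4 x5) *ᵗ x2) ≈ x1)))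

  capD : D 2      -- m Y
  -- It is enough that Y bounds the pair of some nonzero common multiples: d of the numbers i + 1,
  -- and w of the moduli. Neither a factorial nor a product has to be defined in arithmetic.
  capD = ∃≤ x1 (∃≤ x2 (¬d (x1 ≈ # 0) ∧d ¬d (x0 ≈ # 0) ∧d ∃≤ x3 (x0 ≈ prᵗ x2 x1) ∧d
    ∀≤ (prᵗ x2 x2) (∃≤ x2 (x0 *ᵗ S x1 ≈ x3) ∧d ∃≤ x1 (x0 *ᵗ S (S x1 *ᵗ x3) ≈ x2))))

  mem⇔ : ∀ d w k x → ⟪ memD ⟫ (pairing d w ∷ k ∷ x ∷ []) ⇔ (modulus d (pairing k x) ∣ w)
  mem⇔ d w k x = mk⇔ to from
    where
    to : ⟪ memD ⟫ (pairing d w ∷ k ∷ x ∷ []) → modulus d (pairing k x) ∣ w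
    to (d' , _ , w' , _ , e , u , _ , g) with pairing-inj d w d' w' e
    ... | refl , refl = divides u (sym g)
    from : modulus d (pairing k x) ∣ w → ⟪ memD ⟫ (pairing d w ∷ k ∷ x ∷ [])
    from (divides u g) = d , pairing-≤₁ d w , w , pairing-≤₂ d w , refl , u , u≤ , sym g
      where
      u≤ : u ≤ w
      u≤ = subst (u ≤_) (sym g) (m≤m*n u (modulus d (pairing k x)))

  cap-exists' : ∀ m → Σ ℕ λ Y → ⟪ capD ⟫ (m ∷ Y ∷ [])
  cap-exists' m = pairing d w , d , pairing-≤₁ d w , w , pairing-≤₂ d w , (λ e → <-irrefl (sym e) (fac-pos (suc b))) ,
      (λ e → <-irrefl (sym e) (prod-pos d (λ _ → true) b)) , (pairing d w , ≤-refl , refl) , λ i i≤ → quot₁ (fac-multiple b i i≤) , quot₂ {i} (prod-∣ d (λ _ → true) i≤ refl)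
    where
    b d w : ℕ
    b = pairing m m
    d = fac (suc b)
    w = prod d (λ _ → true) b
    quot₁ : ∀ {i} → suc i ∣ d → Σ ℕ λ u → u ≤ d × u * suc i ≡ d
    quot₁ {i} (divides u e) = u , subst (u ≤_) (sym e) (m≤m*n u (suc i)) , sym e
    quot₂ : ∀ {i} → modulus d i ∣ w → Σ ℕ λ u → u ≤ w × u * modulus d i ≡ w
    quot₂ {i} (divides u e) = u , subst (u ≤_) (sym e) (m≤m*n u (modulus d i)) , sym e

  cap-codes' : ∀ {m Y} → ⟪ capD ⟫ (m ∷ Y ∷ []) → (f : ℕ → ℕ → Bool) →
    Σ ℕ λ z → z ≤ Y × (∀ k x → k ≤ m → x ≤ m → ⟪ memD ⟫ (z ∷ k ∷ x ∷ []) ⇔ (f k x ≡ true))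
  cap-codes' {m} {Y} (d , _ , w , _ , d≢0 , w≢0 , (y , y≤ , e) , h) f = pairing d w' ,
      ≤-trans (pairing-mono (≤-refl {d}) (∣⇒≤ {{≢-nonZero w≢0}} (prod-divides cm g (λ i i≤ → let (u , _ , q) = proj₂ (h i i≤) in divides u (sym q)) b ≤-refl))) (subst (_≤ Y) e y≤) ,
      λ k x k≤ x≤ → mk⇔ (to k x k≤ x≤) (from k x k≤ x≤)
    where
    b : ℕ
    b = pairing m m
    cm : CommonMultiple d b
    cm i i≤ = let (u , _ , q) = proj₁ (h i i≤) in divides u (sym q)
    Hit : ℕ → ℕ → ℕ → Set
    Hit q k x = q ≡ pairing k x × f k x ≡ true
    hit? : ∀ q → Dec (Σ ℕ λ k → k ≤ q × Σ ℕ λ x → x ≤ q × Hit q k x)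
    hit? q = any≤? q λ k → any≤? q λ x → (q ≟ pairing k x) ×-dec (f k x Bool.≟ true)
    g : ℕ → Bool
    g q = ⌊ hit? q ⌋
    w' : ℕ
    w' = prod d g b
    g⇒ : ∀ k x → g (pairing k x) ≡ true → f k x ≡ true
    g⇒ k x p with hit? (pairing k x)
    ... | yes (k' , _ , x' , _ , e , r) with pairing-inj k x k' x' e
    ...   | refl , refl = r
    g⇐ : ∀ k x → f k x ≡ true → g (pairing k x) ≡ true
    g⇐ k x p with hit? (pairing k x)
    ... | yes _ = refl
    ... | no n = ⊥-elim (n (k , pairing-≤₁ k x , x , pairing-≤₂ k x , refl , p))
    to : ∀ k x → k ≤ m → x ≤ m → ⟪ memD ⟫ (pairing d w' ∷ k ∷ x ∷ []) → f k x ≡ true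
    to k x k≤ x≤ p with f k x in eq
    ... | true = refl
    ... | false = ⊥-elim (prod-∣⁻ cm g ≤-refl (pairing-mono k≤ x≤) (λ q → t≢f (trans (sym (g⇒ k x q)) eq)) d≢0 (Equivalence.to (mem⇔ d w' k x) p))
      where
      t≢f : true ≢ false
      t≢f ()
    from : ∀ k x → k ≤ m → x ≤ m → f k x ≡ true → ⟪ memD ⟫ (pairing d w' ∷ k ∷ x ∷ [])
    from k x k≤ x≤ p = Equivalence.from (mem⇔ d w' k x) (prod-∣ d g (pairing-mono k≤ x≤) (g⇐ k x p))

  minD : D 3      -- N a a'  :  a' = a ⊓ N
  minD = (x2 ≈ x1 ∧d ∃≤ x0 (x0 ≈ x2)) ∨d (x2 ≈ x0 ∧d ∃≤ x1 (x0 ≈ x1))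

  tableD : ℕ → D 3   -- c a b
  tableD t = ∃≤ x0 (∃≤ x1 (x2 ≈ prᵗ x1 x0 ∧d ∃≤ x1 (∃≤ x2 (
    call minD (x3 ∷ x5 ∷ x1 ∷ []) ∧d call minD (x3 ∷ x6 ∷ x0 ∷ []) ∧d call memD (x2 ∷ # t ∷ prᵗ x1 x0 ∷ [])))))

  min⇒ : ∀ N a a' → ⟪ minD ⟫ (N ∷ a ∷ a' ∷ []) → a' ≡ a ⊓ N
  min⇒ N a a' (inj₁ (e , y , y≤ , g)) = trans e (sym (m≤n⇒m⊓n≡m (subst (_≤ N) g y≤)))
  min⇒ N a a' (inj₂ (e , y , y≤ , g)) = trans e (sym (m≥n⇒m⊓n≡n (subst (_≤ a) g y≤)))

  min⇐ : ∀ N a → ⟪ minD ⟫ (N ∷ a ∷ a ⊓ N ∷ [])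
  min⇐ N a with ≤-total a N
  ... | inj₁ p = inj₁ (m≤n⇒m⊓n≡m p , a , p , refl)
  ... | inj₂ p = inj₂ (m≥n⇒m⊓n≡n p , N , p , refl)

  table⇔ : ∀ t N z a b → ⟪ tableD t ⟫ (pairing N z ∷ a ∷ b ∷ []) ⇔ ⟪ memD ⟫ (z ∷ t ∷ pairing (a ⊓ N) (b ⊓ N) ∷ [])
  table⇔ t N z a b = mk⇔ to from
    where
    to : ⟪ tableD t ⟫ (pairing N z ∷ a ∷ b ∷ []) → ⟪ memD ⟫ (z ∷ t ∷ pairing (a ⊓ N) (b ⊓ N) ∷ [])
    to (N' , _ , z' , _ , e , a' , _ , b' , _ , p , q , r) with pairing-inj N z N' z' e
    ... | refl , refl = subst₂ (λ a' b' → ⟪ memD ⟫ (z ∷ t ∷ pairing a' b' ∷ [])) (min⇒ N a a' p) (min⇒ N b b' q) r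
    from : ⟪ memD ⟫ (z ∷ t ∷ pairing (a ⊓ N) (b ⊓ N) ∷ []) → ⟪ tableD t ⟫ (pairing N z ∷ a ∷ b ∷ [])
    from r = N , pairing-≤₁ N z , z , pairing-≤₂ N z , refl , a ⊓ N , m⊓n≤n a N , b ⊓ N , m⊓n≤n b N , min⇐ N a , min⇐ N b , r

  tables' : ∀ N (f g h : ℕ → ℕ → Bool) → Σ ℕ λ c → N ≤ c × (∀ a b →
    (⟪ tableD 0 ⟫ (c ∷ a ∷ b ∷ []) ⇔ (f (a ⊓ N) (b ⊓ N) ≡ true)) ×
    (⟪ tableD 1 ⟫ (c ∷ a ∷ b ∷ []) ⇔ (g (a ⊓ N) (b ⊓ N) ≡ true)) ×
    (⟪ tableD 2 ⟫ (c ∷ a ∷ b ∷ []) ⇔ (h (a ⊓ N) (b ⊓ N) ≡ true)))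
  tables' N f g h = pairing N z , pairing-≤₁ N z , λ a b → entry 0 z≤n a b , entry 1 (s≤s z≤n) a b , entry 2 (s≤s (s≤s z≤n)) a b
    where
    pick : ℕ → ℕ → ℕ → Bool
    pick 0 = f
    pick 1 = g
    pick _ = h
    hit? : ∀ t x → Dec (Σ ℕ λ a → a ≤ x × Σ ℕ λ b → b ≤ x × (x ≡ pairing a b × pick t a b ≡ true))
    hit? t x = any≤? x λ a → any≤? x λ b → (x ≟ pairing a b) ×-dec (pick t a b Bool.≟ true)
    G : ℕ → ℕ → Bool
    G t x = ⌊ hit? t x ⌋
    G⇔ : ∀ t a b → (G t (pairing a b) ≡ true) ⇔ (pick t a b ≡ true)
    G⇔ t a b with hit? t (pairing a b)
    ... | yes (a' , _ , b' , _ , e , r) = mk⇔ (λ _ → subst₂ (λ a b → pick t a b ≡ true) (sym (proj₁ (pairing-inj a b a' b' e))) (sym (proj₂ (pairing-inj a b a' b' e))) r) λ _ → refl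
    ... | no n = mk⇔ (λ ()) λ r → ⊥-elim (n (a , pairing-≤₁ a b , b , pairing-≤₂ a b , refl , r))
    m : ℕ
    -- The components 0, 1 and 2 of one family hold the three tables, with entries at pairs of
    -- numbers up to N.
    m = 2 ⊔ pairing N N
    coded : Σ ℕ λ z → z ≤ proj₁ (cap-exists' m) × (∀ k x → k ≤ m → x ≤ m → ⟪ memD ⟫ (z ∷ k ∷ x ∷ []) ⇔ (G k x ≡ true))
    coded = cap-codes' (proj₂ (cap-exists' m)) G
    z : ℕ
    z = proj₁ coded
    entry : ∀ t → t ≤ 2 → ∀ a b → ⟪ tableD t ⟫ (pairing N z ∷ a ∷ b ∷ []) ⇔ (pick t (a ⊓ N) (b ⊓ N) ≡ true)
    entry t t≤ a b = mk⇔ (λ p → Equivalence.to (G⇔ t _ _) (Equivalence.to spec (Equivalence.to (table⇔ t N z a b) p)))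
      (λ p → Equivalence.from (table⇔ t N z a b) (Equivalence.from spec (Equivalence.from (G⇔ t _ _) p)))
      where
      spec : ⟪ memD ⟫ (z ∷ t ∷ pairing (a ⊓ N) (b ⊓ N) ∷ []) ⇔ (G t (pairing (a ⊓ N) (b ⊓ N)) ≡ true)
      spec = proj₂ (proj₂ coded) t _ (≤-trans t≤ (m≤m⊔n 2 (pairing N N))) (≤-trans (pairing-mono (m⊓n≤n a N) (m⊓n≤n b N)) (m≤n⊔m 2 (pairing N N)))

-- Systems of Horn clauses over ℕ

data R (n : ℕ) : Set where
  var  : Fin n → R n
  nat  : ℕ → R n
  suc  : R n → R n
  duo  : R n → R n → R n

evR : ∀ {n} → R n → Vec ℕ n → ℕ
evR (var i) ρ = lookup ρ i
evR (nat k) ρ = k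
evR (suc t) ρ = suc (evR t ρ)
evR (duo t s) ρ = pr (evR t ρ) (evR s ρ)

tri-double : ∀ s → tri s + tri s ≡ s * suc s
tri-double zero = refl
tri-double (suc s) = trans (shuffle s (tri s)) (trans (cong (suc s + suc s +_) (tri-double s)) (ring s))
  where
  shuffle : ∀ s t → suc s + t + (suc s + t) ≡ suc s + suc s + (t + t)
  shuffle = solve-∀
  ring : ∀ s → suc s + suc s + s * suc s ≡ suc s * suc (suc s)
  ring = solve-∀

double-inj : ∀ {a b} → a + a ≡ b + b → a ≡ b
double-inj {zero} {zero} e = refl
double-inj {suc a} {suc b} e = cong suc (double-inj (suc-injective (trans (sym (+-suc a a)) (trans (suc-injective e) (+-suc b b)))))

≤-tri : ∀ s → s ≤ tri s
≤-tri zero = z≤n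
≤-tri (suc s) = m≤m+n (suc s) (tri s)

opaque
  unfolding pr

  -- Doubling clears the division by two in the Cantor pairing, so its graph becomes a polynomial
  -- equation that `valD` can express.
  pr-double : ∀ a b → pr a b + pr a b ≡ (a + b) * suc (a + b) + (b + b)
  pr-double a b = trans (shuffle (tri (a + b)) b) (cong (_+ (b + b)) (tri-double (a + b)))
    where
    shuffle : ∀ t b → t + b + (t + b) ≡ t + t + (b + b)
    shuffle = solve-∀

  pr-≤₁ : ∀ a b → a ≤ pr a b
  pr-≤₁ a b = ≤-trans (m≤m+n a b) (≤-trans (≤-tri (a + b)) (m≤m+n _ b))

  pr-≤₂ : ∀ a b → b ≤ pr a b
  pr-≤₂ a b = m≤n+m b _

vs : ∀ k {n} → Vec (Tm (k + n)) n
vs k = tabulate (vr ∘ (k ↑ʳ_))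

evTs-tabulate : ∀ {n m} (f : Fin m → Tm n) ρ → evTs (tabulate f) ρ ≡ tabulate (λ i → evT (f i) ρ)
evTs-tabulate {m = zero} f ρ = refl
evTs-tabulate {m = suc m} f ρ = cong (evT (f zero) ρ ∷_) (evTs-tabulate (f ∘ suc) ρ)

evTs-vars : ∀ {n m} (f : Fin m → Tm n) ρ σ → (∀ i → evT (f i) ρ ≡ lookup σ i) → evTs (tabulate f) ρ ≡ σ
evTs-vars f ρ σ h = trans (evTs-tabulate f ρ) (trans (tabulate-cong h) (tabulate∘lookup σ))

evTs-vs : ∀ {k n} (xs : Vec ℕ k) (ρ : Vec ℕ n) → evTs (vs k) (xs ++ᵥ ρ) ≡ ρ
evTs-vs {k} xs ρ = evTs-vars (vr ∘ (k ↑ʳ_)) (xs ++ᵥ ρ) ρ (λ i → lookup-++ʳ xs ρ i)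

-- x b ρ  :  x is the value of the term at ρ, all subterms being bounded by b
valD : ∀ {n} → R n → D (2 + n)
valD (var i) = x0 ≈ vr (suc (suc i))
valD (nat k) = x0 ≈ # k
valD (suc t) = ∃≤ x1 (call (valD t) (x0 ∷ x2 ∷ vs 3) ∧d x1 ≈ S x0)
valD (duo t s) = ∃≤ x1 (∃≤ x2 (call (valD t) (x1 ∷ x3 ∷ vs 4) ∧d call (valD s) (x0 ∷ x3 ∷ vs 4) ∧d
  x2 +ᵗ x2 ≈ (x1 +ᵗ x0) *ᵗ S (x1 +ᵗ x0) +ᵗ (x0 +ᵗ x0)))

val⇒ : ∀ {n} (t : R n) {x b} ρ → ⟪ valD t ⟫ (x ∷ b ∷ ρ) → x ≡ evR t ρ
val⇒ (var i) ρ p = p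
val⇒ (nat k) ρ p = p
val⇒ (suc t) {x} {b} ρ (y , _ , p , e) = trans e (cong suc (val⇒ t ρ (subst (λ σ → ⟪ valD t ⟫ (y ∷ b ∷ σ)) (evTs-vs (y ∷ x ∷ b ∷ []) ρ) p)))
val⇒ (duo t s) {x} {b} ρ (y , _ , y' , _ , p , q , e) = double-inj (trans e (trans (sym (pr-double y y'))
    (cong₂ (λ u w → pr u w + pr u w) (val⇒ t ρ (subst (λ σ → ⟪ valD t ⟫ (y ∷ b ∷ σ)) eq p)) (val⇒ s ρ (subst (λ σ → ⟪ valD s ⟫ (y' ∷ b ∷ σ)) eq q)))))
  where
  eq : evTs (vs 4) (y' ∷ y ∷ x ∷ b ∷ ρ) ≡ ρ
  eq = evTs-vs (y' ∷ y ∷ x ∷ b ∷ []) ρ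

val⇐ : ∀ {n} (t : R n) {b} ρ → evR t ρ ≤ b → ⟪ valD t ⟫ (evR t ρ ∷ b ∷ ρ)
val⇐ (var i) ρ le = refl
val⇐ (nat k) ρ le = refl
val⇐ (suc t) {b} ρ le = evR t ρ , le' , subst (λ σ → ⟪ valD t ⟫ (evR t ρ ∷ b ∷ σ)) (sym (evTs-vs (evR t ρ ∷ suc (evR t ρ) ∷ b ∷ []) ρ)) (val⇐ t ρ le') , refl
  where
  le' : evR t ρ ≤ b
  le' = ≤-trans (n≤1+n _) le
val⇐ (duo t s) {b} ρ le = y , le₁ , y' , le₂ , subst (λ σ → ⟪ valD t ⟫ (y ∷ b ∷ σ)) (sym eq) (val⇐ t ρ le₁) ,
    subst (λ σ → ⟪ valD s ⟫ (y' ∷ b ∷ σ)) (sym eq) (val⇐ s ρ le₂) , pr-double y y'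
  where
  y y' : ℕ
  y = evR t ρ
  y' = evR s ρ
  le₁ : y ≤ b
  le₁ = ≤-trans (pr-≤₁ y y') le
  le₂ : y' ≤ b
  le₂ = ≤-trans (pr-≤₂ y y') le
  eq : evTs (vs 4) (y' ∷ y ∷ pr y y' ∷ b ∷ ρ) ≡ ρ
  eq = evTs-vs (y' ∷ y ∷ pr y y' ∷ b ∷ []) ρ

Bounded : ∀ {n} → ℕ → Vec ℕ n → Set
Bounded b ρ = ∀ i → lookup ρ i ≤ b

exs : ∀ n → D (n + 4) → D 4
exs zero d = d
exs (suc n) d = exs n (∃≤ (vr (n ↑ʳ suc zero)) d)

module _ (z b s q : ℕ) where

  private
    B : Vec ℕ 4
    B = z ∷ b ∷ s ∷ q ∷ []

  exs⇒ : ∀ n d → ⟪ exs n d ⟫ B → Σ (Vec ℕ n) λ ρ → Bounded b ρ × ⟪ d ⟫ (ρ ++ᵥ B)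
  exs⇒ zero d p = [] , (λ ()) , p
  exs⇒ (suc n) d p = let (ρ , h , x , x≤ , r) = exs⇒ n _ p in
    x ∷ ρ , (λ { zero → subst (x ≤_) (lookup-++ʳ ρ B (suc zero)) x≤ ; (suc i) → h i }) , r

  exs⇐ : ∀ {n} d (ρ : Vec ℕ n) → Bounded b ρ → ⟪ d ⟫ (ρ ++ᵥ B) → ⟪ exs n d ⟫ B
  exs⇐ d [] h p = p
  exs⇐ {suc n} d (x ∷ ρ) h p = exs⇐ _ ρ (h ∘ suc) (x , subst (x ≤_) (sym (lookup-++ʳ ρ B (suc zero))) (h zero) , p)

-- z b s p  :  p occurs in z with a rank below s
below : D 4
below = ∃≤ x2 (∃≤ x3 (S x1 +ᵗ x0 ≈ x4 ∧d call memD (x2 ∷ x1 ∷ x5 ∷ [])))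

Below : ℕ → ℕ → ℕ → Set
Below z s p = Σ ℕ λ s' → s' < s × ⟪ memD ⟫ (z ∷ s' ∷ p ∷ [])

below⇒ : ∀ {z b s p} → ⟪ below ⟫ (z ∷ b ∷ s ∷ p ∷ []) → Below z s p
below⇒ (s' , _ , t , _ , e , m) = s' , subst (suc s' ≤_) e (m≤m+n (suc s') t) , m

below⇐ : ∀ {z b s p} → Below z s p → ⟪ below ⟫ (z ∷ b ∷ s ∷ p ∷ [])
below⇐ {s = s} (s' , lt , m) = s' , ≤-trans (n≤1+n s') lt , s ∸ suc s' , m∸n≤m s (suc s') , m+[n∸m]≡n lt , m

record System : Set₁ where
  field
    Rule  : Set
    rules : List Rule
    every : ∀ r → r ∈ rules
    nv    : Rule → ℕ
    head  : ∀ r → R (nv r)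
    prem  : ∀ r → List (R (nv r))

module Horn (Sys : System) where
  open System Sys

  data Der : ℕ → Set where
    der : ∀ r (ρ : Vec ℕ (nv r)) → All (λ p → Der (evR p ρ)) (prem r) → Der (evR (head r) ρ)

  module _ {n : ℕ} where
    premD : R n → D (n + 4)
    premD p = ∃≤ (vr (n ↑ʳ suc zero)) (call (valD p) (x0 ∷ vr (suc (n ↑ʳ suc zero)) ∷ tabulate (λ i → vr (suc (i ↑ˡ 4)))) ∧d
      call below (vr (suc (n ↑ʳ zero)) ∷ vr (suc (n ↑ʳ suc zero)) ∷ vr (suc (n ↑ʳ suc (suc zero))) ∷ x0 ∷ []))

    premsD : List (R n) → D (n + 4)
    premsD [] = # 0 ≈ # 0
    premsD (p ∷ ps) = premD p ∧d premsD ps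

    headD : R n → D (n + 4)
    headD h = call (valD h) (vr (n ↑ʳ suc (suc (suc zero))) ∷ vr (n ↑ʳ suc zero) ∷ tabulate (λ i → vr (i ↑ˡ 4)))

  ruleD : Rule → D 4
  ruleD r = exs (nv r) (headD (head r) ∧d premsD (prem r))

  justD : D 4
  justD = foldr (λ r d → ruleD r ∨d d) ⊥d rules

  module _ (z b s q : ℕ) where

    private
      B : Vec ℕ 4
      B = z ∷ b ∷ s ∷ q ∷ []

    Just : Set
    Just = Σ Rule λ r → Σ (Vec ℕ (nv r)) λ ρ → q ≡ evR (head r) ρ × All (λ p → evR p ρ ≤ b × Below z s (evR p ρ)) (prem r)

    module _ {n : ℕ} (ρ : Vec ℕ n) where
      private
        at : ∀ (i : Fin 4) → lookup (ρ ++ᵥ B) (n ↑ʳ i) ≡ lookup B i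
        at i = lookup-++ʳ ρ B i
        env : ∀ p → evTs (tabulate (λ i → vr (suc (i ↑ˡ 4)))) (p ∷ (ρ ++ᵥ B)) ≡ ρ
        env p = evTs-vars _ (p ∷ (ρ ++ᵥ B)) ρ (λ i → lookup-++ˡ ρ B i)
        env₀ : evTs (tabulate (λ i → vr (i ↑ˡ 4))) (ρ ++ᵥ B) ≡ ρ
        env₀ = evTs-vars _ (ρ ++ᵥ B) ρ (λ i → lookup-++ˡ ρ B i)

      prem⇒ : ∀ p → ⟪ premD p ⟫ (ρ ++ᵥ B) → evR p ρ ≤ b × Below z s (evR p ρ)
      prem⇒ p (x , x≤ , a , c) = subst (_≤ b) e (subst (x ≤_) (at (suc zero)) x≤) , subst (Below z s) e (below⇒ {b = b} c')
        where
        e : x ≡ evR p ρ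
        e = val⇒ p ρ (subst₂ (λ b σ → ⟪ valD p ⟫ (x ∷ b ∷ σ)) (at (suc zero)) (env x) a)
        c' : ⟪ below ⟫ (z ∷ b ∷ s ∷ x ∷ [])
        c' = subst (λ s → ⟪ below ⟫ (z ∷ b ∷ s ∷ x ∷ [])) (at (suc (suc zero))) (subst₂ (λ z b → ⟪ below ⟫ (z ∷ b ∷ lookup (ρ ++ᵥ B) (n ↑ʳ suc (suc zero)) ∷ x ∷ [])) (at zero) (at (suc zero)) c)

      prem⇐ : ∀ p → evR p ρ ≤ b × Below z s (evR p ρ) → ⟪ premD p ⟫ (ρ ++ᵥ B)
      prem⇐ p (le , w) = x , subst (x ≤_) (sym (at (suc zero))) le ,
          subst₂ (λ b σ → ⟪ valD p ⟫ (x ∷ b ∷ σ)) (sym (at (suc zero))) (sym (env x)) (val⇐ p ρ le) ,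
          subst₂ (λ z b → ⟪ below ⟫ (z ∷ b ∷ lookup (ρ ++ᵥ B) (n ↑ʳ suc (suc zero)) ∷ x ∷ [])) (sym (at zero)) (sym (at (suc zero)))
            (subst (λ s → ⟪ below ⟫ (z ∷ b ∷ s ∷ x ∷ [])) (sym (at (suc (suc zero)))) (below⇐ {b = b} w))
        where
        x : ℕ
        x = evR p ρ

      prems⇒ : ∀ ps → ⟪ premsD ps ⟫ (ρ ++ᵥ B) → All (λ p → evR p ρ ≤ b × Below z s (evR p ρ)) ps
      prems⇒ [] _ = []
      prems⇒ (p ∷ ps) (a , c) = prem⇒ p a ∷ prems⇒ ps c

      prems⇐ : ∀ ps → All (λ p → evR p ρ ≤ b × Below z s (evR p ρ)) ps → ⟪ premsD ps ⟫ (ρ ++ᵥ B)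
      prems⇐ [] [] = refl
      prems⇐ (p ∷ ps) (a ∷ c) = prem⇐ p a , prems⇐ ps c

      head⇒ : ∀ h → ⟪ headD h ⟫ (ρ ++ᵥ B) → q ≡ evR h ρ
      head⇒ h p = trans (sym (at (suc (suc (suc zero))))) (val⇒ h ρ (subst (λ σ → ⟪ valD h ⟫ (lookup (ρ ++ᵥ B) (n ↑ʳ suc (suc (suc zero))) ∷ lookup (ρ ++ᵥ B) (n ↑ʳ suc zero) ∷ σ)) env₀ p))

      head⇐ : ∀ h → q ≤ b → q ≡ evR h ρ → ⟪ headD h ⟫ (ρ ++ᵥ B)
      head⇐ h le e = subst₂ (λ q σ → ⟪ valD h ⟫ (q ∷ lookup (ρ ++ᵥ B) (n ↑ʳ suc zero) ∷ σ)) (trans (sym e) (sym (at (suc (suc (suc zero)))))) (sym env₀)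
        (subst (λ b → ⟪ valD h ⟫ (evR h ρ ∷ b ∷ ρ)) (sym (at (suc zero))) (val⇐ h ρ (subst (_≤ b) e le)))

    just⇒ : ⟪ justD ⟫ B → Just
    just⇒ = go rules
      where
      go : ∀ rs → ⟪ foldr (λ r d → ruleD r ∨d d) ⊥d rs ⟫ B → Just
      go (r ∷ rs) (inj₁ p) = let (ρ , _ , h , ps) = exs⇒ z b s q (nv r) _ p in r , ρ , head⇒ ρ (head r) h , prems⇒ ρ (prem r) ps
      go (r ∷ rs) (inj₂ p) = go rs p

    just⇐ : q ≤ b → (j : Just) → Bounded b (proj₁ (proj₂ j)) → ⟪ justD ⟫ B
    just⇐ le (r , ρ , h , ps) bd = go rules (every r)
      where
      go : ∀ rs → r ∈ rs → ⟪ foldr (λ r d → ruleD r ∨d d) ⊥d rs ⟫ B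
      go (_ ∷ rs) (here refl) = inj₁ (exs⇐ z b s q (headD (head r) ∧d premsD (prem r)) ρ bd (head⇐ ρ (head r) le h , prems⇐ ρ (prem r) ps))
      go (_ ∷ rs) (there p) = inj₂ (go rs p)

  Justified : ℕ → ℕ → Set
  Justified z b = ∀ s → s ≤ b → ∀ q → q ≤ b → ⟪ memD ⟫ (z ∷ s ∷ q ∷ []) → Just z b s q

  -- The premises of a justified fact have lower rank, so unfolding justifications ends; n bounds
  -- the rank.
  justified-der : ∀ {z b} → Justified z b → ∀ n s → s < n → s ≤ b → ∀ q → q ≤ b → ⟪ memD ⟫ (z ∷ s ∷ q ∷ []) → Der q
  justified-der {z} {b} J (suc n) s (s≤s s<) s≤ q q≤ m = from (J s s≤ q q≤ m)
    where
    from : Just z b s q → Der q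
    from (r , ρ , e , ps) = subst Der (sym e) (der r ρ (All.map (λ { (le , s' , lt , m') → justified-der J n s' (<-≤-trans lt s<) (≤-trans (<⇒≤ lt) s≤) _ le m' }) ps))

  Nodes : Set
  Nodes = List (ℕ × ℕ)

  Supported : Nodes → ℕ → ℕ → ℕ → Set
  Supported ns b s q = Σ Rule λ r → Σ (Vec ℕ (nv r)) λ ρ → Bounded b ρ × (q ≡ evR (head r) ρ ×
    All (λ p → evR p ρ ≤ b × Σ ℕ λ s' → s' < s × (s' , evR p ρ) ∈ ns) (prem r))

  -- Derivations are flattened to finite sets of ranked facts, since these are what `memD` can code;
  -- the ranks exclude circular support.
  record Forest (ns : Nodes) (b : ℕ) : Set where
    field
      small : ∀ {s q} → (s , q) ∈ ns → s ≤ b × q ≤ b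
      supp  : ∀ {s q} → (s , q) ∈ ns → Supported ns b s q
  open Forest

  supp-mono : ∀ {ns ns' b b' s q} → (∀ {x} → x ∈ ns → x ∈ ns') → b ≤ b' → Supported ns b s q → Supported ns' b' s q
  supp-mono i le (r , ρ , bd , e , ps) = r , ρ , (λ j → ≤-trans (bd j) le) , e , All.map (λ { (l , s' , lt , m) → ≤-trans l le , s' , lt , i m }) ps

  union : ∀ {ns ns' b b'} → Forest ns b → Forest ns' b' → Forest (ns ++ ns') (b ⊔ b')
  union {ns} {ns'} {b} {b'} F G .small p with ∈-++⁻ ns p
  ... | inj₁ q = let (x , y) = small F q in ≤-trans x (m≤m⊔n b b') , ≤-trans y (m≤m⊔n b b')
  ... | inj₂ q = let (x , y) = small G q in ≤-trans x (m≤n⊔m b b') , ≤-trans y (m≤n⊔m b b')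
  union {ns} {ns'} {b} {b'} F G .supp p with ∈-++⁻ ns p
  ... | inj₁ q = supp-mono ∈-++⁺ˡ (m≤m⊔n b b') (supp F q)
  ... | inj₂ q = supp-mono (∈-++⁺ʳ ns) (m≤n⊔m b b') (supp G q)

  Tree : ℕ → Set
  Tree q = Σ Nodes λ ns → Σ ℕ λ b → Forest ns b × Σ ℕ λ s → (s , q) ∈ ns

  Grove : ∀ {n} → Vec ℕ n → List (R n) → Set
  Grove ρ ps = Σ Nodes λ ns → Σ ℕ λ b → Forest ns b × Σ ℕ λ h → All (λ p → Σ ℕ λ s → s < h × (s , evR p ρ) ∈ ns) ps

  maxVec : ∀ {n} → Vec ℕ n → ℕ
  maxVec [] = 0
  maxVec (x ∷ ρ) = x ⊔ maxVec ρ

  ≤maxVec : ∀ {n} (ρ : Vec ℕ n) → Bounded (maxVec ρ) ρ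
  ≤maxVec (x ∷ ρ) zero = m≤m⊔n x _
  ≤maxVec (x ∷ ρ) (suc i) = ≤-trans (≤maxVec ρ i) (m≤n⊔m x _)

  mutual
    tree : ∀ {q} → Der q → Tree q
    tree (der r ρ ps) = let (ns , b , F , h , a) = grove ρ ps in plant r ρ ns b F h a

    grove : ∀ {n} (ρ : Vec ℕ n) {ps} → All (λ p → Der (evR p ρ)) ps → Grove ρ ps
    grove ρ [] = [] , 0 , record { small = λ () ; supp = λ () } , 0 , []
    grove ρ (d ∷ ds) = let (ns , b , F , s , m) = tree d ; (ns' , b' , G , h , a) = grove ρ ds in
      ns ++ ns' , b ⊔ b' , union F G , suc s ⊔ h , (s , m≤m⊔n (suc s) h , ∈-++⁺ˡ m) ∷
        All.map (λ { (s' , lt , m') → s' , ≤-trans lt (m≤n⊔m (suc s) h) , ∈-++⁺ʳ ns m' }) a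

    plant : ∀ r ρ ns b → Forest ns b → ∀ h → All (λ p → Σ ℕ λ s → s < h × (s , evR p ρ) ∈ ns) (prem r) → Tree (evR (head r) ρ)
    plant r ρ ns b F h a = (h , q) ∷ ns , b' , record { small = sm ; supp = su } , h , here refl
      where
      q b' : ℕ
      q = evR (head r) ρ
      b' = b ⊔ ((h ⊔ q) ⊔ maxVec ρ)
      b≤ : b ≤ b'
      b≤ = m≤m⊔n b _
      rest : (h ⊔ q) ⊔ maxVec ρ ≤ b'
      rest = m≤n⊔m b _
      sm : ∀ {s x} → (s , x) ∈ (h , q) ∷ ns → s ≤ b' × x ≤ b'
      sm (here refl) = ≤-trans (≤-trans (m≤m⊔n h q) (m≤m⊔n (h ⊔ q) (maxVec ρ))) rest , ≤-trans (≤-trans (m≤n⊔m h q) (m≤m⊔n (h ⊔ q) (maxVec ρ))) rest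
      sm (there p) = let (x , y) = small F p in ≤-trans x b≤ , ≤-trans y b≤
      su : ∀ {s x} → (s , x) ∈ (h , q) ∷ ns → Supported ((h , q) ∷ ns) b' s x
      su (here refl) = r , ρ , (λ i → ≤-trans (≤maxVec ρ i) (≤-trans (m≤n⊔m (h ⊔ q) (maxVec ρ)) rest)) , refl ,
        All.map (λ { (s , lt , m) → ≤-trans (proj₂ (small F m)) b≤ , s , lt , there m }) a
      su (there p) = supp-mono there b≤ (supp F p)

  member? : (x : ℕ × ℕ) (ns : Nodes) → Dec (x ∈ ns)
  member? x [] = no λ ()
  member? x (y ∷ ns) with ≡-dec _≟_ _≟_ x y | member? x ns
  ... | yes e | _ = yes (here e)
  ... | no _ | yes p = yes (there p)
  ... | no ne | no np = no λ { (here e) → ne e ; (there p) → np p }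

  -- u ρ  :  u certifies that the instance of the fact t at ρ is derivable
  certOf : ∀ {n} → R n → D (suc n)
  certOf t = ∃≤ x0 (∃≤ x1 (∃≤ x1 (∃≤ x2 (call (valD t) (x0 ∷ x3 ∷ vs 5) ∧d call memD (x2 ∷ x1 ∷ x0 ∷ []) ∧d
    ∀≤ x3 (∀≤ x4 (call memD (x4 ∷ x1 ∷ x0 ∷ []) ⊃ call justD (x4 ∷ x5 ∷ x1 ∷ x0 ∷ [])))))))

  certOf-sound : ∀ {n} (t : R n) {u} ρ → ⟪ certOf t ⟫ (u ∷ ρ) → Der (evR t ρ)
  certOf-sound t {u} ρ (b , _ , z , _ , s , s≤ , q , q≤ , a , m , J) =
    subst Der (val⇒ t ρ (subst (λ σ → ⟪ valD t ⟫ (q ∷ b ∷ σ)) (evTs-vs (q ∷ s ∷ z ∷ b ∷ u ∷ []) ρ) a))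
      (justified-der (λ s s≤ q q≤ m → just⇒ z b s q (J s s≤ q q≤ m)) (suc s) s ≤-refl s≤ q q≤ m)

  certOf-complete : ∀ {n} (t : R n) ρ → Der (evR t ρ) → Σ ℕ λ u → ⟪ certOf t ⟫ (u ∷ ρ)
  certOf-complete t ρ d = b ⊔ z , b , m≤m⊔n b z , z , m≤n⊔m b z , s , proj₁ (small grown m) , q , proj₂ (small grown m) ,
      subst (λ σ → ⟪ valD t ⟫ (q ∷ b ∷ σ)) (sym (evTs-vs (q ∷ s ∷ z ∷ b ∷ b ⊔ z ∷ []) ρ)) (val⇐ t ρ (proj₂ (small grown m))) , to m ,
      λ s s≤ q q≤ p → let (r , ρ' , bd , e , ps) = supp grown (from s≤ q≤ p) in
        just⇐ z b s q q≤ (r , ρ' , e , All.map (λ { (le , s' , lt , m') → le , s' , lt , to m' }) ps) bd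
    where
    q : ℕ
    q = evR t ρ
    T : Tree q
    T = tree d
    ns : Nodes
    ns = proj₁ T
    b : ℕ
    b = proj₁ (proj₂ T)
    grown : Forest ns b
    grown = proj₁ (proj₂ (proj₂ T))
    s : ℕ
    s = proj₁ (proj₂ (proj₂ (proj₂ T)))
    m : (s , q) ∈ ns
    m = proj₂ (proj₂ (proj₂ (proj₂ T)))
    coded : Σ ℕ λ z → z ≤ proj₁ (cap-exists' b) × (∀ k x → k ≤ b → x ≤ b → ⟪ memD ⟫ (z ∷ k ∷ x ∷ []) ⇔ (⌊ member? (k , x) ns ⌋ ≡ true))
    coded = cap-codes' (proj₂ (cap-exists' b)) (λ k x → ⌊ member? (k , x) ns ⌋)
    z : ℕ
    z = proj₁ coded
    from : ∀ {k x} → k ≤ b → x ≤ b → ⟪ memD ⟫ (z ∷ k ∷ x ∷ []) → (k , x) ∈ ns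
    from {k} {x} k≤ x≤ p with member? (k , x) ns | Equivalence.to (proj₂ (proj₂ coded) k x k≤ x≤) p
    ... | yes i | _ = i
    to : ∀ {k x} → (k , x) ∈ ns → ⟪ memD ⟫ (z ∷ k ∷ x ∷ [])
    to {k} {x} i = let (k≤ , x≤) = small grown i in Equivalence.from (proj₂ (proj₂ coded) k x k≤ x≤) (yes' (member? (k , x) ns))
      where
      yes' : (d : Dec ((k , x) ∈ ns)) → ⌊ d ⌋ ≡ true
      yes' (yes _) = refl
      yes' (no n) = ⊥-elim (n i)

-- Facts about syntax, primitive recursive functions and T, each tagged by a number

v0 : ∀ {n} → R (1 + n)
v0 = var zero
v1 : ∀ {n} → R (2 + n)
v1 = var (suc zero)
v2 : ∀ {n} → R (3 + n)
v2 = var (suc (suc zero))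
v3 : ∀ {n} → R (4 + n)
v3 = var (suc (suc (suc zero)))
v4 : ∀ {n} → R (5 + n)
v4 = var (suc (suc (suc (suc zero))))
v5 : ∀ {n} → R (6 + n)
v5 = var (suc (suc (suc (suc (suc zero)))))
v6 : ∀ {n} → R (7 + n)
v6 = var (suc (suc (suc (suc (suc (suc zero))))))
v7 : ∀ {n} → R (8 + n)
v7 = var (suc (suc (suc (suc (suc (suc (suc zero)))))))
v8 : ∀ {n} → R (9 + n)
v8 = var (suc (suc (suc (suc (suc (suc (suc (suc zero))))))))
v9 : ∀ {n} → R (10 + n)
v9 = var (suc (suc (suc (suc (suc (suc (suc (suc (suc zero)))))))))

numR ltR evsR : ∀ {n} → R n → R n → R n
numR j w = duo (nat 0) (duo j w)
ltR i j = duo (nat 1) (duo i j)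
evsR x y = suc (duo x y)

-- The argument k counts the binders passed, and s names the substitution. The logical axioms
-- involve only shifts and single instantiations, so one number is enough for s.
subTR subFR : ∀ {n} → R n → R n → R n → R n → R n
subTR k s u w = duo (nat 2) (duo k (duo s (duo u w)))
subFR k s x w = duo (nat 3) (duo k (duo s (duo x w)))

evalR evalsR : ∀ {n} → R n → R n → R n → R n
evalR c xs y = duo (nat 4) (duo c (duo xs y))
evalsR cs xs ys = duo (nat 5) (duo cs (duo xs ys))

thmR : ∀ {n} → R n → R n
thmR x = duo (nat 6) x

prR : ∀ {n} → R n → R n → R n → R n
prR e x w = duo (nat 7) (duo e (duo x w))

stR nstR : ∀ {n} → R n → R n → R n → R n → R n
stR e c l w = duo (nat 8) (duo e (duo c (duo l w)))
nstR e c l w = duo (nat 9) (duo e (duo c (duo l w)))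

infixr 3 _⇒R_
_⇒R_ eqR : ∀ {n} → R n → R n → R n
x ⇒R y = duo (nat 2) (duo x y)
eqR t s = duo (nat 1) (duo t s)

allR : ∀ {n} → R n → R n
allR x = duo (nat 3) x

data Rule : Set where
  num0 numS lt0 ltS : Rule
  varLt varShift= varShift> varInst= varInst> tZer tSuc tAdd tMul : Rule
  fBot fEq fImp fAllShift fAllInst : Rule
  eZ eS eProj0 eProjS eComp eRec0 eRecS eNil eCons : Rule
  tAx tK tS tDN tIn tDi tVac tRef tEq tMp tGen : Rule
  rPr rSt rNst : Rule

allRules : List Rule
allRules = num0 ∷ numS ∷ lt0 ∷ ltS ∷ varLt ∷ varShift= ∷ varShift> ∷ varInst= ∷ varInst> ∷ tZer ∷ tSuc ∷ tAdd ∷ tMul ∷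
  fBot ∷ fEq ∷ fImp ∷ fAllShift ∷ fAllInst ∷ eZ ∷ eS ∷ eProj0 ∷ eProjS ∷ eComp ∷ eRec0 ∷ eRecS ∷ eNil ∷ eCons ∷
  tAx ∷ tK ∷ tS ∷ tDN ∷ tIn ∷ tDi ∷ tVac ∷ tRef ∷ tEq ∷ tMp ∷ tGen ∷ rPr ∷ rSt ∷ rNst ∷ []

private
  t5 : ∀ {x a b c d e : Rule} {xs} → x ∈ xs → x ∈ a ∷ b ∷ c ∷ d ∷ e ∷ xs
  t5 p = there (there (there (there (there p))))

everyRule : ∀ r → r ∈ allRules
everyRule num0 = here refl
everyRule numS = there (here refl)
everyRule lt0 = there (there (here refl))
everyRule ltS = there (there (there (here refl)))
everyRule varLt = there (there (there (there (here refl))))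
everyRule varShift= = t5 (here refl)
everyRule varShift> = t5 (there (here refl))
everyRule varInst= = t5 (there (there (here refl)))
everyRule varInst> = t5 (there (there (there (here refl))))
everyRule tZer = t5 (there (there (there (there (here refl)))))
everyRule tSuc = t5 (t5 (here refl))
everyRule tAdd = t5 (t5 (there (here refl)))
everyRule tMul = t5 (t5 (there (there (here refl))))
everyRule fBot = t5 (t5 (there (there (there (here refl)))))
everyRule fEq = t5 (t5 (there (there (there (there (here refl))))))
everyRule fImp = t5 (t5 (t5 (here refl)))
everyRule fAllShift = t5 (t5 (t5 (there (here refl))))
everyRule fAllInst = t5 (t5 (t5 (there (there (here refl)))))
everyRule eZ = t5 (t5 (t5 (there (there (there (here refl))))))
everyRule eS = t5 (t5 (t5 (there (there (there (there (here refl)))))))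
everyRule eProj0 = t5 (t5 (t5 (t5 (here refl))))
everyRule eProjS = t5 (t5 (t5 (t5 (there (here refl)))))
everyRule eComp = t5 (t5 (t5 (t5 (there (there (here refl))))))
everyRule eRec0 = t5 (t5 (t5 (t5 (there (there (there (here refl)))))))
everyRule eRecS = t5 (t5 (t5 (t5 (there (there (there (there (here refl))))))))
everyRule eNil = t5 (t5 (t5 (t5 (t5 (here refl)))))
everyRule eCons = t5 (t5 (t5 (t5 (t5 (there (here refl))))))
everyRule tAx = t5 (t5 (t5 (t5 (t5 (there (there (here refl)))))))
everyRule tK = t5 (t5 (t5 (t5 (t5 (there (there (there (here refl))))))))
everyRule tS = t5 (t5 (t5 (t5 (t5 (there (there (there (there (here refl)))))))))
everyRule tDN = t5 (t5 (t5 (t5 (t5 (t5 (here refl))))))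
everyRule tIn = t5 (t5 (t5 (t5 (t5 (t5 (there (here refl)))))))
everyRule tDi = t5 (t5 (t5 (t5 (t5 (t5 (there (there (here refl))))))))
everyRule tVac = t5 (t5 (t5 (t5 (t5 (t5 (there (there (there (here refl)))))))))
everyRule tRef = t5 (t5 (t5 (t5 (t5 (t5 (there (there (there (there (here refl))))))))))
everyRule tEq = t5 (t5 (t5 (t5 (t5 (t5 (t5 (here refl)))))))
everyRule tMp = t5 (t5 (t5 (t5 (t5 (t5 (t5 (there (here refl))))))))
everyRule tGen = t5 (t5 (t5 (t5 (t5 (t5 (t5 (there (there (here refl)))))))))
everyRule rPr = t5 (t5 (t5 (t5 (t5 (t5 (t5 (there (there (there (here refl))))))))))
everyRule rSt = t5 (t5 (t5 (t5 (t5 (t5 (t5 (there (there (there (there (here refl)))))))))))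
everyRule rNst = t5 (t5 (t5 (t5 (t5 (t5 (t5 (t5 (here refl))))))))

arity : Rule → ℕ
arity num0 = 0
arity numS = 2
arity lt0 = 1
arity ltS = 2
arity varLt = 3
arity varShift= = 1
arity varShift> = 2
arity varInst= = 2
arity varInst> = 3
arity tZer = 2
arity tSuc = 4
arity tAdd = 6
arity tMul = 6
arity fBot = 2
arity fEq = 6
arity fImp = 6
arity fAllShift = 3
arity fAllInst = 5
arity eZ = 1
arity eS = 1
arity eProj0 = 2
arity eProjS = 4
arity eComp = 5
arity eRec0 = 4
arity eRecS = 6
arity eNil = 1
arity eCons = 5
arity tAx = 2
arity tK = 4
arity tS = 6
arity tDN = 2
arity tIn = 4
arity tDi = 4
arity tVac = 2
arity tRef = 2
arity tEq = 7
arity tMp = 2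
arity tGen = 1
arity rPr = 7
arity rSt = 10
arity rNst = 4

module Rules (χ : ℕ) where

  conclusion : ∀ r → R (arity r)
  conclusion num0 = numR (nat 0) (duo (nat 1) (nat 0))
  conclusion numS = numR (suc v0) (duo (nat 2) v1)
  conclusion lt0 = ltR v0 (suc v0)
  conclusion ltS = ltR v0 (suc v1)
  conclusion varLt = subTR v0 v1 (duo (nat 0) v2) (duo (nat 0) v2)
  conclusion varShift= = subTR v0 (nat 0) (duo (nat 0) v0) (duo (nat 0) (suc v0))
  conclusion varShift> = subTR v0 (nat 0) (duo (nat 0) v1) (duo (nat 0) (suc v1))
  conclusion varInst= = subTR v0 (suc v1) (duo (nat 0) v0) v1
  conclusion varInst> = subTR v0 (suc v1) (duo (nat 0) (suc v2)) (duo (nat 0) v2)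
  conclusion tZer = subTR v0 v1 (duo (nat 1) (nat 0)) (duo (nat 1) (nat 0))
  conclusion tSuc = subTR v0 v1 (duo (nat 2) v2) (duo (nat 2) v3)
  conclusion tAdd = subTR v0 v1 (duo (nat 3) (duo v2 v4)) (duo (nat 3) (duo v3 v5))
  conclusion tMul = subTR v0 v1 (duo (nat 4) (duo v2 v4)) (duo (nat 4) (duo v3 v5))
  conclusion fBot = subFR v0 v1 (duo (nat 0) (nat 0)) (duo (nat 0) (nat 0))
  conclusion fEq = subFR v0 v1 (eqR v2 v4) (eqR v3 v5)
  conclusion fImp = subFR v0 v1 (v2 ⇒R v4) (v3 ⇒R v5)
  conclusion fAllShift = subFR v0 (nat 0) (allR v1) (allR v2)
  conclusion fAllInst = subFR v0 (suc v3) (allR v1) (allR v2)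
  conclusion eZ = evalR (duo (nat 0) (nat 0)) v0 (nat 0)
  conclusion eS = evalR (duo (nat 1) (nat 0)) (evsR v0 (nat 0)) (suc v0)
  conclusion eProj0 = evalR (duo (nat 2) (nat 0)) (evsR v0 v1) v0
  conclusion eProjS = evalR (duo (nat 2) (suc v0)) (evsR v1 v2) v3
  conclusion eComp = evalR (duo (nat 3) (duo v0 v1)) v2 v4
  conclusion eRec0 = evalR (duo (nat 4) (duo v0 v1)) (evsR (nat 0) v2) v3
  conclusion eRecS = evalR (duo (nat 4) (duo v0 v1)) (evsR (suc v4) v2) v3
  conclusion eNil = evalsR (nat 0) v0 (nat 0)
  conclusion eCons = evalsR (evsR v0 v1) v2 (evsR v3 v4)
  conclusion tAx = thmR v0
  conclusion tK = thmR (v0 ⇒R v1 ⇒R v0)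
  conclusion tS = thmR ((v0 ⇒R v1 ⇒R v2) ⇒R (v0 ⇒R v1) ⇒R v0 ⇒R v2)
  conclusion tDN = thmR (((v0 ⇒R duo (nat 0) (nat 0)) ⇒R duo (nat 0) (nat 0)) ⇒R v0)
  conclusion tIn = thmR (allR v0 ⇒R v1)
  conclusion tDi = thmR (allR (v0 ⇒R v1) ⇒R allR v0 ⇒R allR v1)
  conclusion tVac = thmR (v0 ⇒R allR v1)
  conclusion tRef = thmR (eqR v0 v0)
  conclusion tEq = thmR (eqR v0 v1 ⇒R v5 ⇒R v6)
  conclusion tMp = thmR v1
  conclusion tGen = thmR (allR v0)
  conclusion rPr = prR (duo v0 v1) v2 v6
  conclusion rSt = stR (duo v0 v1) v2 v3 v9
  conclusion rNst = nstR v0 v1 v2 (v3 ⇒R duo (nat 0) (nat 0))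

  premises : ∀ r → List (R (arity r))
  premises num0 = []
  premises numS = numR v0 v1 ∷ []
  premises lt0 = []
  premises ltS = ltR v0 v1 ∷ []
  premises varLt = ltR v2 v0 ∷ []
  premises varShift= = []
  premises varShift> = ltR v0 v1 ∷ []
  premises varInst= = []
  premises varInst> = ltR v0 (suc v2) ∷ []
  premises tZer = []
  premises tSuc = subTR v0 v1 v2 v3 ∷ []
  premises tAdd = subTR v0 v1 v2 v3 ∷ subTR v0 v1 v4 v5 ∷ []
  premises tMul = subTR v0 v1 v2 v3 ∷ subTR v0 v1 v4 v5 ∷ []
  premises fBot = []
  premises fEq = subTR v0 v1 v2 v3 ∷ subTR v0 v1 v4 v5 ∷ []
  premises fImp = subFR v0 v1 v2 v3 ∷ subFR v0 v1 v4 v5 ∷ []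
  premises fAllShift = subFR (suc v0) (nat 0) v1 v2 ∷ []
  premises fAllInst = subTR (nat 0) (nat 0) v3 v4 ∷ subFR (suc v0) (suc v4) v1 v2 ∷ []
  premises eZ = []
  premises eS = []
  premises eProj0 = []
  premises eProjS = evalR (duo (nat 2) v0) v2 v3 ∷ []
  premises eComp = evalsR v1 v2 v3 ∷ evalR v0 v3 v4 ∷ []
  premises eRec0 = evalR v0 v2 v3 ∷ []
  premises eRecS = evalR (duo (nat 4) (duo v0 v1)) (evsR v4 v2) v5 ∷ evalR v1 (evsR v4 (evsR v5 v2)) v3 ∷ []
  premises eNil = []
  premises eCons = evalR v0 v2 v3 ∷ evalsR v1 v2 v4 ∷ []
  premises tAx = evalR (nat χ) (evsR v0 (nat 0)) (suc v1) ∷ []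
  -- A shift fact is derivable only for the code of a formula, and here it serves as the test of
  -- well-formedness; the same device is used for the other logical axioms, with terms as well.
  premises tK = subFR (nat 0) (nat 0) v0 v2 ∷ subFR (nat 0) (nat 0) v1 v3 ∷ []
  premises tS = subFR (nat 0) (nat 0) v0 v3 ∷ subFR (nat 0) (nat 0) v1 v4 ∷ subFR (nat 0) (nat 0) v2 v5 ∷ []
  premises tDN = subFR (nat 0) (nat 0) v0 v1 ∷ []
  premises tIn = subTR (nat 0) (nat 0) v2 v3 ∷ subFR (nat 0) (suc v2) v0 v1 ∷ []
  premises tDi = subFR (nat 0) (nat 0) v0 v2 ∷ subFR (nat 0) (nat 0) v1 v3 ∷ []
  premises tVac = subFR (nat 0) (nat 0) v0 v1 ∷ []
  premises tRef = subTR (nat 0) (nat 0) v0 v1 ∷ []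
  premises tEq = subTR (nat 0) (nat 0) v0 v2 ∷ subTR (nat 0) (nat 0) v1 v3 ∷ subFR (nat 0) (suc v0) v4 v5 ∷ subFR (nat 0) (suc v1) v4 v6 ∷ []
  premises tMp = thmR (v0 ⇒R v1) ∷ thmR v0 ∷ []
  premises tGen = thmR v0 ∷ []
  premises rPr = numR v2 v3 ∷ numR (duo v0 v1) v4 ∷ subFR (nat 0) (suc v3) v0 v5 ∷ subFR (nat 0) (suc v4) v5 v6 ∷ []
  premises rSt = numR v2 v4 ∷ numR v3 v5 ∷ numR (duo v0 v1) v6 ∷ subFR (nat 0) (suc v4) v1 v7 ∷ subFR (nat 0) (suc v5) v7 v8 ∷ subFR (nat 0) (suc v6) v8 v9 ∷ []
  premises rNst = stR v0 v1 v2 v3 ∷ []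

  system : System
  system = record { Rule = Rule ; rules = allRules ; every = everyRule ; nv = arity ; head = conclusion ; prem = premises }

  open Horn system public

-- Substitution under binders, and codes of primitive recursive functions

shiftAt : ℕ → ℕ → Term
shiftAt k n with <-cmp n k
... | tri< _ _ _ = var n
... | tri≈ _ _ _ = var (suc n)
... | tri> _ _ _ = var (suc n)

instAt : ℕ → Term → ℕ → Term
instAt k r n with <-cmp n k
... | tri< _ _ _ = var n
... | tri≈ _ _ _ = r
... | tri> _ _ _ = var (pred n)

shiftAt-< : ∀ {k n} → n < k → shiftAt k n ≡ var n
shiftAt-< {k} {n} p with <-cmp n k
... | tri< _ _ _ = refl
... | tri≈ q _ _ = ⊥-elim (q p)
... | tri> q _ _ = ⊥-elim (q p)

shiftAt-≥ : ∀ {k n} → k ≤ n → shiftAt k n ≡ var (suc n)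
shiftAt-≥ {k} {n} p with <-cmp n k
... | tri< q _ _ = ⊥-elim (<⇒≱ q p)
... | tri≈ _ _ _ = refl
... | tri> _ _ _ = refl

instAt-< : ∀ {k r n} → n < k → instAt k r n ≡ var n
instAt-< {k} {r} {n} p with <-cmp n k
... | tri< _ _ _ = refl
... | tri≈ q _ _ = ⊥-elim (q p)
... | tri> q _ _ = ⊥-elim (q p)

instAt-≡ : ∀ {k r} → instAt k r k ≡ r
instAt-≡ {k} with <-cmp k k
... | tri< _ q _ = ⊥-elim (q refl)
... | tri≈ _ _ _ = refl
... | tri> _ q _ = ⊥-elim (q refl)

instAt-> : ∀ {k r n} → k ≤ n → instAt k r (suc n) ≡ var n
instAt-> {k} {r} {n} p with <-cmp (suc n) k
... | tri< q _ _ = ⊥-elim (<⇒≱ q (≤-trans p (n≤1+n n)))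
... | tri≈ _ q _ = ⊥-elim (<-irrefl (sym q) (s≤s p))
... | tri> _ _ _ = refl

-- Passing a binder only raises k. Together with `lift-instAt`, where the inserted term is shifted
-- too, this lets the clauses describe a lifted substitution by numbers.
lift-shiftAt : ∀ k n → liftS (shiftAt k) n ≡ shiftAt (suc k) n
lift-shiftAt k zero = sym (shiftAt-< {suc k} (s≤s z≤n))
lift-shiftAt k (suc n) with ≤-<-connex k n
... | inj₁ p = trans (cong shiftT (shiftAt-≥ p)) (sym (shiftAt-≥ (s≤s p)))
... | inj₂ p = trans (cong shiftT (shiftAt-< p)) (sym (shiftAt-< (s≤s p)))

lift-instAt : ∀ k r n → liftS (instAt k r) n ≡ instAt (suc k) (shiftT r) n
lift-instAt k r zero = sym (instAt-< {suc k} {shiftT r} (s≤s z≤n))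
lift-instAt k r (suc n) with <-cmp n k
... | tri< p _ _ = sym (instAt-< (s≤s p))
... | tri≈ _ refl _ = sym (instAt-≡ {suc n})
lift-instAt k r (suc (suc n)) | tri> _ _ p = sym (instAt-> p)

shiftAt-0 : ∀ n → shiftAt 0 n ≡ var (suc n)
shiftAt-0 n = shiftAt-≥ z≤n

instAt-0 : ∀ r n → inst r n ≡ instAt 0 r n
instAt-0 r zero = sym (instAt-≡ {0} {r})
instAt-0 r (suc n) = sym (instAt-> {r = r} z≤n)

lift-cong : ∀ {σ τ : ℕ → Term} → (∀ n → σ n ≡ τ n) → ∀ n → liftS σ n ≡ liftS τ n
lift-cong e zero = refl
lift-cong e (suc n) = cong shiftT (e n)

-- s = 0 stands for shifting, s = 1 + code r for instantiation by r
Match : ℕ → ℕ → (ℕ → Term) → Set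
Match k s σ = (s ≡ 0 × (∀ n → σ n ≡ shiftAt k n)) ⊎ Σ Term λ r → s ≡ suc (termCode r) × (∀ n → σ n ≡ instAt k r n)

match-< : ∀ {k s σ n} → Match k s σ → n < k → σ n ≡ var n
match-< (inj₁ (_ , e)) p = trans (e _) (shiftAt-< p)
match-< (inj₂ (r , _ , e)) p = trans (e _) (instAt-< p)

matchShift0 : Match 0 0 (λ n → var (suc n))
matchShift0 = inj₁ (refl , λ n → sym (shiftAt-0 n))

matchInst0 : ∀ r → Match 0 (suc (termCode r)) (inst r)
matchInst0 r = inj₂ (r , refl , instAt-0 r)

prCode : ∀ {n} → PR n → ℕ
vecCode : ∀ {n} → Vec ℕ n → ℕ
vecCode [] = 0
vecCode (x ∷ xs) = suc (pr x (vecCode xs))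

prCode pZ = pr 0 0
prCode pS = pr 1 0
prCode (pProj i) = pr 2 (toℕ i)
prCode (pComp g h) = pr 3 (pr (prCode g) (vecCode (tabulate (λ i → prCode (h i)))))
prCode (pRec g h) = pr 4 (pr (prCode g) (prCode h))

vecCode-inj : ∀ {n} (xs ys : Vec ℕ n) → vecCode xs ≡ vecCode ys → xs ≡ ys
vecCode-inj [] [] e = refl
vecCode-inj (x ∷ xs) (y ∷ ys) e = let (a , b) = pr-inj (suc-injective e) in cong₂ _∷_ a (vecCode-inj xs ys b)

-- Soundness and completeness of the clauses

module Arithmetization (T : Theory) (χ : PR 1)
  (χ-spec : ∀ n → (evalPR χ (n ∷ []) ≢ 0) ⇔ Σ Formula (λ φ → (⌜ φ ⌝ ≡ n) × T φ)) where

  open Rules (prCode χ) public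

  Th : ℕ → Set
  Th x = Σ Formula λ φ → x ≡ (code φ) × (T ⊢ φ)

  SubT : ℕ → ℕ → ℕ → ℕ → Set
  SubT k s u w = Σ Term λ t → u ≡ termCode t × (∀ σ → Match k s σ → w ≡ termCode (substT σ t))

  SubF : ℕ → ℕ → ℕ → ℕ → Set
  SubF k s x w = Σ Formula λ φ → x ≡ (code φ) × (∀ σ → Match k s σ → w ≡ (code (substF σ φ)))

  -- Stated for all functions and arguments with these codes, because `prCode` forgets arities: the
  -- code of a projection shows only its index. Numbers that code nothing satisfy the condition
  -- vacuously.
  Ev : ℕ → ℕ → ℕ → Set
  Ev c xs y = ∀ {n} (p : PR n) (ρ : Vec ℕ n) → c ≡ prCode p → xs ≡ vecCode ρ → y ≡ evalPR p ρ

  Evs : ℕ → ℕ → ℕ → Set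
  Evs cs xs ys = ∀ {m n} (h : Fin m → PR n) (ρ : Vec ℕ n) → cs ≡ vecCode (tabulate (λ i → prCode (h i))) → xs ≡ vecCode ρ →
    ys ≡ vecCode (tabulate (λ i → evalPR (h i) ρ))

  PrM : ℕ → ℕ → ℕ → Set
  PrM e x w = ∀ φ ψ → e ≡ pr (code φ) (code ψ) → w ≡ (code (close2 φ x e))

  StM : ℕ → ℕ → ℕ → ℕ → Set
  StM e c l w = ∀ φ ψ → e ≡ pr (code φ) (code ψ) → w ≡ (code (close3 ψ c l e))

  NstM : ℕ → ℕ → ℕ → ℕ → Set
  NstM e c l w = ∀ φ ψ → e ≡ pr (code φ) (code ψ) → w ≡ (code (¬' (close3 ψ c l e)))

  -- As `pr` is opaque, a fact is decoded by quantifying over its decompositions instead of by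
  -- computation; `pr-inj` makes the decomposition unique.
  Args2 : (ℕ → ℕ → Set) → ℕ → Set
  Args2 P p = ∀ a b → p ≡ pr a b → P a b

  Args3 : (ℕ → ℕ → ℕ → Set) → ℕ → Set
  Args3 P = Args2 λ a → Args2 (P a)

  Args4 : (ℕ → ℕ → ℕ → ℕ → Set) → ℕ → Set
  Args4 P = Args2 λ a → Args3 (P a)

  Mean : ℕ → ℕ → Set
  Mean 0 = Args2 λ j w → w ≡ termCode (numeral j)
  Mean 1 = Args2 _<_
  Mean 2 = Args4 SubT
  Mean 3 = Args4 SubF
  Mean 4 = Args3 Ev
  Mean 5 = Args3 Evs
  Mean 6 = Th
  Mean 7 = Args3 PrM
  Mean 8 = Args4 StM
  Mean 9 = Args4 NstM
  Mean _ = λ _ → ⊤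

  M : ℕ → Set
  M = Args2 Mean

  args2 : ∀ {P : ℕ → ℕ → Set} a b → P a b → Args2 P (pr a b)
  args2 {P} a b p a' b' e = let (x , y) = pr-inj e in subst₂ P x y p

  args3 : ∀ {P : ℕ → ℕ → ℕ → Set} a b c → P a b c → Args3 P (pr a (pr b c))
  args3 {P} a b c p = args2 {λ a → Args2 (P a)} a (pr b c) (args2 {P a} b c p)

  args4 : ∀ {P : ℕ → ℕ → ℕ → ℕ → Set} a b c d → P a b c d → Args4 P (pr a (pr b (pr c d)))
  args4 {P} a b c d p = args2 {λ a → Args3 (P a)} a (pr b (pr c d)) (args3 {P a} b c d p)

  meant : ∀ t {p} → Mean t p → M (pr t p)
  meant t {p} = args2 {Mean} t p

  get2 : ∀ {P : ℕ → ℕ → Set} {a b} t → Mean t ≡ Args2 P → M (pr t (pr a b)) → P a b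
  get2 {a = a} {b} t e h = subst (λ Q → Q (pr a b)) e (h t _ refl) a b refl

  get3 : ∀ {P : ℕ → ℕ → ℕ → Set} {a b c} t → Mean t ≡ Args3 P → M (pr t (pr a (pr b c))) → P a b c
  get3 {P} {a} {b} {c} t e h = subst (λ Q → Q (pr a (pr b c))) e (h t _ refl) a _ refl b c refl

  get4 : ∀ {P : ℕ → ℕ → ℕ → ℕ → Set} {a b c d} t → Mean t ≡ Args4 P → M (pr t (pr a (pr b (pr c d)))) → P a b c d
  get4 {P} {a} {b} {c} {d} t e h = subst (λ Q → Q (pr a (pr b (pr c d)))) e (h t _ refl) a _ refl b _ refl c d refl

  private
    imp-inv : ∀ {x y} φ → pr 2 (pr x y) ≡ (code φ) → Σ Formula λ φ₁ → Σ Formula λ φ₂ → φ ≡ (φ₁ ⇒ φ₂) × (x ≡ (code φ₁) × y ≡ (code φ₂))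
    imp-inv {x} {y} ⊥' e = clash e
    imp-inv {x} {y} (t ≐ s) e = clash e
    imp-inv {x} {y} (φ ⇒ ψ) e = φ , ψ , refl , pr-inj (pr-inj₂ e)
    imp-inv {x} {y} (∀' φ) e = clash e

    isTerm : ∀ {u w} → SubT 0 0 u w → Σ Term λ t → u ≡ termCode t × w ≡ termCode (shiftT t)
    isTerm (t , e , h) = t , e , trans (h _ matchShift0) (cong termCode (sym (renT-substT suc t)))

    liftShift : ∀ {k σ} → Match k 0 σ → Match (suc k) 0 (liftS σ)
    liftShift {k} (inj₁ (_ , e)) = inj₁ (refl , λ n → trans (lift-cong e n) (lift-shiftAt k n))

    liftInst : ∀ {k σ} t → Match k (suc (termCode t)) σ → Match (suc k) (suc (termCode (shiftT t))) (liftS σ)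
    liftInst {k} t (inj₂ (r , e , h)) with termCode-inj t r (suc-injective e)
    ... | refl = inj₂ (shiftT t , refl , λ n → trans (lift-cong h n) (lift-instAt k t n))

    close2-code : ∀ {a b x nx ne w₁ w} φ → a ≡ (code φ) → nx ≡ termCode (numeral x) → ne ≡ termCode (numeral b) → SubF 0 (suc nx) a w₁ → SubF 0 (suc ne) w₁ w →
      w ≡ code (close2 φ x b)
    close2-code {x = x} φ refl refl refl (φ₁ , e₁ , h₁) (φ₂ , e₂ , h₂) with code-inj φ φ₁ e₁
    ... | refl with code-inj (φ [ numeral x ]) φ₂ (trans (sym (h₁ _ (matchInst0 _))) e₂)
    ...   | refl = h₂ _ (matchInst0 _)

    subst-code : ∀ {a x nx w} φ → a ≡ (code φ) → nx ≡ termCode (numeral x) → SubF 0 (suc nx) a w → w ≡ (code (φ [ numeral x ]))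
    subst-code φ refl refl (φ₁ , e₁ , h₁) with code-inj φ φ₁ e₁
    ... | refl = h₁ _ (matchInst0 _)

  private
    sortT : ∀ u w → M (pr 2 (pr 0 (pr 0 (pr u w)))) → Σ Term λ t → u ≡ termCode t × w ≡ termCode (shiftT t)
    sortT u w h = isTerm (get4 {SubT} {0} {0} {u} {w} 2 refl h)

    sortF : ∀ x w → M (pr 3 (pr 0 (pr 0 (pr x w)))) → SubF 0 0 x w
    sortF x w h = get4 {SubF} {0} {0} {x} {w} 3 refl h

    instF : ∀ t x w → M (pr 3 (pr 0 (pr (suc t) (pr x w)))) → SubF 0 (suc t) x w
    instF t x w h = get4 {SubF} {0} {suc t} {x} {w} 3 refl h

  NumM : ℕ → ℕ → Set
  NumM j w = w ≡ termCode (numeral j)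

  sound : ∀ r ρ → All (λ p → M (evR p ρ)) (premises r) → M (evR (conclusion r) ρ)
  sound num0 [] [] = meant 0 (args2 {NumM} 0 _ refl)
  sound numS (j ∷ w ∷ []) (h ∷ []) = meant 0 (args2 {NumM} (suc j) _ (cong (pr 2) (get2 {NumM} 0 refl h)))
  sound lt0 (i ∷ []) [] = meant 1 (args2 {_<_} i _ ≤-refl)
  sound ltS (i ∷ j ∷ []) (h ∷ []) = meant 1 (args2 {_<_} i _ (≤-trans (get2 {_<_} 1 refl h) (n≤1+n j)))
  sound varLt (k ∷ s ∷ i ∷ []) (h ∷ []) = meant 2 (args4 {SubT} k s _ _ (var i , refl , λ σ m → cong termCode (sym (match-< m (get2 {_<_} 1 refl h)))))
  sound varShift= (k ∷ []) [] = meant 2 (args4 {SubT} k 0 _ _ (var k , refl , λ { σ (inj₁ (_ , e)) → cong termCode (sym (trans (e k) (shiftAt-≥ ≤-refl))) }))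
  sound varShift> (k ∷ i ∷ []) (h ∷ []) = meant 2 (args4 {SubT} k 0 _ _ (var i , refl , λ { σ (inj₁ (_ , e)) →
    cong termCode (sym (trans (e i) (shiftAt-≥ (<⇒≤ (get2 {_<_} 1 refl h))))) }))
  sound varInst= (k ∷ t ∷ []) [] = meant 2 (args4 {SubT} k (suc t) _ _ (var k , refl , λ { σ (inj₂ (r , e , g)) →
    trans (suc-injective e) (cong termCode (sym (trans (g k) (instAt-≡ {k})))) }))
  sound varInst> (k ∷ t ∷ i ∷ []) (h ∷ []) = meant 2 (args4 {SubT} k (suc t) _ _ (var (suc i) , refl , λ { σ (inj₂ (r , e , g)) →
    cong termCode (sym (trans (g (suc i)) (instAt-> (≤-pred (get2 {_<_} 1 refl h))))) }))
  sound tZer (k ∷ s ∷ []) [] = meant 2 (args4 {SubT} k s _ _ (zer , refl , λ σ m → refl))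
  sound tSuc (k ∷ s ∷ u ∷ w ∷ []) (h ∷ []) = let (t , e , f) = get4 {SubT} 2 refl h in
    meant 2 (args4 {SubT} k s _ _ (suc' t , cong (pr 2) e , λ σ m → cong (pr 2) (f σ m)))
  sound tAdd (k ∷ s ∷ u ∷ w ∷ u' ∷ w' ∷ []) (h ∷ h' ∷ []) = let (t , e , f) = get4 {SubT} 2 refl h ; (t' , e' , f') = get4 {SubT} 2 refl h' in
    meant 2 (args4 {SubT} k s _ _ (t ⊕ t' , cong₂ (λ a b → pr 3 (pr a b)) e e' , λ σ m → cong₂ (λ a b → pr 3 (pr a b)) (f σ m) (f' σ m)))
  sound tMul (k ∷ s ∷ u ∷ w ∷ u' ∷ w' ∷ []) (h ∷ h' ∷ []) = let (t , e , f) = get4 {SubT} 2 refl h ; (t' , e' , f') = get4 {SubT} 2 refl h' in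
    meant 2 (args4 {SubT} k s _ _ (t ⊗ t' , cong₂ (λ a b → pr 4 (pr a b)) e e' , λ σ m → cong₂ (λ a b → pr 4 (pr a b)) (f σ m) (f' σ m)))
  sound fBot (k ∷ s ∷ []) [] = meant 3 (args4 {SubF} k s _ _ (⊥' , refl , λ σ m → refl))
  sound fEq (k ∷ s ∷ u ∷ w ∷ u' ∷ w' ∷ []) (h ∷ h' ∷ []) = let (t , e , f) = get4 {SubT} 2 refl h ; (t' , e' , f') = get4 {SubT} 2 refl h' in
    meant 3 (args4 {SubF} k s _ _ (t ≐ t' , cong₂ (λ a b → pr 1 (pr a b)) e e' , λ σ m → cong₂ (λ a b → pr 1 (pr a b)) (f σ m) (f' σ m)))
  sound fImp (k ∷ s ∷ u ∷ w ∷ u' ∷ w' ∷ []) (h ∷ h' ∷ []) = let (t , e , f) = get4 {SubF} 3 refl h ; (t' , e' , f') = get4 {SubF} 3 refl h' in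
    meant 3 (args4 {SubF} k s _ _ ((t ⇒ t') , cong₂ (λ a b → pr 2 (pr a b)) e e' , λ σ m → cong₂ (λ a b → pr 2 (pr a b)) (f σ m) (f' σ m)))
  sound fAllShift (k ∷ x ∷ w ∷ []) (h ∷ []) = let (φ , e , f) = get4 {SubF} 3 refl h in
    meant 3 (args4 {SubF} k 0 _ _ (∀' φ , cong (pr 3) e , λ σ m → cong (pr 3) (f (liftS σ) (liftShift m))))
  sound fAllInst (k ∷ x ∷ w ∷ t ∷ t' ∷ []) (h ∷ h' ∷ []) with sortT t t' h | get4 {SubF} {suc k} {suc t'} {x} {w} 3 refl h'
  ... | r , refl , refl | φ , e , f = meant 3 (args4 {SubF} k (suc t) _ _ (∀' φ , cong (pr 3) e , λ σ m → cong (pr 3) (f (liftS σ) (liftInst r m))))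
  sound eZ (xs ∷ []) [] = meant 4 (args3 {Ev} _ xs 0 ev)
    where
    ev : Ev (pr 0 0) xs 0
    ev pZ ρ e _ = refl
    ev pS ρ e _ = clash e
    ev (pProj i) ρ e _ = clash e
    ev (pComp g h) ρ e _ = clash e
    ev (pRec g h) ρ e _ = clash e
  sound eS (x ∷ []) [] = meant 4 (args3 {Ev} (pr 1 0) _ (suc x) ev)
    where
    ev : Ev (pr 1 0) (suc (pr x 0)) (suc x)
    ev pZ ρ e _ = clash e
    ev pS (y ∷ []) e g = cong suc (proj₁ (pr-inj (suc-injective g)))
    ev (pProj i) ρ e _ = clash e
    ev (pComp g h) ρ e _ = clash e
    ev (pRec g h) ρ e _ = clash e
  sound eProj0 (x ∷ xs ∷ []) [] = meant 4 (args3 {Ev} (pr 2 0) _ x ev)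
    where
    ev : Ev (pr 2 0) (suc (pr x xs)) x
    ev pZ ρ e _ = clash e
    ev pS ρ e _ = clash e
    ev (pProj zero) (y ∷ ρ) e g = proj₁ (pr-inj (suc-injective g))
    ev (pProj (suc i)) ρ e g with pr-inj₂ e
    ... | ()
    ev (pComp g h) ρ e _ = clash e
    ev (pRec g h) ρ e _ = clash e
  sound eProjS (i ∷ x ∷ xs ∷ y ∷ []) (p ∷ []) = meant 4 (args3 {Ev} (pr 2 (suc i)) _ y ev)
    where
    ev : Ev (pr 2 (suc i)) (suc (pr x xs)) y
    ev pZ ρ e _ = clash e
    ev pS ρ e _ = clash e
    ev (pProj zero) ρ e g with pr-inj₂ e
    ... | ()
    ev (pProj (suc j)) (z ∷ ρ) e g = get3 {Ev} 4 refl p (pProj j) ρ (cong (pr 2) (suc-injective (pr-inj₂ e)))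
      (proj₂ (pr-inj (suc-injective g)))
    ev (pComp g h) ρ e _ = clash e
    ev (pRec g h) ρ e _ = clash e
  sound eComp (c ∷ cs ∷ xs ∷ ys ∷ y ∷ []) (p ∷ q ∷ []) = meant 4 (args3 {Ev} (pr 3 (pr c cs)) xs y ev)
    where
    ev : Ev (pr 3 (pr c cs)) xs y
    ev pZ ρ e _ = clash e
    ev pS ρ e _ = clash e
    ev (pProj i) ρ e _ = clash e
    ev (pComp g h) ρ e f =
      let hs = vecCode (tabulate (λ i → prCode (h i)))
          (a , b) = pr-inj (pr-inj₂ e)
      in get3 {Ev} 4 refl q g _ a (get3 {Evs} 5 refl p h ρ b f)
    ev (pRec g h) ρ e _ = clash e
  sound eRec0 (c ∷ d ∷ xs ∷ y ∷ []) (p ∷ []) = meant 4 (args3 {Ev} (pr 4 (pr c d)) _ y ev)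
    where
    ev : Ev (pr 4 (pr c d)) (suc (pr 0 xs)) y
    ev pZ ρ e _ = clash e
    ev pS ρ e _ = clash e
    ev (pProj i) ρ e _ = clash e
    ev (pComp g h) ρ e _ = clash e
    ev (pRec g h) (k ∷ ρ) e f with pr-inj (pr-inj₂ e) | pr-inj (suc-injective f)
    ... | a , _ | refl , b = get3 {Ev} 4 refl p g ρ a b
  sound eRecS (c ∷ d ∷ xs ∷ y ∷ k ∷ r ∷ []) (p ∷ q ∷ []) = meant 4 (args3 {Ev} (pr 4 (pr c d)) _ y ev)
    where
    ev : Ev (pr 4 (pr c d)) (suc (pr (suc k) xs)) y
    ev pZ ρ e _ = clash e
    ev pS ρ e _ = clash e
    ev (pProj i) ρ e _ = clash e
    ev (pComp g h) ρ e _ = clash e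
    ev (pRec g h) (k' ∷ ρ) e f with pr-inj (pr-inj₂ e) | pr-inj (suc-injective f)
    ... | a , b | refl , x = get3 {Ev} 4 refl q h (k ∷ _ ∷ ρ) b (cong₂ (λ r z → suc (pr k (suc (pr r z))))
            (get3 {Ev} 4 refl p (pRec g h) (k ∷ ρ) e (cong (λ z → suc (pr k z)) x)) x)
  sound eNil (xs ∷ []) [] = meant 5 (args3 {Evs} 0 xs 0 λ { {zero} h ρ e f → refl ; {suc m} h ρ () f })
  sound eCons (c ∷ cs ∷ xs ∷ y ∷ ys ∷ []) (p ∷ q ∷ []) = meant 5 (args3 {Evs} _ xs _ λ { {zero} h ρ () f ; {suc m} h ρ e f →
    let (a , b) = pr-inj (suc-injective e) in
    cong₂ (λ a b → suc (pr a b)) (get3 {Ev} 4 refl p (h zero) ρ a f) (get3 {Evs} 5 refl q (h ∘ suc) ρ b f) })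
  sound tAx (x ∷ y ∷ []) (h ∷ []) = meant 6 (let (φ , e , t) = Equivalence.to (χ-spec x) nz in φ , trans (sym e) (sym (code≡ φ)) , ax t)
    where
    nz : evalPR χ (x ∷ []) ≢ 0
    nz e with trans (get3 {Ev} 4 refl h χ (x ∷ []) refl refl) e
    ... | ()
  sound tK (x ∷ y ∷ x' ∷ y' ∷ []) (h ∷ h' ∷ []) with sortF x x' h | sortF y y' h'
  ... | φ , refl , _ | ψ , refl , _ = meant 6 ((φ ⇒ ψ ⇒ φ) , refl , axK)
  sound tS (x ∷ y ∷ z ∷ x' ∷ y' ∷ z' ∷ []) (h ∷ h' ∷ h'' ∷ []) with sortF x x' h | sortF y y' h' | sortF z z' h''
  ... | φ , refl , _ | ψ , refl , _ | θ , refl , _ = meant 6 (((φ ⇒ ψ ⇒ θ) ⇒ (φ ⇒ ψ) ⇒ φ ⇒ θ) , refl , axS)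
  sound tDN (x ∷ x' ∷ []) (h ∷ []) with sortF x x' h
  ... | φ , refl , _ = meant 6 ((¬' (¬' φ) ⇒ φ) , refl , axDN)
  sound tIn (x ∷ w ∷ u ∷ u' ∷ []) (h ∷ h' ∷ []) with sortT u u' h | instF u x w h'
  ... | t , refl , _ | φ , refl , f = meant 6 ((∀' φ ⇒ φ [ t ]) , cong (λ w → pr 2 (pr (pr 3 (code φ)) w)) (f _ (matchInst0 t)) , axIn t)
  sound tDi (x ∷ y ∷ x' ∷ y' ∷ []) (h ∷ h' ∷ []) with sortF x x' h | sortF y y' h'
  ... | φ , refl , _ | ψ , refl , _ = meant 6 ((∀' (φ ⇒ ψ) ⇒ ∀' φ ⇒ ∀' ψ) , refl , axDi)
  sound tVac (x ∷ x' ∷ []) (h ∷ []) with sortF x x' h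
  ... | φ , refl , f = meant 6 ((φ ⇒ ∀' (shiftF φ)) , cong (λ w → pr 2 (pr (code φ) (pr 3 w))) (f _ matchShift0) , axVac)
  sound tRef (u ∷ u' ∷ []) (h ∷ []) with sortT u u' h
  ... | t , refl , _ = meant 6 ((t ≐ t) , refl , axRef t)
  sound tEq (u ∷ v ∷ u' ∷ v' ∷ x ∷ y ∷ z ∷ []) (h₁ ∷ h₂ ∷ h₃ ∷ h₄ ∷ []) with sortT u u' h₁ | sortT v v' h₂ | instF u x y h₃ | instF v x z h₄
  ... | t , refl , _ | s , refl , _ | φ , e , f | φ' , e' , f' with code-inj φ φ' (trans (sym e) e')
  ...   | refl = meant 6 (((t ≐ s) ⇒ φ [ t ] ⇒ φ [ s ]) ,
            cong₂ (λ x y → pr 2 (pr (pr 1 (pr (termCode t) (termCode s))) (pr 2 (pr x y)))) (f _ (matchInst0 t)) (f' _ (matchInst0 s)) , axEq φ t s)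
  sound tMp (x ∷ y ∷ []) (h ∷ h' ∷ []) with h 6 _ refl | h' 6 _ refl
  ... | φ , e , p | ψ , e' , q with imp-inv φ e
  ...   | φ₁ , φ₂ , refl , a , b = meant 6 (φ₂ , b , mp p (subst (T ⊢_) (code-inj ψ φ₁ (trans (sym e') a)) q))
  sound tGen (x ∷ []) (h ∷ []) with h 6 _ refl
  ... | φ , e , p = meant 6 (∀' φ , cong (pr 3) e , gen p)
  sound rPr (e₁ ∷ e₂ ∷ x ∷ nx ∷ ne ∷ w₁ ∷ w ∷ []) (h₁ ∷ h₂ ∷ h₃ ∷ h₄ ∷ []) = meant 7 (args3 {PrM} (pr e₁ e₂) x w λ φ ψ e →
    let (p , q) = pr-inj e in
    close2-code φ p (get2 {NumM} {x} 0 refl h₁) (get2 {NumM} {pr e₁ e₂} 0 refl h₂) (instF nx e₁ w₁ h₃) (instF ne w₁ w h₄))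
  sound rSt (e₁ ∷ e₂ ∷ c ∷ l ∷ nc ∷ nl ∷ ne ∷ w₁ ∷ w₂ ∷ w ∷ []) (h₁ ∷ h₂ ∷ h₃ ∷ h₄ ∷ h₅ ∷ h₆ ∷ []) = meant 8 (args4 {StM} (pr e₁ e₂) c l w λ φ ψ e →
    let (p , q) = pr-inj e in
    close2-code (ψ [ numeral c ]) (subst-code ψ q (get2 {NumM} {c} 0 refl h₁) (instF nc e₂ w₁ h₄))
      (get2 {NumM} {l} 0 refl h₂) (get2 {NumM} {pr e₁ e₂} 0 refl h₃) (instF nl w₁ w₂ h₅) (instF ne w₂ w h₆))
  sound rNst (e ∷ c ∷ l ∷ w ∷ []) (h ∷ []) = meant 9 (args4 {NstM} e c l _ λ φ ψ q → cong (λ w → pr 2 (pr w (pr 0 0))) (get4 {StM} {e} {c} {l} {w} 8 refl h φ ψ q))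

  der-sound : ∀ {q} → Der q → M q
  all-sound : ∀ {n} {ρ : Vec ℕ n} {ps} → All (λ p → Der (evR p ρ)) ps → All (λ p → M (evR p ρ)) ps
  der-sound (der r ρ ds) = sound r ρ (all-sound ds)
  all-sound [] = []
  all-sound (d ∷ ds) = der-sound d ∷ all-sound ds

  imp-cert : ∀ {x w} → Th (pr 2 (pr x w)) → Σ Formula λ φ → Σ Formula λ ψ → x ≡ ⌜ φ ⌝ × w ≡ ⌜ ψ ⌝ × (T ⊢ φ ⇒ ψ)
  imp-cert (θ , e , d) with imp-inv θ e
  ... | φ , ψ , refl , a , b = φ , ψ , trans a (code≡ φ) , trans b (code≡ ψ) , d

  derNum : ∀ j → Der (pr 0 (pr j (termCode (numeral j))))
  derNum zero = der num0 [] []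
  derNum (suc j) = der numS (j ∷ termCode (numeral j) ∷ []) (derNum j ∷ [])

  derLt : ∀ {i j} → suc i ≤′ j → Der (pr 1 (pr i j))
  derLt {i} ≤′-refl = der lt0 (i ∷ []) []
  derLt {i} (≤′-step {j} p) = der ltS (i ∷ j ∷ []) (derLt p ∷ [])

  private
    SubTFact : ℕ → ℕ → (ℕ → Term) → Term → ℕ
    SubTFact k s σ t = pr 2 (pr k (pr s (pr (termCode t) (termCode (substT σ t)))))

    SubFFact : ℕ → ℕ → (ℕ → Term) → Formula → ℕ
    SubFFact k s σ φ = pr 3 (pr k (pr s (pr (code φ) (code (substF σ φ)))))

    subVar : ∀ {k s} n {t t'} → t ≡ t' → Der (pr 2 (pr k (pr s (pr (pr 0 n) (termCode t'))))) → Der (pr 2 (pr k (pr s (pr (pr 0 n) (termCode t)))))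
    subVar n refl d = d

  derVar : ∀ {k s σ} → Match k s σ → ∀ n → Der (SubTFact k s σ (var n))
  derVar {k} (inj₁ (refl , e)) n with <-cmp n k | e n
  ... | tri< p _ _ | q = subVar n q (der varLt (k ∷ 0 ∷ n ∷ []) (derLt (≤⇒≤′ p) ∷ []))
  ... | tri≈ _ refl _ | q = subVar n q (der varShift= (n ∷ []) [])
  ... | tri> _ _ p | q = subVar n q (der varShift> (k ∷ n ∷ []) (derLt (≤⇒≤′ p) ∷ []))
  derVar {k} (inj₂ (r , refl , e)) n with <-cmp n k | e n
  ... | tri< p _ _ | q = subVar n q (der varLt (k ∷ suc (termCode r) ∷ n ∷ []) (derLt (≤⇒≤′ p) ∷ []))
  ... | tri≈ _ refl _ | q = subVar n q (der varInst= (n ∷ termCode r ∷ []) [])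
  derVar {k} (inj₂ (r , refl , e)) (suc n) | tri> _ _ p | q = subVar (suc n) q (der varInst> (k ∷ termCode r ∷ n ∷ []) (derLt (≤⇒≤′ p) ∷ []))

  derSubT : ∀ {k s σ} → Match k s σ → ∀ t → Der (SubTFact k s σ t)
  derSubT m (var n) = derVar m n
  derSubT {k} {s} m zer = der tZer (k ∷ s ∷ []) []
  derSubT {k} {s} {σ} m (suc' t) = der tSuc (k ∷ s ∷ termCode t ∷ termCode (substT σ t) ∷ []) (derSubT m t ∷ [])
  derSubT {k} {s} {σ} m (t ⊕ u) = der tAdd (k ∷ s ∷ termCode t ∷ termCode (substT σ t) ∷ termCode u ∷ termCode (substT σ u) ∷ []) (derSubT m t ∷ derSubT m u ∷ [])
  derSubT {k} {s} {σ} m (t ⊗ u) = der tMul (k ∷ s ∷ termCode t ∷ termCode (substT σ t) ∷ termCode u ∷ termCode (substT σ u) ∷ []) (derSubT m t ∷ derSubT m u ∷ [])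

  derShiftT : ∀ t → Der (pr 2 (pr 0 (pr 0 (pr (termCode t) (termCode (shiftT t))))))
  derShiftT t = subst (λ u → Der (pr 2 (pr 0 (pr 0 (pr (termCode t) (termCode u)))))) (sym (renT-substT suc t)) (derSubT matchShift0 t)

  derSubF : ∀ {k s σ} → Match k s σ → ∀ φ → Der (SubFFact k s σ φ)
  derSubF {k} {s} m ⊥' = der fBot (k ∷ s ∷ []) []
  derSubF {k} {s} {σ} m (t ≐ u) = der fEq (k ∷ s ∷ termCode t ∷ termCode (substT σ t) ∷ termCode u ∷ termCode (substT σ u) ∷ []) (derSubT m t ∷ derSubT m u ∷ [])
  derSubF {k} {s} {σ} m (φ ⇒ ψ) = der fImp (k ∷ s ∷ code φ ∷ code (substF σ φ) ∷ code ψ ∷ code (substF σ ψ) ∷ []) (derSubF m φ ∷ derSubF m ψ ∷ [])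
  derSubF {k} {s} {σ} m@(inj₁ (refl , _)) (∀' φ) = der fAllShift (k ∷ code φ ∷ code (substF (liftS σ) φ) ∷ []) (derSubF (liftShift m) φ ∷ [])
  derSubF {k} {s} {σ} m@(inj₂ (r , refl , _)) (∀' φ) = der fAllInst (k ∷ code φ ∷ code (substF (liftS σ) φ) ∷ termCode r ∷ termCode (shiftT r) ∷ [])
    (derShiftT r ∷ derSubF (liftInst r m) φ ∷ [])

  derShiftF : ∀ φ → Der (pr 3 (pr 0 (pr 0 (pr (code φ) (code (shiftF φ))))))
  derShiftF = derSubF matchShift0

  derInst : ∀ t φ → Der (pr 3 (pr 0 (pr (suc (termCode t)) (pr (code φ) (code (φ [ t ]))))))
  derInst t = derSubF (matchInst0 t)

  EvFact : ∀ {n} → PR n → Vec ℕ n → ℕ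
  EvFact p ρ = pr 4 (pr (prCode p) (pr (vecCode ρ) (evalPR p ρ)))

  derEvs : ∀ {m n} (h : Fin m → PR n) ρ → (∀ i → Der (EvFact (h i) ρ)) →
    Der (pr 5 (pr (vecCode (tabulate (λ i → prCode (h i)))) (pr (vecCode ρ) (vecCode (tabulate (λ i → evalPR (h i) ρ))))))
  derEvs {zero} h ρ d = der eNil (vecCode ρ ∷ []) []
  derEvs {suc m} h ρ d = der eCons (prCode (h zero) ∷ vecCode (tabulate (λ i → prCode (h (suc i)))) ∷ vecCode ρ ∷ evalPR (h zero) ρ ∷
    vecCode (tabulate (λ i → evalPR (h (suc i)) ρ)) ∷ []) (d zero ∷ derEvs (h ∘ suc) ρ (d ∘ suc) ∷ [])

  derRec : ∀ {n} (g : PR n) (h : PR (2 + n)) → (∀ ρ → Der (EvFact g ρ)) → (∀ ρ → Der (EvFact h ρ)) → ∀ k ρ → Der (EvFact (pRec g h) (k ∷ ρ))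
  derRec g h dg dh zero ρ = der eRec0 (prCode g ∷ prCode h ∷ vecCode ρ ∷ evalPR g ρ ∷ []) (dg ρ ∷ [])
  derRec g h dg dh (suc k) ρ = der eRecS (prCode g ∷ prCode h ∷ vecCode ρ ∷ evalPR (pRec g h) (suc k ∷ ρ) ∷ k ∷ evalPR (pRec g h) (k ∷ ρ) ∷ [])
    (derRec g h dg dh k ρ ∷ dh (k ∷ evalRec g h ρ k ∷ ρ) ∷ [])

  derProj : ∀ {n} (i : Fin n) ρ → Der (EvFact (pProj i) ρ)
  derProj zero (x ∷ ρ) = der eProj0 (x ∷ vecCode ρ ∷ []) []
  derProj (suc i) (x ∷ ρ) = der eProjS (toℕ i ∷ x ∷ vecCode ρ ∷ lookup ρ i ∷ []) (derProj i ρ ∷ [])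

  derEv : ∀ {n} (p : PR n) ρ → Der (EvFact p ρ)
  derEv pZ ρ = der eZ (vecCode ρ ∷ []) []
  derEv pS (x ∷ []) = der eS (x ∷ []) []
  derEv (pProj i) ρ = derProj i ρ
  derEv (pComp g h) ρ = der eComp (prCode g ∷ vecCode (tabulate (λ i → prCode (h i))) ∷ vecCode ρ ∷ vecCode (tabulate (λ i → evalPR (h i) ρ)) ∷
    evalPR g (tabulate (λ i → evalPR (h i) ρ)) ∷ []) (derEvs h ρ (λ i → derEv (h i) ρ) ∷ derEv g (tabulate (λ i → evalPR (h i) ρ)) ∷ [])
  derEv (pRec g h) (k ∷ ρ) = derRec g h (derEv g) (derEv h) k ρ

  derAx : ∀ x → evalPR χ (x ∷ []) ≢ 0 → Der (pr 6 x)
  derAx x nz = go (evalPR χ (x ∷ [])) refl nz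
    where
    go : ∀ y → evalPR χ (x ∷ []) ≡ y → y ≢ 0 → Der (pr 6 x)
    go zero e nz = ⊥-elim (nz refl)
    go (suc v) e nz = der tAx (x ∷ v ∷ []) (subst (λ y → Der (pr 4 (pr (prCode χ) (pr (vecCode (x ∷ [])) y)))) e (derEv χ (x ∷ [])) ∷ [])

  derThm : ∀ {φ} → T ⊢ φ → Der (pr 6 (code φ))
  derThm (ax {φ} t) = derAx (code φ) (Equivalence.from (χ-spec (code φ)) (φ , sym (code≡ φ) , t))
  derThm (axK {φ} {ψ}) = der tK (code φ ∷ code ψ ∷ code (shiftF φ) ∷ code (shiftF ψ) ∷ []) (derShiftF φ ∷ derShiftF ψ ∷ [])
  derThm (axS {φ} {ψ} {θ}) = der tS (code φ ∷ code ψ ∷ code θ ∷ code (shiftF φ) ∷ code (shiftF ψ) ∷ code (shiftF θ) ∷ []) (derShiftF φ ∷ derShiftF ψ ∷ derShiftF θ ∷ [])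
  derThm (axDN {φ}) = der tDN (code φ ∷ code (shiftF φ) ∷ []) (derShiftF φ ∷ [])
  derThm (axIn {φ} t) = der tIn (code φ ∷ code (φ [ t ]) ∷ termCode t ∷ termCode (shiftT t) ∷ []) (derShiftT t ∷ derInst t φ ∷ [])
  derThm (axDi {φ} {ψ}) = der tDi (code φ ∷ code ψ ∷ code (shiftF φ) ∷ code (shiftF ψ) ∷ []) (derShiftF φ ∷ derShiftF ψ ∷ [])
  derThm (axVac {φ}) = der tVac (code φ ∷ code (shiftF φ) ∷ []) (derShiftF φ ∷ [])
  derThm (axRef t) = der tRef (termCode t ∷ termCode (shiftT t) ∷ []) (derShiftT t ∷ [])
  derThm (axEq φ t s) = der tEq (termCode t ∷ termCode s ∷ termCode (shiftT t) ∷ termCode (shiftT s) ∷ code φ ∷ code (φ [ t ]) ∷ code (φ [ s ]) ∷ [])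
    (derShiftT t ∷ derShiftT s ∷ derInst t φ ∷ derInst s φ ∷ [])
  derThm (mp {φ} {ψ} p q) = der tMp (code φ ∷ code ψ ∷ []) (derThm p ∷ derThm q ∷ [])
  derThm (gen {φ} p) = der tGen (code φ ∷ []) (derThm p ∷ [])

  private
    derNumAt : ∀ {e e'} → e ≡ e' → Der (pr 0 (pr e (termCode (numeral e'))))
    derNumAt refl = derNum _

  derPr : ∀ φ ψ x {e} → pr (code φ) (code ψ) ≡ e → Der (pr 7 (pr (pr (code φ) (code ψ)) (pr x (code (close2 φ x e)))))
  derPr φ ψ x {e} q = der rPr (code φ ∷ code ψ ∷ x ∷ termCode (numeral x) ∷ termCode (numeral e) ∷ code (φ [ numeral x ]) ∷ code (close2 φ x e) ∷ [])
    (derNum x ∷ derNumAt q ∷ derInst (numeral x) φ ∷ derInst (numeral e) (φ [ numeral x ]) ∷ [])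

  derSt : ∀ φ ψ c l {e} → pr (code φ) (code ψ) ≡ e → Der (pr 8 (pr (pr (code φ) (code ψ)) (pr c (pr l (code (close3 ψ c l e))))))
  derSt φ ψ c l {e} q = der rSt (code φ ∷ code ψ ∷ c ∷ l ∷ termCode (numeral c) ∷ termCode (numeral l) ∷ termCode (numeral e) ∷
      code (ψ [ numeral c ]) ∷ code (close2 ψ c l) ∷ code (close3 ψ c l e) ∷ [])
    (derNum c ∷ derNum l ∷ derNumAt q ∷ derInst (numeral c) ψ ∷ derInst (numeral l) (ψ [ numeral c ]) ∷ derInst (numeral e) (close2 ψ c l) ∷ [])

  derNst : ∀ φ ψ c l {e} → pr (code φ) (code ψ) ≡ e → Der (pr 9 (pr (pr (code φ) (code ψ)) (pr c (pr l (code (¬' (close3 ψ c l e)))))))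
  derNst φ ψ c l {e} q = der rNst (pr (code φ) (code ψ) ∷ c ∷ l ∷ code (close3 ψ c l e) ∷ []) (derSt φ ψ c l q ∷ [])

-- The kit of a primitive recursively axiomatized theory

module _ (T : Theory) (χ : PR 1)
  (χ-spec : ∀ n → (evalPR χ (n ∷ []) ≢ 0) ⇔ Σ Formula (λ φ → (⌜ φ ⌝ ≡ n) × T φ)) where

  open Arithmetization T χ χ-spec

  pair-code : ∀ φ ψ → pr (code φ) (code ψ) ≡ pair ⌜ φ ⌝ ⌜ ψ ⌝
  pair-code φ ψ = pr-cong₂ (code≡ φ) (code≡ ψ)

  kit : Kit T
  kit = record
    { cert = certOf (thmR (v0 ⇒R v1))
    ; cert-sound = λ {u} {x} {w} p → imp-cert (der-sound (certOf-sound (thmR (v0 ⇒R v1)) (x ∷ w ∷ []) p) 6 _ refl)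
    ; cert-complete = λ {φ} {ψ} d → certOf-complete (thmR (v0 ⇒R v1)) (⌜ φ ⌝ ∷ ⌜ ψ ⌝ ∷ [])
        (subst₂ (λ x w → Der (pr 6 (pr 2 (pr x w)))) (code≡ φ) (code≡ ψ) (derThm d))
    ; pcert = certOf (prR v0 v1 v2)
    ; pcert-sound = λ φ ψ {u} {x} {w} p → trans (get3 {PrM} {pair ⌜ φ ⌝ ⌜ ψ ⌝} {x} {w} 7 refl
        (der-sound (certOf-sound (prR v0 v1 v2) (pair ⌜ φ ⌝ ⌜ ψ ⌝ ∷ x ∷ w ∷ []) p)) φ ψ (sym (pair-code φ ψ))) (code≡ (close2 φ x (pair ⌜ φ ⌝ ⌜ ψ ⌝)))
    ; pcert-complete = λ φ ψ x → certOf-complete (prR v0 v1 v2) (pair ⌜ φ ⌝ ⌜ ψ ⌝ ∷ x ∷ ⌜ close2 φ x (pair ⌜ φ ⌝ ⌜ ψ ⌝) ⌝ ∷ [])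
        (subst₂ (λ e w → Der (pr 7 (pr e (pr x w)))) (pair-code φ ψ) (code≡ (close2 φ x (pair ⌜ φ ⌝ ⌜ ψ ⌝))) (derPr φ ψ x (pair-code φ ψ)))
    ; scert = certOf (stR v0 v1 v2 v3)
    ; scert-sound = λ φ ψ {u} {c} {l} {w} p → trans (get4 {StM} {pair ⌜ φ ⌝ ⌜ ψ ⌝} {c} {l} {w} 8 refl
        (der-sound (certOf-sound (stR v0 v1 v2 v3) (pair ⌜ φ ⌝ ⌜ ψ ⌝ ∷ c ∷ l ∷ w ∷ []) p)) φ ψ (sym (pair-code φ ψ))) (code≡ (close3 ψ c l (pair ⌜ φ ⌝ ⌜ ψ ⌝)))
    ; scert-complete = λ φ ψ c l → certOf-complete (stR v0 v1 v2 v3) (pair ⌜ φ ⌝ ⌜ ψ ⌝ ∷ c ∷ l ∷ ⌜ close3 ψ c l (pair ⌜ φ ⌝ ⌜ ψ ⌝) ⌝ ∷ [])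
        (subst₂ (λ e w → Der (pr 8 (pr e (pr c (pr l w))))) (pair-code φ ψ) (code≡ (close3 ψ c l (pair ⌜ φ ⌝ ⌜ ψ ⌝))) (derSt φ ψ c l (pair-code φ ψ)))
    ; ncert = certOf (nstR v0 v1 v2 v3)
    ; ncert-sound = λ φ ψ {u} {c} {l} {w} p → trans (get4 {NstM} {pair ⌜ φ ⌝ ⌜ ψ ⌝} {c} {l} {w} 9 refl
        (der-sound (certOf-sound (nstR v0 v1 v2 v3) (pair ⌜ φ ⌝ ⌜ ψ ⌝ ∷ c ∷ l ∷ w ∷ []) p)) φ ψ (sym (pair-code φ ψ))) (code≡ (¬' (close3 ψ c l (pair ⌜ φ ⌝ ⌜ ψ ⌝))))
    ; ncert-complete = λ φ ψ c l → certOf-complete (nstR v0 v1 v2 v3) (pair ⌜ φ ⌝ ⌜ ψ ⌝ ∷ c ∷ l ∷ ⌜ ¬' (close3 ψ c l (pair ⌜ φ ⌝ ⌜ ψ ⌝)) ⌝ ∷ [])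
        (subst₂ (λ e w → Der (pr 9 (pr e (pr c (pr l w))))) (pair-code φ ψ) (code≡ (¬' (close3 ψ c l (pair ⌜ φ ⌝ ⌜ ψ ⌝)))) (derNst φ ψ c l (pair-code φ ψ)))
    ; mem = memD
    ; Cap = capD
    ; cap-exists = cap-exists'
    ; cap-codes = cap-codes'
    ; nbh = tableD 0
    ; elt = tableD 1
    ; val = tableD 2
    ; tables = tables'
    }

theorem4p3 : (L : Logic) (T : Theory) → PRAxiomatized T → ExtendsPA T → Consistent T →
    Σ Formula (λ Pr → Σ₁ Pr × IsProvPred T Pr × CondM T Pr ×
    (∀ (f : Interpretation) (A : MFm) → L ⊢m A → PA ⊢ (f ⟦ Pr ⟧) A) ×
    Σ Interpretation (λ f → ∀ (A : MFm) → (L ⊢m A) ⇔ (T ⊢ (f ⟦ Pr ⟧) A)))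
theorem4p3 L T (χ , spec) hPA con = Completeness.main L (kit T χ spec) hPA con
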